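{- Let $\mu$ be a neutral measure on $2^{\mathbb N}$, where $2^{\mathbb N}$ carries the standard metric, and let $D_\mu$ be its dimension probability. Then $D_\mu$ (projectively) dominates a neutral measure on $[0,1]$: there exist a neutral measure $\nu$ on $[0,1]$ and a constant $c>0$ such that $D_\mu(E)\ge c\,\nu(E)$ for every Borel set $E\subseteq[0,1]$.
   Context: Standard metric on $2^{\mathbb N}$: $d(x,y)=2^{ -m}$ where $m$ is the least index at which $x,y$ differ ($d(x,x)=0$); $B_r(x)$ is the ball of radius $r$. The pointwise dimension of $x$ with respect to a Borel probability measure $\mu$ is $d_\mu(x)=\liminf_{r\to0}\frac{\log\mu(B_r(x))}{\log r}$. The dimension distribution of $\mu$ is $Ddist(\mu,D)=\mu(\{x:d_\mu(x)\in[0,D]\})$, and the dimension probability $D_\mu$ of $\mu$ is the associated Lebesgue–Stieltjes measure on $[0,\infty)$, i.e. the distribution of $d_\mu(x)$ when $x$ is drawn from $\mu$. Neutral measures on $2^{\mathbb N}$. $2^{<\mathbb N}$ is the set of finite binary strings; for a Borel probability measure $\mu$ on $2^{\mathbb N}$ write $\mu(\sigma)=\mu([\sigma])$. A semimeasure is a function $f:2^{<\mathbb N}\to[0,1]$ with $f(\sigma)\ge f(\sigma\,\hat{}\,0)+f(\sigma\,\hat{}\,1)$; its undergraph is $\{(\sigma,q)\in2^{<\mathbb N}\times\mathbb Q: f(\sigma)>q\}$. A c.e. test is a computably enumerable set $T$ of elements $\big((\sigma_i,q_i)_{i<k},(\sigma,q)\big)\in(2^{<\mathbb N}\times\mathbb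 Q)^{<\mathbb N}\times(2^{<\mathbb N}\times\mathbb Q)$ such that for every Borel probability measure $\mu$ the set of $(\sigma,q)$ for which some $\big((\sigma_i,q_i)_{i<k},(\sigma,q)\big)\in T$ has $\mu(\sigma_i)>q_i$ for all $i<k$ is the undergraph of a semimeasure, denoted $T(\mu)$. A c.e. test $U$ is universal if for every c.e. test $T$ there is a rational $c>0$ with $U(\mu)(\sigma)\ge c\,T(\mu)(\sigma)$ for all $\mu,\sigma$. $\mu$ passes $T$ if $T(\mu)(\sigma)\le\mu(\sigma)$ for all $\sigma$; $\mu$ is neutral if it passes a universal c.e. test. Neutral measures on $[0,1]$. A uniform c.e. test on $[0,1]$ is a function $t:P([0,1])\times[0,1]\to[0,\infty]$ ($P([0,1])$ the Borel probability measures) for which there is a c.e. set $E$ of tuples $\big((I_i,q_i)_{i<k},J,q\big)$, with $I_i,J$ relatively open subintervals of $[0,1]$ with rational endpoints, $q_i\in\mathbb Q$, $q\in\mathbb Q_{\ge0}$, such that $t(\nu,x)=\sup\{q: \exists((I_i,q_i)_{i<k},J,q)\in E,\ \nu(I_i)>q_i\ \forall i<k,\ x\in J\}$ ($\sup\emptyset=0$), and $\int t(\nu,x)\,d\nu(x)\le1$ for every $\nu\in P([0,1])$. A measure $\nu\in P([0,1])$ is neutral on $[0,1]$ if $\sup_{x\in[0,1]}t(\nu,x)<\infty$ for every uniform c.e. test $t$. -}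

module Defs where

open import Data.Bool using (Bool; true; false)
open import Data.Empty using (⊥)
open import Data.Fin using (Fin)
open import Data.Integer as ℤ using (ℤ; +_; -[1+_]; 1ℤ)
open import Data.List using (List; []; _∷_; _++_; foldr)
open import Data.List.Relation.Unary.All using (All)
open import Data.List.Relation.Unary.AllPairs using (AllPairs)
open import Data.Nat as ℕ using (ℕ; zero; suc; _!)
open import Data.Nat.Properties as ℕₚ using (_!≢0)
open import Data.Product using (Σ-syntax; ∃-syntax; _×_; _,_; proj₁; proj₂)
open import Data.Rational as ℚ using (ℚ; 0ℚ; 1ℚ; ½; ∣_∣)
open import Data.Rational.Properties as ℚₚ using ()
open import Data.Rational.Solver using (module +-*-Solver)
open import Data.Unit using (⊤)
open import Data.Vec as Vec using (Vec)
open import Data.Vec.Relation.Binary.Pointwise.Inductive using (Pointwise)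
open import Function using (_∘_; _⇔_)
open import Relation.Binary.PropositionalEquality
  using (_≡_; _≢_; refl; sym; trans; cong; cong₂; subst)
open import Relation.Nullary using (¬_)

-- The mathematics below is classical.  Nothing in this file uses excluded
-- middle, but the definitions mean what they should only in its presence;
-- excluded middle for Set is the explicit first hypothesis of the theorem.

------------------------------------------------------------------------
-- Real numbers: Cauchy sequences of rationals, with _≈_ as equality

Eventually : (ℕ → Set) → Set
Eventually P = ∃[ N ] (∀ n → N ℕ.≤ n → P n)

IsCauchy : (ℕ → ℚ) → Set
IsCauchy s = ∀ ε → 0ℚ ℚ.< ε →
  ∃[ N ] (∀ m n → N ℕ.≤ m → N ℕ.≤ n → ∣ s m ℚ.- s n ∣ ℚ.< ε)

record ℝ : Set where
  constructor mkℝ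
  field
    seq    : ℕ → ℚ
    cauchy : IsCauchy seq

open ℝ public

infix 4 _≈_ _<_ _≤_

_≈_ : ℝ → ℝ → Set
x ≈ y = ∀ ε → 0ℚ ℚ.< ε → Eventually (λ n → ∣ seq x n ℚ.- seq y n ∣ ℚ.< ε)

_<_ : ℝ → ℝ → Set
x < y = ∃[ ε ] (0ℚ ℚ.< ε × Eventually (λ n → seq x n ℚ.+ ε ℚ.< seq y n))

_≤_ : ℝ → ℝ → Set
x ≤ y = ¬ (y < x)

private
  half-pos : ∀ {ε} → 0ℚ ℚ.< ε → 0ℚ ℚ.< ½ ℚ.* ε
  half-pos {ε} ε>0 =
    subst (ℚ._< ½ ℚ.* ε) (ℚₚ.*-zeroʳ ½) (ℚₚ.*-monoʳ-<-pos ½ ε>0)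

  halves : ∀ ε → ½ ℚ.* ε ℚ.+ ½ ℚ.* ε ≡ ε
  halves ε = trans (sym (ℚₚ.*-distribʳ-+ ε ½ ½)) (ℚₚ.*-identityˡ ε)

  +-rearrange : ∀ a b c d →
    (a ℚ.+ b) ℚ.- (c ℚ.+ d) ≡ (a ℚ.- c) ℚ.+ (b ℚ.- d)
  +-rearrange = solve 4
    (λ a b c d → (a :+ b) :- (c :+ d) := (a :- c) :+ (b :- d)) refl
    where open +-*-Solver

  *-rearrange : ∀ a b c d →
    (a ℚ.* b) ℚ.- (c ℚ.* d) ≡ a ℚ.* (b ℚ.- d) ℚ.+ d ℚ.* (a ℚ.- c)
  *-rearrange = solve 4
    (λ a b c d → (a :* b) :- (c :* d) := a :* (b :- d) :+ d :* (a :- c)) refl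
    where open +-*-Solver

  bound : ∀ x → ∃[ B ] (0ℚ ℚ.< B × Eventually (λ n → ∣ seq x n ∣ ℚ.≤ B))
  bound x with cauchy x 1ℚ (ℚₚ.positive⁻¹ 1ℚ)
  ... | N , p = 1ℚ ℚ.+ ∣ seq x N ∣
              , ℚₚ.+-mono-<-≤ (ℚₚ.positive⁻¹ 1ℚ) (ℚₚ.0≤∣p∣ (seq x N))
              , N , λ n n≥ →
      subst (λ a → ∣ a ∣ ℚ.≤ _) (cancel (seq x n) (seq x N))
        (ℚₚ.≤-trans (ℚₚ.∣p+q∣≤∣p∣+∣q∣ (seq x n ℚ.- seq x N) (seq x N))
          (ℚₚ.+-monoˡ-≤ ∣ seq x N ∣ (ℚₚ.<⇒≤ (p n N n≥ ℕₚ.≤-refl))))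
    where
      open +-*-Solver
      cancel : ∀ a b → (a ℚ.- b) ℚ.+ b ≡ a
      cancel = solve 2 (λ a b → (a :- b) :+ b := a) refl

  shrink : ∀ B ε → 0ℚ ℚ.< B → 0ℚ ℚ.< ε → ∃[ δ ] (0ℚ ℚ.< δ × B ℚ.* δ ≡ ε)
  shrink B ε B>0 ε>0 =
      B⁻¹ ℚ.* ε
    , subst (ℚ._< B⁻¹ ℚ.* ε) (ℚₚ.*-zeroʳ B⁻¹) (ℚₚ.*-monoʳ-<-pos B⁻¹ ε>0)
    , trans (sym (ℚₚ.*-assoc B B⁻¹ ε))
        (trans (cong (ℚ._* ε) (ℚₚ.*-inverseʳ B)) (ℚₚ.*-identityˡ ε))
    where
      instance
        posB = ℚ.positive B>0
        nzB  = ℚₚ.pos⇒nonZero B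
      B⁻¹ = ℚ.1/ B
      instance posB⁻¹ = ℚₚ.1/pos⇒pos B

  scale : ∀ {a b B δ} → 0ℚ ℚ.< B → ∣ a ∣ ℚ.≤ B → ∣ b ∣ ℚ.< δ →
          ∣ a ℚ.* b ∣ ℚ.< B ℚ.* δ
  scale {a} {b} {B} {δ} B>0 a≤B b<δ =
    subst (ℚ._< B ℚ.* δ) (sym (ℚₚ.∣p*q∣≡∣p∣*∣q∣ a b))
      (ℚₚ.≤-<-trans (ℚₚ.*-monoʳ-≤-nonNeg ∣ b ∣ a≤B) (ℚₚ.*-monoʳ-<-pos B b<δ))
    where instance
      posB = ℚ.positive B>0
      nonNegb = ℚ.nonNegative (ℚₚ.0≤∣p∣ b)

  *-small : ∀ {a b c d B C δ η ε} → 0ℚ ℚ.< B → 0ℚ ℚ.< C →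
            B ℚ.* δ ≡ ½ ℚ.* ε → C ℚ.* η ≡ ½ ℚ.* ε →
            ∣ a ∣ ℚ.≤ B → ∣ d ∣ ℚ.≤ C →
            ∣ b ℚ.- d ∣ ℚ.< δ → ∣ a ℚ.- c ∣ ℚ.< η →
            ∣ a ℚ.* b ℚ.- c ℚ.* d ∣ ℚ.< ε
  *-small {a} {b} {c} {d} {B} {C} {δ} {η} {ε} B>0 C>0 Bδ Cη a≤ d≤ b-d a-c =
    begin-strict
      ∣ a ℚ.* b ℚ.- c ℚ.* d ∣
        ≡⟨ cong ∣_∣ (*-rearrange a b c d) ⟩
      ∣ a ℚ.* (b ℚ.- d) ℚ.+ d ℚ.* (a ℚ.- c) ∣
        ≤⟨ ℚₚ.∣p+q∣≤∣p∣+∣q∣ (a ℚ.* (b ℚ.- d)) (d ℚ.* (a ℚ.- c)) ⟩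
      ∣ a ℚ.* (b ℚ.- d) ∣ ℚ.+ ∣ d ℚ.* (a ℚ.- c) ∣
        <⟨ ℚₚ.+-mono-< (scale {a} {b ℚ.- d} B>0 a≤ b-d)
                       (scale {d} {a ℚ.- c} C>0 d≤ a-c) ⟩
      B ℚ.* δ ℚ.+ C ℚ.* η
        ≡⟨ cong₂ ℚ._+_ Bδ Cη ⟩
      ½ ℚ.* ε ℚ.+ ½ ℚ.* ε
        ≡⟨ halves ε ⟩
      ε ∎
    where open ℚₚ.≤-Reasoning

abstract
  +-cauchy : ∀ x y → IsCauchy (λ n → seq x n ℚ.+ seq y n)
  +-cauchy x y ε ε>0
    with cauchy x (½ ℚ.* ε) (half-pos ε>0) | cauchy y (½ ℚ.* ε) (half-pos ε>0)
  ... | M , p | N , q = M ℕ.⊔ N , λ m n m≥ n≥ →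
    subst (ℚ._< ε)
      (cong ∣_∣ (sym (+-rearrange (seq x m) (seq y m) (seq x n) (seq y n))))
      (ℚₚ.≤-<-trans (ℚₚ.∣p+q∣≤∣p∣+∣q∣ (seq x m ℚ.- seq x n) (seq y m ℚ.- seq y n))
        (subst (_ ℚ.<_) (halves ε)
          (ℚₚ.+-mono-<
            (p m n (ℕₚ.≤-trans (ℕₚ.m≤m⊔n M N) m≥) (ℕₚ.≤-trans (ℕₚ.m≤m⊔n M N) n≥))
            (q m n (ℕₚ.≤-trans (ℕₚ.m≤n⊔m M N) m≥) (ℕₚ.≤-trans (ℕₚ.m≤n⊔m M N) n≥)))))

  *-cauchy : ∀ x y → IsCauchy (λ n → seq x n ℚ.* seq y n)
  *-cauchy x y ε ε>0 =
    let B , B>0 , K , bx = bound x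
        C , C>0 , L , cy = bound y
        δ , δ>0 , Bδ = shrink B (½ ℚ.* ε) B>0 (half-pos ε>0)
        η , η>0 , Cη = shrink C (½ ℚ.* ε) C>0 (half-pos ε>0)
        M , p = cauchy y δ δ>0
        N , q = cauchy x η η>0
    in (K ℕ.⊔ L) ℕ.⊔ (M ℕ.⊔ N) , λ m n m≥ n≥ →
      let m≥KL = ℕₚ.m⊔n≤o⇒m≤o (K ℕ.⊔ L) (M ℕ.⊔ N) m≥
          n≥KL = ℕₚ.m⊔n≤o⇒m≤o (K ℕ.⊔ L) (M ℕ.⊔ N) n≥
          m≥MN = ℕₚ.m⊔n≤o⇒n≤o (K ℕ.⊔ L) (M ℕ.⊔ N) m≥
          n≥MN = ℕₚ.m⊔n≤o⇒n≤o (K ℕ.⊔ L) (M ℕ.⊔ N) n≥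
      in *-small {a = seq x m} {seq y m} {seq x n} {seq y n} {ε = ε} B>0 C>0 Bδ Cη
           (bx m (ℕₚ.m⊔n≤o⇒m≤o K L m≥KL))
           (cy n (ℕₚ.m⊔n≤o⇒n≤o K L n≥KL))
           (p m n (ℕₚ.m⊔n≤o⇒m≤o M N m≥MN) (ℕₚ.m⊔n≤o⇒m≤o M N n≥MN))
           (q m n (ℕₚ.m⊔n≤o⇒n≤o M N m≥MN) (ℕₚ.m⊔n≤o⇒n≤o M N n≥MN))

  const-cauchy : ∀ q → IsCauchy (λ _ → q)
  const-cauchy q ε ε>0 =
    0 , λ _ _ _ _ → subst (ℚ._< ε) (sym (cong ∣_∣ (ℚₚ.+-inverseʳ q))) ε>0

fromℚ : ℚ → ℝ
fromℚ q = mkℝ (λ _ → q) (const-cauchy q)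

0ℝ 1ℝ : ℝ
0ℝ = fromℚ 0ℚ
1ℝ = fromℚ 1ℚ

infixl 6 _+_
infixl 7 _*_

_+_ : ℝ → ℝ → ℝ
x + y = mkℝ (λ n → seq x n ℚ.+ seq y n) (+-cauchy x y)

_*_ : ℝ → ℝ → ℝ
x * y = mkℝ (λ n → seq x n ℚ.* seq y n) (*-cauchy x y)

infixr 8 _^_

_^_ : ℝ → ℕ → ℝ
x ^ zero  = 1ℝ
x ^ suc n = x * x ^ n

ConvergesTo : (ℕ → ℝ) → ℝ → Set
ConvergesTo s l = ∀ ε → 0ℝ < ε → Eventually (λ n → s n < l + ε × l < s n + ε)

partialSum : (ℕ → ℝ) → ℕ → ℝ
partialSum f zero    = 0ℝ
partialSum f (suc n) = partialSum f n + f n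

HasSum : (ℕ → ℝ) → ℝ → Set
HasSum f s = ConvergesTo (partialSum f) s

-- α = log a means e^α = a, with e^α = Σₖ αᵏ / k!.
IsLog : ℝ → ℝ → Set
IsLog a α = HasSum (λ k → fromℚ (ℚ._/_ 1ℤ (k !) {{k !≢0}}) * α ^ k) a

------------------------------------------------------------------------
-- The extended half-line [0,∞]

[0,∞⟩ : Set
[0,∞⟩ = Σ[ x ∈ ℝ ] 0ℝ ≤ x

data [0,∞] : Set where
  fin : [0,∞⟩ → [0,∞]
  ∞   : [0,∞]

abstract
  0≤1 : 0ℝ ≤ 1ℝ
  0≤1 (ε , ε>0 , N , h) = ℚₚ.<-asym
    (ℚₚ.positive⁻¹ 1ℚ)
    (ℚₚ.<-trans (subst (ℚ._< 1ℚ ℚ.+ ε) (ℚₚ.+-identityʳ 1ℚ) (ℚₚ.+-monoʳ-< 1ℚ ε>0))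
                (h N ℕₚ.≤-refl))

infix 4 _≤∞_ _≐_

_≤∞_ : [0,∞] → [0,∞] → Set
_       ≤∞ ∞       = ⊤
∞       ≤∞ fin _   = ⊥
fin (x , _) ≤∞ fin (y , _) = x ≤ y

_≐_ : [0,∞] → ℝ → Set
fin (x , _) ≐ y = x ≈ y
∞           ≐ _ = ⊥

-- Bounds are taken in [0,∞], so the supremum of the empty set is 0 and its
-- infimum is ∞.
IsSup IsInf : ([0,∞] → Set) → [0,∞] → Set
IsSup P s = (∀ v → P v → v ≤∞ s) × (∀ u → (∀ v → P v → v ≤∞ u) → s ≤∞ u)
IsInf P s = (∀ v → P v → s ≤∞ v) × (∀ u → (∀ v → P v → u ≤∞ v) → u ≤∞ s)

-- IsLimInf₀ h l says liminf_{r→0+} h(r) = l, as sup_{δ>0} inf_{0<r<δ} h(r).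
-- The function h is given by its graph.
IsLimInf₀ : (ℝ → [0,∞] → Set) → [0,∞] → Set
IsLimInf₀ h = IsSup λ i → ∃[ δ ] (0ℝ < δ ×
  IsInf (λ v → ∃[ r ] (0ℝ < r × r < δ × h r v)) i)

------------------------------------------------------------------------
-- Borel sets and Borel probability measures

-- Points together with a countable family of basic open sets which generates
-- the Borel σ-algebra.
record Space : Set₁ where
  field
    Point : Set
    Base  : Set
    _∈ᵇ_  : Point → Base → Set

data Code (B : Set) : Set where
  basic : B → Code B
  compl : Code B → Code B
  union : (ℕ → Code B) → Code B

Borel : Space → Set
Borel S = Code (Space.Base S)

module _ (S : Space) where
  open Space S

  member : Point → Borel S → Set
  member x (basic b) = x ∈ᵇ b
  member x (compl A) = ¬ member x A
  member x (union F) = ∃[ n ] member x (F n)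

  Denotes : Borel S → (Point → Set) → Set
  Denotes A P = ∀ x → member x A ⇔ P x

  Disjoint : Borel S → Borel S → Set
  Disjoint A B = ∀ x → ¬ (member x A × member x B)

  record Measure : Set where
    field
      mass        : Borel S → ℝ
      extensional : ∀ A B → (∀ x → member x A ⇔ member x B) → mass A ≈ mass B
      nonNegative : ∀ A → 0ℝ ≤ mass A
      total       : ∀ A → (∀ x → member x A) → mass A ≈ 1ℝ
      σ-additive  : ∀ F → (∀ m n → m ≢ n → Disjoint (F m) (F n)) →
                    HasSum (λ n → mass (F n)) (mass (union F))

open Measure public

module _ {S : Space} where
  open Space S

  -- P is a Borel set, of measure v.
  MeasureOf : Measure S → (Point → Set) → ℝ → Set
  MeasureOf μ P v = ∃[ A ] (Denotes S A P × mass μ A ≈ v)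

  -- Σᵢ aᵢ·1_{Aᵢ} with the Aᵢ pairwise disjoint.
  record Simple : Set where
    field
      terms    : List ([0,∞⟩ × Borel S)
      disjoint : AllPairs (λ s t → Disjoint S (proj₂ s) (proj₂ t)) terms

  open Simple

  infix 4 _≤ˢ_

  _≤ˢ_ : Simple → (Point → [0,∞]) → Set
  s ≤ˢ g = All (λ (a , A) → ∀ x → member S x A → fin a ≤∞ g x) (terms s)

  simpleIntegral : Measure S → Simple → ℝ
  simpleIntegral μ s =
    foldr (λ (a , A) rest → proj₁ a * mass μ A + rest) 0ℝ (terms s)

  IsIntegral : Measure S → (Point → [0,∞]) → [0,∞] → Set
  IsIntegral μ g = IsSup λ v → ∃[ s ] (s ≤ˢ g × v ≐ simpleIntegral μ s)

------------------------------------------------------------------------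
-- The spaces 2^ℕ, [0,∞) and [0,1]

String : Set
String = List Bool

Extends : (ℕ → Bool) → String → Set
Extends x []      = ⊤
Extends x (b ∷ σ) = x 0 ≡ b × Extends (x ∘ suc) σ

cantor : Space
cantor = record { Point = ℕ → Bool ; Base = String ; _∈ᵇ_ = Extends }

Interval : Set
Interval = ℚ × ℚ

Inside : ℝ → Interval → Set
Inside x (p , q) = fromℚ p < x × x < fromℚ q

halfLine : Space
halfLine = record
  { Point = [0,∞⟩ ; Base = Interval ; _∈ᵇ_ = λ (x , _) J → Inside x J }

-- The basic open sets are the traces (p,q) ∩ [0,1]; since p < 0 and q > 1 are
-- allowed, these are all relatively open intervals with rational endpoints.
unitInterval : Space
unitInterval = record
  { Point = Σ[ x ∈ ℝ ] (0ℝ ≤ x × x ≤ 1ℝ)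
  ; Base  = Interval
  ; _∈ᵇ_  = λ (x , _) J → Inside x J
  }

-- The Borel set E, regarded as a subset of [0,∞).
inHalfLine : Borel unitInterval → [0,∞⟩ → Set
inHalfLine E (y , y≥0) = Σ[ y≤1 ∈ y ≤ 1ℝ ] member unitInterval (y , y≥0 , y≤1) E

------------------------------------------------------------------------
-- Pointwise dimension

½^ : ℕ → ℚ
½^ zero    = 1ℚ
½^ (suc m) = ½ ℚ.* ½^ m

data Dist (x y : ℕ → Bool) : ℚ → Set where
  same   : (∀ n → x n ≡ y n) → Dist x y 0ℚ
  differ : ∀ m → x m ≢ y m → (∀ i → i ℕ.< m → x i ≡ y i) → Dist x y (½^ m)

Ball : (ℕ → Bool) → ℝ → (ℕ → Bool) → Set
Ball x r y = ∃[ d ] (Dist x y d × fromℚ d < r)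

-- v = log a / log r, for 0 ≤ a ≤ 1 and 0 < r < 1.  When a = 0 we have
-- log a = -∞, so that the quotient is ∞.
LogQuotient : ℝ → ℝ → [0,∞] → Set
LogQuotient a r ∞             = a ≈ 0ℝ
LogQuotient a r (fin (ρ , _)) =
  ∃[ α ] ∃[ β ] (IsLog a α × IsLog r β × ρ * β ≈ α)

PointwiseDimension : Measure cantor → (ℕ → Bool) → [0,∞] → Set
PointwiseDimension μ x = IsLimInf₀ λ r v →
  r < 1ℝ × ∃[ a ] (MeasureOf μ (Ball x r) a × LogQuotient a r v)

-- v = μ {x : d_μ(x) ∈ [0,t]}
DimensionDistribution : Measure cantor → [0,∞⟩ → ℝ → Set
DimensionDistribution μ (t , _) = MeasureOf μ λ x →
  Σ[ s ∈ [0,∞⟩ ] (proj₁ s ≤ t × PointwiseDimension μ x (fin s))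

-- D is the Lebesgue–Stieltjes measure of the dimension distribution of μ, that
-- is, D[0,t] = Ddist(μ,t) for all t.  This determines D.
IsDimensionProbability : Measure cantor → Measure halfLine → Set
IsDimensionProbability μ D = ∀ t → ∃[ v ]
  (DimensionDistribution μ t v × MeasureOf D (λ (y , _) → y ≤ proj₁ t) v)

------------------------------------------------------------------------
-- Partial recursive functions and computably enumerable sets

data Rec : ℕ → Set where
  zero : Rec 0
  succ : Rec 1
  proj : ∀ {n} → Fin n → Rec n
  comp : ∀ {m n} → Rec m → Vec (Rec n) m → Rec n
  prec : ∀ {n} → Rec n → Rec (2 ℕ.+ n) → Rec (suc n)
  mini : ∀ {n} → Rec (suc n) → Rec n

infix 4 _[_]⇓_

data _[_]⇓_ : ∀ {n} → Rec n → Vec ℕ n → ℕ → Set where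
  zero : zero [ Vec.[] ]⇓ 0
  succ : ∀ {a} → succ [ a Vec.∷ Vec.[] ]⇓ suc a
  proj : ∀ {n} {i : Fin n} {as} → proj i [ as ]⇓ Vec.lookup as i
  comp : ∀ {m n} {f : Rec m} {gs : Vec (Rec n) m} {as bs c} →
         Pointwise (λ g b → g [ as ]⇓ b) gs bs → f [ bs ]⇓ c →
         comp f gs [ as ]⇓ c
  prec-zero : ∀ {n} {f : Rec n} {g as c} →
         f [ as ]⇓ c → prec f g [ 0 Vec.∷ as ]⇓ c
  prec-suc : ∀ {n} {f : Rec n} {g as k b c} →
         prec f g [ k Vec.∷ as ]⇓ b → g [ k Vec.∷ b Vec.∷ as ]⇓ c →
         prec f g [ suc k Vec.∷ as ]⇓ c
  mini : ∀ {n} {f : Rec (suc n)} {as k} →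
         f [ k Vec.∷ as ]⇓ 0 →
         (∀ i → i ℕ.< k → ∃[ b ] (f [ i Vec.∷ as ]⇓ suc b)) →
         mini f [ as ]⇓ k

-- Injective, effective codings of finite objects by natural numbers.

codePair : ℕ → ℕ → ℕ
codePair a b = 2 ℕ.^ a ℕ.* suc (2 ℕ.* b)

codeList : ∀ {A : Set} → (A → ℕ) → List A → ℕ
codeList code = foldr (λ a → codePair (code a)) 0

code× : ∀ {A B : Set} → (A → ℕ) → (B → ℕ) → A × B → ℕ
code× codeA codeB (a , b) = codePair (codeA a) (codeB b)

codeBool : Bool → ℕ
codeBool false = 0
codeBool true  = 1

codeℤ : ℤ → ℕ
codeℤ (+ n)    = 2 ℕ.* n
codeℤ -[1+ n ] = suc (2 ℕ.* n)

codeℚ : ℚ → ℕ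
codeℚ q = codePair (codeℤ (ℚ.numerator q)) (ℚ.denominator-1 q)

-- A computably enumerable set, presented as the domain of a partial recursive
-- function.
record CESet {A : Set} (code : A → ℕ) : Set where
  field
    program : Rec 1

infix 4 _∋_

_∋_ : ∀ {A : Set} {code : A → ℕ} → CESet code → A → Set
_∋_ {code = code} E a = ∃[ b ] (CESet.program E [ code a Vec.∷ Vec.[] ]⇓ b)

------------------------------------------------------------------------
-- Neutral measures on 2^ℕ

record IsSemimeasure (f : String → ℝ) : Set where
  field
    nonNegative   : ∀ σ → 0ℝ ≤ f σ
    atMostOne     : ∀ σ → f σ ≤ 1ℝ
    superadditive : ∀ σ → f (σ ++ false ∷ []) + f (σ ++ true ∷ []) ≤ f σ

TestElement : Set
TestElement = List (String × ℚ) × (String × ℚ)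

codeStringℚ : String × ℚ → ℕ
codeStringℚ = code× (codeList codeBool) codeℚ

codeTestElement : TestElement → ℕ
codeTestElement = code× (codeList codeStringℚ) codeStringℚ

-- The pairs (σ,q) which T produces from μ.
Produces : CESet codeTestElement → Measure cantor → String × ℚ → Set
Produces T μ p = ∃[ conds ] (T ∋ (conds , p) ×
  All (λ (σ , q) → fromℚ q < mass μ (basic σ)) conds)

-- apply μ is the semimeasure T(μ); it is determined by the undergraph.
record CETest : Set where
  field
    elements    : CESet codeTestElement
    apply       : Measure cantor → String → ℝ
    semimeasure : ∀ μ → IsSemimeasure (apply μ)
    undergraph  : ∀ μ σ q → Produces elements μ (σ , q) ⇔ fromℚ q < apply μ σ

open CETest public using (apply)

Universal : CETest → Set
Universal U = ∀ (T : CETest) → ∃[ c ]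
  (0ℚ ℚ.< c × (∀ μ σ → fromℚ c * apply T μ σ ≤ apply U μ σ))

Passes : Measure cantor → CETest → Set
Passes μ T = ∀ σ → apply T μ σ ≤ mass μ (basic σ)

Neutral : Measure cantor → Set
Neutral μ = ∃[ U ] (Universal U × Passes μ U)

------------------------------------------------------------------------
-- Neutral measures on [0,1]

ℚ≥0 : Set
ℚ≥0 = Σ[ q ∈ ℚ ] 0ℚ ℚ.≤ q

UniformElement : Set
UniformElement = List (Interval × ℚ) × (Interval × ℚ≥0)

codeInterval : Interval → ℕ
codeInterval = code× codeℚ codeℚ

codeUniformElement : UniformElement → ℕ
codeUniformElement =
  code× (codeList (code× codeInterval codeℚ)) (code× codeInterval (codeℚ ∘ proj₁))

-- The set of rationals q (as elements of [0,∞]) of which t(ν,x) is the supremum.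
Value : CESet codeUniformElement → Measure unitInterval →
        Space.Point unitInterval → [0,∞] → Set
Value E ν x v = ∃[ conds ] ∃[ J ] ∃[ q ]
  ( E ∋ (conds , J , q)
  × All (λ (I , p) → fromℚ p < mass ν (basic I)) conds
  × member unitInterval x (basic J)
  × v ≐ fromℚ (proj₁ q))

record UniformTest : Set where
  field
    elements : CESet codeUniformElement
    value    : Measure unitInterval → Space.Point unitInterval → [0,∞]
    isSup    : ∀ ν x → IsSup (Value elements ν x) (value ν x)
    integral : ∀ ν → ∃[ i ] (IsIntegral ν (value ν) i × i ≤∞ fin (1ℝ , 0≤1))

NeutralOnUnitInterval : Measure unitInterval → Set
NeutralOnUnitInterval ν = ∀ (t : UniformTest) →
  Σ[ M ∈ [0,∞⟩ ] (∀ x → UniformTest.value t ν x ≤∞ fin M)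

{-# OPTIONS --safe #-}
module Submission where

-- Let g : 2^ω → [0,1] be binary expansion and let ν be the image of μ under g.
--
-- A uniform test t on [0,1] pulls back to the semimeasure ∫_[σ] t(ν, g x) dμ(x),
-- which is enumerable from μ and hence at most μ[σ] / c for some c > 0.  Since μ
-- charges every cylinder, t(ν, ·) is bounded by 1 / c, and so ν is neutral.
--
-- For x in 2^ω let λ_x be the distribution of a diluted sequence: its block
-- [2^j, 2^(j+1)) consists of number(x↾j) random bits followed by zeros, so that
-- - log₂ λ_x[w↾n] is about g(x) n.  The mixture of the uniform measure and the
-- average of the λ_x with x drawn from μ is computable from μ, hence dominated by
-- μ.  Therefore μ[w↾n] is at least λ_x[w↾n] up to the factor μ[x↾k], k = log₂ n,
-- which is only polynomial in n.  Conversely, for almost all w with respect to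
-- λ_x, μ[w↾n] is at most λ_x[w↾n] up to a constant factor.  So λ_x-almost all w
-- have dimension g(x), and averaging over the x with g(x) in E shows that
-- {w : d_μ(w) ∈ E} has mass at least a constant times ν(E).

import Algebra.Solver.Ring as RingSolver
import Algebra.Solver.Ring.AlmostCommutativeRing as ACR
open import Algebra.Bundles using (CommutativeRing)
open import Axiom.ExcludedMiddle using (ExcludedMiddle)
open import Data.Bool using (Bool; true; false)
open import Data.Empty using (⊥; ⊥-elim)
open import Data.Fin using (Fin; zero; suc)
open import Data.Integer as ℤ using (ℤ; +_; -[1+_]; 1ℤ)
import Data.Integer.Properties as ℤₚ
open import Data.List as List using (List; []; _∷_; _∷ʳ_; length; take; drop)
open import Data.List.Membership.Propositional using () renaming (_∈_ to _∈ˡ_)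
open import Data.List.Membership.Propositional.Properties using (∈-map⁺; ∈-concatMap⁺)
import Data.List.Properties as Listₚ
open import Data.List.Relation.Unary.All as All using (All; []; _∷_)
import Data.List.Relation.Unary.All.Properties as Allₚ
open import Data.List.Relation.Unary.AllPairs using (AllPairs; []; _∷_)
import Data.List.Relation.Unary.Any as Any
open import Data.Maybe using (Maybe; just; nothing)
open import Data.Nat as ℕ using (ℕ; zero; suc; s≤s; z≤n; _∸_; _!)
import Data.Nat.Coprimality as Coprimality
import Data.Nat.Properties as ℕₚ
open import Data.Nat.Tactic.RingSolver using (solve-∀)
open import Data.Product using (Σ-syntax; ∃-syntax; _×_; _,_; proj₁; proj₂)
open import Data.Rational as ℚ using (ℚ; mkℚ; 0ℚ; 1ℚ; ½)
open import Data.Rational.Literals using (fromℤ)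
import Data.Rational.Properties as ℚₚ
import Data.Rational.Unnormalised as ℚᵘ
import Data.Rational.Unnormalised.Properties as ℚᵘₚ
open import Data.Sum using (_⊎_; inj₁; inj₂)
open import Data.Unit using (tt)
open import Data.Vec as Vec using (Vec; []; _∷_)
import Data.Vec.Properties as Vecₚ
open import Data.Vec.Relation.Binary.Pointwise.Inductive using (Pointwise; []; _∷_)
open import Defs as D hiding (_≈_; _<_; _≤_; _+_; _*_; _^_; fromℚ; 0ℝ; 1ℝ; apply)
open import Function using (_∘_; mk⇔; Equivalence)
open import Level using (0ℓ)
open import Relation.Binary.Definitions using (tri<; tri≈; tri>)
open import Relation.Binary.PropositionalEquality using (_≡_; _≢_; refl; sym; trans; cong; cong₂; subst; subst₂)
import Relation.Binary.Reasoning.Base.Triple as Triple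
open import Relation.Binary.Structures using (IsPreorder)
open import Relation.Nullary using (¬_; Dec; yes; no)
open import Relation.Nullary.Decidable using (toWitness)

-- Neutrality controls only semimeasures that are enumerable from lower bounds on the masses of
-- cylinders, uniformly in all measures. So neither construction may compare reals: a test accepts
-- finite certificates made of strict lower bounds, and its value is the supremum of what they
-- certify. The pulled-back test is a semimeasure for every μ because a uniform test has integral at
-- most 1 against every measure, in particular against the image of μ.
--
-- Blocks double in length so that the first 2^k bits of a diluted sequence depend on x↾k alone. The
-- uniform half of the mixture is what bounds μ[x↾k] below, by a constant times 2^-k: a loss of k +
-- O(1) bits out of 2^k. A lower limit needs this bound only at the lengths n = 2^k.
--
-- λ_x occurs only through its values on strings, never as a Borel measure. Hence the set of w with
-- dimension in E is first covered by an open set; "almost all" becomes the claim that some finite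
-- level of this open set has λ_x-mass above ½, proved by following a path through the strings, and
-- averaging over x becomes an exchange of finite sums.

-- Cauchy reals: field operations, order and ring solvers

module RealField where

  open import Data.Rational using (∣_∣)

  private
    fromℤ-/ : ∀ z → z ℚ./ 1 ≡ fromℤ z
    fromℤ-/ z = ℚₚ.↥p/↧p≡p (fromℤ z)

  fromℤ-+ : ∀ a b → fromℤ (a ℤ.+ b) ≡ fromℤ a ℚ.+ fromℤ b
  fromℤ-+ a b = sym (trans (cong (ℚ._/ 1) (cong₂ ℤ._+_ (ℤₚ.*-identityʳ a) (ℤₚ.*-identityʳ b))) (fromℤ-/ (a ℤ.+ b)))

  fromℤ-* : ∀ a b → fromℤ (a ℤ.* b) ≡ fromℤ a ℚ.* fromℤ b
  fromℤ-* a b = sym (fromℤ-/ (a ℤ.* b))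

  fromℤ-neg : ∀ a → fromℤ (ℤ.- a) ≡ ℚ.- fromℤ a
  fromℤ-neg (+ zero)  = refl
  fromℤ-neg (+ suc n) = refl
  fromℤ-neg -[1+ n ]  = refl

  private
    ℚ-ACR = ACR.fromCommutativeRing ℚₚ.+-*-commutativeRing

    ℚ-morphism : ℤ.+-*-rawRing ACR.-Raw-AlmostCommutative⟶ ℚ-ACR
    ℚ-morphism = record
      { ⟦_⟧ = fromℤ ; +-homo = fromℤ-+ ; *-homo = fromℤ-* ; -‿homo = fromℤ-neg
      ; 0-homo = refl ; 1-homo = refl }

    ℚ-decide : ∀ p q → Maybe (fromℤ p ≡ fromℤ q)
    ℚ-decide p q with p ℤₚ.≟ q
    ... | yes refl = just refl
    ... | no  _    = nothing

  -- Coefficients are integers embedded by `fromℤ`, so that the normaliser compares integers instead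
  -- of normalised fractions. `ℝ-Solver` below follows the same plan.
  module +-*-Solver = RingSolver ℤ.+-*-rawRing ℚ-ACR ℚ-morphism ℚ-decide

  p≤∣p∣ : ∀ p → p ℚ.≤ ∣ p ∣
  p≤∣p∣ p with ℚₚ.≤-total 0ℚ p
  ... | inj₁ 0≤p = ℚₚ.≤-reflexive (sym (ℚₚ.0≤p⇒∣p∣≡p 0≤p))
  ... | inj₂ p≤0 = ℚₚ.≤-trans p≤0 (ℚₚ.0≤∣p∣ p)

  ∣p-q∣≡∣q-p∣ : ∀ p q → ∣ p ℚ.- q ∣ ≡ ∣ q ℚ.- p ∣
  ∣p-q∣≡∣q-p∣ p q = trans (sym (ℚₚ.∣-p∣≡∣p∣ (p ℚ.- q))) (cong ∣_∣ (eq p q))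
    where
    open +-*-Solver
    eq : ∀ p q → ℚ.- (p ℚ.- q) ≡ q ℚ.- p
    eq = solve 2 (λ p q → :- (p :- q) := q :- p) refl

  ∣p∣<ε : ∀ {p ε} → p ℚ.< ε → ℚ.- p ℚ.< ε → ∣ p ∣ ℚ.< ε
  ∣p∣<ε {p} p<ε -p<ε with ℚₚ.∣p∣≡p∨∣p∣≡-p p
  ... | inj₁ e = subst (ℚ._< _) (sym e) p<ε
  ... | inj₂ e = subst (ℚ._< _) (sym e) -p<ε

  ∣p-r∣-triangle : ∀ p q r {a b} → ∣ p ℚ.- q ∣ ℚ.< a → ∣ q ℚ.- r ∣ ℚ.< b → ∣ p ℚ.- r ∣ ℚ.< a ℚ.+ b
  ∣p-r∣-triangle p q r pq qr =
    ℚₚ.≤-<-trans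
      (subst (λ t → ∣ t ∣ ℚ.≤ ∣ p ℚ.- q ∣ ℚ.+ ∣ q ℚ.- r ∣) (eq p q r) (ℚₚ.∣p+q∣≤∣p∣+∣q∣ (p ℚ.- q) (q ℚ.- r)))
      (ℚₚ.+-mono-< pq qr)
    where
    open +-*-Solver
    eq : ∀ p q r → (p ℚ.- q) ℚ.+ (q ℚ.- r) ≡ p ℚ.- r
    eq = solve 3 (λ p q r → (p :- q) :+ (q :- r) := p :- r) refl

  ½*-pos : ∀ {ε} → 0ℚ ℚ.< ε → 0ℚ ℚ.< ½ ℚ.* ε
  ½*-pos {ε} ε>0 = subst (ℚ._< ½ ℚ.* ε) (ℚₚ.*-zeroʳ ½) (ℚₚ.*-monoʳ-<-pos ½ ε>0)

  ½+½ : ∀ ε → ½ ℚ.* ε ℚ.+ ½ ℚ.* ε ≡ ε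
  ½+½ ε = trans (sym (ℚₚ.*-distribʳ-+ ε ½ ½)) (ℚₚ.*-identityˡ ε)

  *-posℚ : ∀ {p q} → 0ℚ ℚ.< p → 0ℚ ℚ.< q → 0ℚ ℚ.< p ℚ.* q
  *-posℚ {p} {q} 0<p 0<q = subst (ℚ._< p ℚ.* q) (ℚₚ.*-zeroʳ p)
    (ℚₚ.*-monoʳ-<-pos p {{ℚ.positive 0<p}} 0<q)

  divℚ : ∀ B ε → 0ℚ ℚ.< B → 0ℚ ℚ.< ε → ∃[ δ ] (0ℚ ℚ.< δ × B ℚ.* δ ≡ ε)
  divℚ B ε B>0 ε>0 = B⁻¹ ℚ.* ε , *-posℚ (ℚₚ.positive⁻¹ B⁻¹) ε>0 ,
    trans (sym (ℚₚ.*-assoc B B⁻¹ ε)) (trans (cong (ℚ._* ε) (ℚₚ.*-inverseʳ B)) (ℚₚ.*-identityˡ ε))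
    where
    instance
      posB = ℚ.positive B>0
      nzB  = ℚₚ.pos⇒nonZero B
    B⁻¹ = ℚ.1/ B
    instance posB⁻¹ = ℚₚ.1/pos⇒pos B

  p<q⇒0<q-p : ∀ {p q} → p ℚ.< q → 0ℚ ℚ.< q ℚ.- p
  p<q⇒0<q-p {p} {q} p<q = subst (ℚ._< q ℚ.- p) (ℚₚ.+-inverseʳ p) (ℚₚ.+-monoˡ-< (ℚ.- p) p<q)

  both : ∀ {P Q : ℕ → Set} → Eventually P → Eventually Q → Eventually (λ n → P n × Q n)
  both (M , p) (N , q) = M ℕ.⊔ N , λ n h →
    p n (ℕₚ.m⊔n≤o⇒m≤o M N h) , q n (ℕₚ.m⊔n≤o⇒n≤o M N h)

  always : ∀ {P : ℕ → Set} → (∀ n → P n) → Eventually P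
  always p = 0 , λ n _ → p n

  eventually-map : ∀ {P Q : ℕ → Set} → (∀ n → P n → Q n) → Eventually P → Eventually Q
  eventually-map f (N , p) = N , λ n h → f n (p n h)

  eventually-const : ∀ {P : Set} → Eventually (λ _ → P) → P
  eventually-const (N , p) = p N ℕₚ.≤-refl

  infix 4 _≈_ _<_ _≤_
  infixl 6 _+_ _-_
  infixl 7 _*_
  infix 8 -_

  opaque
    -- Sealed, so that type checking never unfolds Cauchy sequences. Facts that depend on the
    -- sequences are proved in blocks that unfold these names; everything later uses only the
    -- algebraic interface.
    _≈_ _<_ _≤_ : ℝ → ℝ → Set
    _≈_ = D._≈_
    _<_ = D._<_
    _≤_ = D._≤_

    _+_ _*_ : ℝ → ℝ → ℝ
    _+_ = D._+_
    _*_ = D._*_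

    -_ : ℝ → ℝ
    - x = mkℝ (λ n → ℚ.- seq x n) λ ε ε>0 → let N , h = cauchy x ε ε>0 in N , λ m n m≥ n≥ →
      subst (ℚ._< ε) (trans (∣p-q∣≡∣q-p∣ (seq x m) (seq x n)) (cong ∣_∣ (eq (seq x m) (seq x n)))) (h m n m≥ n≥)
      where
      open +-*-Solver
      eq : ∀ p q → q ℚ.- p ≡ ℚ.- p ℚ.- ℚ.- q
      eq = solve 2 (λ p q → q :- p := :- p :- :- q) refl

    ⌊_⌋ : ℚ → ℝ
    ⌊_⌋ = D.fromℚ

  _-_ : ℝ → ℝ → ℝ
  x - y = x + - y

  0# 1# : ℝ
  0# = ⌊ 0ℚ ⌋
  1# = ⌊ 1ℚ ⌋

  opaque
    unfolding _≈_

    ≈-refl : ∀ {x} → x ≈ x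
    ≈-refl {x} ε ε>0 = always λ n → subst (ℚ._< ε) (sym (cong ∣_∣ (ℚₚ.+-inverseʳ (seq x n)))) ε>0

    ≈-sym : ∀ {x y} → x ≈ y → y ≈ x
    ≈-sym {x} {y} e ε ε>0 = eventually-map (λ n → subst (ℚ._< ε) (∣p-q∣≡∣q-p∣ (seq x n) (seq y n))) (e ε ε>0)

    ≈-trans : ∀ {x y z} → x ≈ y → y ≈ z → x ≈ z
    ≈-trans {x} {y} {z} e f ε ε>0 =
      eventually-map (λ n (h , k) → subst (_ ℚ.<_) (½+½ ε) (∣p-r∣-triangle (seq x n) (seq y n) (seq z n) h k))
        (both (e _ (½*-pos ε>0)) (f _ (½*-pos ε>0)))

    pointwise : ∀ {x y} → (∀ n → seq x n ≡ seq y n) → x ≈ y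
    pointwise {x} {y} h ε ε>0 = always λ n →
      subst (λ t → ∣ seq x n ℚ.- t ∣ ℚ.< ε) (h n)
        (subst (ℚ._< ε) (sym (cong ∣_∣ (ℚₚ.+-inverseʳ (seq x n)))) ε>0)

    +-cong : ∀ {x x' y y'} → x ≈ x' → y ≈ y' → x + y ≈ x' + y'
    +-cong {x} {x'} {y} {y'} e f ε ε>0 = eventually-map
      (λ n (h , k) → subst₂ ℚ._<_ (cong ∣_∣ (eq (seq x n) (seq x' n) (seq y n) (seq y' n))) (½+½ ε)
        (ℚₚ.≤-<-trans (ℚₚ.∣p+q∣≤∣p∣+∣q∣ (seq x n ℚ.- seq x' n) (seq y n ℚ.- seq y' n)) (ℚₚ.+-mono-< h k)))
      (both (e _ (½*-pos ε>0)) (f _ (½*-pos ε>0)))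
      where
      open +-*-Solver
      eq : ∀ a b c d → (a ℚ.- b) ℚ.+ (c ℚ.- d) ≡ (a ℚ.+ c) ℚ.- (b ℚ.+ d)
      eq = solve 4 (λ a b c d → (a :- b) :+ (c :- d) := (a :+ c) :- (b :+ d)) refl

    -‿cong : ∀ {x y} → x ≈ y → - x ≈ - y
    -‿cong {x} {y} e ε ε>0 = eventually-map
      (λ n → subst (ℚ._< ε) (trans (∣p-q∣≡∣q-p∣ (seq x n) (seq y n)) (cong ∣_∣ (eq (seq x n) (seq y n))))) (e ε ε>0)
      where
      open +-*-Solver
      eq : ∀ p q → q ℚ.- p ≡ ℚ.- p ℚ.- ℚ.- q
      eq = solve 2 (λ p q → q :- p := :- p :- :- q) refl

    bounded : ∀ x → ∃[ B ] (0ℚ ℚ.< B × Eventually (λ n → ∣ seq x n ∣ ℚ.< B))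
    bounded x with cauchy x 1ℚ (ℚₚ.positive⁻¹ 1ℚ)
    ... | N , p = 1ℚ ℚ.+ ∣ seq x N ∣
                , ℚₚ.+-mono-<-≤ (ℚₚ.positive⁻¹ 1ℚ) (ℚₚ.0≤∣p∣ (seq x N))
                , N , λ n n≥ →
        subst (λ a → ∣ a ∣ ℚ.< _) (eq (seq x n) (seq x N))
          (ℚₚ.≤-<-trans (ℚₚ.∣p+q∣≤∣p∣+∣q∣ (seq x n ℚ.- seq x N) (seq x N))
            (ℚₚ.+-monoˡ-< ∣ seq x N ∣ (p n N n≥ ℕₚ.≤-refl)))
      where
      open +-*-Solver
      eq : ∀ a b → (a ℚ.- b) ℚ.+ b ≡ a
      eq = solve 2 (λ a b → (a :- b) :+ b := a) refl

    *-congʳ : ∀ z {x y} → x ≈ y → x * z ≈ y * z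
    *-congʳ z {x} {y} e ε ε>0 =
      let B , B>0 , b = bounded z
          δ , δ>0 , Bδ = divℚ B ε B>0 ε>0
      in eventually-map (λ n (h , k) → subst₂ ℚ._<_
            (trans (sym (ℚₚ.∣p*q∣≡∣p∣*∣q∣ (seq z n) (seq x n ℚ.- seq y n))) (cong ∣_∣ (eq (seq x n) (seq y n) (seq z n)))) Bδ
            (ℚₚ.≤-<-trans (ℚₚ.*-monoʳ-≤-nonNeg ∣ seq x n ℚ.- seq y n ∣ {{ℚ.nonNegative (ℚₚ.0≤∣p∣ (seq x n ℚ.- seq y n))}} (ℚₚ.<⇒≤ k))
              (ℚₚ.*-monoʳ-<-pos B {{ℚ.positive B>0}} h)))
          (both (e δ δ>0) b)
      where
      open +-*-Solver
      eq : ∀ x y z → z ℚ.* (x ℚ.- y) ≡ x ℚ.* z ℚ.- y ℚ.* z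
      eq = solve 3 (λ x y z → z :* (x :- y) := x :* z :- y :* z) refl

    *-comm : ∀ x y → x * y ≈ y * x
    *-comm x y = pointwise {x * y} {y * x} λ n → ℚₚ.*-comm (seq x n) (seq y n)

    *-cong : ∀ {x x' y y'} → x ≈ x' → y ≈ y' → x * y ≈ x' * y'
    *-cong {x} {x'} {y} {y'} e f =
      ≈-trans {x * y} {x' * y} {x' * y'} (*-congʳ y {x} {x'} e)
      (≈-trans {x' * y} {y * x'} {x' * y'} (*-comm x' y)
      (≈-trans {y * x'} {y' * x'} {x' * y'} (*-congʳ x' {y} {y'} f) (*-comm y' x')))

    ⌊⌋-+ : ∀ p q → ⌊ p ℚ.+ q ⌋ ≈ ⌊ p ⌋ + ⌊ q ⌋
    ⌊⌋-+ p q = ≈-refl {⌊ p ℚ.+ q ⌋}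

    ⌊⌋-* : ∀ p q → ⌊ p ℚ.* q ⌋ ≈ ⌊ p ⌋ * ⌊ q ⌋
    ⌊⌋-* p q = ≈-refl {⌊ p ℚ.* q ⌋}

    ⌊⌋-neg : ∀ p → ⌊ ℚ.- p ⌋ ≈ - ⌊ p ⌋
    ⌊⌋-neg p = ≈-refl {⌊ ℚ.- p ⌋}

    +-assoc : ∀ x y z → (x + y) + z ≈ x + (y + z)
    +-assoc x y z = pointwise {(x + y) + z} {x + (y + z)} λ n → ℚₚ.+-assoc (seq x n) (seq y n) (seq z n)

    +-identityˡ : ∀ x → 0# + x ≈ x
    +-identityˡ x = pointwise {0# + x} {x} λ n → ℚₚ.+-identityˡ (seq x n)

    +-identityʳ : ∀ x → x + 0# ≈ x
    +-identityʳ x = pointwise {x + 0#} {x} λ n → ℚₚ.+-identityʳ (seq x n)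

    +-inverseˡ : ∀ x → - x + x ≈ 0#
    +-inverseˡ x = pointwise {(- x) + x} {0#} λ n → ℚₚ.+-inverseˡ (seq x n)

    +-inverseʳ : ∀ x → x + - x ≈ 0#
    +-inverseʳ x = pointwise {x + - x} {0#} λ n → ℚₚ.+-inverseʳ (seq x n)

    +-comm : ∀ x y → x + y ≈ y + x
    +-comm x y = pointwise {x + y} {y + x} λ n → ℚₚ.+-comm (seq x n) (seq y n)

    *-assoc : ∀ x y z → (x * y) * z ≈ x * (y * z)
    *-assoc x y z = pointwise {(x * y) * z} {x * (y * z)} λ n → ℚₚ.*-assoc (seq x n) (seq y n) (seq z n)

    *-identityˡ : ∀ x → 1# * x ≈ x
    *-identityˡ x = pointwise {1# * x} {x} λ n → ℚₚ.*-identityˡ (seq x n)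

    *-identityʳ : ∀ x → x * 1# ≈ x
    *-identityʳ x = pointwise {x * 1#} {x} λ n → ℚₚ.*-identityʳ (seq x n)

    *-distribˡ-+ : ∀ x y z → x * (y + z) ≈ x * y + x * z
    *-distribˡ-+ x y z = pointwise {x * (y + z)} {x * y + x * z} λ n → ℚₚ.*-distribˡ-+ (seq x n) (seq y n) (seq z n)

    *-distribʳ-+ : ∀ x y z → (y + z) * x ≈ y * x + z * x
    *-distribʳ-+ x y z = pointwise {(y + z) * x} {y * x + z * x} λ n → ℚₚ.*-distribʳ-+ (seq x n) (seq y n) (seq z n)

  ℝ-commutativeRing : CommutativeRing 0ℓ 0ℓ
  ℝ-commutativeRing = record
    { Carrier = ℝ ; _≈_ = _≈_ ; _+_ = _+_ ; _*_ = _*_ ; -_ = -_ ; 0# = 0# ; 1# = 1#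
    ; isCommutativeRing = record
      { isRing = record
        { +-isAbelianGroup = record
          { isGroup = record
            { isMonoid = record
              { isSemigroup = record
                { isMagma = record
                  { isEquivalence = record { refl = ≈-refl ; sym = ≈-sym ; trans = ≈-trans }
                  ; ∙-cong = +-cong }
                ; assoc = +-assoc }
              ; identity = +-identityˡ , +-identityʳ }
            ; inverse = +-inverseˡ , +-inverseʳ
            ; ⁻¹-cong = -‿cong }
          ; comm = +-comm }
        ; *-cong = *-cong
        ; *-assoc = *-assoc
        ; *-identity = *-identityˡ , *-identityʳ
        ; distrib = *-distribˡ-+ , *-distribʳ-+ }
      ; *-comm = *-comm } }

  ≡⇒≈ : ∀ {x y} → x ≡ y → x ≈ y
  ≡⇒≈ refl = ≈-refl

  private
    ℝ-ACR = ACR.fromCommutativeRing ℝ-commutativeRing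

    morphism : ℤ.+-*-rawRing ACR.-Raw-AlmostCommutative⟶ ℝ-ACR
    morphism = record
      { ⟦_⟧ = λ z → ⌊ fromℤ z ⌋
      ; +-homo = λ a b → ≈-trans (≡⇒≈ (cong ⌊_⌋ (fromℤ-+ a b))) (⌊⌋-+ (fromℤ a) (fromℤ b))
      ; *-homo = λ a b → ≈-trans (≡⇒≈ (cong ⌊_⌋ (fromℤ-* a b))) (⌊⌋-* (fromℤ a) (fromℤ b))
      ; -‿homo = λ a → ≈-trans (≡⇒≈ (cong ⌊_⌋ (fromℤ-neg a))) (⌊⌋-neg (fromℤ a))
      ; 0-homo = ≈-refl ; 1-homo = ≈-refl }

    decide : ∀ p q → Maybe (⌊ fromℤ p ⌋ ≈ ⌊ fromℤ q ⌋)
    decide p q with p ℤₚ.≟ q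
    ... | yes refl = just ≈-refl
    ... | no  _    = nothing

  module ℝ-Solver = RingSolver ℤ.+-*-rawRing ℝ-ACR morphism decide

  opaque
    unfolding _≈_

    <⇒0<- : ∀ {x y} → x < y → 0# < y - x
    <⇒0<- {x} {y} (ε , ε>0 , h) = ½ ℚ.* ε , ½*-pos ε>0 , eventually-map
      (λ n k → ℚₚ.<-trans (subst₂ ℚ._<_ (sym (ℚₚ.+-identityˡ (½ ℚ.* ε))) (½+½ ε)
          (subst (ℚ._< ½ ℚ.* ε ℚ.+ ½ ℚ.* ε) (ℚₚ.+-identityʳ (½ ℚ.* ε)) (ℚₚ.+-monoʳ-< (½ ℚ.* ε) (½*-pos ε>0))))
        (subst (ℚ._< seq y n ℚ.- seq x n) (eq (seq x n) ε) (ℚₚ.+-monoˡ-< (ℚ.- seq x n) k))) h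
      where
      open +-*-Solver
      eq : ∀ x e → x ℚ.+ e ℚ.- x ≡ e
      eq = solve 2 (λ x e → x :+ e :- x := e) refl

    0<-⇒< : ∀ {x y} → 0# < y - x → x < y
    0<-⇒< {x} {y} (ε , ε>0 , h) = ε , ε>0 , eventually-map
      (λ n k → subst₂ ℚ._<_ (eq₁ (seq x n) ε) (eq₂ (seq x n) (seq y n)) (ℚₚ.+-monoʳ-< (seq x n) k)) h
      where
      open +-*-Solver
      eq₁ : ∀ x e → x ℚ.+ (0ℚ ℚ.+ e) ≡ x ℚ.+ e
      eq₁ = solve 2 (λ x e → x :+ (con (+ 0) :+ e) := x :+ e) refl
      eq₂ : ∀ x y → x ℚ.+ (y ℚ.- x) ≡ y
      eq₂ = solve 2 (λ x y → x :+ (y :- x) := y) refl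

    +-pos : ∀ {x y} → 0# < x → 0# < y → 0# < x + y
    +-pos {x} {y} (ε , ε>0 , h) (δ , δ>0 , k) = ε ℚ.+ δ , ℚₚ.+-mono-< ε>0 δ>0 , eventually-map
      (λ n (p , q) → subst (ℚ._< seq x n ℚ.+ seq y n) (eq ε δ) (ℚₚ.+-mono-< p q)) (both h k)
      where
      open +-*-Solver
      eq : ∀ x y → (0ℚ ℚ.+ x) ℚ.+ (0ℚ ℚ.+ y) ≡ 0ℚ ℚ.+ (x ℚ.+ y)
      eq = solve 2 (λ x y → (con (+ 0) :+ x) :+ (con (+ 0) :+ y) := con (+ 0) :+ (x :+ y)) refl

    *-pos : ∀ {x y} → 0# < x → 0# < y → 0# < x * y
    *-pos {x} {y} (ε , ε>0 , h) (δ , δ>0 , k) = ε ℚ.* δ , *-posℚ ε>0 δ>0 , eventually-map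
      (λ n (p , q) →
        let p' = subst (ℚ._< seq x n) (ℚₚ.+-identityˡ ε) p
            q' = subst (ℚ._< seq y n) (ℚₚ.+-identityˡ δ) q
        in subst (ℚ._< seq x n ℚ.* seq y n) (sym (ℚₚ.+-identityˡ (ε ℚ.* δ)))
          (ℚₚ.<-trans (ℚₚ.*-monoˡ-<-pos δ {{ℚ.positive δ>0}} p')
                      (ℚₚ.*-monoʳ-<-pos (seq x n) {{ℚ.positive (ℚₚ.<-trans ε>0 p')}} q'))) (both h k)

    -- The terms of `y` eventually stay within ½ε of those of `x`, so half of the gap ε survives.
    pos-cong : ∀ {x y} → x ≈ y → 0# < x → 0# < y
    pos-cong {x} {y} e (ε , ε>0 , h) = ½ ℚ.* ε , ½*-pos ε>0 , eventually-map
      (λ n (p , q) → subst₂ ℚ._<_ (trans (cong (λ t → 0ℚ ℚ.+ t ℚ.- ½ ℚ.* ε) (sym (½+½ ε))) (eq₁ (½ ℚ.* ε))) (eq₂ (seq y n) (½ ℚ.* ε))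
        (ℚₚ.+-monoˡ-< (ℚ.- (½ ℚ.* ε)) (ℚₚ.<-trans p
          (subst (ℚ._< seq y n ℚ.+ ½ ℚ.* ε) (eq₃ (seq x n) (seq y n))
            (ℚₚ.+-monoʳ-< (seq y n) (ℚₚ.≤-<-trans (p≤∣p∣ (seq x n ℚ.- seq y n)) q))))))
      (both h (e _ (½*-pos ε>0)))
      where
      open +-*-Solver
      eq₁ : ∀ h → 0ℚ ℚ.+ (h ℚ.+ h) ℚ.- h ≡ 0ℚ ℚ.+ h
      eq₁ = solve 1 (λ h → con (+ 0) :+ (h :+ h) :- h := con (+ 0) :+ h) refl
      eq₂ : ∀ y e → y ℚ.+ e ℚ.- e ≡ y
      eq₂ = solve 2 (λ y e → y :+ e :- e := y) refl
      eq₃ : ∀ x y → y ℚ.+ (x ℚ.- y) ≡ x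
      eq₃ = solve 2 (λ x y → y :+ (x :- y) := x) refl

    0≮0 : ¬ 0# < 0#
    0≮0 (ε , ε>0 , h) = ℚₚ.<-asym ε>0 (subst (ℚ._< 0ℚ) (ℚₚ.+-identityˡ ε) (eventually-const h))

    ≤⇒≮ : ∀ {x y} → x ≤ y → ¬ y < x
    ≤⇒≮ h = h

    ≮⇒≤ : ∀ {x y} → ¬ y < x → x ≤ y
    ≮⇒≤ h = h

    -- A real which is neither positive nor negative is eventually small, since
    -- one large term of a Cauchy sequence keeps all later terms away from 0.
    ≮0∧≯0⇒≈0 : ∀ {x} → ¬ 0# < x → ¬ 0# < - x → x ≈ 0#
    ≮0∧≯0⇒≈0 {x} ≯0 ≮0 ε ε>0 =
      let N , h = cauchy x (½ ℚ.* ε) (½*-pos ε>0) in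
      N , λ n n≥ → subst (λ t → ∣ t ∣ ℚ.< ε) (sym (ℚₚ.+-identityʳ (seq x n))) (∣p∣<ε
        (small {x} {seq x n} ≯0 (λ m m≥ → ℚₚ.≤-<-trans (p≤∣p∣ (seq x n ℚ.- seq x m)) (h n m n≥ m≥)))
        (small { - x} {ℚ.- seq x n} ≮0 (λ m m≥ → ℚₚ.≤-<-trans (p≤∣p∣ (ℚ.- seq x n ℚ.- ℚ.- seq x m))
          (subst (ℚ._< ½ ℚ.* ε) (cong ∣_∣ (eq (seq x n) (seq x m))) (h m n m≥ n≥)))))
      where
      open +-*-Solver
      eq : ∀ p q → q ℚ.- p ≡ ℚ.- p ℚ.- ℚ.- q
      eq = solve 2 (λ p q → q :- p := :- p :- :- q) refl
      -- The terms turn out to be at least ½ε, while `0# < y` requires them to exceed its gap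
      -- strictly; hence a gap of ¼ε.
      quarter : 0ℚ ℚ.+ ½ ℚ.* ½ ℚ.* ε ℚ.< ½ ℚ.* ε
      quarter = subst (ℚ._< ½ ℚ.* ε) (sym (ℚₚ.+-identityˡ (½ ℚ.* ½ ℚ.* ε)))
        (ℚₚ.*-monoˡ-<-pos ε {{ℚ.positive ε>0}} (ℚₚ.*-monoʳ-<-pos ½ (toWitness {a? = ½ ℚₚ.<? 1ℚ} _)))
      half≤ : ∀ p y → p ℚ.- y ℚ.< ½ ℚ.* ε → ε ℚ.≤ p → ½ ℚ.* ε ℚ.≤ y
      half≤ p y k ε≤p = subst₂ ℚ._≤_ (trans (cong (ℚ._- ½ ℚ.* ε) (sym (½+½ ε))) (eq₅ (½ ℚ.* ε))) (eq₆ p y)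
        (ℚₚ.+-mono-≤ ε≤p (ℚₚ.neg-antimono-≤ (ℚₚ.<⇒≤ k)))
        where
        eq₅ : ∀ h → h ℚ.+ h ℚ.- h ≡ h
        eq₅ = solve 1 (λ h → h :+ h :- h := h) refl
        eq₆ : ∀ p y → p ℚ.+ ℚ.- (p ℚ.- y) ≡ y
        eq₆ = solve 2 (λ p y → p :+ :- (p :- y) := y) refl
      small : ∀ {y p N} → ¬ 0# < y → (∀ m → N ℕ.≤ m → p ℚ.- seq y m ℚ.< ½ ℚ.* ε) → p ℚ.< ε
      small {y} {p} {N} ≯0 k = ℚₚ.≰⇒> λ ε≤p → ≯0 (½ ℚ.* ½ ℚ.* ε ,
        *-posℚ (*-posℚ (ℚₚ.positive⁻¹ ½) (ℚₚ.positive⁻¹ ½)) ε>0 , N , λ m m≥ →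
        ℚₚ.<-≤-trans quarter (half≤ p (seq y m) (k m m≥) ε≤p))

    ⌊⌋-mono-< : ∀ {p q} → p ℚ.< q → ⌊ p ⌋ < ⌊ q ⌋
    ⌊⌋-mono-< {p} {q} p<q = ½ ℚ.* (q ℚ.- p) , ½*-pos (p<q⇒0<q-p p<q) , always λ _ →
      subst₂ ℚ._<_ (cong (p ℚ.+_) (ℚₚ.+-identityˡ (½ ℚ.* (q ℚ.- p)))) (trans (cong (p ℚ.+_) (½+½ (q ℚ.- p))) (eq p q))
        (ℚₚ.+-monoʳ-< p (ℚₚ.+-monoˡ-< (½ ℚ.* (q ℚ.- p)) (½*-pos (p<q⇒0<q-p p<q))))
      where
      open +-*-Solver
      eq : ∀ p q → p ℚ.+ (q ℚ.- p) ≡ q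
      eq = solve 2 (λ p q → p :+ (q :- p) := q) refl

    ⌊⌋-cancel-< : ∀ {p q} → ⌊ p ⌋ < ⌊ q ⌋ → p ℚ.< q
    ⌊⌋-cancel-< {p} {q} (ε , ε>0 , h) = ℚₚ.<-trans
      (subst (ℚ._< p ℚ.+ ε) (ℚₚ.+-identityʳ p) (ℚₚ.+-monoʳ-< p ε>0)) (eventually-const h)

    rational-below : ∀ {x} → 0# < x → ∃[ ε ] (0ℚ ℚ.< ε × ⌊ ε ⌋ < x)
    rational-below {x} (ε , ε>0 , h) = ½ ℚ.* ε , ½*-pos ε>0 , ½ ℚ.* ε , ½*-pos ε>0 , eventually-map
      (λ n → subst (ℚ._< seq x n) (trans (ℚₚ.+-identityˡ ε) (sym (½+½ ε)))) h

    seq-close : ∀ x ε → 0ℚ ℚ.< ε → Eventually (λ n → ¬ (x < ⌊ seq x n ℚ.- ε ⌋) × ¬ (⌊ seq x n ℚ.+ ε ⌋ < x))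
    seq-close x ε ε>0 =
      let N , h = cauchy x ε ε>0 in
      N , λ n n≥ →
        (λ (δ , δ>0 , M , k) → let m = N ℕ.⊔ M in
          ℚₚ.<-asym (h n m n≥ (ℕₚ.m≤m⊔n N M)) (ℚₚ.<-≤-trans
            (subst (ℚ._< seq x n ℚ.- seq x m) (ℚₚ.+-identityˡ ε)
              (gap₁ (seq x m) (seq x n) δ>0 (k m (ℕₚ.m≤n⊔m N M))))
            (p≤∣p∣ (seq x n ℚ.- seq x m)))) ,
        (λ (δ , δ>0 , M , k) → let m = N ℕ.⊔ M in
          ℚₚ.<-asym (h m n (ℕₚ.m≤m⊔n N M) n≥) (ℚₚ.<-≤-trans
            (gap₂ (seq x m) (seq x n) δ>0 (k m (ℕₚ.m≤n⊔m N M)))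
            (p≤∣p∣ (seq x m ℚ.- seq x n))))
      where
      open +-*-Solver
      gap₁ : ∀ a b {δ} → 0ℚ ℚ.< δ → a ℚ.+ δ ℚ.< b ℚ.- ε → 0ℚ ℚ.+ ε ℚ.< b ℚ.- a
      gap₁ a b {δ} δ>0 h = subst₂ ℚ._<_ (e₁ a δ ε) (e₂ a b δ ε)
        (ℚₚ.+-mono-< δ>0 (ℚₚ.+-monoˡ-< (ε ℚ.- a ℚ.- δ) h))
        where
        e₁ : ∀ a d e → 0ℚ ℚ.+ (a ℚ.+ d ℚ.+ (e ℚ.- a ℚ.- d)) ≡ 0ℚ ℚ.+ e
        e₁ = solve 3 (λ a d e → con (+ 0) :+ (a :+ d :+ (e :- a :- d)) := con (+ 0) :+ e) refl
        e₂ : ∀ a b d e → d ℚ.+ (b ℚ.- e ℚ.+ (e ℚ.- a ℚ.- d)) ≡ b ℚ.- a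
        e₂ = solve 4 (λ a b d e → d :+ (b :- e :+ (e :- a :- d)) := b :- a) refl
      gap₂ : ∀ a b {δ} → 0ℚ ℚ.< δ → b ℚ.+ ε ℚ.+ δ ℚ.< a → ε ℚ.< a ℚ.- b
      gap₂ a b {δ} δ>0 h = subst₂ ℚ._<_ (e₁ b δ ε) (e₂ a b δ)
        (ℚₚ.+-mono-< δ>0 (ℚₚ.+-monoˡ-< (ℚ.- b ℚ.- δ) h))
        where
        e₁ : ∀ b d e → 0ℚ ℚ.+ (b ℚ.+ e ℚ.+ d ℚ.+ (ℚ.- b ℚ.- d)) ≡ e
        e₁ = solve 3 (λ b d e → con (+ 0) :+ (b :+ e :+ d :+ (:- b :- d)) := e) refl
        e₂ : ∀ a b d → d ℚ.+ (a ℚ.+ (ℚ.- b ℚ.- d)) ≡ a ℚ.- b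
        e₂ = solve 3 (λ a b d → d :+ (a :+ (:- b :- d)) := a :- b) refl

-- Classical order of the reals, and density of the rationals

module RealOrder (em : ExcludedMiddle 0ℓ) where

  open RealField public
  open ℝ-Solver public using (solve; _:=_; _:+_; _:*_; :-_; _:-_; con)

  opaque
    by-contradiction : {P : Set} → ¬ ¬ P → P
    by-contradiction {P} h with em {P}
    ... | yes p = p
    ... | no ¬p = ⊥-elim (h ¬p)

  <-respʳ-≈ : ∀ {x y z} → y ≈ z → x < y → x < z
  <-respʳ-≈ e h = 0<-⇒< (pos-cong (+-cong e ≈-refl) (<⇒0<- h))

  <-respˡ-≈ : ∀ {x y z} → y ≈ z → y < x → z < x
  <-respˡ-≈ e h = 0<-⇒< (pos-cong (+-cong ≈-refl (-‿cong e)) (<⇒0<- h))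

  <-trans : ∀ {x y z} → x < y → y < z → x < z
  <-trans {x} {y} {z} h k = 0<-⇒< (pos-cong
    (solve 3 (λ x y z → (y :- x) :+ (z :- y) := z :- x) ≈-refl x y z) (+-pos (<⇒0<- h) (<⇒0<- k)))

  <-irrefl : ∀ {x} → ¬ x < x
  <-irrefl {x} h = 0≮0 (pos-cong (+-inverseʳ x) (<⇒0<- h))

  <-asym : ∀ {x y} → x < y → ¬ y < x
  <-asym h k = <-irrefl (<-trans h k)

  <⇒≤ : ∀ {x y} → x < y → x ≤ y
  <⇒≤ h = ≮⇒≤ (<-asym h)

  tri : ∀ x y → x < y ⊎ x ≈ y ⊎ y < x
  tri x y with em {x < y} | em {y < x}
  ... | yes h | _     = inj₁ h
  ... | _     | yes k = inj₂ (inj₂ k)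
  ... | no h  | no k  = inj₂ (inj₁ (≈-trans (solve 2 (λ x y → x := (x :- y) :+ y) ≈-refl x y)
    (≈-trans (+-cong (≮0∧≯0⇒≈0 (λ p → k (0<-⇒< p))
      (λ p → h (0<-⇒< (pos-cong (solve 2 (λ x y → :- (x :- y) := y :- x) ≈-refl x y) p)))) ≈-refl) (+-identityˡ y))))

  ≤⇒<⊎≈ : ∀ {x y} → x ≤ y → x < y ⊎ x ≈ y
  ≤⇒<⊎≈ {x} {y} h with tri x y
  ... | inj₁ p        = inj₁ p
  ... | inj₂ (inj₁ p) = inj₂ p
  ... | inj₂ (inj₂ p) = ⊥-elim (≤⇒≮ h p)

  ≈⇒≤ : ∀ {x y} → x ≈ y → x ≤ y
  ≈⇒≤ e = ≮⇒≤ λ h → <-irrefl (<-respˡ-≈ (≈-sym e) h)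

  ≤-refl : ∀ {x} → x ≤ x
  ≤-refl = ≈⇒≤ ≈-refl

  <-≤-trans : ∀ {x y z} → x < y → y ≤ z → x < z
  <-≤-trans h k with ≤⇒<⊎≈ k
  ... | inj₁ p = <-trans h p
  ... | inj₂ p = <-respʳ-≈ p h

  ≤-<-trans : ∀ {x y z} → x ≤ y → y < z → x < z
  ≤-<-trans h k with ≤⇒<⊎≈ h
  ... | inj₁ p = <-trans p k
  ... | inj₂ p = <-respˡ-≈ (≈-sym p) k

  ≤-trans : ∀ {x y z} → x ≤ y → y ≤ z → x ≤ z
  ≤-trans h k = ≮⇒≤ λ p → ≤⇒≮ k (<-≤-trans p h)

  ≤-antisym : ∀ {x y} → x ≤ y → y ≤ x → x ≈ y
  ≤-antisym {x} {y} h k with ≤⇒<⊎≈ h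
  ... | inj₁ p = ⊥-elim (≤⇒≮ k p)
  ... | inj₂ p = p

  ≰⇒> : ∀ {x y} → ¬ x ≤ y → y < x
  ≰⇒> h = by-contradiction λ k → h (≮⇒≤ k)

  ≤-isPreorder : IsPreorder _≈_ _≤_
  ≤-isPreorder = record
    { isEquivalence = record { refl = ≈-refl ; sym = ≈-sym ; trans = ≈-trans }
    ; reflexive = ≈⇒≤ ; trans = ≤-trans }

  module ≤-Reasoning = Triple ≤-isPreorder <-asym <-trans
    (<-respʳ-≈ , <-respˡ-≈) <⇒≤ <-≤-trans ≤-<-trans

  +-nonneg-pos : ∀ {x y} → 0# ≤ x → 0# < y → 0# < x + y
  +-nonneg-pos {x} {y} h k with ≤⇒<⊎≈ h
  ... | inj₁ p = +-pos p k
  ... | inj₂ p = pos-cong (≈-trans (≈-sym (+-identityˡ y)) (+-cong p ≈-refl)) k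

  -- Inequalities are proved by exhibiting the difference of the two sides.
  ≤-by : ∀ {x y d} → 0# ≤ d → y - x ≈ d → x ≤ y
  ≤-by {x} {y} {d} h e = ≮⇒≤ λ y<x → 0≮0 (pos-cong
    (≈-trans (+-cong (≈-sym e) ≈-refl) (solve 2 (λ x y → (y :- x) :+ (x :- y) := con (+ 0)) ≈-refl x y))
    (+-nonneg-pos h (<⇒0<- y<x)))

  <-by : ∀ {x y d} → 0# < d → y - x ≈ d → x < y
  <-by h e = 0<-⇒< (pos-cong (≈-sym e) h)

  ≤⇒0≤- : ∀ {x y} → x ≤ y → 0# ≤ y - x
  ≤⇒0≤- {x} {y} h with ≤⇒<⊎≈ h
  ... | inj₁ p = <⇒≤ (<⇒0<- p)
  ... | inj₂ p = ≈⇒≤ (≈-trans (≈-sym (+-inverseʳ x)) (+-cong p ≈-refl))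

  +-nonneg : ∀ {x y} → 0# ≤ x → 0# ≤ y → 0# ≤ x + y
  +-nonneg {x} {y} h k with ≤⇒<⊎≈ k
  ... | inj₁ p = <⇒≤ (+-nonneg-pos h p)
  ... | inj₂ p = ≤-trans h (≈⇒≤ (≈-trans (≈-sym (+-identityʳ x)) (+-cong ≈-refl p)))

  *-nonneg : ∀ {x y} → 0# ≤ x → 0# ≤ y → 0# ≤ x * y
  *-nonneg {x} {y} h k with ≤⇒<⊎≈ h | ≤⇒<⊎≈ k
  ... | inj₁ p | inj₁ q = <⇒≤ (*-pos p q)
  ... | inj₂ p | _ = ≈⇒≤ (≈-trans (solve 1 (λ y → con (+ 0) := con (+ 0) :* y) ≈-refl y) (*-cong p ≈-refl))
  ... | _ | inj₂ q = ≈⇒≤ (≈-trans (solve 1 (λ x → con (+ 0) := x :* con (+ 0)) ≈-refl x) (*-cong ≈-refl q))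

  +-mono-≤ : ∀ {x y u v} → x ≤ y → u ≤ v → x + u ≤ y + v
  +-mono-≤ {x} {y} {u} {v} h k = ≤-by (+-nonneg (≤⇒0≤- h) (≤⇒0≤- k))
    (solve 4 (λ x y u v → (y :+ v) :- (x :+ u) := (y :- x) :+ (v :- u)) ≈-refl x y u v)

  +-mono-<-≤ : ∀ {x y u v} → x < y → u ≤ v → x + u < y + v
  +-mono-<-≤ {x} {y} {u} {v} h k = <-by (+-nonneg-pos (≤⇒0≤- k) (<⇒0<- h))
    (solve 4 (λ x y u v → (y :+ v) :- (x :+ u) := (v :- u) :+ (y :- x)) ≈-refl x y u v)

  +-mono-≤-< : ∀ {x y u v} → x ≤ y → u < v → x + u < y + v
  +-mono-≤-< {x} {y} {u} {v} h k = <-by (+-nonneg-pos (≤⇒0≤- h) (<⇒0<- k))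
    (solve 4 (λ x y u v → (y :+ v) :- (x :+ u) := (y :- x) :+ (v :- u)) ≈-refl x y u v)

  +-mono-< : ∀ {x y u v} → x < y → u < v → x + u < y + v
  +-mono-< h k = +-mono-<-≤ h (<⇒≤ k)

  *-monoˡ-≤ : ∀ {x y z} → 0# ≤ z → x ≤ y → z * x ≤ z * y
  *-monoˡ-≤ {x} {y} {z} h k = ≤-by (*-nonneg h (≤⇒0≤- k))
    (solve 3 (λ x y z → z :* y :- z :* x := z :* (y :- x)) ≈-refl x y z)

  *-monoʳ-≤ : ∀ {x y z} → 0# ≤ z → x ≤ y → x * z ≤ y * z
  *-monoʳ-≤ {x} {y} {z} h k = ≤-by (*-nonneg h (≤⇒0≤- k))
    (solve 3 (λ x y z → y :* z :- x :* z := z :* (y :- x)) ≈-refl x y z)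

  *-monoˡ-< : ∀ {x y z} → 0# < z → x < y → z * x < z * y
  *-monoˡ-< {x} {y} {z} h k = <-by (*-pos h (<⇒0<- k))
    (solve 3 (λ x y z → z :* y :- z :* x := z :* (y :- x)) ≈-refl x y z)

  *-monoʳ-< : ∀ {x y z} → 0# < z → x < y → x * z < y * z
  *-monoʳ-< {x} {y} {z} h k = <-by (*-pos h (<⇒0<- k))
    (solve 3 (λ x y z → y :* z :- x :* z := z :* (y :- x)) ≈-refl x y z)

  *-mono-≤ : ∀ {x y u v} → 0# ≤ x → 0# ≤ u → x ≤ y → u ≤ v → x * u ≤ y * v
  *-mono-≤ 0≤x 0≤u h k = ≤-trans (*-monoˡ-≤ 0≤x k) (*-monoʳ-≤ (≤-trans 0≤u k) h)

  *-cancelˡ-≤ : ∀ {x y z} → 0# < z → z * x ≤ z * y → x ≤ y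
  *-cancelˡ-≤ h k = ≮⇒≤ λ y<x → ≤⇒≮ k (*-monoˡ-< h y<x)

  *-cancelˡ-< : ∀ {x y z} → 0# ≤ z → z * x < z * y → x < y
  *-cancelˡ-< h k = ≰⇒> λ y≤x → ≤⇒≮ (*-monoˡ-≤ h y≤x) k

  ≤-respˡ-≈ : ∀ {x y z} → y ≈ z → y ≤ x → z ≤ x
  ≤-respˡ-≈ e h = ≤-trans (≈⇒≤ (≈-sym e)) h

  ≤-respʳ-≈ : ∀ {x y z} → y ≈ z → x ≤ y → x ≤ z
  ≤-respʳ-≈ e h = ≤-trans h (≈⇒≤ e)

  ⌊⌋-mono-≤ : ∀ {p q} → p ℚ.≤ q → ⌊ p ⌋ ≤ ⌊ q ⌋
  ⌊⌋-mono-≤ h = ≮⇒≤ λ k → ℚₚ.<-irrefl refl (ℚₚ.<-≤-trans (⌊⌋-cancel-< k) h)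

  nat : ℕ → ℝ
  nat n = ⌊ fromℤ (+ n) ⌋

  fromℤ-mono-≤ : ∀ {a b} → a ℤ.≤ b → fromℤ a ℚ.≤ fromℤ b
  fromℤ-mono-≤ {a} {b} h = ℚ.*≤* (subst₂ ℤ._≤_ (sym (ℤₚ.*-identityʳ a)) (sym (ℤₚ.*-identityʳ b)) h)

  fromℤ-mono-< : ∀ {a b} → a ℤ.< b → fromℤ a ℚ.< fromℤ b
  fromℤ-mono-< {a} {b} h = ℚ.*<* (subst₂ ℤ._<_ (sym (ℤₚ.*-identityʳ a)) (sym (ℤₚ.*-identityʳ b)) h)

  nat-mono-≤ : ∀ {m n} → m ℕ.≤ n → nat m ≤ nat n
  nat-mono-≤ h = ⌊⌋-mono-≤ (fromℤ-mono-≤ (ℤ.+≤+ h))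

  nat-mono-< : ∀ {m n} → m ℕ.< n → nat m < nat n
  nat-mono-< h = ⌊⌋-mono-< (fromℤ-mono-< (ℤ.+<+ h))

  nat-cancel-≤ : ∀ {m n} → nat m ≤ nat n → m ℕ.≤ n
  nat-cancel-≤ h = ℕₚ.≮⇒≥ λ k → ≤⇒≮ h (nat-mono-< k)

  0≤nat : ∀ n → 0# ≤ nat n
  0≤nat n = nat-mono-≤ {0} ℕ.z≤n

  nat-+ : ∀ m n → nat (m ℕ.+ n) ≈ nat m + nat n
  nat-+ m n = ≈-trans (≡⇒≈ (cong ⌊_⌋ (fromℤ-+ (+ m) (+ n)))) (⌊⌋-+ (fromℤ (+ m)) (fromℤ (+ n)))

  nat-* : ∀ m n → nat (m ℕ.* n) ≈ nat m * nat n
  nat-* m n = ≈-trans (≡⇒≈ (cong ⌊_⌋ (trans (cong fromℤ (ℤₚ.pos-* m n)) (fromℤ-* (+ m) (+ n)))))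
    (⌊⌋-* (fromℤ (+ m)) (fromℤ (+ n)))

  nat-suc : ∀ n → nat (suc n) ≈ 1# + nat n
  nat-suc n = nat-+ 1 n

  0<1 : 0# < 1#
  0<1 = nat-mono-< {0} {1} (ℕ.s≤s ℕ.z≤n)

  0<nat-suc : ∀ n → 0# < nat (suc n)
  0<nat-suc n = nat-mono-< {0} (ℕ.s≤s ℕ.z≤n)

  q≤nat : ∀ q → ∃[ n ] (q ℚ.≤ fromℤ (+ n))
  q≤nat q = ℤ.∣ ℚ.↥ q ∣ , ℚ.*≤* (ℤₚ.≤-trans (ℤₚ.≤-reflexive (ℤₚ.*-identityʳ (ℚ.↥ q)))
    (ℤₚ.≤-trans (i≤∣i∣ (ℚ.↥ q)) (subst (ℤ._≤ + ℤ.∣ ℚ.↥ q ∣ ℤ.* ℚ.↧ q) (ℤₚ.*-identityʳ (+ ℤ.∣ ℚ.↥ q ∣))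
      (ℤₚ.*-monoˡ-≤-nonNeg (+ ℤ.∣ ℚ.↥ q ∣) {ℤ.1ℤ} {ℚ.↧ q} (ℤ.+≤+ (ℕ.s≤s ℕ.z≤n))))))
    where
    i≤∣i∣ : ∀ i → i ℤ.≤ + ℤ.∣ i ∣
    i≤∣i∣ (+ n)    = ℤₚ.≤-refl
    i≤∣i∣ -[1+ n ] = ℤ.-≤+

  archimedean : ∀ x → ∃[ n ] (x < nat n)
  archimedean x =
    let N , h = seq-close x 1ℚ (ℚₚ.positive⁻¹ 1ℚ)
        n , k = q≤nat (seq x N ℚ.+ 1ℚ)
    in suc n , ≤-<-trans (≤-trans (≮⇒≤ (proj₂ (h N ℕₚ.≤-refl))) (⌊⌋-mono-≤ k)) (nat-mono-< (ℕₚ.n<1+n n))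

  -- A term of the sequence of `x` that is within a quarter of a rational gap ε < y - x, raised by
  -- ½ε, lies strictly between.
  dense : ∀ {x y} → x < y → ∃[ q ] (x < ⌊ q ⌋ × ⌊ q ⌋ < y)
  dense {x} {y} x<y =
    let ε , ε>0 , ε<y-x = rational-below (<⇒0<- x<y)
        h = ½ ℚ.* ε ; h>0 = ½*-pos ε>0
        k = ½ ℚ.* h ; k>0 = ½*-pos h>0
        N , c = seq-close x k k>0
        a , b = c N ℕₚ.≤-refl
        s = seq x N
    in s ℚ.+ h ,
       (≤-<-trans (≮⇒≤ b) (⌊⌋-mono-< (ℚₚ.+-monoʳ-< s
         (subst (k ℚ.<_) (½+½ h) (subst (ℚ._< k ℚ.+ k) (ℚₚ.+-identityʳ k) (ℚₚ.+-monoʳ-< k k>0)))))) ,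
       <-trans (≤-<-trans (≤-by (≤⇒0≤- (≮⇒≤ a)) (≈-trans (+-cong ≈-refl (-‿cong (⌊⌋-+ s h)))
           (≈-trans (diff x ⌊ s ⌋ ⌊ h ⌋ ⌊ k ⌋)
             (+-cong ≈-refl (-‿cong (≈-trans (+-cong ≈-refl (≈-sym (⌊⌋-neg k))) (≈-sym (⌊⌋-+ s (ℚ.- k)))))))))
         (+-mono-≤-< ≤-refl (+-mono-≤-< {⌊ h ⌋} ≤-refl (⌊⌋-mono-< {k} {h}
           (subst (k ℚ.<_) (½+½ h) (subst (ℚ._< k ℚ.+ k) (ℚₚ.+-identityʳ k) (ℚₚ.+-monoʳ-< k k>0)))))))
       (<-by (<⇒0<- ε<y-x) (≈-trans (solve 3 (λ x y h → y :- (x :+ (h :+ h)) := (y :- x) :- (h :+ h)) ≈-refl x y ⌊ h ⌋)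
         (+-cong ≈-refl (-‿cong (≈-trans (≈-sym (⌊⌋-+ h h)) (≡⇒≈ (cong ⌊_⌋ (½+½ ε))))))))
    where
    diff : ∀ x s h k → (x + (h + k)) - (s + h) ≈ x - (s - k)
    diff = solve 4 (λ x s h k → (x :+ (h :+ k)) :- (s :+ h) := x :- (s :- k)) ≈-refl

-- Powers of one half, suprema by bisection, and reciprocals

module RealCompleteness (em : ExcludedMiddle 0ℓ) where

  open RealOrder em public

  opaque
    ½ⁿ : ℕ → ℝ
    ½ⁿ n = ⌊ ½^ n ⌋

    ½ℝ : ℝ
    ½ℝ = ⌊ ½ ⌋

    ½ℝ+½ℝ : ½ℝ + ½ℝ ≈ 1#
    ½ℝ+½ℝ = ≈-sym (⌊⌋-+ ½ ½)

    ½ⁿ-zero : ½ⁿ 0 ≈ 1#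
    ½ⁿ-zero = ≈-refl

    ½ⁿ-suc : ∀ n → ½ⁿ (suc n) ≈ ½ℝ * ½ⁿ n
    ½ⁿ-suc n = ⌊⌋-* ½ (½^ n)

    0<½ : 0# < ½ℝ
    0<½ = ⌊⌋-mono-< (ℚₚ.positive⁻¹ ½)

    ½ⁿ-def : ∀ n → ½ⁿ n ≡ ⌊ ½^ n ⌋
    ½ⁿ-def n = refl

    midpoint : ℚ → ℚ → ℚ
    midpoint p q = ½ ℚ.* (p ℚ.+ q)

    midpoint-≈ : ∀ p q → ⌊ midpoint p q ⌋ ≈ ½ℝ * ⌊ p ⌋ + ½ℝ * ⌊ q ⌋
    midpoint-≈ p q = ≈-trans (⌊⌋-* ½ (p ℚ.+ q)) (≈-trans (*-cong ≈-refl (⌊⌋-+ p q)) (*-distribˡ-+ ½ℝ ⌊ p ⌋ ⌊ q ⌋))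

  ½-+ : ∀ x → ½ℝ * x + ½ℝ * x ≈ x
  ½-+ x = ≈-trans (solve 2 (λ h x → h :* x :+ h :* x := (h :+ h) :* x) ≈-refl ½ℝ x)
    (≈-trans (*-cong ½ℝ+½ℝ ≈-refl) (*-identityˡ x))

  ½ⁿ-double : ∀ n → ½ⁿ (suc n) + ½ⁿ (suc n) ≈ ½ⁿ n
  ½ⁿ-double n = ≈-trans (+-cong (½ⁿ-suc n) (½ⁿ-suc n)) (½-+ (½ⁿ n))

  ½ⁿ-+ : ∀ m n → ½ⁿ (m ℕ.+ n) ≈ ½ⁿ m * ½ⁿ n
  ½ⁿ-+ zero    n = ≈-sym (≈-trans (*-cong ½ⁿ-zero ≈-refl) (*-identityˡ (½ⁿ n)))
  ½ⁿ-+ (suc m) n = ≈-trans (½ⁿ-suc (m ℕ.+ n)) (≈-trans (*-cong ≈-refl (½ⁿ-+ m n))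
    (≈-trans (≈-sym (*-assoc ½ℝ (½ⁿ m) (½ⁿ n))) (*-cong (≈-sym (½ⁿ-suc m)) ≈-refl)))

  0<½ⁿ : ∀ n → 0# < ½ⁿ n
  0<½ⁿ zero    = pos-cong (≈-sym ½ⁿ-zero) 0<1
  0<½ⁿ (suc n) = pos-cong (≈-sym (½ⁿ-suc n)) (*-pos 0<½ (0<½ⁿ n))

  ½ⁿ-anti-≤ : ∀ {m n} → m ℕ.≤ n → ½ⁿ n ≤ ½ⁿ m
  ½ⁿ-anti-≤ {m} h = go (ℕₚ.≤⇒≤′ h)
    where
    go : ∀ {n} → m ℕ.≤′ n → ½ⁿ n ≤ ½ⁿ m
    go (ℕ.≤′-reflexive refl)     = ≤-refl
    go (ℕ.≤′-step {n} p) = ≤-trans (≤-by (<⇒≤ (0<½ⁿ (suc n)))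
      (≈-trans (+-cong (≈-sym (½ⁿ-double n)) ≈-refl)
        (solve 1 (λ h → (h :+ h) :- h := h) ≈-refl (½ⁿ (suc n))))) (go p)

  ½ⁿ*2^n : ∀ n → ½ⁿ n * nat (2 ℕ.^ n) ≈ 1#
  ½ⁿ*2^n zero    = ≈-trans (*-cong ½ⁿ-zero ≈-refl) (*-identityˡ 1#)
  ½ⁿ*2^n (suc n) = ≈-trans (*-cong ≈-refl (≈-trans (nat-* 2 (2 ℕ.^ n)) (*-cong (nat-+ 1 1) ≈-refl)))
    (≈-trans (solve 2 (λ h t → h :* ((con (+ 1) :+ con (+ 1)) :* t) := (h :+ h) :* t) ≈-refl (½ⁿ (suc n)) (nat (2 ℕ.^ n)))
    (≈-trans (*-cong (½ⁿ-double n) ≈-refl) (½ⁿ*2^n n)))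

  ½ⁿ-cancel : ∀ x n → x * ½ⁿ n * nat (2 ℕ.^ n) ≈ x
  ½ⁿ-cancel x n = ≈-trans (*-assoc x (½ⁿ n) (nat (2 ℕ.^ n))) (≈-trans (*-cong ≈-refl (½ⁿ*2^n n)) (*-identityʳ x))

  2^-cancel : ∀ x n → x * nat (2 ℕ.^ n) * ½ⁿ n ≈ x
  2^-cancel x n = ≈-trans (solve 3 (λ x t h → x :* t :* h := x :* h :* t) ≈-refl x (nat (2 ℕ.^ n)) (½ⁿ n)) (½ⁿ-cancel x n)

  n<2^n : ∀ n → n ℕ.< 2 ℕ.^ n
  n<2^n zero    = ℕ.s≤s ℕ.z≤n
  n<2^n (suc n) = subst (suc (suc n) ℕ.≤_) (cong (2 ℕ.^ n ℕ.+_) (sym (ℕₚ.+-identityʳ (2 ℕ.^ n))))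
    (ℕₚ.+-mono-≤ (ℕₚ.≤-trans (ℕ.s≤s ℕ.z≤n) (n<2^n n)) (n<2^n n))

  -- With a rational q below ε and a natural m above x, any N above (m + 1) / q works, because 2^N
  -- exceeds N.
  ½ⁿ-small : ∀ x {ε} → 0# < ε → ∃[ N ] (½ⁿ N * x < ε)
  ½ⁿ-small x {ε} ε>0 =
    let q , q>0 , q<ε = rational-below ε>0
        m , x<m = archimedean x
        δ , δ>0 , qδ = divℚ q (fromℤ (+ suc m)) q>0 (fromℤ-mono-< (ℤ.+<+ (ℕ.s≤s ℕ.z≤n)))
        N , δ<N = archimedean ⌊ δ ⌋
        open ≤-Reasoning
    in N , (begin-strict
      ½ⁿ N * x                       <⟨ *-monoˡ-< (0<½ⁿ N) (<-trans x<m (nat-mono-< (ℕₚ.n<1+n m))) ⟩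
      ½ⁿ N * nat (suc m)             ≈⟨ *-cong ≈-refl (≈-trans (≡⇒≈ (cong ⌊_⌋ (sym qδ))) (⌊⌋-* q δ)) ⟩
      ½ⁿ N * (⌊ q ⌋ * ⌊ δ ⌋)         ≤⟨ *-monoˡ-≤ (<⇒≤ (0<½ⁿ N)) (*-monoˡ-≤ (<⇒≤ (⌊⌋-mono-< q>0))
                                          (<⇒≤ (<-trans δ<N (nat-mono-< (n<2^n N))))) ⟩
      ½ⁿ N * (⌊ q ⌋ * nat (2 ℕ.^ N)) ≈⟨ solve 3 (λ a b c → a :* (b :* c) := (a :* c) :* b) ≈-refl (½ⁿ N) ⌊ q ⌋ (nat (2 ℕ.^ N)) ⟩
      (½ⁿ N * nat (2 ℕ.^ N)) * ⌊ q ⌋ ≈⟨ *-cong (½ⁿ*2^n N) ≈-refl ⟩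
      1# * ⌊ q ⌋                     ≈⟨ *-identityˡ ⌊ q ⌋ ⟩
      ⌊ q ⌋                          <⟨ q<ε ⟩
      ε                              ∎)

  half : ∀ {ε} → 0# < ε → 0# < ½ℝ * ε
  half = *-pos 0<½

  ≤-from-ε : ∀ {x y} → (∀ ε → 0ℚ ℚ.< ε → x ≤ y + ⌊ ε ⌋) → x ≤ y
  ≤-from-ε {x} {y} h = ≮⇒≤ λ y<x →
    let ε , ε>0 , ε<x-y = rational-below (<⇒0<- y<x)
    in ≤⇒≮ (h ε ε>0) (<-by (<⇒0<- ε<x-y) (solve 3 (λ x y e → x :- (y :+ e) := (x :- y) :- e) ≈-refl x y ⌊ ε ⌋))

  ⌊⌋-minus : ∀ p q → ⌊ p ℚ.- q ⌋ ≈ ⌊ p ⌋ - ⌊ q ⌋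
  ⌊⌋-minus p q = ≈-trans (⌊⌋-+ p (ℚ.- q)) (+-cong ≈-refl (⌊⌋-neg q))

  seq-approximates : ∀ x ε → 0ℚ ℚ.< ε → Eventually (λ n → ⌊ seq x n ⌋ ≤ x + ⌊ ε ⌋ × x ≤ ⌊ seq x n ⌋ + ⌊ ε ⌋)
  seq-approximates x ε ε>0 = let N , k = seq-close x ε ε>0 in
    N , λ n N≤n → below (seq x n) (proj₁ (k n N≤n)) , above (seq x n) (proj₂ (k n N≤n))
    where
    below : ∀ p → ¬ (x < ⌊ p ℚ.- ε ⌋) → ⌊ p ⌋ ≤ x + ⌊ ε ⌋
    below p h = ≤-by (≤⇒0≤- (≮⇒≤ λ k → h (<-respʳ-≈ (≈-sym (⌊⌋-minus p ε)) k)))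
      (solve 3 (λ x p e → (x :+ e) :- p := x :- (p :- e)) ≈-refl x ⌊ p ⌋ ⌊ ε ⌋)
    above : ∀ p → ¬ (⌊ p ℚ.+ ε ⌋ < x) → x ≤ ⌊ p ⌋ + ⌊ ε ⌋
    above p h = ≮⇒≤ λ k → h (<-respˡ-≈ (≈-sym (⌊⌋-+ p ε)) k)

  opaque
    fromSeq : (l : ℕ → ℚ) → IsCauchy l → ℝ
    fromSeq = mkℝ

    fromSeq-close : ∀ l c ε → 0ℚ ℚ.< ε →
      Eventually (λ n → ⌊ l n ⌋ ≤ fromSeq l c + ⌊ ε ⌋ × fromSeq l c ≤ ⌊ l n ⌋ + ⌊ ε ⌋)
    fromSeq-close l c = seq-approximates (mkℝ l c)

  module _ (l : ℕ → ℚ) (w : ℕ → ℝ) (small : ∀ ε → 0# < ε → ∃[ N ] (w N < ε))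
           (nest : ∀ N n → N ℕ.≤ n → ⌊ l N ⌋ ≤ ⌊ l n ⌋ × ⌊ l n ⌋ ≤ ⌊ l N ⌋ + w N) where

    private
      close : ∀ {ε} N → w N < ⌊ ε ⌋ → ∀ m n → N ℕ.≤ m → N ℕ.≤ n → l m ℚ.- l n ℚ.< ε
      close {ε} N wN m n m≥ n≥ = ⌊⌋-cancel-< (<-respˡ-≈ (≈-sym (⌊⌋-minus (l m) (l n)))
        (≤-<-trans (≤-by (+-nonneg (≤⇒0≤- (proj₂ (nest N m m≥))) (≤⇒0≤- (proj₁ (nest N n n≥))))
           (solve 4 (λ a b c w → w :- (a :- b) := (c :+ w :- a) :+ (b :- c)) ≈-refl ⌊ l m ⌋ ⌊ l n ⌋ ⌊ l N ⌋ (w N))) wN))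

      neg-swap : ∀ p q → q ℚ.- p ≡ ℚ.- (p ℚ.- q)
      neg-swap = +-*-Solver.solve 2 (λ p q → q R.:- p R.:= R.:- (p R.:- q)) refl
        where module R = +-*-Solver

      opaque
        l-cauchy : IsCauchy l
        l-cauchy ε ε>0 = let N , h = small ⌊ ε ⌋ (⌊⌋-mono-< ε>0) in
          N , λ m n m≥ n≥ → ∣p∣<ε (close N h m n m≥ n≥)
            (subst (ℚ._< ε) (neg-swap (l m) (l n)) (close N h n m n≥ m≥))

    limit : ℝ
    limit = fromSeq l l-cauchy

    limit-lower : ∀ N → ⌊ l N ⌋ ≤ limit
    limit-lower N = ≤-from-ε λ ε ε>0 →
      let M , h = fromSeq-close l l-cauchy ε ε>0
      in ≤-trans (proj₁ (nest N (N ℕ.⊔ M) (ℕₚ.m≤m⊔n N M))) (proj₁ (h (N ℕ.⊔ M) (ℕₚ.m≤n⊔m N M)))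

    limit-upper : ∀ N → limit ≤ ⌊ l N ⌋ + w N
    limit-upper N = ≤-from-ε λ ε ε>0 →
      let M , h = fromSeq-close l l-cauchy ε ε>0
      in ≤-trans (proj₂ (h (N ℕ.⊔ M) (ℕₚ.m≤n⊔m N M)))
           (+-mono-≤ (proj₂ (nest N (N ℕ.⊔ M) (ℕₚ.m≤m⊔n N M))) ≤-refl)

  IsLub : (ℝ → Set) → ℝ → Set
  IsLub P s = (∀ x → P x → x ≤ s) × (∀ u → (∀ x → P x → x ≤ u) → s ≤ u)

  module _ (P : ℝ → Set) {x₀ b : ℝ} (px₀ : P x₀) (P≤b : ∀ x → P x → x ≤ b) where

    private
      Below : ℚ → Set
      Below q = ∃[ x ] (P x × ⌊ q ⌋ < x)

      l₀ : ∃[ q ] ⌊ q ⌋ < x₀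
      l₀ = let q , h , k = dense {x₀ - 1#} {x₀} (<-by 0<1 (solve 1 (λ x → x :- (x :- con (+ 1)) := con (+ 1)) ≈-refl x₀))
           in q , k

      u₀ : ∃[ n ] b < nat n
      u₀ = archimedean b

      -- The invariant of the bisection: `lo` is below some element of `P` and `hi` below none.
      -- Excluded middle decides which half keeps it.
      record Bracket : Set where
        field
          lo hi : ℚ
          below : Below lo
          above : ¬ Below hi

      open Bracket

      start : Bracket
      start .lo = proj₁ l₀
      start .hi = fromℤ (+ proj₁ u₀)
      start .below = x₀ , px₀ , proj₂ l₀
      start .above (x , px , h) = <-asym h (≤-<-trans (P≤b x px) (proj₂ u₀))

      choose : ∀ B → Dec (Below (midpoint (lo B) (hi B))) → Bracket
      choose B (yes h) = record { lo = midpoint (lo B) (hi B) ; hi = hi B ; below = h ; above = above B }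
      choose B (no  h) = record { lo = lo B ; hi = midpoint (lo B) (hi B) ; below = below B ; above = h }

      bisect : Bracket → Bracket
      bisect B = choose B em

      brackets : ℕ → Bracket
      brackets zero    = start
      brackets (suc n) = bisect (brackets n)

      width : Bracket → ℝ
      width B = ⌊ hi B ⌋ - ⌊ lo B ⌋

      lo<hi : ∀ B → ⌊ lo B ⌋ ≤ ⌊ hi B ⌋
      lo<hi B = let x , px , h = below B in
        ≮⇒≤ λ k → above B (x , px , <-trans k h)

      choose-nested : ∀ B d → ⌊ lo B ⌋ ≤ ⌊ lo (choose B d) ⌋ × ⌊ hi (choose B d) ⌋ ≤ ⌊ hi B ⌋
      choose-nested B (yes h) = ≤-by (*-nonneg (<⇒≤ 0<½) (≤⇒0≤- (lo<hi B))) (≈-trans (+-cong (midpoint-≈ (lo B) (hi B)) (-‿cong (≈-sym (½-+ ⌊ lo B ⌋))))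
          (solve 3 (λ h l u → (h :* l :+ h :* u) :- (h :* l :+ h :* l) := h :* (u :- l)) ≈-refl ½ℝ ⌊ lo B ⌋ ⌊ hi B ⌋)) , ≤-refl
      choose-nested B (no  h) = ≤-refl , ≤-by (*-nonneg (<⇒≤ 0<½) (≤⇒0≤- (lo<hi B))) (≈-trans (+-cong (≈-sym (½-+ ⌊ hi B ⌋)) (-‿cong (midpoint-≈ (lo B) (hi B))))
          (solve 3 (λ h l u → (h :* u :+ h :* u) :- (h :* l :+ h :* u) := h :* (u :- l)) ≈-refl ½ℝ ⌊ lo B ⌋ ⌊ hi B ⌋))

      choose-width : ∀ B d → width (choose B d) ≈ ½ℝ * width B
      choose-width B (yes h) = ≈-trans (+-cong (≈-sym (½-+ ⌊ hi B ⌋)) (-‿cong (midpoint-≈ (lo B) (hi B))))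
          (solve 3 (λ h l u → (h :* u :+ h :* u) :- (h :* l :+ h :* u) := h :* (u :- l)) ≈-refl ½ℝ ⌊ lo B ⌋ ⌊ hi B ⌋)
      choose-width B (no  h) = ≈-trans (+-cong (midpoint-≈ (lo B) (hi B)) (-‿cong (≈-sym (½-+ ⌊ lo B ⌋))))
          (solve 3 (λ h l u → (h :* l :+ h :* u) :- (h :* l :+ h :* l) := h :* (u :- l)) ≈-refl ½ℝ ⌊ lo B ⌋ ⌊ hi B ⌋)

      widths : ∀ n → width (brackets n) ≈ ½ⁿ n * width start
      widths zero    = ≈-sym (≈-trans (*-cong ½ⁿ-zero ≈-refl) (*-identityˡ (width start)))
      widths (suc n) = ≈-trans (choose-width (brackets n) em) (≈-trans (*-cong ≈-refl (widths n))
        (≈-trans (≈-sym (*-assoc ½ℝ (½ⁿ n) (width start))) (*-cong (≈-sym (½ⁿ-suc n)) ≈-refl)))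

      nested : ∀ {N n} → N ℕ.≤′ n → ⌊ lo (brackets N) ⌋ ≤ ⌊ lo (brackets n) ⌋ × ⌊ hi (brackets n) ⌋ ≤ ⌊ hi (brackets N) ⌋
      nested (ℕ.≤′-reflexive refl) = ≤-refl , ≤-refl
      nested (ℕ.≤′-step {n} p) =
        ≤-trans (proj₁ (nested p)) (proj₁ (choose-nested (brackets n) em)) ,
        ≤-trans (proj₂ (choose-nested (brackets n) em)) (proj₂ (nested p))

      lo+width : ∀ B → ⌊ lo B ⌋ + width B ≈ ⌊ hi B ⌋
      lo+width B = solve 2 (λ l h → l :+ (h :- l) := h) ≈-refl ⌊ lo B ⌋ ⌊ hi B ⌋

      narrow : ∀ ε → 0# < ε → ∃[ N ] (width (brackets N) < ε)
      narrow ε ε>0 = let N , h = ½ⁿ-small (width start) ε>0 in N , <-respˡ-≈ (≈-sym (widths N)) h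

      nest : ∀ N n → N ℕ.≤ n → ⌊ lo (brackets N) ⌋ ≤ ⌊ lo (brackets n) ⌋ × ⌊ lo (brackets n) ⌋ ≤ ⌊ lo (brackets N) ⌋ + width (brackets N)
      nest N n N≤n = let p = nested (ℕₚ.≤⇒≤′ N≤n) in proj₁ p ,
          ≤-trans (lo<hi (brackets n)) (≤-trans (proj₂ p) (≈⇒≤ (≈-sym (lo+width (brackets N)))))

      l : ℕ → ℚ
      l n = lo (brackets n)

      w : ℕ → ℝ
      w n = width (brackets n)

      opaque
        sup : ℝ
        sup = limit l w narrow nest

        sup-lower : ∀ N → ⌊ lo (brackets N) ⌋ ≤ sup
        sup-lower = limit-lower l w narrow nest

        sup-upper : ∀ N → sup ≤ ⌊ lo (brackets N) ⌋ + width (brackets N)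
        sup-upper = limit-upper l w narrow nest

      upper : ∀ x → P x → x ≤ sup
      upper x px = ≮⇒≤ λ s<x →
        let N , h = narrow (x - sup) (<⇒0<- s<x)
        in above (brackets N) (x , px , <-by (+-nonneg-pos (≤⇒0≤- (sup-lower N)) (<⇒0<- h))
          (solve 4 (λ x s l h → x :- h := (s :- l) :+ ((x :- s) :- (h :- l))) ≈-refl x sup ⌊ lo (brackets N) ⌋ ⌊ hi (brackets N) ⌋))

      least : ∀ u → (∀ x → P x → x ≤ u) → sup ≤ u
      least u h = ≮⇒≤ λ u<s →
        let N , k = narrow (sup - u) (<⇒0<- u<s)
            x , px , l<x = below (brackets N)
        in ≤⇒≮ (h x px) (<-trans (<-by (+-nonneg-pos (≤⇒0≤- (sup-upper N)) (<⇒0<- k))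
          (solve 4 (λ s u l w → l :- u := ((l :+ w) :- s) :+ ((s :- u) :- w)) ≈-refl sup u ⌊ lo (brackets N) ⌋ (width (brackets N)))) l<x)

    opaque
      lub : Σ[ s ∈ ℝ ] IsLub P s
      lub = sup , upper , least

  lub-witness : ∀ {P s u} → IsLub P s → u < s → ∃[ x ] (P x × u < x)
  lub-witness {P} {s} {u} (_ , least) u<s = by-contradiction λ h →
    ≤⇒≮ (least u λ x px → ≮⇒≤ λ u<x → h (x , px , u<x)) u<s

  module _ {x : ℝ} (x>0 : 0# < x) where

    private
      P : ℝ → Set
      P y = x * y ≤ 1#

      P0 : P 0#
      P0 = ≤-trans (≈⇒≤ (solve 1 (λ x → x :* con (+ 0) := con (+ 0)) ≈-refl x)) (<⇒≤ 0<1)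

      bound : ∃[ b ] (∀ y → P y → y ≤ b)
      bound = let N , h = ½ⁿ-small 1# x>0 in nat (2 ℕ.^ N) , λ y py → ≮⇒≤ λ b<y → ≤⇒≮ py (begin-strict
        1#                     ≈⟨ ≈-sym (½ⁿ*2^n N) ⟩
        ½ⁿ N * nat (2 ℕ.^ N)   ≤⟨ *-monoʳ-≤ (0≤nat (2 ℕ.^ N)) (<⇒≤ (<-respˡ-≈ (*-identityʳ (½ⁿ N)) h)) ⟩
        x * nat (2 ℕ.^ N)      <⟨ *-monoˡ-< x>0 b<y ⟩
        x * y                  ∎)
        where open ≤-Reasoning

      module _ {s} (sup : IsLub P s) where

        s>0 : 0# < s
        s>0 = let N , h = ½ⁿ-small x 0<1 in
          <-≤-trans (0<½ⁿ N) (proj₁ sup (½ⁿ N) (≤-respˡ-≈ (*-comm (½ⁿ N) x) (<⇒≤ h)))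

        xs≮1 : ¬ x * s < 1#
        xs≮1 h =
          let N , k = ½ⁿ-small x (<⇒0<- h)
          in ≤⇒≮ (proj₁ sup (s + ½ⁿ N) (≤-by (<⇒≤ (<⇒0<- k))
               (solve 3 (λ x s t → con (+ 1) :- x :* (s :+ t) := (con (+ 1) :- x :* s) :- t :* x) ≈-refl x s (½ⁿ N))))
             (<-by (0<½ⁿ N) (solve 2 (λ s t → (s :+ t) :- s := t) ≈-refl s (½ⁿ N)))

        1≮xs : ¬ 1# < x * s
        1≮xs h =
          let N , k = ½ⁿ-small x (<⇒0<- h)
              y , py , s-t<y = lub-witness {P} sup (<-by (0<½ⁿ N) (solve 2 (λ s t → s :- (s :- t) := t) ≈-refl s (½ⁿ N)))
          in ≤⇒≮ py (<-trans (<-by (<⇒0<- k)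
               (solve 3 (λ x s t → x :* (s :- t) :- con (+ 1) := (x :* s :- con (+ 1)) :- t :* x) ≈-refl x s (½ⁿ N)))
             (*-monoˡ-< x>0 s-t<y))

        xs≈1 : x * s ≈ 1#
        xs≈1 = ≤-antisym (≮⇒≤ 1≮xs) (≮⇒≤ xs≮1)

    opaque
      -- The reciprocal is the supremum of the y with x y ≤ 1. If x s differed from 1, moving s by a
      -- small power of one half would contradict that s is an upper bound, or that it is the least
      -- one.
      inverse : ∃[ y ] (0# < y × x * y ≈ 1#)
      inverse = let s , sup = lub P P0 (proj₂ bound) in s , s>0 sup , xs≈1 sup

-- Finite sums, convergence, and partial sums of the exponential series

module Series (em : ExcludedMiddle 0ℓ) where

  open RealCompleteness em public
  open ℕₚ using (_!≢0)

  Σ< : ℕ → (ℕ → ℝ) → ℝ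
  Σ< zero    f = 0#
  Σ< (suc n) f = Σ< n f + f n

  Σ<-cong : ∀ n {f g} → (∀ i → i ℕ.< n → f i ≈ g i) → Σ< n f ≈ Σ< n g
  Σ<-cong zero    h = ≈-refl
  Σ<-cong (suc n) h = +-cong (Σ<-cong n λ i i<n → h i (ℕₚ.m<n⇒m<1+n i<n)) (h n ℕₚ.≤-refl)

  Σ<-mono : ∀ n {f g} → (∀ i → i ℕ.< n → f i ≤ g i) → Σ< n f ≤ Σ< n g
  Σ<-mono zero    h = ≤-refl
  Σ<-mono (suc n) h = +-mono-≤ (Σ<-mono n λ i i<n → h i (ℕₚ.m<n⇒m<1+n i<n)) (h n ℕₚ.≤-refl)

  Σ<-nonneg : ∀ n {f} → (∀ i → i ℕ.< n → 0# ≤ f i) → 0# ≤ Σ< n f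
  Σ<-nonneg zero    h = ≤-refl
  Σ<-nonneg (suc n) h = +-nonneg (Σ<-nonneg n λ i i<n → h i (ℕₚ.m<n⇒m<1+n i<n)) (h n ℕₚ.≤-refl)

  Σ<-+ : ∀ n f g → Σ< n (λ i → f i + g i) ≈ Σ< n f + Σ< n g
  Σ<-+ zero    f g = ≈-sym (+-identityˡ 0#)
  Σ<-+ (suc n) f g = ≈-trans (+-cong (Σ<-+ n f g) ≈-refl)
    (solve 4 (λ a b c d → (a :+ b) :+ (c :+ d) := (a :+ c) :+ (b :+ d)) ≈-refl (Σ< n f) (Σ< n g) (f n) (g n))

  Σ<-*ˡ : ∀ n c f → Σ< n (λ i → c * f i) ≈ c * Σ< n f
  Σ<-*ˡ zero    c f = solve 1 (λ c → con (+ 0) := c :* con (+ 0)) ≈-refl c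
  Σ<-*ˡ (suc n) c f = ≈-trans (+-cong (Σ<-*ˡ n c f) ≈-refl) (≈-sym (*-distribˡ-+ c (Σ< n f) (f n)))

  Σ<-shift : ∀ n f → Σ< (suc n) f ≈ f 0 + Σ< n (λ i → f (suc i))
  Σ<-shift zero    f = +-comm 0# (f 0)
  Σ<-shift (suc n) f = ≈-trans (+-cong (Σ<-shift n f) ≈-refl) (+-assoc (f 0) (Σ< n (λ i → f (suc i))) (f (suc n)))

  Σ<-mono-n : ∀ {m n f} → (∀ i → 0# ≤ f i) → m ℕ.≤ n → Σ< m f ≤ Σ< n f
  Σ<-mono-n {m} {f = f} h m≤n = go (ℕₚ.≤⇒≤′ m≤n)
    where
    go : ∀ {n} → m ℕ.≤′ n → Σ< m f ≤ Σ< n f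
    go (ℕ.≤′-reflexive refl) = ≤-refl
    go (ℕ.≤′-step {n} p) = ≤-trans (go p) (≤-by (h n) (solve 2 (λ a b → (a :+ b) :- a := b) ≈-refl (Σ< n f) (f n)))

  Converges : (ℕ → ℝ) → ℝ → Set
  Converges s l = ∀ ε → 0# < ε → Eventually (λ n → s n < l + ε × l < s n + ε)

  Converges-unique : ∀ {s k l} → Converges s k → Converges s l → k ≈ l
  Converges-unique {s} {k} {l} p q = ≤-antisym (bound p q) (bound q p)
    where
    bound : ∀ {k l} → Converges s k → Converges s l → k ≤ l
    bound {k} {l} p q = ≮⇒≤ λ l<k →
      let ε>0 = half (<⇒0<- l<k)
          N , h = both (p _ ε>0) (q _ ε>0)
          (_ , a) , (b , _) = h N ℕₚ.≤-refl
      in <-irrefl (<-trans a (<-≤-trans (+-mono-<-≤ b ≤-refl)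
           (≈⇒≤ (≈-trans (+-assoc l (½ℝ * (k - l)) (½ℝ * (k - l))) (≈-trans (+-cong ≈-refl (½-+ (k - l)))
             (solve 2 (λ k l → l :+ (k :- l) := k) ≈-refl k l))))))

  Converges-cong : ∀ {s t l} → (∀ n → s n ≈ t n) → Converges s l → Converges t l
  Converges-cong e p ε ε>0 = eventually-map (λ n (a , b) →
    <-respˡ-≈ (e n) a , <-respʳ-≈ (+-cong (e n) ≈-refl) b) (p ε ε>0)

  IsSupSeq : (ℕ → ℝ) → ℝ → Set
  IsSupSeq f s = (∀ n → f n ≤ s) × (∀ u → (∀ n → f n ≤ u) → s ≤ u)

  IsSupSeq-witness : ∀ {f s u} → IsSupSeq f s → u < s → ∃[ n ] (u < f n)
  IsSupSeq-witness (_ , least) u<s = by-contradiction λ h →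
    ≤⇒≮ (least _ λ n → ≮⇒≤ λ u<f → h (n , u<f)) u<s

  x<x+ε : ∀ {x ε} → 0# < ε → x < x + ε
  x<x+ε {x} {ε} h = <-by h (solve 2 (λ x e → (x :+ e) :- x := e) ≈-refl x ε)

  x-ε<x : ∀ {x ε} → 0# < ε → x - ε < x
  x-ε<x {x} {ε} h = <-by h (solve 2 (λ x e → x :- (x :- e) := e) ≈-refl x ε)

  Monotone : (ℕ → ℝ) → Set
  Monotone f = ∀ {m n} → m ℕ.≤ n → f m ≤ f n

  sup⇒Converges : ∀ {f s} → Monotone f → IsSupSeq f s → Converges f s
  sup⇒Converges {f} {s} mono p ε ε>0 =
    let N , h = IsSupSeq-witness p (x-ε<x ε>0)
    in N , λ n N≤n → ≤-<-trans (proj₁ p n) (x<x+ε ε>0) ,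
         <-by (<⇒0<- (<-≤-trans h (mono N≤n))) (solve 3 (λ f s e → (f :+ e) :- s := f :- (s :- e)) ≈-refl (f n) s ε)

  Converges⇒sup : ∀ {f s} → Monotone f → Converges f s → IsSupSeq f s
  Converges⇒sup {f} {s} mono p =
    (λ n → ≮⇒≤ λ s<f → let N , h = p (f n - s) (<⇒0<- s<f) in
      ≤⇒≮ (mono (ℕₚ.m≤m⊔n n N)) (<-respʳ-≈ (solve 2 (λ f s → s :+ (f :- s) := f) ≈-refl (f n) s)
        (proj₁ (h (n ℕ.⊔ N) (ℕₚ.m≤n⊔m n N))))) ,
    (λ u k → ≮⇒≤ λ u<s → let N , h = p (s - u) (<⇒0<- u<s) in
      ≤⇒≮ (k N) (<-by (<⇒0<- (proj₂ (h N ℕₚ.≤-refl)))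
        (solve 3 (λ f s u → f :- u := (f :+ (s :- u)) :- s) ≈-refl (f N) s u)))

  opaque
    supSeq : ∀ {f : ℕ → ℝ} {b} → (∀ n → f n ≤ b) → Σ[ s ∈ ℝ ] IsSupSeq f s
    supSeq {f} {b} h =
      let s , up , least = lub (λ x → ∃[ n ] x ≈ f n) (0 , ≈-refl) (λ x (n , e) → ≤-respˡ-≈ (≈-sym e) (h n))
      in s , (λ n → up (f n) (n , ≈-refl)) , λ u k → least u λ x (n , e) → ≤-respˡ-≈ (≈-sym e) (k n)

  sup-scale : ∀ {f s c u} → 0# < c → IsSupSeq f s → (∀ n → c * f n ≤ u) → c * s ≤ u
  sup-scale {f} {s} {c} {u} c>0 (_ , least) h =
    let d , d>0 , cd = inverse c>0
        e : ∀ x → d * (c * x) ≈ x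
        e x = ≈-trans (solve 3 (λ c d x → d :* (c :* x) := (c :* d) :* x) ≈-refl c d x) (≈-trans (*-cong cd ≈-refl) (*-identityˡ x))
    in *-cancelˡ-≤ d>0 (≤-respˡ-≈ (≈-sym (e s)) (least (d * u) λ n → ≤-respˡ-≈ (e (f n)) (*-monoˡ-≤ (<⇒≤ d>0) (h n))))

  opaque
    unfolding _≈_

    partialSum≡Σ< : ∀ f n → partialSum f n ≡ Σ< n f
    partialSum≡Σ< f zero    = refl
    partialSum≡Σ< f (suc n) = cong (D._+ f n) (partialSum≡Σ< f n)

    HasSum⇒Converges : ∀ {f s} → HasSum f s → Converges (λ n → Σ< n f) s
    HasSum⇒Converges {f} {s} h ε ε>0 = eventually-map
      (λ n → subst (λ t → (t D.< s D.+ ε) × (s D.< t D.+ ε)) (partialSum≡Σ< f n)) (h ε ε>0)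

    Converges⇒HasSum : ∀ {f s} → Converges (λ n → Σ< n f) s → HasSum f s
    Converges⇒HasSum {f} {s} h ε ε>0 = eventually-map
      (λ n → subst (λ t → (t D.< s D.+ ε) × (s D.< t D.+ ε)) (sym (partialSum≡Σ< f n))) (h ε ε>0)

  infixr 9 _^_

  _^_ : ℝ → ℕ → ℝ
  x ^ zero  = 1#
  x ^ suc n = x * x ^ n

  opaque
    1/ : ℕ → ℝ
    1/ k = ⌊ ℚ._/_ 1ℤ (k !) {{k !≢0}} ⌋

    1/-inverse : ∀ k → 1/ k * nat (k !) ≈ 1#
    1/-inverse k = ≈-trans (≈-sym (⌊⌋-* (ℚ._/_ 1ℤ (k !) {{k !≢0}}) (fromℤ (+ (k !))))) (≡⇒≈ (cong ⌊_⌋ (inv (k !) {{k !≢0}})))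
      where
      inv : ∀ d .{{_ : ℕ.NonZero d}} → (1ℤ ℚ./ d) ℚ.* fromℤ (+ d) ≡ 1ℚ
      inv (suc n) = trans (cong (ℚ._* fromℤ (+ suc n)) (ℚₚ.↥p/↧p≡p (ℚ.1/ fromℤ (+ suc n)))) (ℚₚ.*-inverseˡ (fromℤ (+ suc n)))

    0≤1/ : ∀ k → 0# ≤ 1/ k
    0≤1/ k = ≮⇒≤ λ h → ≤⇒≮ (≤-respʳ-≈ (solve 1 (λ n → con (+ 0) :* n := con (+ 0)) ≈-refl (nat (k !)))
      (*-monoʳ-≤ (0≤nat (k !)) (<⇒≤ h))) (<-respʳ-≈ (≈-sym (1/-inverse k)) 0<1)

  term : ℕ → ℝ → ℝ
  term k x = 1/ k * x ^ k

  0<k! : ∀ k → 0# < nat (k !)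
  0<k! k = nat-mono-< {0} (ℕₚ.n≢0⇒n>0 λ e → ℕ.≢-nonZero⁻¹ (k !) {{k !≢0}} e)

  k!*term : ∀ k x → nat (k !) * term k x ≈ x ^ k
  k!*term k x = ≈-trans (solve 3 (λ n i p → n :* (i :* p) := (i :* n) :* p) ≈-refl (nat (k !)) (1/ k) (x ^ k))
    (≈-trans (*-cong (1/-inverse k) ≈-refl) (*-identityˡ (x ^ k)))

  *-cancelˡ : ∀ {x y z} → 0# < z → z * x ≈ z * y → x ≈ y
  *-cancelˡ h e = ≤-antisym (*-cancelˡ-≤ h (≈⇒≤ e)) (*-cancelˡ-≤ h (≈⇒≤ (≈-sym e)))

  term-suc : ∀ k x → nat (suc k) * term (suc k) x ≈ x * term k x
  term-suc k x = *-cancelˡ (0<k! k) (begin-equality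
    nat (k !) * (nat (suc k) * term (suc k) x) ≈⟨ solve 3 (λ a b t → a :* (b :* t) := (b :* a) :* t) ≈-refl (nat (k !)) (nat (suc k)) (term (suc k) x) ⟩
    nat (suc k) * nat (k !) * term (suc k) x   ≈⟨ *-cong (≈-sym (nat-* (suc k) (k !))) ≈-refl ⟩
    nat (suc k !) * term (suc k) x             ≈⟨ k!*term (suc k) x ⟩
    x * x ^ k                                  ≈⟨ *-cong ≈-refl (≈-sym (k!*term k x)) ⟩
    x * (nat (k !) * term k x)                 ≈⟨ solve 3 (λ x n t → x :* (n :* t) := n :* (x :* t)) ≈-refl x (nat (k !)) (term k x) ⟩
    nat (k !) * (x * term k x)                 ∎)
    where open ≤-Reasoning

  term-zero : ∀ x → term 0 x ≈ 1#
  term-zero x = ≈-trans (≈-sym (*-identityˡ (term 0 x))) (k!*term 0 x)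

  ^-cong : ∀ k {x y} → x ≈ y → x ^ k ≈ y ^ k
  ^-cong zero    e = ≈-refl
  ^-cong (suc k) e = *-cong e (^-cong k e)

  term-cong : ∀ k {x y} → x ≈ y → term k x ≈ term k y
  term-cong k e = *-cong ≈-refl (^-cong k e)

  0≤^ : ∀ k {x} → 0# ≤ x → 0# ≤ x ^ k
  0≤^ zero    h = <⇒≤ 0<1
  0≤^ (suc k) h = *-nonneg h (0≤^ k h)

  0≤term : ∀ k {x} → 0# ≤ x → 0# ≤ term k x
  0≤term k h = *-nonneg (0≤1/ k) (0≤^ k h)

  term-suc-≤ : ∀ k {x} → 0# ≤ x → term (suc k) x ≤ x * term k x
  term-suc-≤ k {x} h = ≤-trans (≤-by (*-nonneg (0≤nat k) (0≤term (suc k) h)) (≈-trans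
    (+-cong (*-cong (nat-suc k) ≈-refl) ≈-refl)
    (solve 2 (λ n t → (con (+ 1) :+ n) :* t :- t := n :* t) ≈-refl (nat k) (term (suc k) x)))) (≈⇒≤ (term-suc k x))

  neg-^ : ∀ k x → (- x) ^ k ≈ x ^ k ⊎ (- x) ^ k ≈ - (x ^ k)
  neg-^ zero    x = inj₁ ≈-refl
  neg-^ (suc k) x with neg-^ k x
  ... | inj₁ e = inj₂ (≈-trans (*-cong ≈-refl e) (solve 2 (λ x p → :- x :* p := :- (x :* p)) ≈-refl x (x ^ k)))
  ... | inj₂ e = inj₁ (≈-trans (*-cong ≈-refl e) (solve 2 (λ x p → :- x :* :- p := x :* p) ≈-refl x (x ^ k)))

  -x≤x : ∀ {x} → 0# ≤ x → - x ≤ x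
  -x≤x {x} h = ≤-by (+-nonneg h h) (solve 1 (λ x → x :- :- x := x :+ x) ≈-refl x)

  neg-term : ∀ k {x} → 0# ≤ x → term k (- x) ≤ term k x × - term k x ≤ term k (- x)
  neg-term k {x} h with neg-^ k x
  ... | inj₁ e = ≈⇒≤ (*-cong ≈-refl e) , ≤-respʳ-≈ (*-cong ≈-refl (≈-sym e)) (-x≤x (0≤term k h))
  ... | inj₂ e = ≤-respˡ-≈ (≈-sym f) (-x≤x (0≤term k h)) , ≈⇒≤ (≈-sym f)
    where f = ≈-trans (*-cong ≈-refl e) (solve 2 (λ a b → a :* :- b := :- (a :* b)) ≈-refl (1/ k) (x ^ k))

  -- the binomial theorem, in the form Σᵢ xⁱ/i! · yⁿ⁻ⁱ/(n-i)! = (x+y)ⁿ/n!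

  module _ (x y : ℝ) where

    convolution : ℕ → ℝ
    convolution n = Σ< (suc n) (λ i → term i x * term (n ℕ.∸ i) y)

    -- The factor n + 1 splits as i + (n + 1 - i). By `term-suc` the first part takes a factor x out
    -- of the first term and the second part a factor y out of the second; the two boundary summands
    -- vanish.
    convolution-suc : ∀ n → nat (suc n) * convolution (suc n) ≈ (x + y) * convolution n
    convolution-suc n = begin-equality
      nat (suc n) * convolution (suc n)
        ≈⟨ ≈-sym (Σ<-*ˡ (suc (suc n)) (nat (suc n)) (λ i → term i x * term (suc n ℕ.∸ i) y)) ⟩
      Σ< (suc (suc n)) (λ i → nat (suc n) * (term i x * term (suc n ℕ.∸ i) y))
        ≈⟨ Σ<-cong (suc (suc n)) (λ i i≤ → split i (ℕ.s≤s⁻¹ i≤)) ⟩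
      Σ< (suc (suc n)) (λ i → F i + G i)
        ≈⟨ Σ<-+ (suc (suc n)) F G ⟩
      Σ< (suc (suc n)) F + Σ< (suc (suc n)) G
        ≈⟨ +-cong (Σ<-shift (suc n) F) ≈-refl ⟩
      (F 0 + Σ< (suc n) (λ i → F (suc i))) + (Σ< (suc n) G + G (suc n))
        ≈⟨ +-cong (+-cong F0 (Σ<-cong (suc n) λ i _ → Fs i)) (+-cong (Σ<-cong (suc n) λ i i≤ → Gi i (ℕ.s≤s⁻¹ i≤)) Gn) ⟩
      (0# + Σ< (suc n) (λ i → x * C i)) + (Σ< (suc n) (λ i → y * C i) + 0#)
        ≈⟨ +-cong (+-cong ≈-refl (Σ<-*ˡ (suc n) x C)) (+-cong (Σ<-*ˡ (suc n) y C) ≈-refl) ⟩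
      (0# + x * convolution n) + (y * convolution n + 0#)
        ≈⟨ solve 3 (λ x y c → (con (+ 0) :+ x :* c) :+ (y :* c :+ con (+ 0)) := (x :+ y) :* c) ≈-refl x y (convolution n) ⟩
      (x + y) * convolution n ∎
      where
      open ≤-Reasoning
      C F G : ℕ → ℝ
      C i = term i x * term (n ℕ.∸ i) y
      F i = nat i * term i x * term (suc n ℕ.∸ i) y
      G i = term i x * (nat (suc n ℕ.∸ i) * term (suc n ℕ.∸ i) y)
      split : ∀ i → i ℕ.≤ suc n → nat (suc n) * (term i x * term (suc n ℕ.∸ i) y) ≈ F i + G i
      split i i≤ = ≈-trans (*-cong (≈-trans (≡⇒≈ (cong nat (sym (ℕₚ.m+[n∸m]≡n i≤)))) (nat-+ i (suc n ℕ.∸ i))) ≈-refl)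
        (solve 4 (λ a b t u → (a :+ b) :* (t :* u) := a :* t :* u :+ t :* (b :* u)) ≈-refl
          (nat i) (nat (suc n ℕ.∸ i)) (term i x) (term (suc n ℕ.∸ i) y))
      F0 : F 0 ≈ 0#
      F0 = solve 2 (λ t u → con (+ 0) :* t :* u := con (+ 0)) ≈-refl (term 0 x) (term (suc n) y)
      Fs : ∀ i → F (suc i) ≈ x * C i
      Fs i = ≈-trans (*-cong (term-suc i x) ≈-refl) (*-assoc x (term i x) (term (n ℕ.∸ i) y))
      Gn : G (suc n) ≈ 0#
      Gn = ≈-trans (*-cong ≈-refl (*-cong (≡⇒≈ (cong nat (ℕₚ.n∸n≡0 (suc n)))) ≈-refl))
        (solve 2 (λ t u → t :* (con (+ 0) :* u) := con (+ 0)) ≈-refl (term (suc n) x) (term (suc n ℕ.∸ suc n) y))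
      Gi : ∀ i → i ℕ.≤ n → G i ≈ y * C i
      Gi i i≤n = ≈-trans (*-cong ≈-refl (≈-trans (≡⇒≈ (cong (λ m → nat m * term m y) (ℕₚ.+-∸-assoc 1 i≤n)))
        (term-suc (n ℕ.∸ i) y)))
        (solve 3 (λ t y u → t :* (y :* u) := y :* (t :* u)) ≈-refl (term i x) y (term (n ℕ.∸ i) y))

    convolution≈term : ∀ n → convolution n ≈ term n (x + y)
    convolution≈term zero    = ≈-trans (+-identityˡ (term 0 x * term 0 y)) (≈-trans (*-cong (term-zero x) (term-zero y))
      (≈-trans (*-identityˡ 1#) (≈-sym (term-zero (x + y)))))
    convolution≈term (suc n) = *-cancelˡ (0<nat-suc n) (≈-trans (convolution-suc n)
      (≈-trans (*-cong ≈-refl (convolution≈term n)) (≈-sym (term-suc n (x + y)))))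

  E : ℕ → ℝ → ℝ
  E n x = Σ< n (λ k → term k x)

  E-cong : ∀ n {x y} → x ≈ y → E n x ≈ E n y
  E-cong n e = Σ<-cong n λ k _ → term-cong k e

  E-mono : ∀ {x} → 0# ≤ x → Monotone (λ n → E n x)
  E-mono h = Σ<-mono-n λ i → 0≤term i h

  0≤E : ∀ n {x} → 0# ≤ x → 0# ≤ E n x
  0≤E n h = Σ<-nonneg n λ i _ → 0≤term i h

  -- Both sides add the products of terms of degrees i and j over the triangle i + j < n. The step
  -- to n + 1 adds one diagonal, which is a `convolution`.
  E-+ : ∀ n x y → E n (x + y) ≈ Σ< n (λ i → term i x * E (n ℕ.∸ i) y)
  E-+ zero    x y = ≈-refl
  E-+ (suc n) x y = begin-equality
    E n (x + y) + term n (x + y)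
      ≈⟨ +-cong (E-+ n x y) (≈-sym (convolution≈term x y n)) ⟩
    Σ< n (λ i → term i x * E (n ℕ.∸ i) y) + (Σ< n C + C n)
      ≈⟨ solve 3 (λ a b c → a :+ (b :+ c) := (a :+ b) :+ c) ≈-refl _ (Σ< n C) (C n) ⟩
    Σ< n (λ i → term i x * E (n ℕ.∸ i) y) + Σ< n C + C n
      ≈⟨ +-cong (≈-sym (Σ<-+ n _ C)) ≈-refl ⟩
    Σ< n (λ i → term i x * E (n ℕ.∸ i) y + C i) + C n
      ≈⟨ +-cong (Σ<-cong n λ i i<n → ≈-trans (≈-sym (*-distribˡ-+ (term i x) (E (n ℕ.∸ i) y) (term (n ℕ.∸ i) y)))
           (≡⇒≈ (cong (λ m → term i x * E m y) (sym (ℕₚ.+-∸-assoc 1 (ℕₚ.<⇒≤ i<n)))))) last ⟩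
    Σ< n (λ i → term i x * E (suc n ℕ.∸ i) y) + term n x * E (suc n ℕ.∸ n) y ∎
    where
    open ≤-Reasoning
    C : ℕ → ℝ
    C i = term i x * term (n ℕ.∸ i) y
    last : C n ≈ term n x * E (suc n ℕ.∸ n) y
    last = *-cong ≈-refl (≈-trans (≡⇒≈ (cong (λ m → term m y) (ℕₚ.n∸n≡0 n)))
      (≈-trans (≈-sym (+-identityˡ (term 0 y))) (≡⇒≈ (cong (λ m → E m y) (sym (ℕₚ.m+n∸n≡m 1 n))))))

-- The exponential function and logarithms

module Exponential (em : ExcludedMiddle 0ℓ) where

  open Series em public
  open ℕₚ using (_!≢0)

  -- The triangle i + j < n lies in the square i, j < n, and all terms are nonnegative.
  E-+-≤ : ∀ n {x y} → 0# ≤ x → 0# ≤ y → E n (x + y) ≤ E n x * E n y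
  E-+-≤ n {x} {y} 0≤x 0≤y = begin
    E n (x + y)                            ≈⟨ E-+ n x y ⟩
    Σ< n (λ i → term i x * E (n ℕ.∸ i) y)  ≤⟨ Σ<-mono n (λ i _ → *-monoˡ-≤ (0≤term i 0≤x) (E-mono 0≤y (ℕₚ.m∸n≤m n i))) ⟩
    Σ< n (λ i → term i x * E n y)          ≈⟨ Σ<-cong n (λ i _ → *-comm (term i x) (E n y)) ⟩
    Σ< n (λ i → E n y * term i x)          ≈⟨ Σ<-*ˡ n (E n y) (λ i → term i x) ⟩
    E n y * E n x                          ≈⟨ *-comm (E n y) (E n x) ⟩
    E n x * E n y                          ∎
    where open ≤-Reasoning

  -- The square i, j < n lies in the triangle i + j < 2n.
  E-*-≤ : ∀ n {x y} → 0# ≤ x → 0# ≤ y → E n x * E n y ≤ E (n ℕ.+ n) (x + y)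
  E-*-≤ n {x} {y} 0≤x 0≤y = begin
    E n x * E n y                                          ≈⟨ *-comm (E n x) (E n y) ⟩
    E n y * E n x                                          ≈⟨ ≈-sym (Σ<-*ˡ n (E n y) (λ i → term i x)) ⟩
    Σ< n (λ i → E n y * term i x)                          ≈⟨ Σ<-cong n (λ i _ → *-comm (E n y) (term i x)) ⟩
    Σ< n (λ i → term i x * E n y)                          ≤⟨ Σ<-mono n (λ i i<n → *-monoˡ-≤ (0≤term i 0≤x)
                                                                (E-mono 0≤y (subst (ℕ._≤ n ℕ.+ n ℕ.∸ i) (ℕₚ.m+n∸n≡m n n) (ℕₚ.∸-monoʳ-≤ (n ℕ.+ n) (ℕₚ.<⇒≤ i<n))))) ⟩
    Σ< n (λ i → term i x * E (n ℕ.+ n ℕ.∸ i) y)            ≤⟨ Σ<-mono-n (λ i → *-nonneg (0≤term i 0≤x) (0≤E (n ℕ.+ n ℕ.∸ i) 0≤y)) (ℕₚ.m≤m+n n n) ⟩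
    Σ< (n ℕ.+ n) (λ i → term i x * E (n ℕ.+ n ℕ.∸ i) y)    ≈⟨ ≈-sym (E-+ (n ℕ.+ n) x y) ⟩
    E (n ℕ.+ n) (x + y)                                    ∎
    where open ≤-Reasoning

  1≤E : ∀ n {x} → 0# ≤ x → 1# ≤ E (suc n) x
  1≤E n {x} h = ≤-trans (≈⇒≤ (≈-sym (≈-trans (+-identityˡ (term 0 x)) (term-zero x)))) (E-mono h (ℕ.s≤s ℕ.z≤n))

  E-suc-≤ : ∀ n {x} → 0# ≤ x → E (suc n) x ≤ 1# + x * E n x
  E-suc-≤ n {x} h = begin
    E (suc n) x                              ≈⟨ Σ<-shift n (λ k → term k x) ⟩
    term 0 x + Σ< n (λ k → term (suc k) x)   ≤⟨ +-mono-≤ (≈⇒≤ (term-zero x)) (Σ<-mono n λ k _ → term-suc-≤ k h) ⟩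
    1# + Σ< n (λ k → x * term k x)           ≈⟨ +-cong ≈-refl (Σ<-*ˡ n x (λ k → term k x)) ⟩
    1# + x * E n x                           ∎
    where open ≤-Reasoning

  private
    2# : ℝ
    2# = 1# + 1#

    0≤2 : 0# ≤ 2#
    0≤2 = +-nonneg (<⇒≤ 0<1) (<⇒≤ 0<1)

    -- The bound 2 reproduces itself under `E-suc-≤`, as 1 + ½ · 2 = 2.
    E≤2 : ∀ n {x} → 0# ≤ x → x ≤ ½ℝ → E n x ≤ 2#
    E≤2 zero    h k = 0≤2
    E≤2 (suc n) {x} h k = begin
      E (suc n) x       ≤⟨ E-suc-≤ n h ⟩
      1# + x * E n x    ≤⟨ +-mono-≤ ≤-refl (*-mono-≤ h (0≤E n h) k (E≤2 n h k)) ⟩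
      1# + ½ℝ * 2#      ≈⟨ +-cong ≈-refl (≈-trans (solve 1 (λ h → h :* (con (+ 1) :+ con (+ 1)) := h :* con (+ 1) :+ h :* con (+ 1)) ≈-refl ½ℝ) (½-+ 1#)) ⟩
      1# + 1#           ∎
      where open ≤-Reasoning

  -- N counts the halvings that bring x down to ½; undoing one of them squares the bound.
  E-bounded : ∀ N x → 0# ≤ x → ½ⁿ N * x ≤ ½ℝ → ∃[ b ] (∀ n → E n x ≤ b)
  E-bounded zero    x h k = 2# , λ n → E≤2 n h (≤-respˡ-≈ (≈-trans (*-cong ½ⁿ-zero ≈-refl) (*-identityˡ x)) k)
  E-bounded (suc N) x h k =
    let 0≤½x = *-nonneg (<⇒≤ 0<½) h
        b , p = E-bounded N (½ℝ * x) 0≤½x (≤-respˡ-≈ (≈-trans (*-cong (½ⁿ-suc N) ≈-refl)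
          (solve 3 (λ h t x → h :* t :* x := t :* (h :* x)) ≈-refl ½ℝ (½ⁿ N) x)) k)
    in b * b , λ n → ≤-respˡ-≈ (E-cong n (½-+ x)) (≤-trans (E-+-≤ n 0≤½x 0≤½x) (*-mono-≤ (0≤E n 0≤½x) (0≤E n 0≤½x) (p n) (p n)))

  opaque
    E-sup : ∀ x → 0# ≤ x → Σ[ s ∈ ℝ ] IsSupSeq (λ n → E n x) s
    E-sup x h = let N , k = ½ⁿ-small x 0<½
                    b , p = E-bounded N x h (<⇒≤ k)
                in supSeq {λ n → E n x} {b} p

  -- exp x is the exponential of x only for x ≥ 0.
  opaque
    exp-by : ∀ x → Dec (0# ≤ x) → ℝ
    exp-by x (yes h) = proj₁ (E-sup x h)
    exp-by x (no  _) = 0#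

    exp : ℝ → ℝ
    exp x = exp-by x em

    exp-sup : ∀ {x} → 0# ≤ x → IsSupSeq (λ n → E n x) (exp x)
    exp-sup {x} h = go em
      where
      go : (d : Dec (0# ≤ x)) → IsSupSeq (λ n → E n x) (exp-by x d)
      go (yes k) = proj₂ (E-sup x k)
      go (no ¬k) = ⊥-elim (¬k h)

  1+x≤exp : ∀ {x} → 0# ≤ x → 1# + x ≤ exp x
  1+x≤exp {x} h = ≤-trans (≈⇒≤ (≈-sym (+-cong (≈-trans (+-identityˡ (term 0 x)) (term-zero x))
    (≈-trans (≈-trans (≈-sym (*-identityˡ (term 1 x))) (term-suc 0 x)) (≈-trans (*-cong ≈-refl (term-zero x)) (*-identityʳ x))))))
    (proj₁ (exp-sup h) 2)

  1≤exp : ∀ {x} → 0# ≤ x → 1# ≤ exp x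
  1≤exp {x} h = ≤-trans (≤-by h (solve 1 (λ x → (con (+ 1) :+ x) :- con (+ 1) := x) ≈-refl x)) (1+x≤exp h)

  0<exp : ∀ {x} → 0# ≤ x → 0# < exp x
  0<exp h = <-≤-trans 0<1 (1≤exp h)

  exp-cong : ∀ {x y} → 0# ≤ x → x ≈ y → exp x ≈ exp y
  exp-cong {x} {y} h e = ≤-antisym (bound h e) (bound k (≈-sym e))
    where
    k : 0# ≤ y
    k = ≤-respʳ-≈ e h
    bound : ∀ {x y} → 0# ≤ x → x ≈ y → exp x ≤ exp y
    bound {x} {y} h e = proj₂ (exp-sup h) (exp y) λ n → ≤-respˡ-≈ (E-cong n (≈-sym e)) (proj₁ (exp-sup (≤-respʳ-≈ e h)) n)

  exp-+ : ∀ {x y} → 0# ≤ x → 0# ≤ y → exp (x + y) ≈ exp x * exp y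
  exp-+ {x} {y} 0≤x 0≤y = ≤-antisym
    (proj₂ (exp-sup (+-nonneg 0≤x 0≤y)) (exp x * exp y) λ n → ≤-trans (E-+-≤ n 0≤x 0≤y)
      (*-mono-≤ (0≤E n 0≤x) (0≤E n 0≤y) (proj₁ (exp-sup 0≤x) n) (proj₁ (exp-sup 0≤y) n)))
    (sup-scale (0<exp 0≤x) (exp-sup 0≤y) λ n → ≤-respˡ-≈ (*-comm (E n y) (exp x)) (lower n))
    where
    product : ∀ m n → E n y * E m x ≤ exp (x + y)
    product m n = let k = m ℕ.⊔ n in
      ≤-trans (*-mono-≤ (0≤E n 0≤y) (0≤E m 0≤x) (E-mono 0≤y (ℕₚ.m≤n⊔m m n)) (E-mono 0≤x (ℕₚ.m≤m⊔n m n)))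
      (≤-trans (≈⇒≤ (*-comm (E k y) (E k x))) (≤-trans (E-*-≤ k 0≤x 0≤y) (proj₁ (exp-sup (+-nonneg 0≤x 0≤y)) (k ℕ.+ k))))
    lower : ∀ n → E n y * exp x ≤ exp (x + y)
    lower zero    = ≤-respˡ-≈ (solve 1 (λ e → con (+ 0) := con (+ 0) :* e) ≈-refl (exp x)) (<⇒≤ (0<exp (+-nonneg 0≤x 0≤y)))
    lower (suc n) = sup-scale (<-≤-trans 0<1 (1≤E n 0≤y)) (exp-sup 0≤x) λ m → product m (suc n)

  exp-mono-< : ∀ {x y} → 0# ≤ x → x < y → exp x < exp y
  exp-mono-< {x} {y} h x<y = <-respʳ-≈ (≈-trans (≈-sym (exp-+ h 0≤d)) (exp-cong (+-nonneg h 0≤d) (solve 2 (λ x y → x :+ (y :- x) := y) ≈-refl x y)))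
    (<-respˡ-≈ (*-identityʳ (exp x)) (*-monoˡ-< (0<exp h) (<-≤-trans (x<x+ε (<⇒0<- x<y)) (1+x≤exp 0≤d))))
    where
    0≤d : 0# ≤ y - x
    0≤d = <⇒≤ (<⇒0<- x<y)

  exp-mono-≤ : ∀ {x y} → 0# ≤ x → x ≤ y → exp x ≤ exp y
  exp-mono-≤ h k with ≤⇒<⊎≈ k
  ... | inj₁ p = <⇒≤ (exp-mono-< h p)
  ... | inj₂ p = ≈⇒≤ (exp-cong h p)

  exp-cancel-≤ : ∀ {x y} → 0# ≤ y → exp x ≤ exp y → x ≤ y
  exp-cancel-≤ h k = ≮⇒≤ λ y<x → ≤⇒≮ k (exp-mono-< h y<x)

  exp-zero : exp 0# ≈ 1#
  exp-zero = *-cancelˡ (0<exp ≤-refl) (≈-trans (≈-sym (exp-+ ≤-refl ≤-refl))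
    (≈-trans (exp-cong (+-nonneg ≤-refl ≤-refl) (+-identityˡ 0#)) (≈-sym (*-identityʳ (exp 0#)))))

  -- An explicit modulus of continuity at 0. Through `small-step` it gives the continuity that
  -- logarithms require.
  exp-small : ∀ {x} → 0# ≤ x → x ≤ 1# → exp x ≤ 1# + x * exp 1#
  exp-small {x} h k = proj₂ (exp-sup h) (1# + x * exp 1#) λ where
    zero    → ≤-trans (<⇒≤ 0<1) (≤-by (*-nonneg h (<⇒≤ (0<exp (<⇒≤ 0<1)))) (solve 1 (λ x → (con (+ 1) :+ x) :- con (+ 1) := x) ≈-refl (x * exp 1#)))
    (suc n) → ≤-trans (E-suc-≤ n h) (+-mono-≤ ≤-refl (*-monoˡ-≤ h (≤-trans (proj₁ (exp-sup h) n) (exp-mono-≤ h k))))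

  module _ {a : ℝ} (1≤a : 1# ≤ a) where

    private
      P : ℝ → Set
      P s = 0# ≤ s × exp s ≤ a

      0≤a : 0# ≤ a
      0≤a = ≤-trans (<⇒≤ 0<1) 1≤a

      P≤a : ∀ s → P s → s ≤ a
      P≤a s (h , k) = ≤-trans (≤-by (<⇒≤ 0<1) (solve 1 (λ s → (con (+ 1) :+ s) :- s := con (+ 1)) ≈-refl s)) (≤-trans (1+x≤exp h) k)

      P0 : P 0#
      P0 = ≤-refl , ≤-respˡ-≈ (≈-sym exp-zero) 1≤a

      C = exp 1#

      0≤C : 0# ≤ C
      0≤C = <⇒≤ (0<exp (<⇒≤ 0<1))

      small-step : ∀ b {ε} → 0# ≤ b → 0# < ε → ∃[ δ ] (0# < δ × δ ≤ 1# × (∀ d → 0# ≤ d → d ≤ δ → b * exp d < b + ε))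
      small-step b {ε} 0≤b ε>0 =
        let N , k = ½ⁿ-small (b * C) ε>0
        in ½ⁿ N , 0<½ⁿ N , ≤-respʳ-≈ ½ⁿ-zero (½ⁿ-anti-≤ ℕ.z≤n) , λ d 0≤d d≤δ → begin-strict
          b * exp d              ≤⟨ *-monoˡ-≤ 0≤b (exp-small 0≤d (≤-trans d≤δ (≤-respʳ-≈ ½ⁿ-zero (½ⁿ-anti-≤ ℕ.z≤n)))) ⟩
          b * (1# + d * C)       ≤⟨ *-monoˡ-≤ 0≤b (+-mono-≤ ≤-refl (*-monoʳ-≤ 0≤C d≤δ)) ⟩
          b * (1# + ½ⁿ N * C)    ≈⟨ solve 3 (λ b t c → b :* (con (+ 1) :+ t :* c) := b :+ t :* (b :* c)) ≈-refl b (½ⁿ N) C ⟩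
          b + ½ⁿ N * (b * C)     <⟨ +-mono-≤-< ≤-refl k ⟩
          b + ε                  ∎
        where open ≤-Reasoning

      module _ {s} (sup : IsLub P s) where

        0≤s : 0# ≤ s
        0≤s = proj₁ sup 0# P0

        exp≮a : ¬ exp s < a
        exp≮a h =
          let δ , δ>0 , _ , k = small-step (exp s) (<⇒≤ (0<exp 0≤s)) (<⇒0<- h)
              0≤s+δ = +-nonneg 0≤s (<⇒≤ δ>0)
          in ≤⇒≮ (proj₁ sup (s + δ) (0≤s+δ , ≤-trans (≈⇒≤ (exp-+ 0≤s (<⇒≤ δ>0)))
               (≤-trans (<⇒≤ (k δ (<⇒≤ δ>0) ≤-refl)) (≈⇒≤ (solve 2 (λ e a → e :+ (a :- e) := a) ≈-refl (exp s) a)))))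
             (x<x+ε δ>0)

        a≮exp : ¬ a < exp s
        a≮exp h =
          let δ , δ>0 , _ , k = small-step a 0≤a (<⇒0<- h)
              t , (0≤t , et≤a) , s-δ<t = lub-witness {P} sup (x-ε<x δ>0)
              0≤s-t = ≤⇒0≤- (proj₁ sup t (0≤t , et≤a))
              open ≤-Reasoning
          in <-irrefl (begin-strict
            exp s                ≈⟨ exp-cong 0≤s (solve 2 (λ s t → s := t :+ (s :- t)) ≈-refl s t) ⟩
            exp (t + (s - t))    ≈⟨ exp-+ 0≤t 0≤s-t ⟩
            exp t * exp (s - t)  ≤⟨ *-monoʳ-≤ (<⇒≤ (0<exp 0≤s-t)) et≤a ⟩
            a * exp (s - t)      <⟨ k (s - t) 0≤s-t (≤-by (<⇒≤ (<⇒0<- s-δ<t)) (solve 3 (λ s t d → d :- (s :- t) := t :- (s :- d)) ≈-refl s t δ)) ⟩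
            a + (exp s - a)      ≈⟨ solve 2 (λ e a → a :+ (e :- a) := e) ≈-refl (exp s) a ⟩
            exp s                ∎)

    opaque
      -- The supremum of the s with exp s ≤ a. By continuity, a strict inequality in either
      -- direction would survive a small change of s and contradict the supremum.
      log-exists : ∃[ s ] (0# ≤ s × exp s ≈ a)
      log-exists = let s , sup = lub P P0 P≤a in s , 0≤s sup , ≤-antisym (≮⇒≤ (a≮exp sup)) (≮⇒≤ (exp≮a sup))

  -- Negative arguments: E n s · E n (- s) differs from 1 by at most the same
  -- remainder as E n s · E n s does from E n (s + s).

  module _ {s : ℝ} (0≤s : 0# ≤ s) where

    private
      gap : ∀ {m n} → m ℕ.≤ n → E n (- s) - E m (- s) ≤ E n s - E m s × - (E n s - E m s) ≤ E n (- s) - E m (- s)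
      gap {m} m≤n = go (ℕₚ.≤⇒≤′ m≤n)
        where
        go : ∀ {n} → m ℕ.≤′ n → E n (- s) - E m (- s) ≤ E n s - E m s × - (E n s - E m s) ≤ E n (- s) - E m (- s)
        go (ℕ.≤′-reflexive refl) =
          ≈⇒≤ (≈-trans (+-inverseʳ (E m (- s))) (≈-sym (+-inverseʳ (E m s)))) ,
          ≈⇒≤ (≈-trans (-‿cong (+-inverseʳ (E m s))) (≈-trans (solve 0 (:- con (+ 0) := con (+ 0)) ≈-refl) (≈-sym (+-inverseʳ (E m (- s))))))
        go (ℕ.≤′-step {n} p) =
          ≤-trans (≈⇒≤ (swap (E n (- s)) (term n (- s)) (E m (- s)))) (≤-trans (+-mono-≤ (proj₁ (go p)) (proj₁ (neg-term n 0≤s)))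
            (≈⇒≤ (≈-sym (swap (E n s) (term n s) (E m s))))) ,
          ≤-trans (≈⇒≤ (≈-trans (-‿cong (swap (E n s) (term n s) (E m s)))
            (solve 2 (λ a b → :- (a :+ b) := :- a :+ :- b) ≈-refl (E n s - E m s) (term n s))))
            (≤-trans (+-mono-≤ (proj₂ (go p)) (proj₂ (neg-term n 0≤s))) (≈⇒≤ (≈-sym (swap (E n (- s)) (term n (- s)) (E m (- s))))))
          where
          swap : ∀ a b c → (a + b) - c ≈ (a - c) + b
          swap = solve 3 (λ a b c → (a :+ b) :- c := (a :- c) :+ b) ≈-refl

      remainder : ∀ n x → E n s * E n x ≈ E n (s + x) + Σ< n (λ i → term i s * (E n x - E (n ℕ.∸ i) x))
      remainder n x = begin-equality
        E n s * E n x ≈⟨ *-comm (E n s) (E n x) ⟩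
        E n x * E n s ≈⟨ ≈-sym (Σ<-*ˡ n (E n x) (λ i → term i s)) ⟩
        Σ< n (λ i → E n x * term i s)
          ≈⟨ Σ<-cong n (λ i _ → solve 3 (λ e t f → e :* t := t :* f :+ t :* (e :- f)) ≈-refl (E n x) (term i s) (E (n ℕ.∸ i) x)) ⟩
        Σ< n (λ i → term i s * E (n ℕ.∸ i) x + term i s * (E n x - E (n ℕ.∸ i) x)) ≈⟨ Σ<-+ n _ _ ⟩
        Σ< n (λ i → term i s * E (n ℕ.∸ i) x) + Σ< n (λ i → term i s * (E n x - E (n ℕ.∸ i) x)) ≈⟨ +-cong (≈-sym (E-+ n s x)) ≈-refl ⟩
        E n (s + x) + Σ< n (λ i → term i s * (E n x - E (n ℕ.∸ i) x)) ∎
        where open ≤-Reasoning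

      R : ℕ → ℝ → ℝ
      R n x = Σ< n (λ i → term i s * (E n x - E (n ℕ.∸ i) x))

      R-bound : ∀ n → R n (- s) ≤ R n s × - R n s ≤ R n (- s)
      R-bound n = Σ<-mono n (λ i _ → *-monoˡ-≤ (0≤term i 0≤s) (proj₁ (gap (ℕₚ.m∸n≤m n i)))) ,
        ≤-respˡ-≈ (≈-trans (Σ<-cong n λ i _ → solve 2 (λ t g → t :* :- g := :- con (+ 1) :* (t :* g)) ≈-refl (term i s) (E n s - E (n ℕ.∸ i) s))
          (≈-trans (Σ<-*ˡ n (- 1#) (λ i → term i s * (E n s - E (n ℕ.∸ i) s))) (solve 1 (λ r → :- con (+ 1) :* r := :- r) ≈-refl (R n s))))
          (Σ<-mono n (λ i _ → *-monoˡ-≤ (0≤term i 0≤s) (proj₂ (gap (ℕₚ.m∸n≤m n i)))))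

      ^-zero : ∀ k → 0# ^ suc k ≈ 0#
      ^-zero k = solve 1 (λ p → con (+ 0) :* p := con (+ 0)) ≈-refl (0# ^ k)

      E-0 : ∀ n → E (suc n) 0# ≈ 1#
      E-0 zero    = ≈-trans (+-identityˡ (term 0 0#)) (term-zero 0#)
      E-0 (suc n) = ≈-trans (+-cong (E-0 n) (≈-trans (*-cong ≈-refl (^-zero n)) (solve 1 (λ i → i :* con (+ 0) := con (+ 0)) ≈-refl (1/ (suc n)))))
        (+-identityʳ 1#)

      0≤2s = +-nonneg 0≤s 0≤s

      -- Since the square of `E n s` is at most exp (s + s), the remainder is at most a tail of the
      -- series at s + s and tends to 0.
      R-tail : ∀ n → R n s ≤ exp (s + s) - E n (s + s)
      R-tail n = ≤-by (≤⇒0≤- (≤-trans (E-*-≤ n 0≤s 0≤s) (proj₁ (exp-sup 0≤2s) (n ℕ.+ n))))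
        (≈-trans (solve 3 (λ x e r → (x :- e) :- r := x :- (e :+ r)) ≈-refl (exp (s + s)) (E n (s + s)) (R n s))
          (+-cong ≈-refl (-‿cong (≈-sym (remainder n s)))))

      product≈ : ∀ n → E (suc n) s * E (suc n) (- s) ≈ 1# + R (suc n) (- s)
      product≈ n = ≈-trans (remainder (suc n) (- s)) (+-cong (≈-trans (E-cong (suc n) (+-inverseʳ s)) (E-0 n)) ≈-refl)

    -- Multiplied by `E M s`, both a and `E M (- s)` come close to 1: the former because a is the
    -- reciprocal of exp s, the latter by `product≈` and `R-tail`. As `E M s` is at least 1,
    -- cancelling it does not enlarge the error.
    exp-neg : ∀ {a} → a * exp s ≈ 1# → Converges (λ n → E n (- s)) a
    exp-neg {a} e ε ε>0 =
      let N₁ , h₁ = IsSupSeq-witness (exp-sup 0≤2s) (x-ε<x (half ε>0))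
          N₂ , h₂ = IsSupSeq-witness (exp-sup 0≤s) (x-ε<x (*-pos (half ε>0) (0<exp 0≤s)))
      in suc (N₁ ℕ.⊔ N₂) , λ where
        (suc n) (ℕ.s≤s k) → bound n
          (<-≤-trans h₁ (E-mono 0≤2s (ℕₚ.m≤n⇒m≤1+n (ℕₚ.m⊔n≤o⇒m≤o N₁ N₂ k))))
          (<-≤-trans h₂ (E-mono 0≤s (ℕₚ.m≤n⇒m≤1+n (ℕₚ.m⊔n≤o⇒n≤o N₁ N₂ k))))
      where
      open ≤-Reasoning
      0<a : 0# < a
      0<a = *-cancelˡ-< (<⇒≤ (0<exp 0≤s)) (<-respˡ-≈ (solve 1 (λ x → con (+ 0) := x :* con (+ 0)) ≈-refl (exp s))
        (<-respʳ-≈ (≈-trans (≈-sym e) (*-comm a (exp s))) 0<1))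
      module _ (n : ℕ) (h₁ : exp (s + s) - ½ℝ * ε < E (suc n) (s + s)) (h₂ : exp s - ½ℝ * ε * exp s < E (suc n) s) where
        M = suc n
        r<½ε : R M s < ½ℝ * ε
        r<½ε = ≤-<-trans (R-tail M) (<-by (<⇒0<- h₁) (solve 3 (λ x e d → d :- (x :- e) := e :- (x :- d)) ≈-refl (exp (s + s)) (E M (s + s)) (½ℝ * ε)))
        aE≤1 : a * E M s ≤ 1#
        aE≤1 = ≤-respʳ-≈ e (*-monoˡ-≤ (<⇒≤ 0<a) (proj₁ (exp-sup 0≤s) M))
        1<aE : 1# < a * E M s + ½ℝ * ε
        1<aE = <-by (*-pos 0<a (<⇒0<- h₂)) (begin-equality
          a * E M s + ½ℝ * ε - 1#                              ≈⟨ +-cong (+-cong ≈-refl (≈-sym (*-identityʳ (½ℝ * ε)))) (-‿cong (≈-sym e)) ⟩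
          a * E M s + ½ℝ * ε * 1# - a * exp s                  ≈⟨ +-cong (+-cong ≈-refl (*-cong ≈-refl (≈-sym e))) ≈-refl ⟩
          a * E M s + ½ℝ * ε * (a * exp s) - a * exp s         ≈⟨ solve 4 (λ a m x d → a :* m :+ d :* (a :* x) :- a :* x := a :* (m :- (x :- d :* x))) ≈-refl a (E M s) (exp s) (½ℝ * ε) ⟩
          a * (E M s - (exp s - ½ℝ * ε * exp s))               ∎)
        ε≤ : ε ≤ E M s * ε
        ε≤ = ≤-respˡ-≈ (*-identityˡ ε) (*-monoʳ-≤ (<⇒≤ ε>0) (1≤E n 0≤s))
        bound : E M (- s) < a + ε × a < E M (- s) + ε
        bound = *-cancelˡ-< (0≤E M 0≤s) (begin-strict
            E M s * E M (- s)           ≈⟨ product≈ n ⟩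
            1# + R M (- s)              ≤⟨ +-mono-≤ ≤-refl (proj₁ (R-bound M)) ⟩
            1# + R M s                  <⟨ +-mono-< 1<aE r<½ε ⟩
            a * E M s + ½ℝ * ε + ½ℝ * ε ≈⟨ ≈-trans (+-assoc (a * E M s) (½ℝ * ε) (½ℝ * ε)) (+-cong ≈-refl (½-+ ε)) ⟩
            a * E M s + ε               ≤⟨ +-mono-≤ ≤-refl ε≤ ⟩
            a * E M s + E M s * ε       ≈⟨ solve 3 (λ a m e → a :* m :+ m :* e := m :* (a :+ e)) ≈-refl a (E M s) ε ⟩
            E M s * (a + ε)             ∎) ,
          *-cancelˡ-< (0≤E M 0≤s) (begin-strict
            E M s * a                       ≈⟨ *-comm (E M s) a ⟩
            a * E M s                       ≤⟨ aE≤1 ⟩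
            1#                              <⟨ x<x+ε (<⇒0<- r<½ε) ⟩
            1# + (½ℝ * ε - R M s)           ≈⟨ solve 3 (λ o h r → o :+ (h :- r) := (o :+ :- r) :+ h) ≈-refl 1# (½ℝ * ε) (R M s) ⟩
            (1# + - R M s) + ½ℝ * ε         ≤⟨ +-mono-≤ (+-mono-≤ ≤-refl (proj₂ (R-bound M))) (≤-by (<⇒≤ (half ε>0)) (≈-trans (+-cong (≈-sym (½-+ ε)) ≈-refl) (solve 1 (λ h → (h :+ h) :- h := h) ≈-refl (½ℝ * ε)))) ⟩
            (1# + R M (- s)) + ε            ≈⟨ +-cong (≈-sym (product≈ n)) ≈-refl ⟩
            E M s * E M (- s) + ε           ≤⟨ +-mono-≤ ≤-refl ε≤ ⟩
            E M s * E M (- s) + E M s * ε   ≈⟨ ≈-sym (*-distribˡ-+ (E M s) (E M (- s)) ε) ⟩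
            E M s * (E M (- s) + ε)         ∎)

  opaque
    unfolding _≈_ 1/

    ^≡ : ∀ x k → x D.^ k ≡ x ^ k
    ^≡ x zero    = refl
    ^≡ x (suc k) = cong (x D.*_) (^≡ x k)

    term≡ : ∀ α k → D.fromℚ (ℚ._/_ 1ℤ (k !) {{k !≢0}}) D.* α D.^ k ≡ term k α
    term≡ α k = cong (_ D.*_) (^≡ α k)

  Σ<-≡ : ∀ n {f g : ℕ → ℝ} → (∀ i → f i ≡ g i) → Σ< n f ≡ Σ< n g
  Σ<-≡ zero    h = refl
  Σ<-≡ (suc n) h = cong₂ _+_ (Σ<-≡ n h) (h n)

  IsLog⇒ : ∀ {a α} → IsLog a α → Converges (λ n → E n α) a
  IsLog⇒ {a} {α} h ε ε>0 = eventually-map (λ n → subst (λ t → t < a + ε × a < t + ε) (Σ<-≡ n (term≡ α))) (HasSum⇒Converges h ε ε>0)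

  ⇒IsLog : ∀ {a α} → Converges (λ n → E n α) a → IsLog a α
  ⇒IsLog {a} {α} h = Converges⇒HasSum λ ε ε>0 → eventually-map (λ n → subst (λ t → t < a + ε × a < t + ε) (sym (Σ<-≡ n (term≡ α)))) (h ε ε>0)

  -- s = - log a, for 0 < a ≤ 1
  NegLog : ℝ → ℝ → Set
  NegLog a s = 0# ≤ s × a * exp s ≈ 1#

  NegLog⇒IsLog : ∀ {a s} → NegLog a s → IsLog a (- s)
  NegLog⇒IsLog (h , e) = ⇒IsLog (exp-neg h e)

  -- If α were positive, the series would converge to at least 1 + α, beyond a ≤ 1. Otherwise it
  -- also converges to the reciprocal of exp (- α), and limits are unique.
  IsLog⇒NegLog : ∀ {a α} → a ≤ 1# → IsLog a α → NegLog a (- α)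
  IsLog⇒NegLog {a} {α} a≤1 h = 0≤-α , ≈-trans (*-cong (≈-sym b≈a) ≈-refl) (≈-trans (*-comm b (exp (- α))) be)
    where
    conv = IsLog⇒ h
    α≤0 : α ≤ 0#
    α≤0 = ≮⇒≤ λ 0<α → ≤⇒≮ a≤1 (<-≤-trans (<-by 0<α (solve 1 (λ x → (con (+ 1) :+ x) :- con (+ 1) := x) ≈-refl α))
      (≤-trans (1+x≤exp (<⇒≤ 0<α)) (≈⇒≤ (Converges-unique (sup⇒Converges (E-mono (<⇒≤ 0<α)) (exp-sup (<⇒≤ 0<α))) conv))))
    0≤-α : 0# ≤ - α
    0≤-α = ≤-by (≤⇒0≤- α≤0) (solve 1 (λ x → :- x :- con (+ 0) := con (+ 0) :- x) ≈-refl α)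
    inv = inverse (0<exp 0≤-α)
    b = proj₁ inv
    be : exp (- α) * b ≈ 1#
    be = proj₂ (proj₂ inv)
    b≈a : b ≈ a
    b≈a = Converges-unique (Converges-cong (λ n → E-cong n (solve 1 (λ x → :- :- x := x) ≈-refl α))
      (exp-neg 0≤-α (≈-trans (*-comm b (exp (- α))) be))) conv

  NegLog-exists : ∀ {a} → 0# < a → a ≤ 1# → ∃[ s ] NegLog a s
  NegLog-exists {a} 0<a a≤1 =
    let b , b>0 , ab = inverse 0<a
        s , 0≤s , e = log-exists (≤-trans (≈⇒≤ (≈-sym ab)) (≤-respʳ-≈ (*-identityˡ b) (*-monoʳ-≤ (<⇒≤ b>0) a≤1)))
    in s , 0≤s , ≈-trans (*-cong ≈-refl e) ab

-- Measures on Cantor space: cylinders, clopen sets and open sets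

module CantorMeasure (em : ExcludedMiddle 0ℓ) where

  open Exponential em public

  2^ω : Set
  2^ω = ℕ → Bool

  infix 4 _∈_ _⊆_ _≐ˢ_

  _∈_ : 2^ω → Borel cantor → Set
  x ∈ A = member cantor x A

  _⊆_ _≐ˢ_ : Borel cantor → Borel cantor → Set
  A ⊆ B = ∀ x → x ∈ A → x ∈ B
  A ≐ˢ B = A ⊆ B × B ⊆ A

  full ∅ : Borel cantor
  full = basic []
  ∅ = compl full

  pair : Borel cantor → Borel cantor → ℕ → Borel cantor
  pair A B zero          = A
  pair A B (suc zero)    = B
  pair A B (suc (suc _)) = ∅

  infixr 6 _∪_ _∩_

  _∪_ _∩_ : Borel cantor → Borel cantor → Borel cantor
  A ∪ B = union (pair A B)
  A ∩ B = compl (compl A ∪ compl B)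

  ∈-∪ : ∀ {x} A B → x ∈ A ∪ B → x ∈ A ⊎ x ∈ B
  ∈-∪ A B (zero , h)        = inj₁ h
  ∈-∪ A B (suc zero , h)    = inj₂ h
  ∈-∪ A B (suc (suc n) , h) = ⊥-elim (h tt)

  ∪-∈ : ∀ {x} A B → x ∈ A ⊎ x ∈ B → x ∈ A ∪ B
  ∪-∈ A B (inj₁ h) = 0 , h
  ∪-∈ A B (inj₂ h) = 1 , h

  ∈-∩ : ∀ {x} A B → x ∈ A ∩ B → x ∈ A × x ∈ B
  ∈-∩ A B h = by-contradiction (λ k → h (0 , k)) , by-contradiction (λ k → h (1 , k))

  ∩-∈ : ∀ {x} A B → x ∈ A × x ∈ B → x ∈ A ∩ B
  ∩-∈ A B (a , b) h with ∈-∪ (compl A) (compl B) h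
  ... | inj₁ k = k a
  ... | inj₂ k = k b

  prefix : 2^ω → ℕ → String
  prefix x zero    = []
  prefix x (suc n) = x 0 ∷ prefix (x ∘ suc) n

  prefix-∷ʳ : ∀ x n → prefix x (suc n) ≡ prefix x n ∷ʳ x n
  prefix-∷ʳ x zero    = refl
  prefix-∷ʳ x (suc n) = cong (x 0 ∷_) (prefix-∷ʳ (x ∘ suc) n)

  length-prefix : ∀ x n → length (prefix x n) ≡ n
  length-prefix x zero    = refl
  length-prefix x (suc n) = cong suc (length-prefix (x ∘ suc) n)

  take-prefix : ∀ x {m n} → m ℕ.≤ n → take m (prefix x n) ≡ prefix x m
  take-prefix x {zero}          h         = refl
  take-prefix x {suc m} {suc n} (ℕ.s≤s h) = cong (x 0 ∷_) (take-prefix (x ∘ suc) h)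

  take-∷ʳ : ∀ m (σ : String) b → m ℕ.≤ length σ → take m (σ ∷ʳ b) ≡ take m σ
  take-∷ʳ zero    σ       b h         = refl
  take-∷ʳ (suc m) (c ∷ σ) b (ℕ.s≤s h) = cong (c ∷_) (take-∷ʳ m σ b h)

  take-take : ∀ j k (τ : String) → j ℕ.≤ k → take j (take k τ) ≡ take j τ
  take-take zero    k       τ       h         = refl
  take-take (suc j) (suc k) []      h         = refl
  take-take (suc j) (suc k) (b ∷ τ) (ℕ.s≤s h) = cong (b ∷_) (take-take j k τ h)

  length-∷ʳ : ∀ (σ : String) b → length (σ ∷ʳ b) ≡ suc (length σ)
  length-∷ʳ σ b = trans (Listₚ.length-++ σ) (ℕₚ.+-comm (length σ) 1)

  Extends⇒prefix : ∀ x σ → Extends x σ → prefix x (length σ) ≡ σ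
  Extends⇒prefix x []      h       = refl
  Extends⇒prefix x (b ∷ σ) (h , k) = cong₂ _∷_ h (Extends⇒prefix (x ∘ suc) σ k)

  prefix⇒Extends : ∀ x σ → prefix x (length σ) ≡ σ → Extends x σ
  prefix⇒Extends x []      e = tt
  prefix⇒Extends x (b ∷ σ) e = Listₚ.∷-injectiveˡ e , prefix⇒Extends (x ∘ suc) σ (Listₚ.∷-injectiveʳ e)

  Extends-prefix : ∀ x n → Extends x (prefix x n)
  Extends-prefix x zero    = tt
  Extends-prefix x (suc n) = refl , Extends-prefix (x ∘ suc) n

  Extends-∷ʳ⁻ : ∀ x σ b → Extends x (σ ∷ʳ b) → Extends x σ × x (length σ) ≡ b
  Extends-∷ʳ⁻ x []      b (h , _) = tt , h
  Extends-∷ʳ⁻ x (c ∷ σ) b (h , k) = let p , q = Extends-∷ʳ⁻ (x ∘ suc) σ b k in (h , p) , q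

  Extends-∷ʳ : ∀ x σ → Extends x σ → Extends x (σ ∷ʳ x (length σ))
  Extends-∷ʳ x []      h       = refl , tt
  Extends-∷ʳ x (c ∷ σ) (h , k) = h , Extends-∷ʳ (x ∘ suc) σ k

  -- Multiplication by an indicator. The decision is an argument, so that a proof can split on it
  -- once for all its occurrences in a sum.
  weigh : {P : Set} → Dec P → ℝ → ℝ
  weigh (yes _) r = r
  weigh (no  _) r = 0#

  [_]·_ : Set → ℝ → ℝ
  [ P ]· r = weigh (em {P}) r

  []·-yes : ∀ {P r} → P → [ P ]· r ≈ r
  []·-yes {P} p with em {P}
  ... | yes _ = ≈-refl
  ... | no ¬p = ⊥-elim (¬p p)

  []·-no : ∀ {P r} → ¬ P → [ P ]· r ≈ 0#
  []·-no {P} ¬p with em {P}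
  ... | yes p = ⊥-elim (¬p p)
  ... | no _  = ≈-refl

  0≤[]· : ∀ {P r} → 0# ≤ r → 0# ≤ [ P ]· r
  0≤[]· {P} h with em {P}
  ... | yes _ = h
  ... | no  _ = ≤-refl

  []·-cong : ∀ {P r s} → r ≈ s → [ P ]· r ≈ [ P ]· s
  []·-cong {P} e with em {P}
  ... | yes _ = e
  ... | no  _ = ≈-refl

  []·-mono : ∀ {P Q r s} → (P → Q) → 0# ≤ s → (P → r ≤ s) → [ P ]· r ≤ [ Q ]· s
  []·-mono {P} {Q} f 0≤s h with em {P} | em {Q}
  ... | yes p | yes _ = h p
  ... | yes p | no ¬q = ⊥-elim (¬q (f p))
  ... | no _  | yes _ = 0≤s
  ... | no _  | no _  = ≤-refl

  -- The substitute for integration: if `f τ` is `cylinder μ τ` times a value, this is the integral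
  -- over the cylinder of σ of a function of the first |σ| + n bits.
  Ext : ℕ → String → (String → ℝ) → ℝ
  Ext zero    σ f = f σ
  Ext (suc n) σ f = Ext n (σ ∷ʳ false) f + Ext n (σ ∷ʳ true) f

  Ext-cong : ∀ n σ {f g} → (∀ τ → length τ ≡ length σ ℕ.+ n → f τ ≈ g τ) → Ext n σ f ≈ Ext n σ g
  Ext-mono : ∀ n σ {f g} → (∀ τ → length τ ≡ length σ ℕ.+ n → f τ ≤ g τ) → Ext n σ f ≤ Ext n σ g

  private
    len : ∀ (σ : String) b n (τ : String) → length τ ≡ length (σ ∷ʳ b) ℕ.+ n → length τ ≡ length σ ℕ.+ suc n
    len σ b n τ e = trans e (trans (cong (ℕ._+ n) (length-∷ʳ σ b)) (sym (ℕₚ.+-suc (length σ) n)))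

  Ext-cong zero    σ h = h σ (sym (ℕₚ.+-identityʳ (length σ)))
  Ext-cong (suc n) σ h = +-cong (Ext-cong n (σ ∷ʳ false) λ τ e → h τ (len σ false n τ e))
                                (Ext-cong n (σ ∷ʳ true) λ τ e → h τ (len σ true n τ e))

  Ext-mono zero    σ h = h σ (sym (ℕₚ.+-identityʳ (length σ)))
  Ext-mono (suc n) σ h = +-mono-≤ (Ext-mono n (σ ∷ʳ false) λ τ e → h τ (len σ false n τ e))
                                  (Ext-mono n (σ ∷ʳ true) λ τ e → h τ (len σ true n τ e))

  Ext-zero : ∀ n σ → Ext n σ (λ _ → 0#) ≈ 0#
  Ext-zero zero    σ = ≈-refl
  Ext-zero (suc n) σ = ≈-trans (+-cong (Ext-zero n (σ ∷ʳ false)) (Ext-zero n (σ ∷ʳ true))) (+-identityˡ 0#)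

  Ext-nonneg : ∀ n σ {f} → (∀ τ → 0# ≤ f τ) → 0# ≤ Ext n σ f
  Ext-nonneg n σ h = ≤-respˡ-≈ (Ext-zero n σ) (Ext-mono n σ λ τ _ → h τ)

  Ext-+ : ∀ n σ f g → Ext n σ (λ τ → f τ + g τ) ≈ Ext n σ f + Ext n σ g
  Ext-+ zero    σ f g = ≈-refl
  Ext-+ (suc n) σ f g = ≈-trans (+-cong (Ext-+ n (σ ∷ʳ false) f g) (Ext-+ n (σ ∷ʳ true) f g))
    (solve 4 (λ a b c d → (a :+ b) :+ (c :+ d) := (a :+ c) :+ (b :+ d)) ≈-refl
      (Ext n (σ ∷ʳ false) f) (Ext n (σ ∷ʳ false) g) (Ext n (σ ∷ʳ true) f) (Ext n (σ ∷ʳ true) g))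

  Ext-*ˡ : ∀ n σ c f → Ext n σ (λ τ → c * f τ) ≈ c * Ext n σ f
  Ext-*ˡ zero    σ c f = ≈-refl
  Ext-*ˡ (suc n) σ c f = ≈-trans (+-cong (Ext-*ˡ n (σ ∷ʳ false) c f) (Ext-*ˡ n (σ ∷ʳ true) c f))
    (≈-sym (*-distribˡ-+ c (Ext n (σ ∷ʳ false) f) (Ext n (σ ∷ʳ true) f)))

  Ext-suc : ∀ n σ f → Ext (suc n) σ f ≈ Ext n σ (λ τ → f (τ ∷ʳ false) + f (τ ∷ʳ true))
  Ext-suc zero    σ f = ≈-refl
  Ext-suc (suc n) σ f = +-cong (Ext-suc n (σ ∷ʳ false) f) (Ext-suc n (σ ∷ʳ true) f)

  Additive : (String → ℝ) → Set
  Additive f = ∀ σ → f σ ≈ f (σ ∷ʳ false) + f (σ ∷ʳ true)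

  Ext-additive : ∀ {f} → Additive f → ∀ n σ → Ext n σ f ≈ f σ
  Ext-additive add zero    σ = ≈-refl
  Ext-additive add (suc n) σ = ≈-trans (+-cong (Ext-additive add n (σ ∷ʳ false)) (Ext-additive add n (σ ∷ʳ true))) (≈-sym (add σ))

  -- {x : x extends σ and P holds of its prefix of length |σ| + n}

  choose : {P : Set} → Dec P → Borel cantor → Borel cantor
  choose (yes _) A = A
  choose (no  _) A = ∅

  level : ℕ → String → (String → Set) → Borel cantor
  level zero    σ P = choose (em {P σ}) (basic σ)
  level (suc n) σ P = level n (σ ∷ʳ false) P ∪ level n (σ ∷ʳ true) P

  ∈-choose : ∀ {P x A} (d : Dec P) → x ∈ choose d A → x ∈ A × P
  ∈-choose (yes p) h = h , p
  ∈-choose (no _)  h = ⊥-elim (h tt)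

  choose-∈ : ∀ {P x A} (d : Dec P) → x ∈ A → P → x ∈ choose d A
  choose-∈ (yes p) h _ = h
  choose-∈ (no ¬p) h p = ⊥-elim (¬p p)

  ∈-level : ∀ n σ P x → x ∈ level n σ P → Extends x σ × P (prefix x (length σ ℕ.+ n))
  ∈-level zero    σ P x h =
    let k , p = ∈-choose {A = basic σ} (em {P σ}) h
    in k , subst P (sym (trans (cong (prefix x) (ℕₚ.+-identityʳ (length σ))) (Extends⇒prefix x σ k))) p
  ∈-level (suc n) σ P x h with ∈-∪ (level n (σ ∷ʳ false) P) (level n (σ ∷ʳ true) P) h
  ... | inj₁ k = let e , p = ∈-level n (σ ∷ʳ false) P x k in
    proj₁ (Extends-∷ʳ⁻ x σ false e) , subst (λ m → P (prefix x m)) (trans (cong (ℕ._+ n) (length-∷ʳ σ false)) (sym (ℕₚ.+-suc (length σ) n))) p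
  ... | inj₂ k = let e , p = ∈-level n (σ ∷ʳ true) P x k in
    proj₁ (Extends-∷ʳ⁻ x σ true e) , subst (λ m → P (prefix x m)) (trans (cong (ℕ._+ n) (length-∷ʳ σ true)) (sym (ℕₚ.+-suc (length σ) n))) p

  level-∈ : ∀ n σ P x → Extends x σ → P (prefix x (length σ ℕ.+ n)) → x ∈ level n σ P
  level-∈ zero    σ P x h p = choose-∈ {A = basic σ} (em {P σ}) h
    (subst P (trans (cong (prefix x) (ℕₚ.+-identityʳ (length σ))) (Extends⇒prefix x σ h)) p)
  level-∈ (suc n) σ P x h p = go (x (length σ)) refl
    where
    go : ∀ b → x (length σ) ≡ b → x ∈ level (suc n) σ P
    step : ∀ b → x (length σ) ≡ b → x ∈ level n (σ ∷ʳ b) P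
    step b e = level-∈ n (σ ∷ʳ b) P x (subst (λ c → Extends x (σ ∷ʳ c)) e (Extends-∷ʳ x σ h))
      (subst (λ m → P (prefix x m)) (trans (ℕₚ.+-suc (length σ) n) (cong (ℕ._+ n) (sym (length-∷ʳ σ b)))) p)
    go false e = ∪-∈ (level n (σ ∷ʳ false) P) (level n (σ ∷ʳ true) P) (inj₁ (step false e))
    go true  e = ∪-∈ (level n (σ ∷ʳ false) P) (level n (σ ∷ʳ true) P) (inj₂ (step true e))

  clopen : ℕ → (String → Set) → Borel cantor
  clopen n P = level n [] P

  ∈-clopen : ∀ n P x → x ∈ clopen n P → P (prefix x n)
  ∈-clopen n P x h = proj₂ (∈-level n [] P x h)

  clopen-∈ : ∀ n P x → P (prefix x n) → x ∈ clopen n P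
  clopen-∈ n P x p = level-∈ n [] P x tt p

  open-set : (String → Set) → Borel cantor
  open-set P = union λ n → clopen n P

  ∈-open : ∀ P x → x ∈ open-set P → ∃[ n ] P (prefix x n)
  ∈-open P x (n , h) = n , ∈-clopen n P x h

  open-∈ : ∀ P x n → P (prefix x n) → x ∈ open-set P
  open-∈ P x n p = n , clopen-∈ n P x p

  module _ (μ : Measure cantor) where

    private
      m : Borel cantor → ℝ
      m = mass μ

    opaque
      unfolding _≈_

      mass-cong : ∀ A B → A ≐ˢ B → m A ≈ m B
      mass-cong A B (f , g) = extensional μ A B λ x → mk⇔ (f x) (g x)

      0≤mass : ∀ A → 0# ≤ m A
      0≤mass A = nonNegative μ A

      mass-full : m full ≈ 1#
      mass-full = total μ full λ _ → tt

    mass-union : ∀ F → (∀ i j → i ≢ j → ∀ x → x ∈ F i → ¬ x ∈ F j) → Converges (λ n → Σ< n (λ i → m (F i))) (m (union F))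
    mass-union F h = HasSum⇒Converges (σ-additive μ F λ i j i≢j x (a , b) → h i j i≢j x a b)

    private
      -- Adding one more term to a convergent constant series shows s + c = s. It is applied to ∅, a
      -- disjoint union of copies of itself.
      const-sum : ∀ {c s} → Converges (λ n → Σ< n (λ _ → c)) s → c ≈ 0#
      const-sum {c} {s} h = ≈-trans (solve 2 (λ c s → c := (s :+ c) :- s) ≈-refl c s)
        (≈-trans (+-cong {s + c} {s} (Converges-unique h₂ h₁) ≈-refl) (+-inverseʳ s))
        where
        h₁ : Converges (λ n → Σ< (suc n) (λ _ → c)) s
        h₁ ε ε>0 = let N , k = h ε ε>0 in N , λ n N≤n → k (suc n) (ℕₚ.m≤n⇒m≤1+n N≤n)
        h₂ : Converges (λ n → Σ< (suc n) (λ _ → c)) (s + c)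
        h₂ ε ε>0 = let N , k = h ε ε>0 in N , λ n N≤n →
          shift (Σ< n (λ _ → c)) s ε (proj₁ (k n N≤n)) , shift s (Σ< n (λ _ → c)) ε (proj₂ (k n N≤n))
          where
          shift : ∀ t u ε → t < u + ε → t + c < (u + c) + ε
          shift t u ε k = <-respʳ-≈ (solve 3 (λ u c e → (u :+ e) :+ c := (u :+ c) :+ e) ≈-refl u c ε) (+-mono-<-≤ k (≤-refl {c}))

    mass-∅ : m ∅ ≈ 0#
    mass-∅ = const-sum (mass-union (λ _ → ∅) λ i j _ x h _ → h tt)

    mass-∪ : ∀ A B → (∀ x → x ∈ A → ¬ x ∈ B) → m (A ∪ B) ≈ m A + m B
    mass-∪ A B disj = Converges-unique (mass-union (pair A B) λ where
        zero zero i≢j → ⊥-elim (i≢j refl)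
        zero (suc zero) _ x a b → disj x a b
        zero (suc (suc j)) _ x a b → b tt
        (suc zero) zero _ x b a → disj x a b
        (suc zero) (suc zero) i≢j → ⊥-elim (i≢j refl)
        (suc zero) (suc (suc j)) _ x a b → b tt
        (suc (suc i)) _ _ x a _ → a tt)
      λ ε ε>0 → 2 , λ where
        (suc zero) (ℕ.s≤s ())
        (suc (suc n)) _ → ≤-<-trans (≈⇒≤ (sum n)) (x<x+ε ε>0) , <-≤-trans (x<x+ε ε>0) (+-mono-≤ (≈⇒≤ (≈-sym (sum n))) ≤-refl)
      where
      sum : ∀ n → Σ< (suc (suc n)) (λ i → m (pair A B i)) ≈ m A + m B
      sum zero    = +-cong (+-identityˡ (m A)) ≈-refl
      sum (suc n) = ≈-trans (+-cong (sum n) mass-∅) (+-identityʳ (m A + m B))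

    mass-split : ∀ A B → m A ≈ m (A ∩ B) + m (A ∩ compl B)
    mass-split A B = ≈-trans (mass-cong A ((A ∩ B) ∪ (A ∩ compl B)) (to , from))
      (mass-∪ (A ∩ B) (A ∩ compl B) λ x h k → proj₂ (∈-∩ A (compl B) k) (proj₂ (∈-∩ A B h)))
      where
      to : A ⊆ ((A ∩ B) ∪ (A ∩ compl B))
      to x a with em {x ∈ B}
      ... | yes b = ∪-∈ (A ∩ B) (A ∩ compl B) (inj₁ (∩-∈ A B (a , b)))
      ... | no ¬b = ∪-∈ (A ∩ B) (A ∩ compl B) (inj₂ (∩-∈ A (compl B) (a , ¬b)))
      from : ((A ∩ B) ∪ (A ∩ compl B)) ⊆ A
      from x h with ∈-∪ (A ∩ B) (A ∩ compl B) h
      ... | inj₁ k = proj₁ (∈-∩ A B k)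
      ... | inj₂ k = proj₁ (∈-∩ A (compl B) k)

    mass-mono : ∀ A B → A ⊆ B → m A ≤ m B
    mass-mono A B h = ≤-trans (≈⇒≤ (mass-cong A (B ∩ A) ((λ x a → ∩-∈ B A (h x a , a)) , (λ x k → proj₂ (∈-∩ B A k)))))
      (≤-by (0≤mass (B ∩ compl A)) (≈-trans (+-cong (mass-split B A) ≈-refl)
        (solve 2 (λ a b → (a :+ b) :- a := b) ≈-refl (m (B ∩ A)) (m (B ∩ compl A)))))

    mass≤1 : ∀ A → m A ≤ 1#
    mass≤1 A = ≤-respʳ-≈ mass-full (mass-mono A full λ _ _ → tt)

    mass-∪-≤ : ∀ A B → m (A ∪ B) ≤ m A + m B
    mass-∪-≤ A B = begin
      m (A ∪ B)                                     ≈⟨ mass-split (A ∪ B) A ⟩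
      m ((A ∪ B) ∩ A) + m ((A ∪ B) ∩ compl A)       ≤⟨ +-mono-≤ (mass-mono ((A ∪ B) ∩ A) A λ x h → proj₂ (∈-∩ (A ∪ B) A h))
                                                         (mass-mono ((A ∪ B) ∩ compl A) B inB) ⟩
      m A + m B                                     ∎
      where
      open ≤-Reasoning
      inB : ((A ∪ B) ∩ compl A) ⊆ B
      inB x h with ∈-∩ (A ∪ B) (compl A) h
      ... | k , ¬a with ∈-∪ A B k
      ...   | inj₁ a = ⊥-elim (¬a a)
      ...   | inj₂ b = b

    module _ (F : ℕ → Borel cantor) (inc : ∀ n → F n ⊆ F (suc n)) where

      private
        G : ℕ → Borel cantor
        G zero    = F zero
        G (suc n) = F (suc n) ∩ compl (F n)

        F-mono : ∀ {i j} → i ℕ.≤′ j → F i ⊆ F j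
        F-mono (ℕ.≤′-reflexive refl) x h = h
        F-mono (ℕ.≤′-step {n} p) x h = inc n x (F-mono p x h)

        G⊆F : ∀ n → G n ⊆ F n
        G⊆F zero    x h = h
        G⊆F (suc n) x h = proj₁ (∈-∩ (F (suc n)) (compl (F n)) h)

        G-disjoint-< : ∀ {i j} → i ℕ.< j → ∀ x → x ∈ G i → ¬ x ∈ G j
        G-disjoint-< {i} {suc j} (ℕ.s≤s i≤j) x h k = proj₂ (∈-∩ (F (suc j)) (compl (F j)) k) (F-mono (ℕₚ.≤⇒≤′ i≤j) x (G⊆F i x h))

        G-disjoint : ∀ i j → i ≢ j → ∀ x → x ∈ G i → ¬ x ∈ G j
        G-disjoint i j i≢j x h k with ℕₚ.<-cmp i j
        ... | tri< i<j _ _ = G-disjoint-< i<j x h k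
        ... | tri≈ _ e _ = i≢j e
        ... | tri> _ _ j<i = G-disjoint-< j<i x k h

        F⊆⋃G : ∀ n → F n ⊆ union G
        F⊆⋃G zero    x h = 0 , h
        F⊆⋃G (suc n) x h with em {x ∈ F n}
        ... | yes k = F⊆⋃G n x k
        ... | no ¬k = suc n , ∩-∈ (F (suc n)) (compl (F n)) (h , ¬k)

        partial : ∀ n → Σ< (suc n) (λ i → m (G i)) ≈ m (F n)
        partial zero    = +-identityˡ (m (F 0))
        partial (suc n) = ≈-trans (+-cong (partial n) ≈-refl) (≈-sym (≈-trans (mass-split (F (suc n)) (F n))
          (+-cong (mass-cong (F (suc n) ∩ F n) (F n) ((λ x h → proj₂ (∈-∩ (F (suc n)) (F n) h)) , λ x h → ∩-∈ (F (suc n)) (F n) (inc n x h , h))) ≈-refl)))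

        sup : IsSupSeq (λ n → Σ< n (λ i → m (G i))) (m (union G))
        sup = Converges⇒sup (Σ<-mono-n λ i → 0≤mass (G i)) (mass-union G G-disjoint)

      -- Continuity from below: the differences `G n` are disjoint and their masses telescope to
      -- `m (F n)`.
      mass-sup : IsSupSeq (λ n → m (F n)) (m (union F))
      mass-sup = (λ n → mass-mono (F n) (union F) λ x h → n , h) ,
        λ u h → ≤-respˡ-≈ (mass-cong (union G) (union F) ((λ x (n , k) → n , G⊆F n x k) , λ x (n , k) → F⊆⋃G n x k))
          (proj₂ sup u λ n → ≤-trans (Σ<-mono-n (λ i → 0≤mass (G i)) (ℕₚ.n≤1+n n)) (≤-respˡ-≈ (≈-sym (partial n)) (h n)))

    cylinder : String → ℝ
    cylinder σ = m (basic σ)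

    cylinder-additive : Additive cylinder
    cylinder-additive σ = ≈-trans (mass-cong (basic σ) (basic (σ ∷ʳ false) ∪ basic (σ ∷ʳ true)) (to , from))
      (mass-∪ (basic (σ ∷ʳ false)) (basic (σ ∷ʳ true)) λ x h k → absurd (trans (sym (proj₂ (Extends-∷ʳ⁻ x σ false h))) (proj₂ (Extends-∷ʳ⁻ x σ true k))))
      where
      absurd : ¬ false ≡ true
      absurd ()
      to : basic σ ⊆ (basic (σ ∷ʳ false) ∪ basic (σ ∷ʳ true))
      to x h = go (x (length σ)) refl
        where
        go : ∀ b → x (length σ) ≡ b → x ∈ (basic (σ ∷ʳ false) ∪ basic (σ ∷ʳ true))
        go false e = ∪-∈ (basic (σ ∷ʳ false)) (basic (σ ∷ʳ true)) (inj₁ (subst (λ c → Extends x (σ ∷ʳ c)) e (Extends-∷ʳ x σ h)))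
        go true  e = ∪-∈ (basic (σ ∷ʳ false)) (basic (σ ∷ʳ true)) (inj₂ (subst (λ c → Extends x (σ ∷ʳ c)) e (Extends-∷ʳ x σ h)))
      from : (basic (σ ∷ʳ false) ∪ basic (σ ∷ʳ true)) ⊆ basic σ
      from x h with ∈-∪ (basic (σ ∷ʳ false)) (basic (σ ∷ʳ true)) h
      ... | inj₁ k = proj₁ (Extends-∷ʳ⁻ x σ false k)
      ... | inj₂ k = proj₁ (Extends-∷ʳ⁻ x σ true k)

    0≤cylinder : ∀ σ → 0# ≤ cylinder σ
    0≤cylinder σ = 0≤mass (basic σ)

    mass-level : ∀ n σ P → m (level n σ P) ≈ Ext n σ (λ τ → [ P τ ]· cylinder τ)
    mass-level zero    σ P with em {P σ}
    ... | yes _ = ≈-refl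
    ... | no  _ = mass-∅
    mass-level (suc n) σ P = ≈-trans
      (mass-∪ (level n (σ ∷ʳ false) P) (level n (σ ∷ʳ true) P) λ x h k → absurd (trans
        (sym (proj₂ (Extends-∷ʳ⁻ x σ false (proj₁ (∈-level n (σ ∷ʳ false) P x h)))))
        (proj₂ (Extends-∷ʳ⁻ x σ true (proj₁ (∈-level n (σ ∷ʳ true) P x k))))))
      (+-cong (mass-level n (σ ∷ʳ false) P) (mass-level n (σ ∷ʳ true) P))
      where
      absurd : ¬ false ≡ true
      absurd ()

    mass-clopen : ∀ n P → m (clopen n P) ≈ Ext n [] (λ τ → [ P τ ]· cylinder τ)
    mass-clopen n P = mass-level n [] P

    Ext-cylinder : ∀ n σ → Ext n σ cylinder ≈ cylinder σ
    Ext-cylinder = Ext-additive cylinder-additive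

  Upward : (String → Set) → Set
  Upward P = ∀ σ b → P σ → P (σ ∷ʳ b)

  Upward-≤ : ∀ {P} → Upward P → ∀ x {i j} → i ℕ.≤ j → P (prefix x i) → P (prefix x j)
  Upward-≤ {P} up x i≤j p = go (ℕₚ.≤⇒≤′ i≤j)
    where
    go : ∀ {j} → _ ℕ.≤′ j → P (prefix x j)
    go (ℕ.≤′-reflexive refl) = p
    go (ℕ.≤′-step {n} q) = subst P (sym (prefix-∷ʳ x n)) (up (prefix x n) (x n) (go q))

  open-sup : ∀ μ P → Upward P → IsSupSeq (λ n → mass μ (clopen n P)) (mass μ (open-set P))
  open-sup μ P up = mass-sup μ (λ n → clopen n P) λ n x h →
    clopen-∈ (suc n) P x (Upward-≤ up x (ℕₚ.n≤1+n n) (∈-clopen n P x h))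

-- Outer regularity of measures on Cantor space

module OuterRegularity (em : ExcludedMiddle 0ℓ) where

  open CantorMeasure em public

  ⋃< : ℕ → (ℕ → Borel cantor) → Borel cantor
  ⋃< zero    F = ∅
  ⋃< (suc n) F = ⋃< n F ∪ F n

  ∈-⋃< : ∀ n F x → x ∈ ⋃< n F → ∃[ i ] (i ℕ.< n × x ∈ F i)
  ∈-⋃< zero    F x h = ⊥-elim (h tt)
  ∈-⋃< (suc n) F x h with ∈-∪ (⋃< n F) (F n) h
  ... | inj₁ k = let i , i<n , p = ∈-⋃< n F x k in i , ℕₚ.m<n⇒m<1+n i<n , p
  ... | inj₂ k = n , ℕₚ.≤-refl , k

  ⋃<-∈ : ∀ n F x i → i ℕ.< n → x ∈ F i → x ∈ ⋃< n F
  ⋃<-∈ (suc n) F x i (ℕ.s≤s i≤n) h with ℕₚ.m≤n⇒m<n∨m≡n i≤n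
  ... | inj₁ i<n  = ∪-∈ (⋃< n F) (F n) (inj₁ (⋃<-∈ n F x i i<n h))
  ... | inj₂ refl = ∪-∈ (⋃< n F) (F n) (inj₂ h)

  Σ½ⁿ : ∀ n → Σ< n (λ i → ½ⁿ (suc i)) + ½ⁿ n ≈ 1#
  Σ½ⁿ zero    = ≈-trans (+-identityˡ (½ⁿ 0)) ½ⁿ-zero
  Σ½ⁿ (suc n) = ≈-trans (+-assoc (Σ< n (λ i → ½ⁿ (suc i))) (½ⁿ (suc n)) (½ⁿ (suc n)))
    (≈-trans (+-cong ≈-refl (½ⁿ-double n)) (Σ½ⁿ n))

  module _ (μ : Measure cantor) where

    private
      m : Borel cantor → ℝ
      m = mass μ

    mass-⋃< : ∀ n F → m (⋃< n F) ≤ Σ< n (λ i → m (F i))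
    mass-⋃< zero    F = ≈⇒≤ (mass-∅ μ)
    mass-⋃< (suc n) F = ≤-trans (mass-∪-≤ μ (⋃< n F) (F n)) (+-mono-≤ (mass-⋃< n F) ≤-refl)

    mass-⋃<-sup : ∀ F → IsSupSeq (λ n → m (⋃< n F)) (m (union F))
    mass-⋃<-sup F =
      let up , least = mass-sup μ (λ n → ⋃< n F) (λ n x h → ∪-∈ (⋃< n F) (F n) (inj₁ h))
          e = mass-cong μ (union λ n → ⋃< n F) (union F)
            ((λ x (n , h) → let i , _ , k = ∈-⋃< n F x h in i , k) , λ x (i , k) → suc i , ⋃<-∈ (suc i) F x i ℕₚ.≤-refl k)
      in (λ n → ≤-respʳ-≈ e (up n)) , λ u h → ≤-respˡ-≈ e (least u h)

    -- Open sets are taken around A and around its complement at once, with small overlap. This is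
    -- symmetric, so the induction on codes passes through `compl`, which outer regularity alone
    -- would not.
    record Sandwich (A : Borel cantor) (ε : ℝ) : Set₁ where
      field
        outer outerᶜ : String → Set
        upward  : Upward outer
        upwardᶜ : Upward outerᶜ
        covers  : ∀ x → x ∈ A → ∃[ n ] outer (prefix x n)
        coversᶜ : ∀ x → ¬ x ∈ A → ∃[ n ] outerᶜ (prefix x n)
        thin : m (open-set outer ∩ open-set outerᶜ) < ε

    open Sandwich

    sandwich-basic : ∀ σ {ε} → 0# < ε → Sandwich (basic σ) ε
    sandwich-basic σ ε>0 = record
      { outer   = λ τ → length σ ℕ.≤ length τ × take (length σ) τ ≡ σ
      ; outerᶜ  = λ τ → length σ ℕ.≤ length τ × take (length σ) τ ≢ σ
      ; upward  = λ τ b (l , e) → longer τ b l , trans (take-∷ʳ (length σ) τ b l) e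
      ; upwardᶜ = λ τ b (l , e) → longer τ b l , λ k → e (trans (sym (take-∷ʳ (length σ) τ b l)) k)
      ; covers  = λ x h → length σ , here x , trans (take-prefix x ℕₚ.≤-refl) (Extends⇒prefix x σ h)
      ; coversᶜ = λ x ¬h → length σ , here x , λ k → ¬h (prefix⇒Extends x σ (trans (sym (take-prefix x ℕₚ.≤-refl)) k))
      ; thin = ≤-<-trans (≤-trans (mass-mono μ (open-set O ∩ open-set Oᶜ) ∅ λ x h → ⊥-elim (disjoint x h)) (≈⇒≤ (mass-∅ μ))) ε>0
      }
      where
      O Oᶜ : String → Set
      O τ = length σ ℕ.≤ length τ × take (length σ) τ ≡ σ
      Oᶜ τ = length σ ℕ.≤ length τ × take (length σ) τ ≢ σ
      longer : ∀ τ b → length σ ℕ.≤ length τ → length σ ℕ.≤ length (τ ∷ʳ b)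
      longer τ b l = ℕₚ.≤-trans l (subst (length τ ℕ.≤_) (sym (length-∷ʳ τ b)) (ℕₚ.n≤1+n (length τ)))
      here : ∀ x → length σ ℕ.≤ length (prefix x (length σ))
      here x = ℕₚ.≤-reflexive (sym (length-prefix x (length σ)))
      disjoint : ∀ x → ¬ x ∈ (open-set O ∩ open-set Oᶜ)
      disjoint x h =
        let p , q = ∈-∩ (open-set O) (open-set Oᶜ) h
            i , l , e = ∈-open O x p
            j , l′ , e′ = ∈-open Oᶜ x q
            i≥ = subst (length σ ℕ.≤_) (length-prefix x i) l
            j≥ = subst (length σ ℕ.≤_) (length-prefix x j) l′
        in e′ (trans (take-prefix x j≥) (trans (sym (take-prefix x i≥)) e))

    sandwich-compl : ∀ A {ε} → Sandwich A ε → Sandwich (compl A) ε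
    sandwich-compl A s = record
      { outer = outerᶜ s ; outerᶜ = outer s ; upward = upwardᶜ s ; upwardᶜ = upward s
      ; covers = coversᶜ s ; coversᶜ = λ x h → covers s x (by-contradiction h)
      ; thin = ≤-<-trans (mass-mono μ (open-set (outerᶜ s) ∩ open-set (outer s)) (open-set (outer s) ∩ open-set (outerᶜ s)) λ x h →
          let p , q = ∈-∩ (open-set (outerᶜ s)) (open-set (outer s)) h in ∩-∈ (open-set (outer s)) (open-set (outerᶜ s)) (q , p)) (thin s) }

    module _ (F : ℕ → Borel cantor) {ε : ℝ} (ε>0 : 0# < ε)
             (s : ∀ i → Sandwich (F i) (½ⁿ (suc i) * (½ℝ * ε))) where

      private
        V : ℕ → Borel cantor
        V i = open-set (outer (s i))

        W : ℕ → Borel cantor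
        W i = open-set (outer (s i)) ∩ open-set (outerᶜ (s i))

        opaque
          cut : ∃[ N ] (m (union V) - ½ℝ * ε < m (⋃< N V))
          cut = IsSupSeq-witness (mass-⋃<-sup V) (x-ε<x (half ε>0))

        N : ℕ
        N = proj₁ cut

        O Oᶜ : String → Set
        O τ = ∃[ i ] outer (s i) τ
        Oᶜ τ = ∀ i → i ℕ.< N → outerᶜ (s i) τ

        coversAll : ∀ x → (∀ i → ¬ x ∈ F i) → ∀ k → ∃[ n ] (∀ i → i ℕ.< k → outerᶜ (s i) (prefix x n))
        coversAll x h zero    = 0 , λ i ()
        coversAll x h (suc k) =
          let n , p = coversAll x h k
              n′ , q = coversᶜ (s k) x (h k)
          in n ℕ.⊔ n′ , λ i i≤k → go n p n′ q i (ℕₚ.m≤n⇒m<n∨m≡n (ℕ.s≤s⁻¹ i≤k))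
          where
          go : ∀ n → (∀ i → i ℕ.< k → outerᶜ (s i) (prefix x n)) → ∀ n′ → outerᶜ (s k) (prefix x n′) →
               ∀ i → i ℕ.< k ⊎ i ≡ k → outerᶜ (s i) (prefix x (n ℕ.⊔ n′))
          go n p n′ q i (inj₁ i<k)  = Upward-≤ (upwardᶜ (s i)) x (ℕₚ.m≤m⊔n n n′) (p i i<k)
          go n p n′ q i (inj₂ refl) = Upward-≤ (upwardᶜ (s i)) x (ℕₚ.m≤n⊔m n n′) q

        V∖ : Borel cantor
        V∖ = union V ∩ compl (⋃< N V)

        overlap-⊆ : (open-set O ∩ open-set Oᶜ) ⊆ (V∖ ∪ ⋃< N W)
        overlap-⊆ x h = go (∈-open O x (proj₁ (∈-∩ (open-set O) (open-set Oᶜ) h))) (∈-open Oᶜ x (proj₂ (∈-∩ (open-set O) (open-set Oᶜ) h))) em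
          where
          go : ∃[ n ] O (prefix x n) → ∃[ k ] Oᶜ (prefix x k) → Dec (x ∈ ⋃< N V) → x ∈ (V∖ ∪ ⋃< N W)
          go (n , i , o) q (no ¬r) = ∪-∈ V∖ (⋃< N W) (inj₁ (∩-∈ (union V) (compl (⋃< N V)) ((i , open-∈ (outer (s i)) x n o) , ¬r)))
          go p (k , q) (yes r) = let i , i<N , v = ∈-⋃< N V x r in
            ∪-∈ V∖ (⋃< N W) (inj₂ (⋃<-∈ N W x i i<N (∩-∈ (V i) (open-set (outerᶜ (s i)))
              (v , open-∈ (outerᶜ (s i)) x k (q i i<N)))))

        V∖<½ε : m V∖ < ½ℝ * ε
        V∖<½ε = <-by (<⇒0<- (proj₂ cut)) (begin-equality
          ½ℝ * ε - m V∖ ≈⟨ solve 3 (λ e v w → e :- v := w :- ((w :+ v) :- e)) ≈-refl (½ℝ * ε) (m V∖) (m (⋃< N V)) ⟩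
          m (⋃< N V) - (m (⋃< N V) + m V∖ - ½ℝ * ε)
            ≈⟨ +-cong ≈-refl (-‿cong (+-cong (+-cong (mass-cong μ (⋃< N V) (union V ∩ ⋃< N V)
                 ((λ x h → ∩-∈ (union V) (⋃< N V) ((let i , _ , k = ∈-⋃< N V x h in i , k) , h)) , λ x h → proj₂ (∈-∩ (union V) (⋃< N V) h))) ≈-refl) ≈-refl)) ⟩
          m (⋃< N V) - (m (union V ∩ ⋃< N V) + m V∖ - ½ℝ * ε)
            ≈⟨ +-cong ≈-refl (-‿cong (+-cong (≈-sym (mass-split μ (union V) (⋃< N V))) ≈-refl)) ⟩
          m (⋃< N V) - (m (union V) - ½ℝ * ε) ∎)
          where open ≤-Reasoning

        overlap-< : m (open-set O ∩ open-set Oᶜ) < ε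
        overlap-< = begin-strict
          m (open-set O ∩ open-set Oᶜ) ≤⟨ mass-mono μ (open-set O ∩ open-set Oᶜ) (V∖ ∪ ⋃< N W) overlap-⊆ ⟩
          m (V∖ ∪ ⋃< N W)              ≤⟨ mass-∪-≤ μ V∖ (⋃< N W) ⟩
          m V∖ + m (⋃< N W)            <⟨ +-mono-<-≤ V∖<½ε (≤-trans (mass-⋃< N W) (Σ<-mono N λ i _ → <⇒≤ (thin (s i)))) ⟩
          ½ℝ * ε + Σ< N (λ i → ½ⁿ (suc i) * (½ℝ * ε))
            ≈⟨ +-cong ≈-refl (≈-trans (Σ<-cong N λ i _ → *-comm (½ⁿ (suc i)) (½ℝ * ε)) (Σ<-*ˡ N (½ℝ * ε) (λ i → ½ⁿ (suc i)))) ⟩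
          ½ℝ * ε + ½ℝ * ε * Σ< N (λ i → ½ⁿ (suc i))
            ≤⟨ +-mono-≤ ≤-refl (*-monoˡ-≤ (<⇒≤ (half ε>0)) (≤-by (<⇒≤ (0<½ⁿ N)) (≈-trans (+-cong (≈-sym (Σ½ⁿ N)) ≈-refl)
                 (solve 2 (λ a b → (a :+ b) :- a := b) ≈-refl (Σ< N (λ i → ½ⁿ (suc i))) (½ⁿ N))))) ⟩
          ½ℝ * ε + ½ℝ * ε * 1#         ≈⟨ ≈-trans (+-cong ≈-refl (*-identityʳ (½ℝ * ε))) (½-+ ε) ⟩
          ε                            ∎
          where open ≤-Reasoning

      -- An infinite intersection of open sets need not be open, so the complement is covered by the
      -- first `N` open sets only. `N` is such that the later `V i` add less than ½ε to the union;
      -- the overlaps of the first `N` add up to at most the other ½ε.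
      sandwich-union : Sandwich (union F) ε
      sandwich-union = record
        { outer = O ; outerᶜ = Oᶜ
        ; upward = λ σ b (i , h) → i , upward (s i) σ b h
        ; upwardᶜ = λ σ b h i i<N → upwardᶜ (s i) σ b (h i i<N)
        ; covers = λ x (i , h) → let n , o = covers (s i) x h in n , i , o
        ; coversᶜ = λ x ¬h → coversAll x (λ i h → ¬h (i , h)) N
        ; thin = overlap-< }

    sandwich : ∀ A {ε} → 0# < ε → Sandwich A ε
    sandwich (basic σ) ε>0 = sandwich-basic σ ε>0
    sandwich (compl A) ε>0 = sandwich-compl A (sandwich A ε>0)
    sandwich (union F) ε>0 = sandwich-union F ε>0 λ i → sandwich (F i) (*-pos (0<½ⁿ (suc i)) (half ε>0))

    -- The part of the open set outside A lies in the thin overlap of the sandwich.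
    outer-regular : ∀ A {ε} → 0# < ε → Σ[ O ∈ (String → Set) ]
      (Upward O × (∀ x → x ∈ A → ∃[ n ] O (prefix x n)) × m (open-set O) < m A + ε)
    outer-regular A {ε} ε>0 = outer s , upward s , covers s , (begin-strict
      m U                           ≈⟨ mass-split μ U A ⟩
      m (U ∩ A) + m (U ∩ compl A)   <⟨ +-mono-≤-< (mass-mono μ (U ∩ A) A λ x h → proj₂ (∈-∩ U A h))
                                        (≤-<-trans (mass-mono μ (U ∩ compl A) (U ∩ open-set (outerᶜ s)) λ x h →
                                          let u , ¬a = ∈-∩ U (compl A) h
                                              n , o = coversᶜ s x ¬a
                                          in ∩-∈ U (open-set (outerᶜ s)) (u , open-∈ (outerᶜ s) x n o)) (thin s)) ⟩
      m A + ε                       ∎)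
      where
      open ≤-Reasoning
      s = sandwich A ε>0
      U = open-set (outer s)

-- Terms and formulas compiled to recursive functions

module RecursiveFunctions where

  ⇓-deterministic : ∀ {n} {f : Rec n} {as a b} → f [ as ]⇓ a → f [ as ]⇓ b → a ≡ b
  ⇓*-deterministic : ∀ {m n} {gs : Vec (Rec n) m} {as bs cs} →
    Pointwise (λ g b → g [ as ]⇓ b) gs bs → Pointwise (λ g b → g [ as ]⇓ b) gs cs → bs ≡ cs

  ⇓-deterministic zero zero = refl
  ⇓-deterministic succ succ = refl
  ⇓-deterministic proj proj = refl
  ⇓-deterministic (comp gs f) (comp hs k) with refl ← ⇓*-deterministic gs hs = ⇓-deterministic f k
  ⇓-deterministic (prec-zero f) (prec-zero g) = ⇓-deterministic f g
  ⇓-deterministic (prec-suc f g) (prec-suc h k) with refl ← ⇓-deterministic f h = ⇓-deterministic g k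
  ⇓-deterministic (mini {k = k} f below) (mini {k = l} g below′) with ℕₚ.<-cmp k l
  ... | tri≈ _ e _ = e
  ... | tri< k<l _ _ with () ← ⇓-deterministic f (proj₂ (below′ k k<l))
  ... | tri> _ _ l<k with () ← ⇓-deterministic g (proj₂ (below l l<k))

  ⇓*-deterministic [] [] = refl
  ⇓*-deterministic (f ∷ fs) (g ∷ gs) = cong₂ _∷_ (⇓-deterministic f g) (⇓*-deterministic fs gs)

  record Fun (n : ℕ) : Set where
    field
      apply   : Vec ℕ n → ℕ
      program : Rec n
      correct : ∀ as → program [ as ]⇓ apply as

  open Fun public

  projections : ∀ {m n} → (Fin m → Fin n) → Vec (Rec n) m
  projections f = Vec.tabulate (proj ∘ f)

  projections-⇓ : ∀ {m n} (f : Fin m → Fin n) as →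
    Pointwise (λ g b → g [ as ]⇓ b) (projections f) (Vec.tabulate (Vec.lookup as ∘ f))
  projections-⇓ {zero}  f as = []
  projections-⇓ {suc m} f as = proj ∷ projections-⇓ (f ∘ suc) as

  constᴿ : ∀ {n} → ℕ → Rec n
  constᴿ zero    = comp zero []
  constᴿ (suc k) = comp succ (constᴿ k ∷ [])

  constᴿ-⇓ : ∀ {n} k (as : Vec ℕ n) → constᴿ k [ as ]⇓ k
  constᴿ-⇓ zero    as = comp [] zero
  constᴿ-⇓ (suc k) as = comp (constᴿ-⇓ k as ∷ []) succ

  private
    #0 : ∀ {n} → Fin (suc n)
    #0 = zero
    #1 : ∀ {n} → Fin (suc (suc n))
    #1 = suc zero
    #2 : ∀ {n} → Fin (suc (suc (suc n)))
    #2 = suc (suc zero)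

  -- `prec` recurses on its first argument, which for truncated subtraction must be the subtrahend;
  -- hence the flipped order.
  addᴿ mulᴿ flipped-subᴿ : Rec 2
  addᴿ = prec (proj #0) (comp succ (proj #1 ∷ []))
  mulᴿ = prec (constᴿ 0) (comp addᴿ (proj #2 ∷ proj #1 ∷ []))
  predᴿ powᴿ : Rec 1
  predᴿ = prec (constᴿ 0) (proj #0)
  flipped-subᴿ = prec (proj #0) (comp predᴿ (proj #1 ∷ []))
  powᴿ = prec (constᴿ 1) (comp mulᴿ (constᴿ 2 ∷ proj #1 ∷ []))

  addᴿ-⇓ : ∀ x y → addᴿ [ x ∷ y ∷ [] ]⇓ x ℕ.+ y
  addᴿ-⇓ zero    y = prec-zero proj
  addᴿ-⇓ (suc x) y = prec-suc (addᴿ-⇓ x y) (comp (proj ∷ []) succ)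

  mulᴿ-⇓ : ∀ x y → mulᴿ [ x ∷ y ∷ [] ]⇓ x ℕ.* y
  mulᴿ-⇓ zero    y = prec-zero (constᴿ-⇓ 0 _)
  mulᴿ-⇓ (suc x) y = prec-suc (mulᴿ-⇓ x y) (comp (proj ∷ proj ∷ []) (addᴿ-⇓ y (x ℕ.* y)))

  predᴿ-⇓ : ∀ x → predᴿ [ x ∷ [] ]⇓ ℕ.pred x
  predᴿ-⇓ zero    = prec-zero (constᴿ-⇓ 0 _)
  predᴿ-⇓ (suc x) = prec-suc (predᴿ-⇓ x) proj

  flipped-subᴿ-⇓ : ∀ x y → flipped-subᴿ [ y ∷ x ∷ [] ]⇓ x ∸ y
  flipped-subᴿ-⇓ x zero    = prec-zero proj
  flipped-subᴿ-⇓ x (suc y) = prec-suc (flipped-subᴿ-⇓ x y)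
    (subst (comp predᴿ (proj #1 ∷ []) [ y ∷ x ∸ y ∷ x ∷ [] ]⇓_) (ℕₚ.pred[m∸n]≡m∸[1+n] x y) (comp (proj ∷ []) (predᴿ-⇓ (x ∸ y))))

  powᴿ-⇓ : ∀ x → powᴿ [ x ∷ [] ]⇓ 2 ℕ.^ x
  powᴿ-⇓ zero    = prec-zero (constᴿ-⇓ 1 _)
  powᴿ-⇓ (suc x) = prec-suc (powᴿ-⇓ x) (comp (constᴿ-⇓ 2 _ ∷ proj ∷ []) (mulᴿ-⇓ 2 (2 ℕ.^ x)))

  natrec : ℕ → (ℕ → ℕ → ℕ) → ℕ → ℕ
  natrec z s zero    = z
  natrec z s (suc k) = s k (natrec z s k)

  ∑ : ℕ → (ℕ → ℕ) → ℕ
  ∑ zero    f = 0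
  ∑ (suc n) f = ∑ n f ℕ.+ f n

  infixl 6 _⊕_ _⊖_
  infixl 7 _⊛_

  -- Programs are written as terms with a meaning in Agda, so that the correctness of `compile` is
  -- proved once and not for each program.
  data Tm (n : ℕ) : Set where
    var         : Fin n → Tm n
    lit         : ℕ → Tm n
    _⊕_ _⊛_ _⊖_ : Tm n → Tm n → Tm n
    pow         : Tm n → Tm n
    call        : ∀ {k} → Fun k → Vec (Tm n) k → Tm n
    rec         : Tm n → Tm (suc (suc n)) → Tm n → Tm n
    sum         : Tm n → Tm (suc n) → Tm n

  eval  : ∀ {n} → Tm n → Vec ℕ n → ℕ
  evals : ∀ {n k} → Vec (Tm n) k → Vec ℕ n → Vec ℕ k
  eval (var i)     ρ = Vec.lookup ρ i
  eval (lit k)     ρ = k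
  eval (t ⊕ u)     ρ = eval t ρ ℕ.+ eval u ρ
  eval (t ⊛ u)     ρ = eval t ρ ℕ.* eval u ρ
  eval (t ⊖ u)     ρ = eval t ρ ∸ eval u ρ
  eval (pow t)     ρ = 2 ℕ.^ eval t ρ
  eval (call f ts) ρ = apply f (evals ts ρ)
  eval (rec z s t) ρ = natrec (eval z ρ) (λ k a → eval s (k ∷ a ∷ ρ)) (eval t ρ)
  eval (sum t u)   ρ = ∑ (eval t ρ) (λ k → eval u (k ∷ ρ))
  evals []         ρ = []
  evals (t ∷ ts)   ρ = eval t ρ ∷ evals ts ρ

  compile  : ∀ {n} → Tm n → Rec n
  compiles : ∀ {n k} → Vec (Tm n) k → Vec (Rec n) k
  compile (var i)     = proj i
  compile (lit k)     = constᴿ k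
  compile (t ⊕ u)     = comp addᴿ (compile t ∷ compile u ∷ [])
  compile (t ⊛ u)     = comp mulᴿ (compile t ∷ compile u ∷ [])
  compile (t ⊖ u)     = comp flipped-subᴿ (compile u ∷ compile t ∷ [])
  compile (pow t)     = comp powᴿ (compile t ∷ [])
  compile (call f ts) = comp (program f) (compiles ts)
  compile (rec z s t) = comp (prec (compile z) (compile s)) (compile t ∷ projections (λ i → i))
  compile (sum t u)   = comp (prec (constᴿ 0) (comp addᴿ (proj #1 ∷ comp (compile u) (proj #0 ∷ projections (λ i → suc (suc i))) ∷ [])))
                             (compile t ∷ projections (λ i → i))
  compiles []         = []
  compiles (t ∷ ts)   = compile t ∷ compiles ts

  private
    identity-⇓ : ∀ {n} (as : Vec ℕ n) → Pointwise (λ g b → g [ as ]⇓ b) (projections (λ i → i)) as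
    identity-⇓ as = subst (Pointwise _ _) (Vecₚ.tabulate∘lookup as) (projections-⇓ (λ i → i) as)

  compile-⇓  : ∀ {n} (t : Tm n) ρ → compile t [ ρ ]⇓ eval t ρ
  compiles-⇓ : ∀ {n k} (ts : Vec (Tm n) k) ρ → Pointwise (λ g b → g [ ρ ]⇓ b) (compiles ts) (evals ts ρ)
  compile-⇓ (var i)     ρ = proj
  compile-⇓ (lit k)     ρ = constᴿ-⇓ k ρ
  compile-⇓ (t ⊕ u)     ρ = comp (compile-⇓ t ρ ∷ compile-⇓ u ρ ∷ []) (addᴿ-⇓ (eval t ρ) (eval u ρ))
  compile-⇓ (t ⊛ u)     ρ = comp (compile-⇓ t ρ ∷ compile-⇓ u ρ ∷ []) (mulᴿ-⇓ (eval t ρ) (eval u ρ))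
  compile-⇓ (t ⊖ u)     ρ = comp (compile-⇓ u ρ ∷ compile-⇓ t ρ ∷ []) (flipped-subᴿ-⇓ (eval t ρ) (eval u ρ))
  compile-⇓ (pow t)     ρ = comp (compile-⇓ t ρ ∷ []) (powᴿ-⇓ (eval t ρ))
  compile-⇓ (call f ts) ρ = comp (compiles-⇓ ts ρ) (correct f (evals ts ρ))
  compile-⇓ (rec z s t) ρ = comp (compile-⇓ t ρ ∷ identity-⇓ ρ) (go (eval t ρ))
    where
    go : ∀ k → prec (compile z) (compile s) [ k ∷ ρ ]⇓ natrec (eval z ρ) (λ k a → eval s (k ∷ a ∷ ρ)) k
    go zero    = prec-zero (compile-⇓ z ρ)
    go (suc k) = prec-suc (go k) (compile-⇓ s _)
  compile-⇓ (sum t u)   ρ = comp (compile-⇓ t ρ ∷ identity-⇓ ρ) (go (eval t ρ))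
    where
    params : ∀ k a → Pointwise (λ g b → g [ k ∷ a ∷ ρ ]⇓ b) (projections (λ i → suc (suc i))) ρ
    params k a = subst (Pointwise _ _) (Vecₚ.tabulate∘lookup ρ) (projections-⇓ (λ i → suc (suc i)) (k ∷ a ∷ ρ))
    go : ∀ k → _ [ k ∷ ρ ]⇓ ∑ k (λ k → eval u (k ∷ ρ))
    go zero    = prec-zero (constᴿ-⇓ 0 ρ)
    go (suc k) = prec-suc (go k) (comp (proj ∷ comp (proj ∷ params k _) (compile-⇓ u (k ∷ ρ)) ∷ []) (addᴿ-⇓ _ _))
  compiles-⇓ []       ρ = []
  compiles-⇓ (t ∷ ts) ρ = compile-⇓ t ρ ∷ compiles-⇓ ts ρ

  -- The meaning is replaced by a pointwise equal `f` of choice, so that later goals mention `f` and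
  -- not the unfolded recursions of the term.
  function : ∀ {n} (t : Tm n) (f : Vec ℕ n → ℕ) → (∀ as → eval t as ≡ f as) → Fun n
  function t f e = record { apply = f ; program = compile t ; correct = λ as → subst (_ [ as ]⇓_) (e as) (compile-⇓ t as) }

  -- The characteristic function is 0 where the predicate holds.

  record Pred (n : ℕ) : Set₁ where
    field
      holds : Vec ℕ n → Set
      char  : Fun n
      to    : ∀ as → apply char as ≡ 0 → holds as
      from  : ∀ as → holds as → apply char as ≡ 0

  open Pred public

  infix  5 _⊴_
  infixr 4 _∧_
  infixr 3 _∨_

  -- All quantifiers are bounded, so every formula has a total characteristic function; unbounded
  -- search is left to `mini` in `guard`.
  data Fm (n : ℕ) : Set₁ where
    _⊴_     : Tm n → Tm n → Fm n
    _∧_ _∨_ : Fm n → Fm n → Fm n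
    neg     : Fm n → Fm n
    all< ex< : Tm n → Fm (suc n) → Fm n
    atom    : ∀ {k} → Pred k → Vec (Tm n) k → Fm n

  ⟦_⟧ : ∀ {n} → Fm n → Vec ℕ n → Set
  ⟦ t ⊴ u ⟧ ρ     = eval t ρ ℕ.≤ eval u ρ
  ⟦ φ ∧ ψ ⟧ ρ     = ⟦ φ ⟧ ρ × ⟦ ψ ⟧ ρ
  ⟦ φ ∨ ψ ⟧ ρ     = ⟦ φ ⟧ ρ ⊎ ⟦ ψ ⟧ ρ
  ⟦ neg φ ⟧ ρ     = ¬ ⟦ φ ⟧ ρ
  ⟦ all< t φ ⟧ ρ  = ∀ i → i ℕ.< eval t ρ → ⟦ φ ⟧ (i ∷ ρ)
  ⟦ ex< t φ ⟧ ρ   = ∃[ i ] (i ℕ.< eval t ρ × ⟦ φ ⟧ (i ∷ ρ))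
  ⟦ atom P ts ⟧ ρ = holds P (evals ts ρ)

  χ : ∀ {n} → Fm n → Tm n
  χ (t ⊴ u)     = t ⊖ u
  χ (φ ∧ ψ)     = χ φ ⊕ χ ψ
  χ (φ ∨ ψ)     = χ φ ⊛ χ ψ
  χ (neg φ)     = lit 1 ⊖ χ φ
  χ (all< t φ)  = sum t (χ φ)
  χ (ex< t φ)   = lit 1 ⊖ sum t (lit 1 ⊖ χ φ)
  χ (atom P ts) = call (char P) ts

  ∑≡0 : ∀ n {f} → ∑ n f ≡ 0 → ∀ i → i ℕ.< n → f i ≡ 0
  ∑≡0 (suc n) {f} e i (s≤s i≤n) with ℕₚ.m≤n⇒m<n∨m≡n i≤n
  ... | inj₁ i<n  = ∑≡0 n (ℕₚ.m+n≡0⇒m≡0 (∑ n f) e) i i<n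
  ... | inj₂ refl = ℕₚ.m+n≡0⇒n≡0 (∑ n f) e

  ≡0⇒∑ : ∀ n {f} → (∀ i → i ℕ.< n → f i ≡ 0) → ∑ n f ≡ 0
  ≡0⇒∑ zero    h = refl
  ≡0⇒∑ (suc n) h = cong₂ ℕ._+_ (≡0⇒∑ n λ i i<n → h i (ℕₚ.m<n⇒m<1+n i<n)) (h n ℕₚ.≤-refl)

  ∑≢0 : ∀ n {f} → ∑ n f ≢ 0 → ∃[ i ] (i ℕ.< n × f i ≢ 0)
  ∑≢0 zero    h = ⊥-elim (h refl)
  ∑≢0 (suc n) {f} h with f n ℕₚ.≟ 0
  ... | no  k = n , ℕₚ.≤-refl , k
  ... | yes e = let i , i<n , k = ∑≢0 n {f} (λ z → h (cong₂ ℕ._+_ z e)) in i , ℕₚ.m<n⇒m<1+n i<n , k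

  private
    1∸≡0 : ∀ {n} → 1 ∸ n ≡ 0 → n ≢ 0
    1∸≡0 () refl
    ≢0⇒1∸ : ∀ {n} → n ≢ 0 → 1 ∸ n ≡ 0
    ≢0⇒1∸ {zero}  h = ⊥-elim (h refl)
    ≢0⇒1∸ {suc n} h = ℕₚ.0∸n≡0 n

  χ-to   : ∀ {n} (φ : Fm n) ρ → eval (χ φ) ρ ≡ 0 → ⟦ φ ⟧ ρ
  χ-from : ∀ {n} (φ : Fm n) ρ → ⟦ φ ⟧ ρ → eval (χ φ) ρ ≡ 0
  χ-to (t ⊴ u)     ρ e = ℕₚ.m∸n≡0⇒m≤n e
  χ-to (φ ∧ ψ)     ρ e = χ-to φ ρ (ℕₚ.m+n≡0⇒m≡0 _ e) , χ-to ψ ρ (ℕₚ.m+n≡0⇒n≡0 (eval (χ φ) ρ) e)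
  χ-to (φ ∨ ψ)     ρ e with ℕₚ.m*n≡0⇒m≡0∨n≡0 (eval (χ φ) ρ) e
  ... | inj₁ z = inj₁ (χ-to φ ρ z)
  ... | inj₂ z = inj₂ (χ-to ψ ρ z)
  χ-to (neg φ)     ρ e p = 1∸≡0 e (χ-from φ ρ p)
  χ-to (all< t φ)  ρ e i i< = χ-to φ (i ∷ ρ) (∑≡0 (eval t ρ) e i i<)
  χ-to (ex< t φ)   ρ e = let i , i< , k = ∑≢0 (eval t ρ) (1∸≡0 e) in i , i< , χ-to φ (i ∷ ρ) (zero? k)
    where
    zero? : ∀ {n} → 1 ∸ n ≢ 0 → n ≡ 0
    zero? {zero}  h = refl
    zero? {suc n} h = ⊥-elim (h (ℕₚ.0∸n≡0 n))
  χ-to (atom P ts) ρ e = to P (evals ts ρ) e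
  χ-from (t ⊴ u)     ρ p = ℕₚ.m≤n⇒m∸n≡0 p
  χ-from (φ ∧ ψ)     ρ (p , q) = cong₂ ℕ._+_ (χ-from φ ρ p) (χ-from ψ ρ q)
  χ-from (φ ∨ ψ)     ρ (inj₁ p) = cong (ℕ._* eval (χ ψ) ρ) (χ-from φ ρ p)
  χ-from (φ ∨ ψ)     ρ (inj₂ q) = trans (cong (eval (χ φ) ρ ℕ.*_) (χ-from ψ ρ q)) (ℕₚ.*-zeroʳ (eval (χ φ) ρ))
  χ-from (neg φ)     ρ p = ≢0⇒1∸ λ e → p (χ-to φ ρ e)
  χ-from (all< t φ)  ρ p = ≡0⇒∑ (eval t ρ) λ i i< → χ-from φ (i ∷ ρ) (p i i<)
  χ-from (ex< t φ)   ρ (i , i< , p) = ≢0⇒1∸ λ e → one (∑≡0 (eval t ρ) e i i<) (χ-from φ (i ∷ ρ) p)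
    where
    one : ∀ {n} → 1 ∸ n ≡ 0 → n ≢ 0
    one () refl
  χ-from (atom P ts) ρ p = from P (evals ts ρ) p

  predicate : ∀ {n} (φ : Fm n) (P : Vec ℕ n → Set) → (∀ as → ⟦ φ ⟧ as → P as) → (∀ as → P as → ⟦ φ ⟧ as) → Pred n
  predicate φ P f g = record
    { holds = P ; char = function (χ φ) (eval (χ φ)) (λ _ → refl)
    ; to = λ as e → f as (χ-to φ as e) ; from = λ as p → χ-from φ as (g as p) }

  -- The program which halts on n if φ holds of n and E halts on each of the
  -- numbers q 0 n, ..., q (k n - 1) n.
  module _ (φ : Fm 1) (k : Tm 1) (q : Tm 2) (E : Rec 1) where

    private
      guard : Rec 1
      -- The minimised function ignores its search variable: the search stops at 0 if φ holds and
      -- runs forever otherwise.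
      guard = mini (comp (compile (χ φ)) (proj #1 ∷ []))

      loop : Rec 2
      loop = prec (constᴿ 0) (comp E (comp (compile q) (proj #0 ∷ proj #2 ∷ []) ∷ []))

      guard⇓ : ∀ {n b} → guard [ n ∷ [] ]⇓ b → ⟦ φ ⟧ (n ∷ [])
      guard⇓ (mini (comp (proj ∷ []) h) _) = χ-to φ _ (⇓-deterministic (compile-⇓ (χ φ) _) h)

      ⇓guard : ∀ {n} → ⟦ φ ⟧ (n ∷ []) → guard [ n ∷ [] ]⇓ 0
      ⇓guard {n} p = mini (comp (proj ∷ []) (subst (compile (χ φ) [ n ∷ [] ]⇓_) (χ-from φ _ p) (compile-⇓ (χ φ) _))) λ i ()

      loop⇓ : ∀ {n b} j → loop [ j ∷ n ∷ [] ]⇓ b → ∀ i → i ℕ.< j → ∃[ c ] (E [ eval q (i ∷ n ∷ []) ∷ [] ]⇓ c)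
      loop⇓ {n} (suc j) (prec-suc h (comp (comp (proj ∷ proj ∷ []) g ∷ []) e)) i (s≤s i≤j) with ℕₚ.m≤n⇒m<n∨m≡n i≤j
      ... | inj₁ i<j  = loop⇓ j h i i<j
      ... | inj₂ refl = _ , subst (λ m → E [ m ∷ [] ]⇓ _) (⇓-deterministic g (compile-⇓ q (j ∷ n ∷ []))) e

      ⇓loop : ∀ {n} j → (∀ i → i ℕ.< j → ∃[ c ] (E [ eval q (i ∷ n ∷ []) ∷ [] ]⇓ c)) → ∃[ b ] (loop [ j ∷ n ∷ [] ]⇓ b)
      ⇓loop zero    h = 0 , prec-zero (constᴿ-⇓ 0 _)
      ⇓loop (suc j) h =
        let b , p = ⇓loop j (λ i i<j → h i (ℕₚ.m<n⇒m<1+n i<j))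
            c , e = h j ℕₚ.≤-refl
        in c , prec-suc p (comp (comp (proj ∷ proj ∷ []) (compile-⇓ q _) ∷ []) e)

    acceptor : Rec 1
    -- `comp` is strict, so although only the first component is returned, halting requires that the
    -- loop halts as well.
    acceptor = comp (proj #0) (guard ∷ comp loop (compile k ∷ proj #0 ∷ []) ∷ [])

    acceptor⇓ : ∀ n → ∃[ b ] (acceptor [ n ∷ [] ]⇓ b) →
      ⟦ φ ⟧ (n ∷ []) × (∀ i → i ℕ.< eval k (n ∷ []) → ∃[ c ] (E [ eval q (i ∷ n ∷ []) ∷ [] ]⇓ c))
    acceptor⇓ n (b , comp (g ∷ comp (c ∷ proj ∷ []) l ∷ []) proj)
      with refl ← ⇓-deterministic c (compile-⇓ k (n ∷ [])) = guard⇓ g , loop⇓ _ l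

    ⇓acceptor : ∀ n → ⟦ φ ⟧ (n ∷ []) → (∀ i → i ℕ.< eval k (n ∷ []) → ∃[ c ] (E [ eval q (i ∷ n ∷ []) ∷ [] ]⇓ c)) →
      ∃[ b ] (acceptor [ n ∷ [] ]⇓ b)
    ⇓acceptor n p h = 0 , comp (⇓guard p ∷ comp (compile-⇓ k _ ∷ proj ∷ []) (proj₂ (⇓loop _ h)) ∷ []) proj

-- Computable decoding of pairs, lists, rationals and elements of tests

module Decoding where

  open RecursiveFunctions public
  open import Data.Nat.Coprimality using (Coprime)
  open import Data.Nat.Divisibility using (_∣_; divides; ∣⇒≤)
  open import Data.Nat.Solver using (module +-*-Solver)

  v0 : ∀ {n} → Tm (1 ℕ.+ n)
  v0 = var zero
  v1 : ∀ {n} → Tm (2 ℕ.+ n)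
  v1 = var (suc zero)
  v2 : ∀ {n} → Tm (3 ℕ.+ n)
  v2 = var (suc (suc zero))
  v3 : ∀ {n} → Tm (4 ℕ.+ n)
  v3 = var (suc (suc (suc zero)))
  v4 : ∀ {n} → Tm (5 ℕ.+ n)
  v4 = var (suc (suc (suc (suc zero))))

  call₁ : ∀ {n} → Fun 1 → Tm n → Tm n
  call₁ f t = call f (t ∷ [])

  call₂ : ∀ {n} → Fun 2 → Tm n → Tm n → Tm n
  call₂ f t u = call f (t ∷ u ∷ [])

  -- ⌊n/2⌋ as a single primitive recursion, from the identity ⌊(n+1)/2⌋ + ⌊n/2⌋ = n.
  half : ℕ → ℕ
  half zero    = 0
  half (suc n) = n ∸ half n

  half≤ : ∀ n → half n ℕ.≤ n
  half≤ zero    = z≤n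
  half≤ (suc n) = ℕₚ.m≤n⇒m≤1+n (ℕₚ.m∸n≤m n (half n))

  half-2+ : ∀ n → half (suc (suc n)) ≡ suc (half n)
  half-2+ n = trans (ℕₚ.+-∸-assoc 1 (ℕₚ.m∸n≤m n (half n))) (cong suc (ℕₚ.m∸[m∸n]≡n (half≤ n)))

  2*suc : ∀ n → 2 ℕ.* suc n ≡ suc (suc (2 ℕ.* n))
  2*suc n = cong suc (ℕₚ.+-suc n (n ℕ.+ 0))

  half-2* : ∀ n → half (2 ℕ.* n) ≡ n
  half-2* zero    = refl
  half-2* (suc n) = trans (cong half (2*suc n)) (trans (half-2+ (2 ℕ.* n)) (cong suc (half-2* n)))

  half-1+2* : ∀ n → half (suc (2 ℕ.* n)) ≡ n
  half-1+2* zero    = refl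
  half-1+2* (suc n) = trans (cong (half ∘ suc) (2*suc n)) (trans (half-2+ (suc (2 ℕ.* n))) (cong suc (half-1+2* n)))

  odd : ℕ → ℕ
  odd n = n ∸ 2 ℕ.* half n

  odd-2* : ∀ n → odd (2 ℕ.* n) ≡ 0
  odd-2* n = trans (cong (λ h → 2 ℕ.* n ∸ 2 ℕ.* h) (half-2* n)) (ℕₚ.n∸n≡0 (2 ℕ.* n))

  odd-1+2* : ∀ n → odd (suc (2 ℕ.* n)) ≡ 1
  odd-1+2* n = trans (cong (λ h → suc (2 ℕ.* n) ∸ 2 ℕ.* h) (half-1+2* n)) (ℕₚ.m+n∸n≡m 1 (2 ℕ.* n))

  data Parity : ℕ → Set where
    is-even : ∀ n → Parity (2 ℕ.* n)
    is-odd  : ∀ n → Parity (suc (2 ℕ.* n))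

  parity : ∀ n → Parity n
  parity zero    = is-even 0
  parity (suc n) with parity n
  ... | is-even k = is-odd k
  ... | is-odd k  = subst Parity (2*suc k) (is-even (suc k))

  halfF : Fun 1
  halfF = function (rec (lit 0) (v0 ⊖ v1) v0) (λ { (n ∷ []) → half n }) λ { (n ∷ []) → go n }
    where
    go : ∀ n → natrec 0 (λ k a → k ∸ a) n ≡ half n
    go zero    = refl
    go (suc n) = cong (n ∸_) (go n)

  halves : ℕ → ℕ → ℕ
  halves m zero    = m
  halves m (suc i) = half (halves m i)

  halvesF : Fun 2
  halvesF = function (rec v0 (call₁ halfF v1) v1) (λ { (m ∷ i ∷ []) → halves m i }) λ { (m ∷ i ∷ []) → go m i }
    where
    go : ∀ m i → natrec m (λ _ a → half a) i ≡ halves m i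
    go m zero    = refl
    go m (suc i) = cong half (go m i)

  halves-2^ : ∀ i m → halves (2 ℕ.^ i ℕ.* m) i ≡ m
  halves-half : ∀ m i → halves m (suc i) ≡ halves (half m) i
  halves-half m zero    = refl
  halves-half m (suc i) = cong half (halves-half m i)
  halves-2^ zero    m = ℕₚ.+-identityʳ m
  halves-2^ (suc i) m = trans (halves-half _ i) (trans (cong (λ k → halves k i)
    (trans (cong half (ℕₚ.*-assoc 2 (2 ℕ.^ i) m)) (half-2* (2 ℕ.^ i ℕ.* m)))) (halves-2^ i m))

  infix 5 _≐ᵗ_
  _≐ᵗ_ : ∀ {n} → Tm n → Tm n → Fm n
  t ≐ᵗ u = (t ⊴ u) ∧ (u ⊴ t)

  private
    divides-F : Fm 2
    divides-F = ex< (v1 ⊕ lit 1) (v0 ⊛ pow (v1 ⊕ lit 1) ≐ᵗ v2)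

    -- The exponent of 2 in n, as the number of i < n such that 2^(i+1) divides n; the
    -- characteristic function of the negation is 1 exactly at these i.
    leftT : Tm 1
    leftT = sum v0 (χ (neg divides-F))

  opaque
    left : ℕ → ℕ
    left n = eval leftT (n ∷ [])

    left-def : ∀ n → eval leftT (n ∷ []) ≡ left n
    left-def n = refl

    left-0 : left 0 ≡ 0
    left-0 = refl

  leftF : Fun 1
  leftF = function leftT (λ { (n ∷ []) → left n }) λ { (n ∷ []) → left-def n }

  opaque
    right : ℕ → ℕ
    right n = half (halves n (left n))

    right-def : ∀ n → half (halves n (left n)) ≡ right n
    right-def n = refl

    right-0 : right 0 ≡ 0
    right-0 = cong (λ k → half (halves 0 k)) left-0

  rightF : Fun 1
  rightF = function (call₁ halfF (call₂ halvesF v0 (call₁ leftF v0))) (λ { (n ∷ []) → right n }) λ { (n ∷ []) → right-def n }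

  ∑-initial : ∀ n a f → a ℕ.≤ n → (∀ i → i ℕ.< a → f i ≡ 1) → (∀ i → a ℕ.≤ i → f i ≡ 0) → ∑ n f ≡ a
  ∑-initial n a f a≤n h k = above (ℕₚ.≤⇒≤′ a≤n)
    where
    below : ∀ n → n ℕ.≤ a → ∑ n f ≡ n
    below zero    _ = refl
    below (suc n) l = trans (cong₂ ℕ._+_ (below n (ℕₚ.<⇒≤ l)) (h n l)) (ℕₚ.+-comm n 1)
    above : ∀ {n} → a ℕ.≤′ n → ∑ n f ≡ a
    above (ℕ.≤′-reflexive refl) = below a ℕₚ.≤-refl
    above (ℕ.≤′-step {n} p) = trans (cong₂ ℕ._+_ (above p) (k n (ℕₚ.≤′⇒≤ p))) (ℕₚ.+-identityʳ a)

  a<2^a : ∀ a → a ℕ.< 2 ℕ.^ a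
  a<2^a zero    = s≤s z≤n
  a<2^a (suc a) = subst (suc (suc a) ℕ.≤_) (cong (2 ℕ.^ a ℕ.+_) (sym (ℕₚ.+-identityʳ (2 ℕ.^ a))))
    (ℕₚ.+-mono-≤ (ℕₚ.≤-trans (s≤s z≤n) (a<2^a a)) (a<2^a a))

  1≤2^ : ∀ a → 1 ℕ.≤ 2 ℕ.^ a
  1≤2^ a = ℕₚ.≤-trans (s≤s z≤n) (a<2^a a)

  a<codePair : ∀ a b → a ℕ.< codePair a b
  a<codePair a b = ℕₚ.≤-trans (a<2^a a) (ℕₚ.≤-trans (ℕₚ.≤-reflexive (sym (ℕₚ.*-identityʳ (2 ℕ.^ a)))) (ℕₚ.*-monoʳ-≤ (2 ℕ.^ a) (s≤s z≤n)))

  b<codePair : ∀ a b → b ℕ.< codePair a b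
  b<codePair a b = ℕₚ.≤-trans (s≤s (ℕₚ.m≤m+n b (b ℕ.+ 0))) (ℕₚ.≤-trans (ℕₚ.≤-reflexive (sym (ℕₚ.+-identityʳ (suc (2 ℕ.* b)))))
    (ℕₚ.*-monoˡ-≤ (suc (2 ℕ.* b)) (1≤2^ a)))

  1≤codePair : ∀ a b → 1 ℕ.≤ codePair a b
  1≤codePair a b = ℕₚ.≤-trans (s≤s z≤n) (a<codePair a b)

  2^i+1∣ : ∀ i a b → i ℕ.< a → codePair a b ≡ (2 ℕ.^ (a ∸ suc i) ℕ.* suc (2 ℕ.* b)) ℕ.* 2 ℕ.^ suc i
  2^i+1∣ i a b i<a = begin-equality
    2 ℕ.^ a ℕ.* s                              ≡⟨ cong (λ k → 2 ℕ.^ k ℕ.* s) (sym (ℕₚ.m+[n∸m]≡n i<a)) ⟩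
    2 ℕ.^ (suc i ℕ.+ (a ∸ suc i)) ℕ.* s        ≡⟨ cong (ℕ._* s) (ℕₚ.^-distribˡ-+-* 2 (suc i) (a ∸ suc i)) ⟩
    2 ℕ.^ suc i ℕ.* 2 ℕ.^ (a ∸ suc i) ℕ.* s    ≡⟨ ℕₚ.*-assoc (2 ℕ.^ suc i) (2 ℕ.^ (a ∸ suc i)) s ⟩
    2 ℕ.^ suc i ℕ.* (2 ℕ.^ (a ∸ suc i) ℕ.* s)  ≡⟨ ℕₚ.*-comm (2 ℕ.^ suc i) _ ⟩
    2 ℕ.^ (a ∸ suc i) ℕ.* s ℕ.* 2 ℕ.^ suc i    ∎
    where
    open ℕₚ.≤-Reasoning
    s = suc (2 ℕ.* b)

  -- Cancelling 2^a would make the odd number 2b + 1 even.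
  2^i+1∤ : ∀ i a b c → a ℕ.≤ i → c ℕ.* 2 ℕ.^ suc i ≢ codePair a b
  2^i+1∤ i a b c a≤i e = 1≢0 (trans (sym (odd-1+2* b)) (trans (cong odd (ℕₚ.*-cancelˡ-≡ (suc (2 ℕ.* b)) (2 ℕ.* (c ℕ.* 2 ℕ.^ (i ∸ a))) (2 ℕ.^ a) {{ℕₚ.m^n≢0 2 a}}
    (trans (sym e) eq))) (odd-2* (c ℕ.* 2 ℕ.^ (i ∸ a)))))
    where
    1≢0 : 1 ≢ 0
    1≢0 ()
    open ℕₚ.≤-Reasoning
    eq : c ℕ.* 2 ℕ.^ suc i ≡ 2 ℕ.^ a ℕ.* (2 ℕ.* (c ℕ.* 2 ℕ.^ (i ∸ a)))
    eq = begin-equality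
      c ℕ.* (2 ℕ.* 2 ℕ.^ i)                              ≡⟨ cong (λ k → c ℕ.* (2 ℕ.* 2 ℕ.^ k)) (sym (ℕₚ.m+[n∸m]≡n a≤i)) ⟩
      c ℕ.* (2 ℕ.* 2 ℕ.^ (a ℕ.+ (i ∸ a)))                ≡⟨ cong (λ k → c ℕ.* (2 ℕ.* k)) (ℕₚ.^-distribˡ-+-* 2 a (i ∸ a)) ⟩
      c ℕ.* (2 ℕ.* (2 ℕ.^ a ℕ.* 2 ℕ.^ (i ∸ a)))          ≡⟨ solve 3 (λ c x y → c :* (con 2 :* (x :* y)) := x :* (con 2 :* (c :* y))) refl c (2 ℕ.^ a) (2 ℕ.^ (i ∸ a)) ⟩
      2 ℕ.^ a ℕ.* (2 ℕ.* (c ℕ.* 2 ℕ.^ (i ∸ a)))          ∎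
      where open +-*-Solver

  opaque
    unfolding left right

    left-codePair : ∀ a b → left (codePair a b) ≡ a
    left-codePair a b = ∑-initial n a _ (ℕₚ.<⇒≤ (a<codePair a b))
      (λ i i<a → one (χ-from divides-F (i ∷ n ∷ []) (c i , c< i i<a , ℕₚ.≤-reflexive (sym (2^i+1′ i i<a)) , ℕₚ.≤-reflexive (2^i+1′ i i<a))))
      (λ i a≤i → χ-from (neg divides-F) (i ∷ n ∷ []) λ (c , _ , l , g) → 2^i+1∤ i a b c a≤i (trans (cong (λ k → c ℕ.* 2 ℕ.^ k) (ℕₚ.+-comm 1 i)) (ℕₚ.≤-antisym l g)))
      where
      n : ℕ
      n = codePair a b
      c : ℕ → ℕ
      c i = 2 ℕ.^ (a ∸ suc i) ℕ.* suc (2 ℕ.* b)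
      2^i+1′ : ∀ i → i ℕ.< a → n ≡ c i ℕ.* 2 ℕ.^ (i ℕ.+ 1)
      2^i+1′ i i<a = trans (2^i+1∣ i a b i<a) (cong (λ k → c i ℕ.* 2 ℕ.^ k) (ℕₚ.+-comm 1 i))
      c< : ∀ i → i ℕ.< a → c i ℕ.< n ℕ.+ 1
      c< i i<a = subst (c i ℕ.<_) (ℕₚ.+-comm 1 n) (s≤s (subst (c i ℕ.≤_) (sym (2^i+1∣ i a b i<a))
        (ℕₚ.≤-trans (ℕₚ.≤-reflexive (sym (ℕₚ.*-identityʳ (c i)))) (ℕₚ.*-monoʳ-≤ (c i) (1≤2^ (suc i))))))
      one : ∀ {k} → k ≡ 0 → 1 ∸ k ≡ 1
      one refl = refl

    right-codePair : ∀ a b → right (codePair a b) ≡ b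
    right-codePair a b = trans (cong (λ k → half (halves (codePair a b) k)) (left-codePair a b))
      (trans (cong half (halves-2^ a (suc (2 ℕ.* b)))) (half-1+2* b))

  codePair-surjective : ∀ n → 1 ℕ.≤ n → ∃[ a ] ∃[ b ] (n ≡ codePair a b)
  codePair-surjective n = go n n ℕₚ.≤-refl
    where
    go : ∀ fuel n → n ℕ.≤ fuel → 1 ℕ.≤ n → ∃[ a ] ∃[ b ] (n ≡ codePair a b)
    go (suc fuel) n n≤ 1≤n with parity n
    ... | is-odd b  = 0 , b , sym (ℕₚ.+-identityʳ (suc (2 ℕ.* b)))
    ... | is-even (suc k) =
      let a , b , e = go fuel (suc k) (ℕₚ.≤-pred (ℕₚ.≤-trans (s≤s (s≤s (ℕₚ.m≤m+n k (k ℕ.+ 0)))) (ℕₚ.≤-trans (ℕₚ.≤-reflexive (sym (2*suc k))) n≤))) (s≤s z≤n)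
      in suc a , b , trans (cong (2 ℕ.*_) e) (sym (ℕₚ.*-assoc 2 (2 ℕ.^ a) (suc (2 ℕ.* b))))
    go zero zero z≤n ()

  pair-η : ∀ n → 1 ℕ.≤ n → n ≡ codePair (left n) (right n)
  pair-η n 1≤n with codePair-surjective n 1≤n
  ... | a , b , refl = cong₂ codePair (sym (left-codePair a b)) (sym (right-codePair a b))

  right< : ∀ n → 1 ℕ.≤ n → right n ℕ.< n
  right< n 1≤n = subst (right n ℕ.<_) (sym (pair-η n 1≤n)) (b<codePair (left n) (right n))

  tails : ℕ → ℕ → ℕ
  tails c zero    = c
  tails c (suc i) = right (tails c i)

  tailsF : Fun 2
  tailsF = function (rec v0 (call₁ rightF v1) v1) (λ { (c ∷ i ∷ []) → tails c i }) λ { (c ∷ i ∷ []) → go c i }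
    where
    go : ∀ c i → natrec c (λ _ a → right a) i ≡ tails c i
    go c zero    = refl
    go c (suc i) = cong right (go c i)

  entry : ℕ → ℕ → ℕ
  entry c i = left (tails c i)

  entryF : Fun 2
  entryF = function (call₁ leftF (call₂ tailsF v0 v1)) (λ { (c ∷ i ∷ []) → entry c i }) λ { (c ∷ i ∷ []) → refl }

  tails-right : ∀ c i → tails c (suc i) ≡ tails (right c) i
  tails-right c zero    = refl
  tails-right c (suc i) = cong right (tails-right c i)

  module _ {A : Set} (code : A → ℕ) where

    tails-codeList : ∀ l i → tails (codeList code l) i ≡ codeList code (drop i l)
    tails-codeList []      zero    = refl
    tails-codeList []      (suc i) = trans (cong right (tails-codeList [] i)) (trans (cong (right ∘ codeList code) (drop-[] i)) right-0)
      where
      drop-[] : ∀ i → drop i ([] {A = A}) ≡ []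
      drop-[] zero    = refl
      drop-[] (suc i) = refl
    tails-codeList (a ∷ l) zero    = refl
    tails-codeList (a ∷ l) (suc i) = trans (tails-right (codeList code (a ∷ l)) i)
      (trans (cong (λ c → tails c i) (right-codePair (code a) (codeList code l))) (tails-codeList l i))

    entry-codeList : ∀ l i {a r} → drop i l ≡ a ∷ r → entry (codeList code l) i ≡ code a
    entry-codeList l i {a} {r} e = trans (cong left (trans (tails-codeList l i) (cong (codeList code) e))) (left-codePair (code a) (codeList code r))

    length≤codeList : ∀ l → length l ℕ.≤ codeList code l
    length≤codeList []      = z≤n
    length≤codeList (a ∷ l) = ℕₚ.≤-trans (s≤s (length≤codeList l)) (b<codePair (code a) (codeList code l))

    1≤codeList⇒ : ∀ l → 1 ℕ.≤ codeList code l → ∃[ a ] ∃[ r ] (l ≡ a ∷ r)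
    1≤codeList⇒ (a ∷ l) _ = a , l , refl

    1≤tails⇒ : ∀ l i → 1 ℕ.≤ tails (codeList code l) i → ∃[ a ] ∃[ r ] (drop i l ≡ a ∷ r)
    1≤tails⇒ l i h = 1≤codeList⇒ (drop i l) (subst (1 ℕ.≤_) (tails-codeList l i) h)

    ⇒1≤tails : ∀ l i → i ℕ.< length l → 1 ℕ.≤ tails (codeList code l) i
    ⇒1≤tails l i h = subst (1 ℕ.≤_) (sym (tails-codeList l i)) (go l i h)
      where
      go : ∀ l i → i ℕ.< length l → 1 ℕ.≤ codeList code (drop i l)
      go (a ∷ l) zero    _       = 1≤codePair (code a) (codeList code l)
      go (a ∷ l) (suc i) (s≤s h) = go l i h

  -- Only the empty list has code 0, and `tails` stays 0 from there on because `right 0` is 0. So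
  -- the length is the first index at which `tails` vanishes.
  IsLength : ℕ → ℕ → Set
  IsLength c k = tails c k ℕ.≤ 0 × (∀ i → i ℕ.< k → 1 ℕ.≤ tails c i)

  IsLengthP : Pred 2
  IsLengthP = predicate ((call₂ tailsF v0 v1 ⊴ lit 0) ∧ all< v1 (lit 1 ⊴ call₂ tailsF v1 v0))
    (λ { (c ∷ k ∷ []) → IsLength c k }) (λ { (c ∷ k ∷ []) h → h }) (λ { (c ∷ k ∷ []) h → h })

  module _ {A : Set} (code : A → ℕ) where

    isLength-codeList : ∀ l → IsLength (codeList code l) (length l)
    isLength-codeList l = ℕₚ.≤-reflexive (trans (tails-codeList code l (length l)) (cong (codeList code) (drop-all l))) , λ i → ⇒1≤tails code l i
      where
      drop-all : ∀ (l : List A) → drop (length l) l ≡ []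
      drop-all []      = refl
      drop-all (a ∷ l) = drop-all l

    codeList-isLength : ∀ l {k} → IsLength (codeList code l) k → length l ≡ k
    codeList-isLength l {k} (e , h) with ℕₚ.<-cmp (length l) k
    ... | tri≈ _ eq _ = eq
    ... | tri< l<k _ _ = ⊥-elim (ℕₚ.<⇒≱ (h (length l) l<k) (proj₁ (isLength-codeList l)))
    ... | tri> _ _ k<l = ⊥-elim (ℕₚ.<⇒≱ (⇒1≤tails code l k k<l) e)

  -- the number with a given binary expansion, most significant bit first

  number : String → ℕ
  number = List.foldl (λ a b → 2 ℕ.* a ℕ.+ codeBool b) 0

  number-∷ʳ : ∀ σ b → number (σ ∷ʳ b) ≡ 2 ℕ.* number σ ℕ.+ codeBool b
  number-∷ʳ σ b = Listₚ.foldl-∷ʳ (λ a b → 2 ℕ.* a ℕ.+ codeBool b) 0 b σ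

  -- `number` computed from the code of a string, for its first k bits.
  horner : ℕ → ℕ → ℕ
  horner c zero    = 0
  horner c (suc k) = 2 ℕ.* horner c k ℕ.+ entry c k

  hornerF : Fun 2
  hornerF = function (rec (lit 0) (lit 2 ⊛ v1 ⊕ call₂ entryF v2 v0) v1) (λ { (c ∷ k ∷ []) → horner c k }) λ { (c ∷ k ∷ []) → go c k }
    where
    go : ∀ c k → natrec 0 (λ i a → 2 ℕ.* a ℕ.+ entry c i) k ≡ horner c k
    go c zero    = refl
    go c (suc k) = cong (λ h → 2 ℕ.* h ℕ.+ entry c k) (go c k)

  codeString : String → ℕ
  codeString = codeList codeBool

  take-suc : ∀ k (σ : String) → k ℕ.< length σ → ∃[ b ] ∃[ r ] (drop k σ ≡ b ∷ r × take (suc k) σ ≡ take k σ ∷ʳ b)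
  take-suc zero    (b ∷ σ) _       = b , σ , refl , refl
  take-suc (suc k) (c ∷ σ) (s≤s h) = let b , r , e , f = take-suc k σ h in b , r , e , cong (c ∷_) f

  horner-codeString : ∀ σ k → k ℕ.≤ length σ → horner (codeString σ) k ≡ number (take k σ)
  horner-codeString σ zero    h = refl
  horner-codeString σ (suc k) h =
    let b , r , e , f = take-suc k σ h
    in trans (cong₂ (λ a x → 2 ℕ.* a ℕ.+ x) (horner-codeString σ k (ℕₚ.<⇒≤ h)) (entry-codeList codeBool σ k e))
         (trans (sym (number-∷ʳ (take k σ) b)) (cong number (sym f)))

  take-length : ∀ (σ : String) → take (length σ) σ ≡ σ
  take-length []      = refl
  take-length (b ∷ σ) = cong (b ∷_) (take-length σ)

  horner-length : ∀ σ → horner (codeString σ) (length σ) ≡ number σ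
  horner-length σ = trans (horner-codeString σ (length σ) ℕₚ.≤-refl) (cong number (take-length σ))

  half-number : ∀ σ b → half (number (σ ∷ʳ b)) ≡ number σ
  half-number σ false = trans (cong half (trans (number-∷ʳ σ false) (ℕₚ.+-identityʳ _))) (half-2* (number σ))
  half-number σ true  = trans (cong half (trans (number-∷ʳ σ true) (ℕₚ.+-comm _ 1))) (half-1+2* (number σ))

  -- N ≤ q D, for q given by its code
  AtMost : ℕ → ℕ → ℕ → Set
  AtMost N D q = odd (left q) ℕ.≤ 0 × N ℕ.* suc (right q) ℕ.≤ half (left q) ℕ.* D

  oddF : Fun 1
  oddF = function (v0 ⊖ lit 2 ⊛ call₁ halfF v0) (λ { (n ∷ []) → odd n }) λ { (n ∷ []) → refl }

  AtMostP : Pred 3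
  AtMostP = predicate ((call₁ oddF (call₁ leftF v2) ⊴ lit 0) ∧ (v0 ⊛ (lit 1 ⊕ call₁ rightF v2) ⊴ call₁ halfF (call₁ leftF v2) ⊛ v1))
    (λ { (N ∷ D ∷ q ∷ []) → AtMost N D q }) (λ { (N ∷ D ∷ q ∷ []) h → h }) (λ { (N ∷ D ∷ q ∷ []) h → h })

  AtMost-pos : ∀ N D q {n} → ℚ.↥ q ≡ + n → (AtMost N D (codeℚ q) → N ℕ.* ℚ.↧ₙ q ℕ.≤ n ℕ.* D) × (N ℕ.* ℚ.↧ₙ q ℕ.≤ n ℕ.* D → AtMost N D (codeℚ q))
  AtMost-pos N D q {n} e = (λ (_ , h) → subst₂ ℕ._≤_ (cong (N ℕ.*_) den) (cong (ℕ._* D) num) h) ,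
    λ h → ℕₚ.≤-reflexive (trans (cong odd z) (odd-2* n)) , subst₂ ℕ._≤_ (cong (N ℕ.*_) (sym den)) (cong (ℕ._* D) (sym num)) h
    where
    z : left (codeℚ q) ≡ 2 ℕ.* n
    z = trans (left-codePair (codeℤ (ℚ.↥ q)) (ℚ.denominator-1 q)) (cong codeℤ e)
    num : half (left (codeℚ q)) ≡ n
    num = trans (cong half z) (half-2* n)
    den : suc (right (codeℚ q)) ≡ ℚ.↧ₙ q
    den = cong suc (right-codePair (codeℤ (ℚ.↥ q)) (ℚ.denominator-1 q))

  AtMost-neg : ∀ N D q {n} → ℚ.↥ q ≡ -[1+ n ] → ¬ AtMost N D (codeℚ q)
  AtMost-neg N D q {n} e (h , _) = ℕₚ.<⇒≱ (s≤s z≤n) (subst (ℕ._≤ 0) (trans (cong odd z) (odd-1+2* n)) h)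
    where
    z : left (codeℚ q) ≡ suc (2 ℕ.* n)
    z = trans (left-codePair (codeℤ (ℚ.↥ q)) (ℚ.denominator-1 q)) (cong codeℤ e)

  -- A `ℚ` carries a proof that it is in lowest terms, so codes of rationals are recognised only
  -- together with coprimality. A common divisor of n and d + 1 and its two cofactors are all below
  -- 2 + n + d unless the divisor or a cofactor is trivially excluded, so a bounded search decides
  -- it.
  CoprimeP : Pred 2
  CoprimeP = predicate formula (λ { (n ∷ d ∷ []) → Coprime n (suc d) })
    (λ { (n ∷ d ∷ []) h (divides j p , divides k q) → coprime n d h _ j k p q })
    λ { (n ∷ d ∷ []) c i _ j _ k _ → decide n d c i j k }
    where
    bound₀ : Tm 2
    bound₀ = lit 2 ⊕ v0 ⊕ v1
    bound₁ : Tm 3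
    bound₁ = lit 2 ⊕ v1 ⊕ v2
    bound₂ : Tm 4
    bound₂ = lit 2 ⊕ v2 ⊕ v3
    formula : Fm 2
    formula = all< bound₀ (all< bound₁ (all< bound₂ (neg ((v1 ⊛ v2 ≐ᵗ v3) ∧ (v0 ⊛ v2 ≐ᵗ lit 1 ⊕ v4)) ∨ (v2 ⊴ lit 1))))
    coprime : ∀ n d → ⟦ formula ⟧ (n ∷ d ∷ []) → ∀ i j k → n ≡ j ℕ.* i → suc d ≡ k ℕ.* i → i ≡ 1
    coprime n d h zero    j k p q = ⊥-elim (ℕₚ.1+n≢0 (trans q (ℕₚ.*-zeroʳ k)))
    coprime n d h (suc i) j k p q = conclude
      (h (suc i) (below₂ (ℕₚ.≤-trans (ℕₚ.m≤n*m (suc i) k {{ℕ.≢-nonZero k≢0}}) (ℕₚ.≤-reflexive (sym q))))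
         j (below₁ (ℕₚ.≤-trans (ℕₚ.m≤m*n j (suc i)) (ℕₚ.≤-reflexive (sym p))))
         k (below₂ (ℕₚ.≤-trans (ℕₚ.m≤m*n k (suc i)) (ℕₚ.≤-reflexive (sym q)))))
      where
      k≢0 : k ≢ 0
      k≢0 refl = ℕₚ.1+n≢0 q
      below₁ : ∀ {x} → x ℕ.≤ n → x ℕ.< 2 ℕ.+ n ℕ.+ d
      below₁ x≤n = s≤s (ℕₚ.≤-trans x≤n (ℕₚ.≤-trans (ℕₚ.m≤m+n n d) (ℕₚ.n≤1+n (n ℕ.+ d))))
      below₂ : ∀ {x} → x ℕ.≤ suc d → x ℕ.< 2 ℕ.+ n ℕ.+ d
      below₂ x≤d = s≤s (ℕₚ.≤-trans x≤d (s≤s (ℕₚ.m≤n+m d n)))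
      conclude : ¬ ((j ℕ.* suc i ℕ.≤ n × n ℕ.≤ j ℕ.* suc i) × (k ℕ.* suc i ℕ.≤ suc d × suc d ℕ.≤ k ℕ.* suc i)) ⊎ suc i ℕ.≤ 1 → suc i ≡ 1
      conclude (inj₂ i≤0) = cong suc (ℕₚ.n≤0⇒n≡0 (ℕₚ.≤-pred i≤0))
      conclude (inj₁ ¬e)  = ⊥-elim (¬e ((ℕₚ.≤-reflexive (sym p) , ℕₚ.≤-reflexive p) , ℕₚ.≤-reflexive (sym q) , ℕₚ.≤-reflexive q))
    decide : ∀ n d → Coprime n (suc d) → ∀ i j k →
      ¬ ((j ℕ.* i ℕ.≤ n × n ℕ.≤ j ℕ.* i) × (k ℕ.* i ℕ.≤ suc d × suc d ℕ.≤ k ℕ.* i)) ⊎ i ℕ.≤ 1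
    decide n d c i j k with i ℕₚ.≤? 1
    ... | yes i≤1 = inj₂ i≤1
    ... | no  i≰1 = inj₁ λ ((p , q) , (r , s)) → i≰1 (ℕₚ.≤-reflexive
      (c (divides j (ℕₚ.≤-antisym q p) , divides k (ℕₚ.≤-antisym s r))))

  -- `half (1 + left c)` is the absolute value of the numerator. In `IsElement` the code of the list
  -- bounds its length, so quantifying below the code reaches every entry.
  IsRational IsInterval IsCondition IsElement : ℕ → Set
  IsRational c = 1 ℕ.≤ c × Coprime (half (1 ℕ.+ left c)) (suc (right c))
  IsInterval c = 1 ℕ.≤ c × IsRational (left c) × IsRational (right c)
  IsCondition c = 1 ℕ.≤ c × IsInterval (left c) × IsRational (right c)
  IsElement c = 1 ℕ.≤ c × (∀ i → i ℕ.< left c → tails (left c) i ℕ.≤ 0 ⊎ IsCondition (entry (left c) i)) ×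
    1 ℕ.≤ right c × IsInterval (left (right c)) × IsRational (right (right c)) × odd (left (right (right c))) ℕ.≤ 0

  IsRationalP IsIntervalP IsConditionP IsElementP : Pred 1
  IsRationalP = predicate ((lit 1 ⊴ v0) ∧ atom CoprimeP (call₁ halfF (lit 1 ⊕ call₁ leftF v0) ∷ call₁ rightF v0 ∷ []))
    (λ { (c ∷ []) → IsRational c }) (λ { (c ∷ []) h → h }) (λ { (c ∷ []) h → h })
  IsIntervalP = predicate ((lit 1 ⊴ v0) ∧ atom IsRationalP (call₁ leftF v0 ∷ []) ∧ atom IsRationalP (call₁ rightF v0 ∷ []))
    (λ { (c ∷ []) → IsInterval c }) (λ { (c ∷ []) h → h }) (λ { (c ∷ []) h → h })
  IsConditionP = predicate ((lit 1 ⊴ v0) ∧ atom IsIntervalP (call₁ leftF v0 ∷ []) ∧ atom IsRationalP (call₁ rightF v0 ∷ []))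
    (λ { (c ∷ []) → IsCondition c }) (λ { (c ∷ []) h → h }) (λ { (c ∷ []) h → h })
  IsElementP = predicate ((lit 1 ⊴ v0) ∧
      all< (call₁ leftF v0) ((call₂ tailsF (call₁ leftF v1) v0 ⊴ lit 0) ∨ atom IsConditionP (call₂ entryF (call₁ leftF v1) v0 ∷ [])) ∧
      (lit 1 ⊴ call₁ rightF v0) ∧ atom IsIntervalP (call₁ leftF (call₁ rightF v0) ∷ []) ∧
      atom IsRationalP (call₁ rightF (call₁ rightF v0) ∷ []) ∧ (call₁ oddF (call₁ leftF (call₁ rightF (call₁ rightF v0))) ⊴ lit 0))
    (λ { (c ∷ []) → IsElement c }) (λ { (c ∷ []) h → h }) (λ { (c ∷ []) h → h })

  half-suc-codeℤ : ∀ z → half (suc (codeℤ z)) ≡ ℤ.∣ z ∣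
  half-suc-codeℤ (+ n)    = half-1+2* n
  half-suc-codeℤ -[1+ n ] = trans (cong half (sym (2*suc n))) (half-2* (suc n))

  isRational : ∀ q → IsRational (codeℚ q)
  isRational (mkℚ z d c) = 1≤codePair (codeℤ z) d , λ {i} h → Coprimality.recompute c {i}
    (subst₂ (λ a b → i ∣ a × i ∣ suc b) (trans (cong (half ∘ suc) (left-codePair (codeℤ z) d)) (half-suc-codeℤ z)) (right-codePair (codeℤ z) d) h)

  codeCondition : Interval × ℚ → ℕ
  codeCondition = code× codeInterval codeℚ

  codeConditions : List (Interval × ℚ) → ℕ
  codeConditions = codeList codeCondition

  isInterval : ∀ J → IsInterval (codeInterval J)
  isInterval (u , v) = 1≤codePair (codeℚ u) (codeℚ v) ,
    subst IsRational (sym (left-codePair (codeℚ u) (codeℚ v))) (isRational u) ,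
    subst IsRational (sym (right-codePair (codeℚ u) (codeℚ v))) (isRational v)

  isCondition : ∀ c → IsCondition (codeCondition c)
  isCondition (J , q) = 1≤codePair (codeInterval J) (codeℚ q) ,
    subst IsInterval (sym (left-codePair (codeInterval J) (codeℚ q))) (isInterval J) ,
    subst IsRational (sym (right-codePair (codeInterval J) (codeℚ q))) (isRational q)

  isElement : ∀ e → IsElement (codeUniformElement e)
  isElement (conds , J , q , 0≤q) =
      1≤codePair (codeConditions conds) r
    , (λ i _ → subst (λ l → tails l i ℕ.≤ 0 ⊎ IsCondition (entry l i)) (sym (left-codePair (codeConditions conds) r)) (conditions i))
    , subst (1 ℕ.≤_) (sym (right-codePair (codeConditions conds) r)) (1≤codePair (codeInterval J) (codeℚ q))
    , subst IsInterval (sym (trans (cong left (right-codePair (codeConditions conds) r)) (left-codePair (codeInterval J) (codeℚ q)))) (isInterval J)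
    , subst IsRational (sym rr) (isRational q)
    , ℕₚ.≤-reflexive (trans (cong (odd ∘ left) rr) (trans (cong odd (left-codePair (codeℤ (ℚ.↥ q)) (ℚ.denominator-1 q))) (nonneg q (ℚ.nonNegative 0≤q))))
    where
    r : ℕ
    r = codePair (codeInterval J) (codeℚ q)
    rr : right (right (codeUniformElement (conds , J , q , 0≤q))) ≡ codeℚ q
    rr = trans (cong right (right-codePair (codeConditions conds) r)) (right-codePair (codeInterval J) (codeℚ q))
    nonneg : ∀ q → ℚ.NonNegative q → odd (codeℤ (ℚ.↥ q)) ≡ 0
    nonneg (mkℚ (+ n) _ _) _ = odd-2* n
    conditions : ∀ i → tails (codeConditions conds) i ℕ.≤ 0 ⊎ IsCondition (entry (codeConditions conds) i)
    conditions i with drop i conds in eq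
    ... | []    = inj₁ (ℕₚ.≤-reflexive (trans (tails-codeList codeCondition conds i) (cong codeConditions eq)))
    ... | c ∷ _ = inj₂ (subst IsCondition (sym (entry-codeList codeCondition conds i eq)) (isCondition c))

  decodeℤ : ∀ n → ∃[ z ] (codeℤ z ≡ n)
  decodeℤ n with parity n
  ... | is-even k = + k , refl
  ... | is-odd k  = -[1+ k ] , refl

  decodeℚ : ∀ c → IsRational c → ∃[ q ] (codeℚ q ≡ c)
  decodeℚ c (1≤c , coprime) =
    let z , e = decodeℤ (left c)
    in mkℚ z (right c) (subst (λ a → Coprime a (suc (right c))) (trans (cong (half ∘ suc) (sym e)) (half-suc-codeℤ z)) coprime) ,
       trans (cong (λ a → codePair a (right c)) e) (sym (pair-η c 1≤c))

  decodePair : ∀ {A B : Set} (codeA : A → ℕ) (codeB : B → ℕ) c → 1 ℕ.≤ c →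
    ∃[ a ] (codeA a ≡ left c) → ∃[ b ] (codeB b ≡ right c) → ∃[ p ] (code× codeA codeB p ≡ c)
  decodePair codeA codeB c 1≤c (a , e) (b , f) = (a , b) , trans (cong₂ codePair e f) (sym (pair-η c 1≤c))

  decodeInterval : ∀ c → IsInterval c → ∃[ J ] (codeInterval J ≡ c)
  decodeInterval c (1≤c , p , q) = decodePair codeℚ codeℚ c 1≤c (decodeℚ (left c) p) (decodeℚ (right c) q)

  decodeCondition : ∀ c → IsCondition c → ∃[ d ] (codeCondition d ≡ c)
  decodeCondition c (1≤c , p , q) = decodePair codeInterval codeℚ c 1≤c (decodeInterval (left c) p) (decodeℚ (right c) q)

  decodeList : ∀ {A : Set} (code : A → ℕ) {P : ℕ → Set} → (∀ n → P n → ∃[ a ] (code a ≡ n)) →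
    ∀ c → (∀ i → i ℕ.< c → tails c i ℕ.≤ 0 ⊎ P (entry c i)) → ∃[ l ] (codeList code l ≡ c)
  decodeList code {P} decode c = go c c ℕₚ.≤-refl
    where
    go : ∀ fuel c → c ℕ.≤ fuel → (∀ i → i ℕ.< c → tails c i ℕ.≤ 0 ⊎ P (entry c i)) → ∃[ l ] (codeList code l ≡ c)
    go _ zero _ _ = [] , refl
    go (suc fuel) (suc c) c≤ h with h 0 (s≤s z≤n)
    ... | inj₂ p =
      let a , e = decode (left (suc c)) p
          r<c = right< (suc c) (s≤s z≤n)
          l , f = go fuel (right (suc c)) (ℕₚ.≤-pred (ℕₚ.≤-trans r<c c≤))
            λ i i< → subst (λ t → t ℕ.≤ 0 ⊎ P (left t)) (tails-right (suc c) i) (h (suc i) (ℕₚ.≤-trans (s≤s i<) r<c))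
      in a ∷ l , trans (cong₂ codePair e f) (sym (pair-η (suc c) (s≤s z≤n)))

  -- The program of a test may halt on numbers that code no element. Certificates are therefore
  -- checked for genuine codes, and this recovers the elements behind them.
  decodeElement : ∀ c → IsElement c → ∃[ e ] (codeUniformElement e ≡ c)
  decodeElement c (1≤c , h , 1≤r , J , q , nonneg) =
    let l , el = decodeList codeCondition decodeCondition (left c) h
        I , eI = decodeInterval (left (right c)) J
        p , ep = decodeℚ (right (right c)) q
    in (l , I , p , ℚₚ.nonNegative⁻¹ p {{sign p (subst (λ t → odd t ℕ.≤ 0) (trans (cong left (sym ep)) (left-codePair (codeℤ (ℚ.↥ p)) (ℚ.denominator-1 p))) nonneg)}}) ,
       trans (cong₂ codePair el (trans (cong₂ codePair eI ep) (sym (pair-η (right c) 1≤r)))) (sym (pair-η c 1≤c))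
    where
    sign : ∀ q → odd (codeℤ (ℚ.↥ q)) ℕ.≤ 0 → ℚ.NonNegative q
    sign (mkℚ (+ n) _ _)    _ = _
    sign (mkℚ -[1+ n ] _ _) h = ⊥-elim (ℕₚ.<⇒≱ (s≤s z≤n) (subst (ℕ._≤ 0) (odd-1+2* n) h))

-- Tests on Cantor space defined by finite certificates

module Tests (em : ExcludedMiddle 0ℓ) where

  open OuterRegularity em public
  open Decoding public renaming (half to halfℕ)
  open Any using (here; there)

  ⌊⌋-denominator : ∀ q → ⌊ q ⌋ * nat (ℚ.↧ₙ q) ≈ ⌊ fromℤ (ℚ.↥ q) ⌋
  ⌊⌋-denominator q = ≈-trans (≈-sym (⌊⌋-* q (fromℤ (+ ℚ.↧ₙ q)))) (≡⇒≈ (cong ⌊_⌋ (eq q)))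
    where
    eq : ∀ q → q ℚ.* fromℤ (+ ℚ.↧ₙ q) ≡ fromℤ (ℚ.↥ q)
    eq q@(mkℚ n d c) = ℚₚ.toℚᵘ-injective (ℚᵘₚ.≃-trans (ℚₚ.toℚᵘ-homo-* q (fromℤ (+ suc d)))
      (ℚᵘ.*≡* (trans (ℤₚ.*-identityʳ (n ℤ.* + suc d)) (cong (n ℤ.*_) (sym (ℤₚ.*-identityʳ (+ suc d)))))))

  ⌊⌋-negative : ∀ q {n} → ℚ.↥ q ≡ -[1+ n ] → ⌊ q ⌋ < 0#
  ⌊⌋-negative (mkℚ -[1+ n ] d c) refl = ⌊⌋-mono-< (ℚₚ.negative⁻¹ (mkℚ -[1+ n ] d c))

  AtMost⇒ : ∀ {N D} q → AtMost N D (codeℚ q) → nat N ≤ ⌊ q ⌋ * nat D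
  AtMost⇒ {N} {D} q h = go (ℚ.↥ q) refl
    where
    open ≤-Reasoning
    d : ℕ
    d = ℚ.↧ₙ q
    go : ∀ z → ℚ.↥ q ≡ z → nat N ≤ ⌊ q ⌋ * nat D
    go -[1+ n ] e = ⊥-elim (AtMost-neg N D q e h)
    go (+ n)    e = *-cancelˡ-≤ {z = nat d} (0<nat-suc (ℚ.denominator-1 q)) (begin
      nat d * nat N             ≈⟨ *-comm (nat d) (nat N) ⟩
      nat N * nat d             ≈⟨ ≈-sym (nat-* N d) ⟩
      nat (N ℕ.* d)             ≤⟨ nat-mono-≤ (proj₁ (AtMost-pos N D q e) h) ⟩
      nat (n ℕ.* D)             ≈⟨ nat-* n D ⟩
      nat n * nat D             ≈⟨ *-cong (≡⇒≈ (cong (⌊_⌋ ∘ fromℤ) (sym e))) ≈-refl ⟩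
      ⌊ fromℤ (ℚ.↥ q) ⌋ * nat D ≈⟨ *-cong (≈-sym (⌊⌋-denominator q)) ≈-refl ⟩
      ⌊ q ⌋ * nat d * nat D     ≈⟨ solve 3 (λ q d D → q :* d :* D := d :* (q :* D)) ≈-refl ⌊ q ⌋ (nat d) (nat D) ⟩
      nat d * (⌊ q ⌋ * nat D)   ∎)

  ⇒AtMost : ∀ {N D} q → 1 ℕ.≤ D → nat N ≤ ⌊ q ⌋ * nat D → AtMost N D (codeℚ q)
  ⇒AtMost {N} {D} q 1≤D h = go (ℚ.↥ q) refl
    where
    open ≤-Reasoning
    d : ℕ
    d = ℚ.↧ₙ q
    go : ∀ z → ℚ.↥ q ≡ z → AtMost N D (codeℚ q)
    go -[1+ n ] e = ⊥-elim (≤⇒≮ (0≤nat N) (≤-<-trans h (begin-strict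
      ⌊ q ⌋ * nat D  <⟨ *-monoʳ-< (nat-mono-< {0} 1≤D) (⌊⌋-negative q e) ⟩
      0# * nat D     ≈⟨ solve 1 (λ x → con (+ 0) :* x := con (+ 0)) ≈-refl (nat D) ⟩
      0#             ∎)))
    go (+ n)    e = proj₂ (AtMost-pos N D q e) (nat-cancel-≤ (begin
      nat (N ℕ.* d)             ≈⟨ nat-* N d ⟩
      nat N * nat d             ≤⟨ *-monoʳ-≤ (0≤nat d) h ⟩
      ⌊ q ⌋ * nat D * nat d     ≈⟨ solve 3 (λ q d D → q :* D :* d := q :* d :* D) ≈-refl ⌊ q ⌋ (nat d) (nat D) ⟩
      ⌊ q ⌋ * nat d * nat D     ≈⟨ *-cong (⌊⌋-denominator q) ≈-refl ⟩
      ⌊ fromℤ (ℚ.↥ q) ⌋ * nat D ≈⟨ *-cong (≡⇒≈ (cong (⌊_⌋ ∘ fromℤ) e)) ≈-refl ⟩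
      nat n * nat D             ≈⟨ ≈-sym (nat-* n D) ⟩
      nat (n ℕ.* D)             ∎))

  number<2^ : ∀ n τ → length τ ≡ n → number τ ℕ.< 2 ℕ.^ n
  number-injective : ∀ n σ τ → length σ ≡ n → length τ ≡ n → number σ ≡ number τ → σ ≡ τ
  string-of : ∀ n m → m ℕ.< 2 ℕ.^ n → ∃[ τ ] (length τ ≡ n × number τ ≡ m)

  private
    unsnoc : ∀ n (τ : String) → length τ ≡ suc n → ∃[ σ ] ∃[ b ] (length σ ≡ n × τ ≡ σ ∷ʳ b)
    unsnoc n τ e with List.initLast τ
    ... | σ List.∷ʳ′ b = σ , b , ℕₚ.suc-injective (trans (sym (length-∷ʳ σ b)) e) , refl

    bit≤1 : ∀ b → codeBool b ℕ.≤ 1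
    bit≤1 false = z≤n
    bit≤1 true  = s≤s z≤n

    odd-bit : ∀ m b → odd (2 ℕ.* m ℕ.+ codeBool b) ≡ codeBool b
    odd-bit m false = trans (cong odd (ℕₚ.+-identityʳ (2 ℕ.* m))) (odd-2* m)
    odd-bit m true  = trans (cong odd (ℕₚ.+-comm (2 ℕ.* m) 1)) (odd-1+2* m)

    bit-injective : ∀ b c → codeBool b ≡ codeBool c → b ≡ c
    bit-injective false false _ = refl
    bit-injective true  true  _ = refl

    double-< : ∀ {m n} k → k ℕ.≤ 1 → m ℕ.< n → 2 ℕ.* m ℕ.+ k ℕ.< 2 ℕ.* n
    double-< {m} {n} k k≤1 m<n = ℕₚ.≤-trans (s≤s (ℕₚ.+-monoʳ-≤ (2 ℕ.* m) k≤1)) (ℕₚ.≤-trans (ℕₚ.≤-reflexive (trans (cong suc (ℕₚ.+-comm (2 ℕ.* m) 1)) (sym (2*suc m)))) (ℕₚ.*-monoʳ-≤ 2 m<n))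

  number<2^ zero    []      _ = s≤s z≤n
  number<2^ (suc n) τ       e with unsnoc n τ e
  ... | σ , b , l , refl = subst (ℕ._< 2 ℕ.^ suc n) (sym (number-∷ʳ σ b)) (double-< (codeBool b) (bit≤1 b) (number<2^ n σ l))

  number-injective zero    []      []      _ _ _ = refl
  number-injective (suc n) σ       τ       k l e with unsnoc n σ k | unsnoc n τ l
  ... | σ′ , b , k′ , refl | τ′ , c , l′ , refl = cong₂ _∷ʳ_
    (number-injective n σ′ τ′ k′ l′ (trans (sym (half-number σ′ b)) (trans (cong halfℕ e) (half-number τ′ c))))
    (bit-injective b c (trans (sym (odd-bit (number σ′) b)) (trans (cong odd (trans (sym (number-∷ʳ σ′ b)) (trans e (number-∷ʳ τ′ c)))) (odd-bit (number τ′) c))))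

  string-of zero    zero    _ = [] , refl , refl
  string-of zero    (suc m) (s≤s ())
  string-of (suc n) m       h with parity m
  ... | is-even k = let τ , l , e = string-of n k (ℕₚ.*-cancelˡ-< 2 k (2 ℕ.^ n) h)
                    in τ ∷ʳ false , trans (length-∷ʳ τ false) (cong suc l) , trans (number-∷ʳ τ false) (trans (ℕₚ.+-identityʳ _) (cong (2 ℕ.*_) e))
  ... | is-odd k  = let τ , l , e = string-of n k (ℕₚ.*-cancelˡ-< 2 k (2 ℕ.^ n) (ℕₚ.<-trans (ℕₚ.n<1+n _) h))
                    in τ ∷ʳ true , trans (length-∷ʳ τ true) (cong suc l) , trans (number-∷ʳ τ true) (trans (ℕₚ.+-comm _ 1) (cong (λ x → suc (2 ℕ.* x)) e))

  nat-∑ : ∀ n f → nat (∑ n f) ≈ Σ< n (nat ∘ f)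
  nat-∑ zero    f = ≈-refl
  nat-∑ (suc n) f = ≈-trans (nat-+ (∑ n f) (f n)) (+-cong (nat-∑ n f) ≈-refl)

  Σ<-double : ∀ n f → Σ< (2 ℕ.* n) f ≈ Σ< n (λ m → f (2 ℕ.* m) + f (suc (2 ℕ.* m)))
  Σ<-double zero    f = ≈-refl
  Σ<-double (suc n) f = ≈-trans (≡⇒≈ (cong (λ k → Σ< k f) (2*suc n)))
    (≈-trans (+-assoc (Σ< (2 ℕ.* n) f) (f (2 ℕ.* n)) (f (suc (2 ℕ.* n)))) (+-cong (Σ<-double n f) ≈-refl))

  -- Strings of length n correspond to the numbers below 2^n; this turns sums over strings into sums
  -- that a program evaluates.
  Ext-number : ∀ n f → Ext n [] (f ∘ number) ≈ Σ< (2 ℕ.^ n) f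
  Ext-number zero    f = ≈-sym (+-identityˡ (f 0))
  Ext-number (suc n) f = ≈-trans (Ext-suc n [] (f ∘ number)) (≈-trans
    (Ext-cong n [] λ τ _ → +-cong (≡⇒≈ (cong f (trans (number-∷ʳ τ false) (ℕₚ.+-identityʳ _)))) (≡⇒≈ (cong f (trans (number-∷ʳ τ true) (ℕₚ.+-comm _ 1)))))
    (≈-trans (Ext-number n (λ m → f (2 ℕ.* m) + f (suc (2 ℕ.* m)))) (≈-sym (Σ<-double (2 ℕ.^ n) f))))

  strings : ℕ → List String
  strings zero    = [] ∷ []
  strings (suc n) = List.concatMap (λ τ → τ ∷ʳ false ∷ τ ∷ʳ true ∷ []) (strings n)

  ∈-strings : ∀ n τ → length τ ≡ n → τ ∈ˡ strings n
  ∈-strings zero    []      _ = here refl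
  ∈-strings (suc n) τ       e with unsnoc n τ e
  ... | σ , b , l , refl = ∈-concatMap⁺ (λ τ → τ ∷ʳ false ∷ τ ∷ʳ true ∷ []) (Any.map (λ { refl → last b }) (∈-strings n σ l))
    where
    last : ∀ b → σ ∷ʳ b ∈ˡ (σ ∷ʳ false ∷ σ ∷ʳ true ∷ [])
    last false = here refl
    last true  = there (here refl)

  ∈-strings⁻ : ∀ n {τ} → τ ∈ˡ strings n → length τ ≡ n
  ∈-strings⁻ zero    (here refl) = refl
  ∈-strings⁻ (suc n) h = go (strings n) (λ σ → ∈-strings⁻ n) h
    where
    go : ∀ l → (∀ σ → σ ∈ˡ l → length σ ≡ n) → ∀ {τ} → τ ∈ˡ List.concatMap (λ τ → τ ∷ʳ false ∷ τ ∷ʳ true ∷ []) l → length τ ≡ suc n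
    go (σ ∷ l) k (here refl)         = trans (length-∷ʳ σ false) (cong suc (k σ (here refl)))
    go (σ ∷ l) k (there (here refl)) = trans (length-∷ʳ σ true) (cong suc (k σ (here refl)))
    go (σ ∷ l) k (there (there h))   = go l (λ ρ p → k ρ (there p)) h

  ∈⇒drop : ∀ {A : Set} {a : A} {l} → a ∈ˡ l → ∃[ i ] ∃[ r ] (i ℕ.< length l × drop i l ≡ a ∷ r)
  ∈⇒drop {l = a ∷ l} (here refl) = 0 , l , s≤s z≤n , refl
  ∈⇒drop (there h) = let i , r , i< , e = ∈⇒drop h in suc i , r , s≤s i< , e

  drop⇒∈ : ∀ {A : Set} {a : A} {r} i l → drop i l ≡ a ∷ r → a ∈ˡ l
  drop⇒∈ zero    (a ∷ l) refl = here refl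
  drop⇒∈ (suc i) (a ∷ l) e    = there (drop⇒∈ i l e)

  opaque
    unfolding _≈_

    fromℚ<⇒ : ∀ {q x} → D.fromℚ q D.< x → ⌊ q ⌋ < x
    fromℚ<⇒ h = h

    ⇒fromℚ< : ∀ {q x} → ⌊ q ⌋ < x → D.fromℚ q D.< x
    ⇒fromℚ< h = h

  /-scale : ∀ a d → ⌊ + a ℚ./ suc d ⌋ * nat (suc d) ≈ nat a
  /-scale a d = ≈-trans (≈-sym (⌊⌋-* (+ a ℚ./ suc d) (fromℤ (+ suc d)))) (≡⇒≈ (cong ⌊_⌋ eq))
    where
    eq : (+ a ℚ./ suc d) ℚ.* fromℤ (+ suc d) ≡ fromℤ (+ a)
    eq = ℚₚ.toℚᵘ-injective (ℚᵘₚ.≃-trans (ℚₚ.toℚᵘ-homo-* (+ a ℚ./ suc d) (fromℤ (+ suc d)))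
      (ℚᵘₚ.≃-trans (ℚᵘₚ.*-congʳ (ℚₚ.toℚᵘ-fromℚᵘ (ℚᵘ.mkℚᵘ (+ a) d)))
        (ℚᵘ.*≡* (trans (ℤₚ.*-identityʳ (+ a ℤ.* + suc d)) (cong (+ a ℤ.*_) (sym (ℤₚ.*-identityʳ (+ suc d))))))))

  -- A certificate k encodes the length of the strings in play, a common
  -- denominator, the length of σ, and lower bounds for the masses of the strings.

  level-of scale-of length-of : ℕ → ℕ
  level-of k = entry k 0
  scale-of k = suc (entry k 1)
  length-of k = entry k 2

  bound-of : ℕ → ℕ → ℕ
  bound-of k m = entry (entry k 3) m

  entryᵗ : ∀ {n} → Tm n → ℕ → Tm n
  entryᵗ t i = call₂ entryF t (lit i)

  lowerᵗ : ∀ {n} → Tm n → Tm n → Tm n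
  lowerᵗ k m = call₂ entryF (entryᵗ k 3) m

  -- The value of the test at σ is the supremum, over the certificates that pass `checks` and on
  -- whose queries the oracle halts, of the sum of bound times weight, divided by the common
  -- denominator and by `divisor`.
  record TestData : Set₁ where
    field
      weight   : Fun 3   -- of the certificate, the number of a string, and σ
      divisor  : Fun 2   -- of the certificate and σ
      checks   : Pred 2  -- of the certificate and σ
      queries  : Fun 1
      query    : Fun 2   -- of an index and the certificate
      oracle   : Rec 1

  module Test (T : TestData) where
    open TestData T

    weightOf : ℕ → ℕ → String → ℕ
    weightOf k m σ = apply weight (k ∷ m ∷ codeString σ ∷ [])

    divisorOf : ℕ → String → ℕ
    divisorOf k σ = apply divisor (k ∷ codeString σ ∷ [])

    HoldsAt : ℕ → String → Set
    HoldsAt k σ = length-of k ≡ length σ × holds checks (k ∷ codeString σ ∷ []) ×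
      (∀ j → j ℕ.< apply queries (k ∷ []) → ∃[ b ] (oracle [ apply query (j ∷ k ∷ []) ∷ [] ]⇓ b))

    totalOf : ℕ → String → ℕ
    totalOf k σ = ∑ (2 ℕ.^ level-of k) (λ m → bound-of k m ℕ.* weightOf k m σ)

    Bounded : ℕ → ℕ → ℕ → ℕ → Set
    Bounded C k m i = 1 ℕ.≤ tails C i × IsLength (left (entry C i)) (level-of k) ×
      (horner (left (entry C i)) (level-of k) ℕ.≤ m × m ℕ.≤ horner (left (entry C i)) (level-of k)) ×
      AtMost (bound-of k m) (scale-of k) (right (entry C i))

    private
      -- The arguments are C, k, m and i.
      BoundedP : Pred 4
      BoundedP = predicate ((lit 1 ⊴ call₂ tailsF v0 v3) ∧ atom IsLengthP (c ∷ entryᵗ v1 0 ∷ []) ∧ (call₂ hornerF c (entryᵗ v1 0) ≐ᵗ v2) ∧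
          atom AtMostP (lowerᵗ v1 v2 ∷ lit 1 ⊕ entryᵗ v1 1 ∷ call₁ rightF (call₂ entryF v0 v3) ∷ []))
        (λ { (C ∷ k ∷ m ∷ i ∷ []) → Bounded C k m i }) (λ { (C ∷ k ∷ m ∷ i ∷ []) h → h }) (λ { (C ∷ k ∷ m ∷ i ∷ []) h → h })
        where
        c : Tm 4
        c = call₁ leftF (call₂ entryF v0 v3)

      -- The arguments are C, k and the code of σ.
      BoundsP : Pred 3
      BoundsP = predicate (all< (pow (entryᵗ v1 0)) ((lowerᵗ v2 v0 ⊴ lit 0) ∨ ex< v1 (atom BoundedP (v2 ∷ v3 ∷ v1 ∷ v0 ∷ []))))
        (λ { (C ∷ k ∷ s ∷ []) → ∀ m → m ℕ.< 2 ℕ.^ level-of k → bound-of k m ℕ.≤ 0 ⊎ ∃[ i ] (i ℕ.< C × Bounded C k m i) })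
        (λ { (C ∷ k ∷ s ∷ []) h → h }) (λ { (C ∷ k ∷ s ∷ []) h → h })

      totalF : Fun 2
      totalF = function (sum (pow (entryᵗ v0 0)) (lowerᵗ v1 v0 ⊛ call weight (v1 ∷ v0 ∷ v2 ∷ [])))
        (λ { (k ∷ s ∷ []) → ∑ (2 ℕ.^ level-of k) (λ m → bound-of k m ℕ.* apply weight (k ∷ m ∷ s ∷ [])) }) (λ { (k ∷ s ∷ []) → refl })

      -- The certificate k is passed as the harmless first condition μ[] > - k.
      certificate : ℕ → ℕ
      certificate C = halfℕ (suc (left (right (entry C 0))))

      certificateF : Fun 1
      certificateF = function (call₁ halfF (lit 1 ⊕ call₁ leftF (call₁ rightF (entryᵗ v0 0)))) (λ { (C ∷ []) → certificate C }) (λ { (C ∷ []) → refl })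

      Accepts : ℕ → ℕ → ℕ → ℕ → Set
      Accepts C k s q = IsLength s (length-of k) ×
        (∀ m → m ℕ.< 2 ℕ.^ level-of k → bound-of k m ℕ.≤ 0 ⊎ ∃[ i ] (i ℕ.< C × Bounded C k m i)) ×
        holds checks (k ∷ s ∷ []) ×
        ¬ AtMost (apply totalF (k ∷ s ∷ [])) (scale-of k ℕ.* apply divisor (k ∷ s ∷ [])) q

      AcceptsP : Pred 4
      AcceptsP = predicate (atom IsLengthP (v2 ∷ entryᵗ v1 2 ∷ []) ∧ atom BoundsP (v0 ∷ v1 ∷ v2 ∷ []) ∧ atom checks (v1 ∷ v2 ∷ []) ∧
          neg (atom AtMostP (call₂ totalF v1 v2 ∷ (lit 1 ⊕ entryᵗ v1 1) ⊛ call₂ divisor v1 v2 ∷ v3 ∷ [])))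
        (λ { (C ∷ k ∷ s ∷ q ∷ []) → Accepts C k s q }) (λ { (C ∷ k ∷ s ∷ q ∷ []) h → h }) (λ { (C ∷ k ∷ s ∷ q ∷ []) h → h })

      accept : Fm 1
      accept = atom AcceptsP (call₁ leftF v0 ∷ call₁ certificateF (call₁ leftF v0) ∷ call₁ leftF (call₁ rightF v0) ∷ call₁ rightF (call₁ rightF v0) ∷ [])

      queriesᵗ : Tm 1
      queriesᵗ = call₁ queries (call₁ certificateF (call₁ leftF v0))

      queryᵗ : Tm 2
      queryᵗ = call₂ query v0 (call₁ certificateF (call₁ leftF v1))

    elements : CESet codeTestElement
    elements = record { program = acceptor accept queriesᵗ queryᵗ oracle }

    private
      codeConds : List (String × ℚ) → ℕ
      codeConds = codeList codeStringℚ

      Accepted : List (String × ℚ) → String × ℚ → Set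
      Accepted conds (σ , q) = let k = certificate (codeConds conds) in
        Accepts (codeConds conds) k (codeString σ) (codeℚ q) ×
        (∀ j → j ℕ.< apply queries (k ∷ []) → ∃[ b ] (oracle [ apply query (j ∷ k ∷ []) ∷ [] ]⇓ b))

      decode : ∀ conds σ q → let n = codeTestElement (conds , σ , q) in
        left n ≡ codeConds conds × left (right n) ≡ codeString σ × right (right n) ≡ codeℚ q
      decode conds σ q = left-codePair c r , trans (cong left (right-codePair c r)) (left-codePair s (codeℚ q)) ,
        trans (cong right (right-codePair c r)) (right-codePair s (codeℚ q))
        where
        c s r : ℕ
        c = codeConds conds
        s = codeString σ
        r = codePair s (codeℚ q)

      Halts : ℕ → Set
      Halts C = ∀ j → j ℕ.< apply queries (certificate C ∷ []) → ∃[ b ] (oracle [ apply query (j ∷ certificate C ∷ []) ∷ [] ]⇓ b)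

      ∋⇒ : ∀ conds p → elements ∋ (conds , p) → Accepted conds p
      ∋⇒ conds (σ , q) h =
        let n = codeTestElement (conds , σ , q)
            e₁ , e₂ , e₃ = decode conds σ q
            a , b = acceptor⇓ accept queriesᵗ queryᵗ oracle n h
        in subst₂ (λ s q → Accepts (codeConds conds) (certificate (codeConds conds)) s q) e₂ e₃
             (subst (λ C → Accepts C (certificate C) (left (right n)) (right (right n))) e₁ a) ,
           subst Halts e₁ b

      ⇒∋ : ∀ conds p → Accepted conds p → elements ∋ (conds , p)
      ⇒∋ conds (σ , q) (a , b) =
        let n = codeTestElement (conds , σ , q)
            e₁ , e₂ , e₃ = decode conds σ q
        in ⇓acceptor accept queriesᵗ queryᵗ oracle n
             (subst (λ C → Accepts C (certificate C) (left (right n)) (right (right n))) (sym e₁)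
               (subst₂ (λ s q → Accepts (codeConds conds) (certificate (codeConds conds)) s q) (sym e₂) (sym e₃) a))
             (subst Halts (sym e₁) b)

    module _ (μ : Measure cantor) where

      -- What an accepted list of conditions amounts to, in terms of μ and free of codes. `Produces`
      -- is shown equivalent to the existence of such a k, so later arguments never look at
      -- condition lists.
      record Certified (k : ℕ) (σ : String) (q : ℚ) : Set where
        field
          bounds  : ∀ τ → length τ ≡ level-of k → bound-of k (number τ) ≡ 0 ⊎ nat (bound-of k (number τ)) < cylinder μ τ * nat (scale-of k)
          holdsAt : HoldsAt k σ
          exceeds : ⌊ q ⌋ * nat (scale-of k ℕ.* divisorOf k σ) < nat (totalOf k σ)

      open Certified

      produces⇒certified : (∀ k σ → 1 ℕ.≤ divisorOf k σ) → ∀ σ q → Produces elements μ (σ , q) → ∃[ k ] Certified k σ q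
      produces⇒certified 1≤div σ q (conds , accepted , conds-hold) = k , record
        { bounds = λ τ l → bound τ l (h₂ (number τ) (number<2^ (level-of k) τ l))
        ; holdsAt = sym (codeList-isLength codeBool σ h₁) , h₃ , halts
        ; exceeds = ≰⇒> λ h → h₄ (⇒AtMost q (ℕₚ.*-mono-≤ {1} {scale-of k} {1} (s≤s z≤n) (1≤div k σ)) (≤-trans h ≤-refl)) }
        where
        C k : ℕ
        C = codeConds conds
        k = certificate C
        both′ = ∋⇒ conds (σ , q) accepted
        h₁ = proj₁ (proj₁ both′)
        h₂ = proj₁ (proj₂ (proj₁ both′))
        h₃ = proj₁ (proj₂ (proj₂ (proj₁ both′)))
        h₄ = proj₂ (proj₂ (proj₂ (proj₁ both′)))
        halts = proj₂ both′
        bound : ∀ τ → length τ ≡ level-of k → bound-of k (number τ) ℕ.≤ 0 ⊎ ∃[ i ] (i ℕ.< C × Bounded C k (number τ) i) →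
          bound-of k (number τ) ≡ 0 ⊎ nat (bound-of k (number τ)) < cylinder μ τ * nat (scale-of k)
        bound τ l (inj₁ z) = inj₁ (ℕₚ.n≤0⇒n≡0 z)
        bound τ l (inj₂ (i , _ , 1≤ , len , (n≤ , n≥) , low)) =
          let (ρ , t) , r , e = 1≤tails⇒ codeStringℚ conds i 1≤
              en : entry C i ≡ codePair (codeString ρ) (codeℚ t)
              en = entry-codeList codeStringℚ conds i e
              le : left (entry C i) ≡ codeString ρ
              le = trans (cong left en) (left-codePair (codeString ρ) (codeℚ t))
              re : right (entry C i) ≡ codeℚ t
              re = trans (cong right en) (right-codePair (codeString ρ) (codeℚ t))
              lρ : length ρ ≡ level-of k
              lρ = codeList-isLength codeBool ρ (subst (λ c → IsLength c (level-of k)) le len)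
              nρ : number ρ ≡ number τ
              nρ = trans (sym (horner-length ρ)) (trans (cong₂ horner (sym le) lρ) (ℕₚ.≤-antisym n≤ n≥))
              -- The program identifies the string of a condition by length and number only.
              ρ≡τ = number-injective (level-of k) ρ τ lρ l nρ
          in inj₂ (≤-<-trans (AtMost⇒ t (subst (AtMost (bound-of k (number τ)) (scale-of k)) re low))
               (*-monoʳ-< (0<nat-suc (entry k 1)) (subst (λ ρ → ⌊ t ⌋ < cylinder μ ρ) ρ≡τ
                 (fromℚ<⇒ {t} (All.lookup conds-hold (drop⇒∈ i conds e))))))

      -- A bound of 0 gets the condition μ(τ) > -1, which always holds; μ(τ) > 0 might fail.
      threshold : ℕ → ℕ → ℚ
      threshold zero    d = fromℤ -[1+ 0 ]
      threshold (suc a) d = + suc a ℚ./ suc d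

      certified⇒produces : ∀ k σ q → Certified k σ q → Produces elements μ (σ , q)
      certified⇒produces k σ q c = conds , ⇒∋ conds (σ , q) (subst Accepted′ (sym k≡) (accepts , proj₂ (proj₂ (holdsAt c)))) , conds-hold
        where
        cond : String → String × ℚ
        cond τ = τ , threshold (bound-of k (number τ)) (entry k 1)
        conds : List (String × ℚ)
        conds = ([] , fromℤ (ℤ.- + k)) ∷ List.map cond (strings (level-of k))
        C : ℕ
        C = codeConds conds
        Accepted′ : ℕ → Set
        Accepted′ k = Accepts C k (codeString σ) (codeℚ q) × (∀ j → j ℕ.< apply queries (k ∷ []) → ∃[ b ] (oracle [ apply query (j ∷ k ∷ []) ∷ [] ]⇓ b))
        k≡ : certificate C ≡ k
        k≡ = trans (cong (λ e → halfℕ (suc (left (right e)))) (entry-codeList codeStringℚ conds 0 refl))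
          (trans (cong (λ e → halfℕ (suc (left e))) (right-codePair 0 (codeℚ (fromℤ (ℤ.- + k)))))
          (trans (cong (λ e → halfℕ (suc e)) (left-codePair (codeℤ (ℤ.- + k)) 0))
          (trans (half-suc-codeℤ (ℤ.- + k)) (ℤₚ.∣-i∣≡∣i∣ (+ k)))))
        lower-bounds : ∀ m → m ℕ.< 2 ℕ.^ level-of k → bound-of k m ℕ.≤ 0 ⊎ ∃[ i ] (i ℕ.< C × Bounded C k m i)
        lower-bounds m m< = go (bound-of k m) refl
          where
          go : ∀ a → bound-of k m ≡ a → bound-of k m ℕ.≤ 0 ⊎ ∃[ i ] (i ℕ.< C × Bounded C k m i)
          go zero    low = inj₁ (ℕₚ.≤-reflexive low)
          go (suc a) low = inj₂ (suc i , ℕₚ.≤-trans (s≤s i<) (length≤codeList codeStringℚ conds) ,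
              ⇒1≤tails codeStringℚ conds (suc i) (s≤s i<) ,
              subst (λ e → IsLength e (level-of k)) (sym le) (subst (IsLength (codeString τ)) l (isLength-codeList codeBool τ)) ,
              (ℕₚ.≤-reflexive num , ℕₚ.≤-reflexive (sym num)) ,
              subst₂ (λ n t → AtMost n (scale-of k) t) (sym low) (sym re)
                (⇒AtMost (+ suc a ℚ./ suc (entry k 1)) (s≤s z≤n) (≈⇒≤ (≈-sym (/-scale (suc a) (entry k 1))))))
            where
            found = string-of (level-of k) m m<
            τ = proj₁ found
            l = proj₁ (proj₂ found)
            position = ∈⇒drop (∈-map⁺ cond (∈-strings (level-of k) τ l))
            i = proj₁ position
            i< = proj₁ (proj₂ (proj₂ position))
            en : entry C (suc i) ≡ codePair (codeString τ) (codeℚ (threshold (bound-of k (number τ)) (entry k 1)))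
            en = entry-codeList codeStringℚ conds (suc i) (proj₂ (proj₂ (proj₂ position)))
            le : left (entry C (suc i)) ≡ codeString τ
            le = trans (cong left en) (left-codePair (codeString τ) (codeℚ (threshold (bound-of k (number τ)) (entry k 1))))
            re : right (entry C (suc i)) ≡ codeℚ (+ suc a ℚ./ suc (entry k 1))
            re = trans (trans (cong right en) (right-codePair (codeString τ) (codeℚ (threshold (bound-of k (number τ)) (entry k 1)))))
              (cong (λ n → codeℚ (threshold n (entry k 1))) (trans (cong (bound-of k) (proj₂ (proj₂ found))) low))
            num : horner (left (entry C (suc i))) (level-of k) ≡ m
            num = trans (cong₂ horner le (sym l)) (trans (horner-length τ) (proj₂ (proj₂ found)))
        accepts : Accepts C k (codeString σ) (codeℚ q)
        accepts = subst (IsLength (codeString σ)) (sym (proj₁ (holdsAt c))) (isLength-codeList codeBool σ) , lower-bounds ,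
          proj₁ (proj₂ (holdsAt c)) , λ h → ≤⇒≮ (AtMost⇒ q h) (exceeds c)
        conds-hold : All (λ (τ , t) → D.fromℚ t D.< mass μ (basic τ)) conds
        conds-hold = ⇒fromℚ< (≤-<-trans (⌊⌋-mono-≤ (fromℤ-mono-≤ ( -k≤0 k))) (<-respʳ-≈ (≈-sym (mass-full μ)) 0<1)) ∷
          Allₚ.map⁺ (All.tabulate λ {τ} h → ⇒fromℚ< (below τ (bounds c τ (∈-strings⁻ (level-of k) h))))
          where
          -k≤0 : ∀ k → ℤ.- + k ℤ.≤ + 0
          -k≤0 zero    = ℤ.+≤+ z≤n
          -k≤0 (suc k) = ℤ.-≤+
          below : ∀ τ → bound-of k (number τ) ≡ 0 ⊎ nat (bound-of k (number τ)) < cylinder μ τ * nat (scale-of k) →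
            ⌊ threshold (bound-of k (number τ)) (entry k 1) ⌋ < cylinder μ τ
          below τ h with bound-of k (number τ)
          ... | zero  = <-≤-trans (⌊⌋-mono-< (fromℤ-mono-< {b = + 0} ℤ.-<+)) (0≤cylinder μ τ)
          below τ (inj₂ h) | suc a = *-cancelˡ-< (0≤nat (scale-of k)) (<-respˡ-≈ (≈-trans (≈-sym (/-scale (suc a) (entry k 1))) (*-comm ⌊ + suc a ℚ./ suc (entry k 1) ⌋ (nat (scale-of k))))
            (<-respʳ-≈ (*-comm (cylinder μ τ) (nat (scale-of k))) h))

-- Rounding masses to certificates, and diluted sequences

module Dilution (em : ExcludedMiddle 0ℓ) where

  open Tests em public

  archimedean-* : ∀ x {ε} → 0# < ε → ∃[ N ] (∀ n → N ℕ.≤ n → x < nat n * ε)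
  archimedean-* x {ε} ε>0 =
    let N , h = ½ⁿ-small x ε>0
        open ≤-Reasoning
        base : x < nat (2 ℕ.^ N) * ε
        base = begin-strict
          x                               ≈⟨ ≈-sym (≈-trans (*-cong (½ⁿ*2^n N) ≈-refl) (*-identityˡ x)) ⟩
          ½ⁿ N * nat (2 ℕ.^ N) * x        ≈⟨ solve 3 (λ h n x → h :* n :* x := n :* (h :* x)) ≈-refl (½ⁿ N) (nat (2 ℕ.^ N)) x ⟩
          nat (2 ℕ.^ N) * (½ⁿ N * x)      <⟨ *-monoˡ-< (nat-mono-< {0} (1≤2^ N)) h ⟩
          nat (2 ℕ.^ N) * ε               ∎
    in 2 ℕ.^ N , λ n N≤n → <-≤-trans base (*-monoʳ-≤ (<⇒≤ ε>0) (nat-mono-≤ N≤n))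

  2^-scale : ∀ {q x} k → (⌊ q ⌋ * nat (2 ℕ.^ k) < x → ⌊ q ⌋ < x * ½ⁿ k) × (⌊ q ⌋ < x * ½ⁿ k → ⌊ q ⌋ * nat (2 ℕ.^ k) < x)
  2^-scale {q} {x} k =
    (λ h → <-respˡ-≈ (2^-cancel ⌊ q ⌋ k) (*-monoʳ-< (0<½ⁿ k) h)) ,
    (λ h → <-respʳ-≈ (½ⁿ-cancel x k) (*-monoʳ-< (nat-mono-< {0} (1≤2^ k)) h))

  opaque
    -- For positive y this is ⌈y⌉ - 1: the conditions of a test are strict, so a natural number y
    -- must be rounded to y - 1.
    floor : ∀ y → ∃[ a ] ((a ≡ 0 ⊎ nat a < y) × y ≤ nat a + 1#)
    floor y = let n , h = archimedean y in go n (<⇒≤ h)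
      where
      go : ∀ n → y ≤ nat n → ∃[ a ] ((a ≡ 0 ⊎ nat a < y) × y ≤ nat a + 1#)
      go zero    h = 0 , inj₁ refl , ≤-trans h (≤-by (<⇒≤ 0<1) (solve 1 (λ x → (x :+ con (+ 1)) :- x := con (+ 1)) ≈-refl 0#))
      go (suc n) h with em {nat n < y}
      ... | yes k = n , inj₂ k , ≤-respʳ-≈ (≈-trans (nat-suc n) (+-comm 1# (nat n))) h
      ... | no ¬k = go n (≮⇒≤ ¬k)

  ⌊_⌋ℕ : ℝ → ℕ
  ⌊ y ⌋ℕ = proj₁ (floor y)

  module _ {L : ℕ} {f : String → ℝ} (0≤f : ∀ τ → 0# ≤ f τ) (w : String → ℕ) where

    -- Rounding loses at most `w τ` per string, in total an amount independent of the denominator d,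
    -- whereas the gap to x grows like d.
    Ext-floor : ∀ {x} → x < Ext L [] (λ τ → f τ * nat (w τ)) →
      ∃[ N ] (∀ d → N ℕ.≤ d → x * nat d < Ext L [] (λ τ → nat (⌊ f τ * nat d ⌋ℕ ℕ.* w τ)))
    Ext-floor {x} x< =
      let N , h = archimedean-* (Ext L [] (nat ∘ w)) (<⇒0<- x<)
      in N , λ d N≤d → begin-strict
        x * nat d
          ≈⟨ solve 3 (λ x d f → x :* d := d :* f :- d :* (f :- x)) ≈-refl x (nat d) (Ext L [] F) ⟩
        nat d * Ext L [] F - nat d * (Ext L [] F - x)
          <⟨ +-mono-≤-< ≤-refl (<-by (<⇒0<- (h d N≤d)) (solve 2 (λ a b → :- a :- :- b := b :- a) ≈-refl (Ext L [] (nat ∘ w)) (nat d * (Ext L [] F - x)))) ⟩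
        nat d * Ext L [] F - Ext L [] (nat ∘ w)
          ≈⟨ +-cong (≈-sym (Ext-*ˡ L [] (nat d) F)) ≈-refl ⟩
        Ext L [] (λ τ → nat d * F τ) - Ext L [] (nat ∘ w)
          ≤⟨ +-mono-≤ (Ext-mono L [] λ τ _ → step d τ) ≤-refl ⟩
        Ext L [] (λ τ → nat (⌊ f τ * nat d ⌋ℕ ℕ.* w τ) + nat (w τ)) - Ext L [] (nat ∘ w)
          ≈⟨ +-cong (Ext-+ L [] (λ τ → nat (⌊ f τ * nat d ⌋ℕ ℕ.* w τ)) (nat ∘ w)) ≈-refl ⟩
        Ext L [] (λ τ → nat (⌊ f τ * nat d ⌋ℕ ℕ.* w τ)) + Ext L [] (nat ∘ w) - Ext L [] (nat ∘ w)
          ≈⟨ solve 2 (λ a b → a :+ b :- b := a) ≈-refl (Ext L [] (λ τ → nat (⌊ f τ * nat d ⌋ℕ ℕ.* w τ))) (Ext L [] (nat ∘ w)) ⟩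
        Ext L [] (λ τ → nat (⌊ f τ * nat d ⌋ℕ ℕ.* w τ)) ∎
      where
      open ≤-Reasoning
      F : String → ℝ
      F τ = f τ * nat (w τ)
      step : ∀ d τ → nat d * F τ ≤ nat (⌊ f τ * nat d ⌋ℕ ℕ.* w τ) + nat (w τ)
      step d τ = begin
        nat d * (f τ * nat (w τ))                    ≈⟨ solve 3 (λ d f w → d :* (f :* w) := (f :* d) :* w) ≈-refl (nat d) (f τ) (nat (w τ)) ⟩
        f τ * nat d * nat (w τ)                      ≤⟨ *-monoʳ-≤ (0≤nat (w τ)) (proj₂ (proj₂ (floor (f τ * nat d)))) ⟩
        (nat ⌊ f τ * nat d ⌋ℕ + 1#) * nat (w τ)      ≈⟨ solve 2 (λ a w → (a :+ con (+ 1)) :* w := a :* w :+ w) ≈-refl (nat ⌊ f τ * nat d ⌋ℕ) (nat (w τ)) ⟩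
        nat ⌊ f τ * nat d ⌋ℕ * nat (w τ) + nat (w τ) ≈⟨ +-cong (≈-sym (nat-* ⌊ f τ * nat d ⌋ℕ (w τ))) ≈-refl ⟩
        nat (⌊ f τ * nat d ⌋ℕ ℕ.* w τ) + nat (w τ)   ∎

  codeNumbers : List ℕ → ℕ
  codeNumbers = codeList (λ n → n)

  table : (ℕ → ℕ) → ℕ → List ℕ
  table f zero    = []
  table f (suc n) = f 0 ∷ table (f ∘ suc) n

  entry-table : ∀ f n m → m ℕ.< n → entry (codeNumbers (table f n)) m ≡ f m
  entry-table f n m m<n = let r , e = go f n m m<n in entry-codeList (λ n → n) (table f n) m e
    where
    go : ∀ f n m → m ℕ.< n → ∃[ r ] (drop m (table f n) ≡ f m ∷ r)
    go f (suc n) zero    _       = table (f ∘ suc) n , refl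
    go f (suc n) (suc m) (s≤s h) = go (f ∘ suc) n m h

  opaque
    string : ℕ → ℕ → String
    string n m with m ℕₚ.<? 2 ℕ.^ n
    ... | yes h = proj₁ (string-of n m h)
    ... | no  _ = []

    string-number : ∀ n τ → length τ ≡ n → string n (number τ) ≡ τ
    string-number n τ l with number τ ℕₚ.<? 2 ℕ.^ n
    ... | yes h = let σ , k , e = string-of n (number τ) h in number-injective n σ τ k l e
    ... | no ¬h = ⊥-elim (¬h (number<2^ n τ l))

  -- The diluted sequences.  The positions are divided into the blocks
  -- [2^j, 2^(j+1)).  In block j the first ψ j positions are free and the bits at
  -- all other positions are forced to be 0; position 0 belongs to block 0.

  block : ℕ → ℕ
  block zero    = 0
  block (suc i) = block i ℕ.+ (1 ∸ (2 ℕ.^ suc (block i) ∸ suc i))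

  forced : (ℕ → ℕ) → ℕ → ℕ
  forced ψ i = 1 ∸ (ψ (block i) ∸ (i ∸ 2 ℕ.^ block i))

  -- Twice the conditional probability of the bit b: 1 at a free position (f = 0), and 2 or 0 at a
  -- forced one.
  factor : ℕ → ℕ → ℕ
  factor f b = 1 ℕ.+ f ∸ 2 ℕ.* (f ℕ.* b)

  -- 2^n times the probability of the bits b 0, ..., b (n-1) when the free bits
  -- are chosen uniformly and independently
  dilution : (ℕ → ℕ) → (ℕ → ℕ) → ℕ → ℕ
  dilution ψ b zero    = 1
  dilution ψ b (suc i) = dilution ψ b i ℕ.* factor (forced ψ i) (b i)

  block≤ : ∀ i → block i ℕ.≤ i
  block≤ zero    = z≤n
  block≤ (suc i) = ℕₚ.≤-trans (ℕₚ.+-mono-≤ (block≤ i) (ℕₚ.m∸n≤m 1 (2 ℕ.^ suc (block i) ∸ suc i))) (ℕₚ.≤-reflexive (ℕₚ.+-comm i 1))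

  block-< : ∀ i → i ℕ.< 2 ℕ.^ suc (block i)
  block-< zero    = s≤s z≤n
  block-< (suc i) with suc (suc i) ℕₚ.≤? 2 ℕ.^ suc (block i)
  ... | yes h = ℕₚ.≤-trans h (ℕₚ.^-monoʳ-≤ 2 (s≤s (ℕₚ.m≤m+n (block i) _)))
  ... | no ¬h = subst (λ k → suc (suc i) ℕ.≤ 2 ℕ.^ suc (block i ℕ.+ (1 ∸ k))) (sym (ℕₚ.m≤n⇒m∸n≡0 (ℕₚ.≤-pred (ℕₚ.≰⇒> ¬h))))
      (subst (λ k → suc (suc i) ℕ.≤ 2 ℕ.^ suc k) (ℕₚ.+-comm 1 (block i)) (ℕₚ.≤-trans (s≤s (block-< i)) (double (1≤2^ (suc (block i))))))
    where
    double : ∀ {m} → 1 ℕ.≤ m → suc m ℕ.≤ 2 ℕ.* m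
    double {m} h = ℕₚ.≤-trans (ℕₚ.+-monoˡ-≤ m h) (ℕₚ.+-monoʳ-≤ m (ℕₚ.m≤m+n m 0))

  2^block≤ : ∀ i → 1 ℕ.≤ i → 2 ℕ.^ block i ℕ.≤ i
  2^block≤ (suc zero)    _ = s≤s z≤n
  2^block≤ (suc (suc i)) _ = step (suc i) (2^block≤ (suc i) (s≤s z≤n)) (2 ℕ.^ suc (block (suc i)) ℕₚ.≤? suc (suc i))
    where
    one∸ : ∀ {m n} → m ℕ.< n → 1 ∸ (n ∸ m) ≡ 0
    one∸ {m} {n} h with n ∸ m | ℕₚ.m<n⇒0<n∸m h
    ... | suc k | _ = ℕₚ.0∸n≡0 k
    step : ∀ i → 2 ℕ.^ block i ℕ.≤ i → Dec (2 ℕ.^ suc (block i) ℕ.≤ suc i) → 2 ℕ.^ block (suc i) ℕ.≤ suc i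
    step i ih (yes h) = ℕₚ.≤-trans (ℕₚ.^-monoʳ-≤ 2 (ℕₚ.≤-trans (ℕₚ.+-monoʳ-≤ (block i) (ℕₚ.m∸n≤m 1 (2 ℕ.^ suc (block i) ∸ suc i))) (ℕₚ.≤-reflexive (ℕₚ.+-comm (block i) 1)))) h
    step i ih (no ¬h) = subst (λ k → 2 ℕ.^ (block i ℕ.+ k) ℕ.≤ suc i) (sym (one∸ (ℕₚ.≰⇒> ¬h)))
      (subst (λ k → 2 ℕ.^ k ℕ.≤ suc i) (sym (ℕₚ.+-identityʳ (block i))) (ℕₚ.m≤n⇒m≤1+n ih))

  dilution-cong : ∀ n {ψ ψ′ b b′} → (∀ i → i ℕ.< n → ψ (block i) ≡ ψ′ (block i)) → (∀ i → i ℕ.< n → b i ≡ b′ i) → dilution ψ b n ≡ dilution ψ′ b′ n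
  dilution-cong zero    h k = refl
  dilution-cong (suc n) h k = cong₂ ℕ._*_ (dilution-cong n (λ i i<n → h i (ℕₚ.m<n⇒m<1+n i<n)) (λ i i<n → k i (ℕₚ.m<n⇒m<1+n i<n)))
    (cong₂ (λ p b → factor (1 ∸ (p ∸ (n ∸ 2 ℕ.^ block n))) b) (h n ℕₚ.≤-refl) (k n ℕₚ.≤-refl))

  bits : String → ℕ → ℕ
  bits σ = entry (codeString σ)

  bits-∷ʳ : ∀ σ b i → i ℕ.< length σ → bits (σ ∷ʳ b) i ≡ bits σ i
  bits-∷ʳ σ b i h = let c , r , e , _ = take-suc i σ h in
    trans (entry-codeList codeBool (σ ∷ʳ b) i (go i σ e)) (sym (entry-codeList codeBool σ i e))
    where
    go : ∀ i (σ : String) {c r} → drop i σ ≡ c ∷ r → drop i (σ ∷ʳ b) ≡ c ∷ (r ∷ʳ b)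
    go zero    (c ∷ σ) refl = refl
    go (suc i) (c ∷ σ) e    = go i σ e

  bits-last : ∀ σ b → bits (σ ∷ʳ b) (length σ) ≡ codeBool b
  bits-last σ b = entry-codeList codeBool (σ ∷ʳ b) (length σ) (go σ)
    where
    go : ∀ (σ : String) → drop (length σ) (σ ∷ʳ b) ≡ b ∷ []
    go []      = refl
    go (c ∷ σ) = go σ

  diluted : (ℕ → ℕ) → String → ℕ
  diluted ψ σ = dilution ψ (bits σ) (length σ)

  diluted-∷ʳ : ∀ ψ σ b → diluted ψ (σ ∷ʳ b) ≡ diluted ψ σ ℕ.* factor (forced ψ (length σ)) (codeBool b)
  diluted-∷ʳ ψ σ b = trans (cong (dilution ψ (bits (σ ∷ʳ b))) (length-∷ʳ σ b))
    (cong₂ (λ d c → d ℕ.* factor (forced ψ (length σ)) c) (dilution-cong (length σ) (λ _ _ → refl) (bits-∷ʳ σ b)) (bits-last σ b))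

  forced≤1 : ∀ ψ i → forced ψ i ≡ 0 ⊎ forced ψ i ≡ 1
  forced≤1 ψ i with ψ (block i) ∸ (i ∸ 2 ℕ.^ block i)
  ... | zero  = inj₂ refl
  ... | suc k = inj₁ (ℕₚ.0∸n≡0 k)

  diluted-additive : ∀ ψ σ → diluted ψ (σ ∷ʳ false) ℕ.+ diluted ψ (σ ∷ʳ true) ≡ 2 ℕ.* diluted ψ σ
  diluted-additive ψ σ = trans (cong₂ ℕ._+_ (diluted-∷ʳ ψ σ false) (diluted-∷ʳ ψ σ true))
    (trans (sym (ℕₚ.*-distribˡ-+ (diluted ψ σ) (factor f 0) (factor f 1))) (trans (cong (diluted ψ σ ℕ.*_) (two (forced≤1 ψ (length σ)))) (ℕₚ.*-comm (diluted ψ σ) 2)))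
    where
    f : ℕ
    f = forced ψ (length σ)
    two : f ≡ 0 ⊎ f ≡ 1 → factor f 0 ℕ.+ factor f 1 ≡ 2
    two (inj₁ e) = subst (λ f → factor f 0 ℕ.+ factor f 1 ≡ 2) (sym e) refl
    two (inj₂ e) = subst (λ f → factor f 0 ℕ.+ factor f 1 ≡ 2) (sym e) refl

  pattern-of : String → ℕ → ℕ
  pattern-of τ j = number (take j τ)

  -- Halving a number deletes its last bit; this is how a program reads the prefixes of a string off
  -- its number.
  halves-number : ∀ n j τ → length τ ≡ n → j ℕ.≤ n → halves (number τ) (n ∸ j) ≡ pattern-of τ j
  halves-number n j τ l j≤n = trans (cong (halves (number τ)) (cong (_∸ j) (sym l))) (go (length τ ∸ j) refl)
    where
    step : ∀ i → j ℕ.+ i ℕ.≤ length τ → halves (number (take (j ℕ.+ i) τ)) i ≡ number (take j τ)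
    step zero    h = cong (λ k → number (take k τ)) (ℕₚ.+-identityʳ j)
    step (suc i) h = let b , r , _ , e = take-suc (j ℕ.+ i) τ (subst (ℕ._≤ length τ) (ℕₚ.+-suc j i) h) in
      trans (cong (λ k → halves (number (take k τ)) (suc i)) (ℕₚ.+-suc j i))
      (trans (halves-half _ i) (trans (cong (λ m → halves m i) (trans (cong (halfℕ ∘ number) e) (half-number (take (j ℕ.+ i) τ) b)))
        (step i (ℕₚ.≤-trans (ℕₚ.+-monoʳ-≤ j (ℕₚ.n≤1+n i)) h))))
    go : ∀ i → length τ ∸ j ≡ i → halves (number τ) i ≡ pattern-of τ j
    go i e = trans (cong (λ σ → halves (number σ) i) (trans (sym (take-length τ)) (cong (λ k → take k τ) (trans (sym (ℕₚ.m+[n∸m]≡n j≤)) (cong (j ℕ.+_) e)))))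
      (step i (ℕₚ.≤-reflexive (trans (cong (j ℕ.+_) (sym e)) (ℕₚ.m+[n∸m]≡n j≤))))
      where
      j≤ : j ℕ.≤ length τ
      j≤ = subst (j ℕ.≤_) (sym l) j≤n

-- The test that averages diluted sequences and adds the uniform measure

module DilutedTest (em : ExcludedMiddle 0ℓ) where

  open Dilution em public

  module _ (T : TestData) (μ : Measure cantor) where
    open Test T
    open Certified

    total≈Ext : ∀ k σ → nat (totalOf k σ) ≈ Ext (level-of k) [] (λ τ → nat (bound-of k (number τ) ℕ.* weightOf k (number τ) σ))
    total≈Ext k σ = ≈-trans (nat-∑ (2 ℕ.^ level-of k) (λ m → bound-of k m ℕ.* weightOf k m σ))
      (≈-sym (Ext-number (level-of k) (λ m → nat (bound-of k m ℕ.* weightOf k m σ))))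

    certified-sound : ∀ {k σ q} → Certified μ k σ q →
      ⌊ q ⌋ * nat (divisorOf k σ) < Ext (level-of k) [] (λ τ → cylinder μ τ * nat (weightOf k (number τ) σ))
    certified-sound {k} {σ} {q} c = *-cancelˡ-< (0≤nat d) (begin-strict
      nat d * (⌊ q ⌋ * nat g)                     ≈⟨ solve 3 (λ d q g → d :* (q :* g) := q :* (d :* g)) ≈-refl (nat d) ⌊ q ⌋ (nat g) ⟩
      ⌊ q ⌋ * (nat d * nat g)                     ≈⟨ *-cong ≈-refl (≈-sym (nat-* d g)) ⟩
      ⌊ q ⌋ * nat (d ℕ.* g)                       <⟨ exceeds c ⟩
      nat (totalOf k σ)                           ≈⟨ total≈Ext k σ ⟩
      Ext (level-of k) [] (λ τ → nat (bound-of k (number τ) ℕ.* w τ)) ≤⟨ Ext-mono (level-of k) [] step ⟩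
      Ext (level-of k) [] (λ τ → nat d * (cylinder μ τ * nat (w τ))) ≈⟨ Ext-*ˡ (level-of k) [] (nat d) (λ τ → cylinder μ τ * nat (w τ)) ⟩
      nat d * Ext (level-of k) [] (λ τ → cylinder μ τ * nat (w τ)) ∎)
      where
      open ≤-Reasoning
      d g : ℕ
      d = scale-of k
      g = divisorOf k σ
      w : String → ℕ
      w τ = weightOf k (number τ) σ
      step : ∀ τ → length τ ≡ level-of k → nat (bound-of k (number τ) ℕ.* w τ) ≤ nat d * (cylinder μ τ * nat (w τ))
      step τ l = ≤-respʳ-≈ (solve 3 (λ d c w → c :* d :* w := d :* (c :* w)) ≈-refl (nat d) (cylinder μ τ) (nat (w τ)))
        (≤-respˡ-≈ (≈-sym (nat-* (bound-of k (number τ)) (w τ))) (*-monoʳ-≤ (0≤nat (w τ)) (low (bounds c τ l))))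
        where
        low : bound-of k (number τ) ≡ 0 ⊎ nat (bound-of k (number τ)) < cylinder μ τ * nat d → nat (bound-of k (number τ)) ≤ cylinder μ τ * nat d
        low (inj₁ e) = ≤-respˡ-≈ (≡⇒≈ (cong nat (sym e))) (*-nonneg (0≤cylinder μ τ) (0≤nat d))
        low (inj₂ h) = <⇒≤ h

  module _ (μ : Measure cantor) where

    lower-bound : ℕ → String → ℕ
    lower-bound d τ = ⌊ cylinder μ τ * nat d ⌋ℕ

    opaque
      -- Laid out as `level-of`, `scale-of`, `length-of` and `bound-of` expect. The denominator is d
      -- + 1, since `scale-of` adds 1 to rule out 0.
      certificate-for : ℕ → ℕ → ℕ → List ℕ → ℕ
      certificate-for n d l extra = codeNumbers (n ∷ d ∷ l ∷ codeNumbers (table (λ m → lower-bound (suc d) (string n m)) (2 ℕ.^ n)) ∷ extra)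

      certificate-entry : ∀ n d l extra i {e r} →
        drop i (n ∷ d ∷ l ∷ codeNumbers (table (λ m → lower-bound (suc d) (string n m)) (2 ℕ.^ n)) ∷ extra) ≡ e ∷ r →
        entry (certificate-for n d l extra) i ≡ e
      certificate-entry n d l extra i h = entry-codeList (λ x → x) (n ∷ d ∷ l ∷ codeNumbers (table (λ m → lower-bound (suc d) (string n m)) (2 ℕ.^ n)) ∷ extra) i h

    module _ (n d l : ℕ) (extra : List ℕ) where

      private
        k : ℕ
        k = certificate-for n d l extra

      certificate-level : level-of k ≡ n
      certificate-level = certificate-entry n d l extra 0 refl

      certificate-scale : scale-of k ≡ suc d
      certificate-scale = cong suc (certificate-entry n d l extra 1 refl)

      certificate-length : length-of k ≡ l
      certificate-length = certificate-entry n d l extra 2 refl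

      certificate-extra : ∀ i {e r} → drop i extra ≡ e ∷ r → entry k (4 ℕ.+ i) ≡ e
      certificate-extra i h = certificate-entry n d l extra (4 ℕ.+ i) h

      certificate-lower : ∀ τ → length τ ≡ n → bound-of k (number τ) ≡ lower-bound (suc d) τ
      certificate-lower τ e = trans (cong (λ c → entry c (number τ)) (certificate-entry n d l extra 3 refl))
        (trans (entry-table (λ m → lower-bound (suc d) (string n m)) (2 ℕ.^ n) (number τ) (number<2^ n τ e))
          (cong (lower-bound (suc d)) (string-number n τ e)))

      certificate-bounds : ∀ τ → length τ ≡ level-of k → bound-of k (number τ) ≡ 0 ⊎ nat (bound-of k (number τ)) < cylinder μ τ * nat (scale-of k)
      certificate-bounds τ e = subst₂ (λ a s → a ≡ 0 ⊎ nat a < cylinder μ τ * nat s)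
        (sym (certificate-lower τ (trans e certificate-level))) (sym certificate-scale) (proj₁ (proj₂ (floor (cylinder μ τ * nat (suc d)))))

      certificate-total : ∀ (T : TestData) σ → let open Test T in
        nat (totalOf k σ) ≈ Ext n [] (λ τ → nat (lower-bound (suc d) τ ℕ.* weightOf k (number τ) σ))
      certificate-total T σ = ≈-trans (total≈Ext T μ k σ) (≈-trans (≡⇒≈ (cong (λ n → Ext n [] (λ τ → nat (bound-of k (number τ) ℕ.* weightOf k (number τ) σ))) certificate-level))
        (Ext-cong n [] λ τ e → ≡⇒≈ (cong (λ a → nat (a ℕ.* weightOf k (number τ) σ)) (certificate-lower τ e))))
        where open Test T

  -- The test which mixes the diluted sequences with pattern x, where x is drawn
  -- from μ, in equal parts with the uniform measure.

  blockF : Fun 1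
  blockF = function (rec (lit 0) (v1 ⊕ (lit 1 ⊖ (pow (lit 1 ⊕ v1) ⊖ (lit 1 ⊕ v0)))) v0) (λ { (n ∷ []) → block n }) λ { (n ∷ []) → go n }
    where
    go : ∀ n → natrec 0 (λ i a → a ℕ.+ (1 ∸ (2 ℕ.^ suc a ∸ suc i))) n ≡ block n
    go zero    = refl
    go (suc n) = cong (λ a → a ℕ.+ (1 ∸ (2 ℕ.^ suc a ∸ suc n))) (go n)

  dilutionF : Fun 3
  dilutionF = function (lit 1 ⊕ rec (lit 1) (v1 ⊛ (lit 1 ⊕ f ⊖ lit 2 ⊛ (f ⊛ call₂ entryF v4 v0))) (entryᵗ v0 2))
    (λ { (k ∷ m ∷ s ∷ []) → suc (dilution (λ j → halves m (entry k 0 ∸ j)) (entry s) (entry k 2)) }) λ { (k ∷ m ∷ s ∷ []) → cong suc (go k m s (entry k 2)) }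
    where
    f : Tm 5
    f = lit 1 ⊖ (call₂ halvesF v3 (entryᵗ v2 0 ⊖ call₁ blockF v0) ⊖ (v0 ⊖ pow (call₁ blockF v0)))
    go : ∀ k m s n → natrec 1 (λ i a → a ℕ.* factor (forced (λ j → halves m (entry k 0 ∸ j)) i) (entry s i)) n ≡ dilution (λ j → halves m (entry k 0 ∸ j)) (entry s) n
    go k m s zero    = refl
    go k m s (suc n) = cong (ℕ._* factor (forced (λ j → halves m (entry k 0 ∸ j)) n) (entry s n)) (go k m s n)

  -- The level is forced to equal |σ|. This is enough of x: a position below |σ| belongs to a block
  -- whose index is below |σ| too, and the pattern of block j needs only x↾j.
  dilutionData : TestData
  dilutionData = record
    { weight  = dilutionF
    ; divisor = function (pow (lit 1 ⊕ entryᵗ v0 2)) (λ { (k ∷ s ∷ []) → 2 ℕ.^ suc (entry k 2) }) λ { (k ∷ s ∷ []) → refl }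
    ; checks  = predicate (entryᵗ v0 0 ≐ᵗ entryᵗ v0 2) (λ { (k ∷ s ∷ []) → entry k 0 ℕ.≤ entry k 2 × entry k 2 ℕ.≤ entry k 0 })
                  (λ { (k ∷ s ∷ []) h → h }) (λ { (k ∷ s ∷ []) h → h })
    ; queries = function (lit 0) (λ _ → 0) (λ _ → refl)
    ; query   = function (lit 0) (λ _ → 0) (λ _ → refl)
    ; oracle  = constᴿ 0 }

  module DilutionTest = Test dilutionData

  -- The summand 1 is 2^|σ| times the uniform probability of σ. Dividing by 2^(|σ|+1), as `divisor`
  -- does, gives each of the two measures weight ½.
  mixture : String → String → ℕ
  mixture τ σ = suc (diluted (pattern-of τ) σ)

  dilution-weight : ∀ k σ τ → level-of k ≡ length σ → length-of k ≡ length σ → length τ ≡ length σ →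
    DilutionTest.weightOf k (number τ) σ ≡ mixture τ σ
  dilution-weight k σ τ eL eS l = cong suc (trans (cong (dilution (λ j → halves (number τ) (entry k 0 ∸ j)) (bits σ)) eS)
    (dilution-cong (length σ) (λ i i< → trans (cong (λ n → halves (number τ) (n ∸ block i)) eL)
      (halves-number (length σ) (block i) τ l (ℕₚ.≤-trans (block≤ i) (ℕₚ.<⇒≤ i<)))) (λ _ _ → refl)))

  module _ (μ : Measure cantor) where

    mix : String → String → ℝ
    mix σ τ = cylinder μ τ * nat (mixture τ σ)

    dilutionValue : String → ℝ
    dilutionValue σ = Ext (length σ) [] (mix σ) * ½ⁿ (suc (length σ))

    private
      0≤mix : ∀ σ τ → 0# ≤ mix σ τ
      0≤mix σ τ = *-nonneg (0≤cylinder μ τ) (0≤nat (mixture τ σ))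

    dilution-produces⇒ : ∀ σ q → Produces DilutionTest.elements μ (σ , q) → ⌊ q ⌋ < dilutionValue σ
    dilution-produces⇒ σ q p =
      let k , c = DilutionTest.produces⇒certified μ (λ k _ → 1≤2^ (suc (entry k 2))) σ q p
          eS , (l≤ , l≥) , _ = DilutionTest.Certified.holdsAt c
          eL = trans (ℕₚ.≤-antisym l≤ l≥) eS
      in proj₁ (2^-scale {q} {Ext (length σ) [] (mix σ)} (suc (length σ)))
           (<-respˡ-≈ (≡⇒≈ (cong (λ n → ⌊ q ⌋ * nat (2 ℕ.^ suc n)) eS))
           (<-respʳ-≈ (≈-trans (≡⇒≈ (cong (λ n → Ext n [] (λ τ → cylinder μ τ * nat (DilutionTest.weightOf k (number τ) σ))) eL))
               (Ext-cong (length σ) [] λ τ l → ≡⇒≈ (cong (λ w → cylinder μ τ * nat w) (dilution-weight k σ τ eL eS l))))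
             (certified-sound dilutionData μ c)))

    ⇒dilution-produces : ∀ σ q → ⌊ q ⌋ < dilutionValue σ → Produces DilutionTest.elements μ (σ , q)
    ⇒dilution-produces σ q h =
      let N , approx = Ext-floor {n} (0≤cylinder μ) (λ τ → mixture τ σ) (proj₂ (2^-scale {q} {Ext n [] (mix σ)} (suc n)) h)
      in produce N (approx (suc N) (ℕₚ.n≤1+n N))
      where
      n : ℕ
      n = length σ
      produce : ∀ d → ⌊ q ⌋ * nat (2 ℕ.^ suc n) * nat (suc d) < Ext n [] (λ τ → nat (lower-bound μ (suc d) τ ℕ.* mixture τ σ)) →
        Produces DilutionTest.elements μ (σ , q)
      produce d h = DilutionTest.certified⇒produces μ k σ q record
        { bounds = certificate-bounds μ n d n []
        ; holdsAt = eS , (ℕₚ.≤-reflexive (trans eL (sym eS)) , ℕₚ.≤-reflexive (trans eS (sym eL))) , λ j ()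
        ; exceeds = exceed }
        where
        open ≤-Reasoning
        k : ℕ
        k = certificate-for μ n d n []
        eL : level-of k ≡ n
        eL = certificate-level μ n d n []
        eS : length-of k ≡ n
        eS = certificate-length μ n d n []
        exceed : ⌊ q ⌋ * nat (scale-of k ℕ.* 2 ℕ.^ suc (length-of k)) < nat (DilutionTest.totalOf k σ)
        exceed = begin-strict
          ⌊ q ⌋ * nat (scale-of k ℕ.* 2 ℕ.^ suc (length-of k)) ≈⟨ *-cong ≈-refl (≡⇒≈ (cong₂ (λ a b → nat (a ℕ.* 2 ℕ.^ suc b)) (certificate-scale μ n d n []) eS)) ⟩
          ⌊ q ⌋ * nat (suc d ℕ.* 2 ℕ.^ suc n)                  ≈⟨ *-cong ≈-refl (nat-* (suc d) (2 ℕ.^ suc n)) ⟩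
          ⌊ q ⌋ * (nat (suc d) * nat (2 ℕ.^ suc n))            ≈⟨ solve 3 (λ q a b → q :* (a :* b) := q :* b :* a) ≈-refl ⌊ q ⌋ (nat (suc d)) (nat (2 ℕ.^ suc n)) ⟩
          ⌊ q ⌋ * nat (2 ℕ.^ suc n) * nat (suc d)              <⟨ h ⟩
          Ext n [] (λ τ → nat (lower-bound μ (suc d) τ ℕ.* mixture τ σ))
            ≈⟨ Ext-cong n [] (λ τ l → ≡⇒≈ (cong (λ w → nat (lower-bound μ (suc d) τ ℕ.* w)) (sym (dilution-weight k σ τ eL eS l)))) ⟩
          Ext n [] (λ τ → nat (lower-bound μ (suc d) τ ℕ.* DilutionTest.weightOf k (number τ) σ))
            ≈⟨ ≈-sym (certificate-total μ n d n [] dilutionData σ) ⟩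
          nat (DilutionTest.totalOf k σ)                       ∎

    pattern-∷ʳ : ∀ τ c j → j ℕ.≤ length τ → pattern-of (τ ∷ʳ c) j ≡ pattern-of τ j
    pattern-∷ʳ τ c j h = cong number (take-∷ʳ j τ c h)

    diluted-pattern-∷ʳ : ∀ τ c σ → length σ ℕ.≤ suc (length τ) → diluted (pattern-of (τ ∷ʳ c)) σ ≡ diluted (pattern-of τ) σ
    diluted-pattern-∷ʳ τ c σ h = dilution-cong (length σ) (λ i i< → pattern-∷ʳ τ c (block i) (ℕₚ.≤-trans (block≤ i) (ℕₚ.≤-pred (ℕₚ.≤-trans i< h)))) (λ _ _ → refl)

    mixture-additive : ∀ τ c σ → length τ ≡ length σ → mixture (τ ∷ʳ c) (σ ∷ʳ false) ℕ.+ mixture (τ ∷ʳ c) (σ ∷ʳ true) ≡ 2 ℕ.* mixture τ σ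
    mixture-additive τ c σ l = trans (cong₂ (λ a b → suc a ℕ.+ suc b) (drop-last false) (drop-last true))
      (trans (cong suc (ℕₚ.+-suc (diluted ψ (σ ∷ʳ false)) (diluted ψ (σ ∷ʳ true)))) (trans (cong (2 ℕ.+_) (diluted-additive ψ σ)) (sym (2*suc (diluted ψ σ)))))
      where
      ψ : ℕ → ℕ
      ψ = pattern-of τ
      drop-last : ∀ b → diluted (pattern-of (τ ∷ʳ c)) (σ ∷ʳ b) ≡ diluted ψ (σ ∷ʳ b)
      drop-last b = diluted-pattern-∷ʳ τ c (σ ∷ʳ b) (ℕₚ.≤-reflexive (trans (length-∷ʳ σ b) (cong suc (sym l))))

    -- The children of σ are averaged over one more bit of x than σ is. That bit does not influence
    -- their diluted probabilities, so it sums out by the additivity of μ.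
    dilutionValue-additive : Additive dilutionValue
    dilutionValue-additive σ = ≈-sym (begin-equality
      dilutionValue (σ ∷ʳ false) + dilutionValue (σ ∷ʳ true)
        ≈⟨ +-cong (at false) (at true) ⟩
      Ext (suc n) [] (mix (σ ∷ʳ false)) * ½ⁿ (2 ℕ.+ n) + Ext (suc n) [] (mix (σ ∷ʳ true)) * ½ⁿ (2 ℕ.+ n)
        ≈⟨ ≈-sym (*-distribʳ-+ (½ⁿ (2 ℕ.+ n)) (Ext (suc n) [] (mix (σ ∷ʳ false))) (Ext (suc n) [] (mix (σ ∷ʳ true)))) ⟩
      (Ext (suc n) [] (mix (σ ∷ʳ false)) + Ext (suc n) [] (mix (σ ∷ʳ true))) * ½ⁿ (2 ℕ.+ n)
        ≈⟨ *-cong (≈-trans (≈-sym (Ext-+ (suc n) [] (mix (σ ∷ʳ false)) (mix (σ ∷ʳ true)))) (≈-trans (Ext-suc n [] _) (Ext-cong n [] doubles))) ≈-refl ⟩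
      Ext n [] (λ τ → (1# + 1#) * mix σ τ) * ½ⁿ (2 ℕ.+ n)
        ≈⟨ *-cong (Ext-*ˡ n [] (1# + 1#) (mix σ)) ≈-refl ⟩
      (1# + 1#) * Ext n [] (mix σ) * ½ⁿ (2 ℕ.+ n)
        ≈⟨ solve 2 (λ e h → (con (+ 1) :+ con (+ 1)) :* e :* h := e :* (h :+ h)) ≈-refl (Ext n [] (mix σ)) (½ⁿ (2 ℕ.+ n)) ⟩
      Ext n [] (mix σ) * (½ⁿ (2 ℕ.+ n) + ½ⁿ (2 ℕ.+ n))
        ≈⟨ *-cong ≈-refl (½ⁿ-double (suc n)) ⟩
      dilutionValue σ ∎)
      where
      open ≤-Reasoning
      n : ℕ
      n = length σ
      at : ∀ b → dilutionValue (σ ∷ʳ b) ≈ Ext (suc n) [] (mix (σ ∷ʳ b)) * ½ⁿ (2 ℕ.+ n)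
      at b = ≡⇒≈ (cong (λ m → Ext m [] (mix (σ ∷ʳ b)) * ½ⁿ (suc m)) (length-∷ʳ σ b))
      double : ∀ τ c → length τ ≡ n → mix (σ ∷ʳ false) (τ ∷ʳ c) + mix (σ ∷ʳ true) (τ ∷ʳ c) ≈ (1# + 1#) * (cylinder μ (τ ∷ʳ c) * nat (mixture τ σ))
      double τ c l = begin-equality
        mix (σ ∷ʳ false) (τ ∷ʳ c) + mix (σ ∷ʳ true) (τ ∷ʳ c)
          ≈⟨ ≈-sym (*-distribˡ-+ (cylinder μ (τ ∷ʳ c)) (nat (mixture (τ ∷ʳ c) (σ ∷ʳ false))) (nat (mixture (τ ∷ʳ c) (σ ∷ʳ true)))) ⟩
        cylinder μ (τ ∷ʳ c) * (nat (mixture (τ ∷ʳ c) (σ ∷ʳ false)) + nat (mixture (τ ∷ʳ c) (σ ∷ʳ true)))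
          ≈⟨ *-cong ≈-refl (≈-trans (≈-sym (nat-+ (mixture (τ ∷ʳ c) (σ ∷ʳ false)) (mixture (τ ∷ʳ c) (σ ∷ʳ true))))
               (≈-trans (≡⇒≈ (cong nat (mixture-additive τ c σ l))) (nat-* 2 (mixture τ σ)))) ⟩
        cylinder μ (τ ∷ʳ c) * (nat 2 * nat (mixture τ σ))
          ≈⟨ *-cong ≈-refl (*-cong (nat-+ 1 1) ≈-refl) ⟩
        cylinder μ (τ ∷ʳ c) * ((1# + 1#) * nat (mixture τ σ))
          ≈⟨ solve 2 (λ c m → c :* ((con (+ 1) :+ con (+ 1)) :* m) := (con (+ 1) :+ con (+ 1)) :* (c :* m)) ≈-refl (cylinder μ (τ ∷ʳ c)) (nat (mixture τ σ)) ⟩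
        (1# + 1#) * (cylinder μ (τ ∷ʳ c) * nat (mixture τ σ)) ∎
      doubles : ∀ τ → length τ ≡ n →
        (mix (σ ∷ʳ false) (τ ∷ʳ false) + mix (σ ∷ʳ true) (τ ∷ʳ false)) + (mix (σ ∷ʳ false) (τ ∷ʳ true) + mix (σ ∷ʳ true) (τ ∷ʳ true)) ≈ (1# + 1#) * mix σ τ
      doubles τ l = ≈-trans (+-cong (double τ false l) (double τ true l))
        (≈-trans (solve 3 (λ a b m → (con (+ 1) :+ con (+ 1)) :* (a :* m) :+ (con (+ 1) :+ con (+ 1)) :* (b :* m) := (con (+ 1) :+ con (+ 1)) :* ((a :+ b) :* m))
           ≈-refl (cylinder μ (τ ∷ʳ false)) (cylinder μ (τ ∷ʳ true)) (nat (mixture τ σ)))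
         (*-cong ≈-refl (*-cong (≈-sym (cylinder-additive μ τ)) ≈-refl)))

    0≤dilutionValue : ∀ σ → 0# ≤ dilutionValue σ
    0≤dilutionValue σ = *-nonneg (Ext-nonneg (length σ) [] (0≤mix σ)) (<⇒≤ (0<½ⁿ (suc (length σ))))

    dilutionValue-[] : dilutionValue [] ≈ 1#
    dilutionValue-[] = begin-equality
      cylinder μ [] * nat 2 * ½ⁿ 1   ≈⟨ *-cong (*-cong (mass-full μ) (nat-+ 1 1)) ≈-refl ⟩
      1# * (1# + 1#) * ½ⁿ 1          ≈⟨ solve 1 (λ h → con (+ 1) :* (con (+ 1) :+ con (+ 1)) :* h := h :+ h) ≈-refl (½ⁿ 1) ⟩
      ½ⁿ 1 + ½ⁿ 1                    ≈⟨ ≈-trans (½ⁿ-double 0) ½ⁿ-zero ⟩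
      1#                             ∎
      where open ≤-Reasoning

  ≤-[] : ∀ {f} → (∀ σ → 0# ≤ f σ) → Additive f → ∀ σ → f σ ≤ f []
  ≤-[] {f} 0≤f add σ = go (length σ) σ refl
    where
    child : ∀ σ b → f (σ ∷ʳ b) ≤ f σ
    child σ false = ≤-by (0≤f (σ ∷ʳ true)) (≈-trans (+-cong (add σ) ≈-refl) (solve 2 (λ a b → (a :+ b) :- a := b) ≈-refl (f (σ ∷ʳ false)) (f (σ ∷ʳ true))))
    child σ true  = ≤-by (0≤f (σ ∷ʳ false)) (≈-trans (+-cong (add σ) ≈-refl) (solve 2 (λ a b → (a :+ b) :- b := a) ≈-refl (f (σ ∷ʳ false)) (f (σ ∷ʳ true))))
    go : ∀ n σ → length σ ≡ n → f σ ≤ f []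
    go zero    []      _ = ≤-refl
    go (suc n) σ       e with List.initLast σ
    ... | τ List.∷ʳ′ b = ≤-trans (child τ b) (go n τ (ℕₚ.suc-injective (trans (sym (length-∷ʳ τ b)) e)))

  opaque
    unfolding _≈_

    is-semimeasure : ∀ {f} → (∀ σ → 0# ≤ f σ) → (∀ σ → f σ ≤ 1#) → (∀ σ → f (σ ∷ʳ false) + f (σ ∷ʳ true) ≤ f σ) → IsSemimeasure f
    is-semimeasure h k s = record { nonNegative = h ; atMostOne = k ; superadditive = s }

  dilutionTest : CETest
  dilutionTest = record
    { elements    = DilutionTest.elements
    ; apply       = dilutionValue
    ; semimeasure = λ μ → is-semimeasure (0≤dilutionValue μ)
        (λ σ → ≤-respʳ-≈ (dilutionValue-[] μ) (≤-[] (0≤dilutionValue μ) (dilutionValue-additive μ) σ))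
        (λ σ → ≈⇒≤ (≈-sym (dilutionValue-additive μ σ)))
    ; undergraph  = λ μ σ q → mk⇔ (λ p → ⇒fromℚ< (dilution-produces⇒ μ σ q p)) (λ h → ⇒dilution-produces μ σ q (fromℚ<⇒ h)) }

-- Counting the free positions of a diluted sequence

module FreePositions (em : ExcludedMiddle 0ℓ) where

  open DilutedTest em public

  free : (ℕ → ℕ) → ℕ → ℕ
  free ψ zero    = 0
  free ψ (suc i) = free ψ i ℕ.+ (1 ∸ forced ψ i)

  -- Every free bit halves the probability; every forced bit keeps it or makes it 0.
  dilution-free : ∀ ψ b n → dilution ψ b n ≡ 0 ⊎ dilution ψ b n ℕ.* 2 ℕ.^ free ψ n ≡ 2 ℕ.^ n
  dilution-free ψ b zero    = inj₂ refl
  dilution-free ψ b (suc n) = go (dilution-free ψ b n) (forced≤1 ψ n)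
    where
    D F f : ℕ
    D = dilution ψ b n
    F = 2 ℕ.^ free ψ n
    f = forced ψ n
    eq₁ : ∀ d f → (d ℕ.* 1) ℕ.* (2 ℕ.* f) ≡ 2 ℕ.* (d ℕ.* f)
    eq₁ = solve-∀
    eq₂ : ∀ d f → (d ℕ.* 2) ℕ.* f ≡ 2 ℕ.* (d ℕ.* f)
    eq₂ = solve-∀
    go : D ≡ 0 ⊎ D ℕ.* F ≡ 2 ℕ.^ n → f ≡ 0 ⊎ f ≡ 1 → D ℕ.* factor f (b n) ≡ 0 ⊎ (D ℕ.* factor f (b n)) ℕ.* 2 ℕ.^ (free ψ n ℕ.+ (1 ∸ f)) ≡ 2 ℕ.^ suc n
    go (inj₁ e) _ = inj₁ (cong (ℕ._* factor f (b n)) e)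
    go (inj₂ e) (inj₁ z) = inj₂ (trans (cong₂ (λ a c → (D ℕ.* a) ℕ.* 2 ℕ.^ c) (cong (λ f → factor f (b n)) z) (trans (cong (λ f → free ψ n ℕ.+ (1 ∸ f)) z) (ℕₚ.+-comm (free ψ n) 1)))
      (trans (eq₁ D F) (cong (2 ℕ.*_) e)))
    go (inj₂ e) (inj₂ o) with b n
    ... | zero  = inj₂ (trans (cong₂ (λ a c → (D ℕ.* a) ℕ.* 2 ℕ.^ c) (cong (λ f → factor f 0) o) (trans (cong (λ f → free ψ n ℕ.+ (1 ∸ f)) o) (ℕₚ.+-identityʳ (free ψ n))))
      (trans (eq₂ D F) (cong (2 ℕ.*_) e)))
    ... | suc m = inj₁ (trans (cong (D ℕ.*_) (trans (cong (λ f → factor f (suc m)) o) (ℕₚ.m≤n⇒m∸n≡0 (ℕₚ.*-monoʳ-≤ 2 {1} {1 ℕ.* suc m} (s≤s z≤n))))) (ℕₚ.*-zeroʳ D))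

  dilutedMeasure : (ℕ → ℕ) → String → ℝ
  dilutedMeasure ψ σ = nat (diluted ψ σ) * ½ⁿ (length σ)

  0≤dilutedMeasure : ∀ ψ σ → 0# ≤ dilutedMeasure ψ σ
  0≤dilutedMeasure ψ σ = *-nonneg (0≤nat (diluted ψ σ)) (<⇒≤ (0<½ⁿ (length σ)))

  dilutedMeasure-additive : ∀ ψ → Additive (dilutedMeasure ψ)
  dilutedMeasure-additive ψ σ = begin-equality
    nat d * ½ⁿ n                                   ≈⟨ *-cong ≈-refl (≈-sym (½ⁿ-double n)) ⟩
    nat d * (½ⁿ (suc n) + ½ⁿ (suc n))              ≈⟨ solve 2 (λ d h → d :* (h :+ h) := ((con (+ 1) :+ con (+ 1)) :* d) :* h) ≈-refl (nat d) (½ⁿ (suc n)) ⟩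
    (1# + 1#) * nat d * ½ⁿ (suc n)                 ≈⟨ *-cong (*-cong (≈-sym (nat-+ 1 1)) ≈-refl) ≈-refl ⟩
    nat 2 * nat d * ½ⁿ (suc n)                     ≈⟨ *-cong (≈-trans (≈-sym (nat-* 2 d)) (≈-trans (≡⇒≈ (cong nat (sym (diluted-additive ψ σ)))) (nat-+ (diluted ψ (σ ∷ʳ false)) (diluted ψ (σ ∷ʳ true))))) ≈-refl ⟩
    (nat (diluted ψ (σ ∷ʳ false)) + nat (diluted ψ (σ ∷ʳ true))) * ½ⁿ (suc n) ≈⟨ *-distribʳ-+ (½ⁿ (suc n)) (nat (diluted ψ (σ ∷ʳ false))) (nat (diluted ψ (σ ∷ʳ true))) ⟩
    nat (diluted ψ (σ ∷ʳ false)) * ½ⁿ (suc n) + nat (diluted ψ (σ ∷ʳ true)) * ½ⁿ (suc n)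
      ≈⟨ +-cong (*-cong ≈-refl (≡⇒≈ (cong ½ⁿ (sym (length-∷ʳ σ false))))) (*-cong ≈-refl (≡⇒≈ (cong ½ⁿ (sym (length-∷ʳ σ true))))) ⟩
    dilutedMeasure ψ (σ ∷ʳ false) + dilutedMeasure ψ (σ ∷ʳ true) ∎
    where
    open ≤-Reasoning
    d n : ℕ
    d = diluted ψ σ
    n = length σ

  dilutedMeasure-[] : ∀ ψ → dilutedMeasure ψ [] ≈ 1#
  dilutedMeasure-[] ψ = ≈-trans (*-identityˡ (½ⁿ 0)) ½ⁿ-zero

  ½ⁿ-reduce : ∀ {a} m n → a ℕ.* 2 ℕ.^ m ≡ 2 ℕ.^ n → nat a * ½ⁿ n ≈ ½ⁿ m
  ½ⁿ-reduce {a} m n e = begin-equality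
    nat a * ½ⁿ n                              ≈⟨ solve 1 (λ x → x := x :* con (+ 1)) ≈-refl (nat a * ½ⁿ n) ⟩
    nat a * ½ⁿ n * 1#                         ≈⟨ *-cong ≈-refl (≈-sym (½ⁿ*2^n m)) ⟩
    nat a * ½ⁿ n * (½ⁿ m * nat (2 ℕ.^ m))     ≈⟨ solve 4 (λ a h k t → a :* h :* (k :* t) := (a :* t) :* h :* k) ≈-refl (nat a) (½ⁿ n) (½ⁿ m) (nat (2 ℕ.^ m)) ⟩
    nat a * nat (2 ℕ.^ m) * ½ⁿ n * ½ⁿ m       ≈⟨ *-cong (*-cong (≈-trans (≈-sym (nat-* a (2 ℕ.^ m))) (≡⇒≈ (cong nat e))) ≈-refl) ≈-refl ⟩
    nat (2 ℕ.^ n) * ½ⁿ n * ½ⁿ m               ≈⟨ *-cong (≈-trans (*-comm (nat (2 ℕ.^ n)) (½ⁿ n)) (½ⁿ*2^n n)) ≈-refl ⟩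
    1# * ½ⁿ m                                 ≈⟨ *-identityˡ (½ⁿ m) ⟩
    ½ⁿ m                                      ∎
    where open ≤-Reasoning

  dilutedMeasure-value : ∀ ψ σ → 0# < dilutedMeasure ψ σ → dilutedMeasure ψ σ ≈ ½ⁿ (free ψ (length σ))
  dilutedMeasure-value ψ σ h = go (dilution-free ψ (bits σ) (length σ))
    where
    go : diluted ψ σ ≡ 0 ⊎ diluted ψ σ ℕ.* 2 ℕ.^ free ψ (length σ) ≡ 2 ℕ.^ length σ → dilutedMeasure ψ σ ≈ ½ⁿ (free ψ (length σ))
    go (inj₁ e) = ⊥-elim (<-irrefl (<-respʳ-≈ (≈-trans (*-cong (≡⇒≈ (cong nat e)) ≈-refl) (solve 1 (λ h → con (+ 0) :* h := con (+ 0)) ≈-refl (½ⁿ (length σ)))) h))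
    go (inj₂ e) = ½ⁿ-reduce (free ψ (length σ)) (length σ) e

  block-unique : ∀ k n → 2 ℕ.^ k ℕ.≤ n → n ℕ.< 2 ℕ.^ suc k → block n ≡ k
  block-unique k n l u = ℕₚ.≤-antisym
    (ℕₚ.≤-pred (ℕₚ.≰⇒> λ h → ℕₚ.<⇒≱ u (ℕₚ.≤-trans (ℕₚ.^-monoʳ-≤ 2 h) (2^block≤ n (ℕₚ.≤-trans (1≤2^ k) l)))))
    (ℕₚ.≤-pred (ℕₚ.≰⇒> λ h → ℕₚ.<⇒≱ (block-< n) (ℕₚ.≤-trans (ℕₚ.^-monoʳ-≤ 2 h) l)))

  module _ (ψ : ℕ → ℕ) where

    free-block : ∀ k i → i ℕ.≤ 2 ℕ.^ k → free ψ (2 ℕ.^ k ℕ.+ i) ≡ free ψ (2 ℕ.^ k) ℕ.+ (i ℕ.⊓ ψ k)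
    free-block k zero    h = trans (cong (free ψ) (ℕₚ.+-identityʳ (2 ℕ.^ k))) (sym (ℕₚ.+-identityʳ _))
    free-block k (suc i) h = trans (cong (free ψ) (ℕₚ.+-suc (2 ℕ.^ k) i))
      (trans (cong₂ (λ a b → a ℕ.+ (1 ∸ b)) (free-block k i (ℕₚ.<⇒≤ h)) forced-here)
      (trans (ℕₚ.+-assoc (free ψ (2 ℕ.^ k)) (i ℕ.⊓ ψ k) (1 ∸ (1 ∸ (ψ k ∸ i)))) (cong (free ψ (2 ℕ.^ k) ℕ.+_) (step (ψ k) i))))
      where
      b≡k : block (2 ℕ.^ k ℕ.+ i) ≡ k
      b≡k = block-unique k (2 ℕ.^ k ℕ.+ i) (ℕₚ.m≤m+n (2 ℕ.^ k) i) (ℕₚ.+-monoʳ-< (2 ℕ.^ k) (ℕₚ.≤-trans h (ℕₚ.≤-reflexive (sym (ℕₚ.+-identityʳ (2 ℕ.^ k))))))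
      forced-here : forced ψ (2 ℕ.^ k ℕ.+ i) ≡ 1 ∸ (ψ k ∸ i)
      forced-here = trans (cong (λ b → 1 ∸ (ψ b ∸ (2 ℕ.^ k ℕ.+ i ∸ 2 ℕ.^ b))) b≡k) (cong (λ j → 1 ∸ (ψ k ∸ j)) (ℕₚ.m+n∸m≡n (2 ℕ.^ k) i))
      step : ∀ p i → i ℕ.⊓ p ℕ.+ (1 ∸ (1 ∸ (p ∸ i))) ≡ suc i ℕ.⊓ p
      step zero    i       = cong₂ (λ a b → a ℕ.+ (1 ∸ (1 ∸ b))) (ℕₚ.⊓-zeroʳ i) (ℕₚ.0∸n≡0 i)
      step (suc p) zero    = cong (1 ∸_) (ℕₚ.0∸n≡0 p)
      step (suc p) (suc i) = cong suc (step p i)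

    module _ {y : ℝ} (0≤y : 0# ≤ y) (y≤1 : y ≤ 1#) (ψ0 : ψ 0 ≡ 0)
             (ψ≤ : ∀ j → nat (ψ j) ≤ y * nat (2 ℕ.^ j)) (≤ψ : ∀ j → y * nat (2 ℕ.^ j) ≤ nat (ψ j) + 1#) where

      private
        free1 : free ψ 1 ≡ 0
        free1 = cong (λ p → 1 ∸ (1 ∸ p)) ψ0

        double : ∀ k → y * nat (2 ℕ.^ suc k) ≈ y * nat (2 ℕ.^ k) + y * nat (2 ℕ.^ k)
        double k = ≈-trans (*-cong ≈-refl (≈-trans (≡⇒≈ (cong (λ m → nat (2 ℕ.^ k ℕ.+ m)) (ℕₚ.+-identityʳ (2 ℕ.^ k)))) (nat-+ (2 ℕ.^ k) (2 ℕ.^ k))))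
          (*-distribˡ-+ y (nat (2 ℕ.^ k)) (nat (2 ℕ.^ k)))

        free-double : ∀ k → free ψ (2 ℕ.^ suc k) ≡ free ψ (2 ℕ.^ k) ℕ.+ (2 ℕ.^ k ℕ.⊓ ψ k)
        free-double k = trans (cong (λ m → free ψ (2 ℕ.^ k ℕ.+ m)) (ℕₚ.+-identityʳ (2 ℕ.^ k))) (free-block k (2 ℕ.^ k) ℕₚ.≤-refl)

        -- Either all of the first i positions of the block are free, and y ≤ 1, or all ψ k free
        -- positions have been passed, and ψ k + 1 is at least y times the length of the whole
        -- block.
        y*≤ : ∀ i k → i ℕ.≤ 2 ℕ.^ k → y * nat i ≤ nat (i ℕ.⊓ ψ k) + 1#
        y*≤ i k h with ℕₚ.⊓-sel i (ψ k)
        ... | inj₁ e = ≤-trans (≤-respʳ-≈ (*-identityˡ (nat i)) (*-monoʳ-≤ (0≤nat i) y≤1))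
                         (≤-trans (<⇒≤ (x<x+ε 0<1)) (≈⇒≤ (+-cong (≡⇒≈ (cong nat (sym e))) ≈-refl)))
        ... | inj₂ e = ≤-trans (*-monoˡ-≤ 0≤y (nat-mono-≤ h)) (≤-trans (≤ψ k) (≈⇒≤ (+-cong (≡⇒≈ (cong nat (sym e))) ≈-refl)))

      -- Stated at ends of blocks: the free positions of a block come first, so inside a block their
      -- number can run ahead of y n.
      free-upper : ∀ k → nat (free ψ (2 ℕ.^ k)) ≤ y * nat (2 ℕ.^ k)
      free-upper zero    = ≤-respˡ-≈ (≡⇒≈ (cong nat (sym free1))) (*-nonneg 0≤y (0≤nat 1))
      free-upper (suc k) = begin
        nat (free ψ (2 ℕ.^ suc k))                             ≈⟨ ≡⇒≈ (cong nat (free-double k)) ⟩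
        nat (free ψ (2 ℕ.^ k) ℕ.+ (2 ℕ.^ k ℕ.⊓ ψ k))           ≈⟨ nat-+ (free ψ (2 ℕ.^ k)) (2 ℕ.^ k ℕ.⊓ ψ k) ⟩
        nat (free ψ (2 ℕ.^ k)) + nat (2 ℕ.^ k ℕ.⊓ ψ k)         ≤⟨ +-mono-≤ (free-upper k) (≤-trans (nat-mono-≤ (ℕₚ.m⊓n≤n (2 ℕ.^ k) (ψ k))) (ψ≤ k)) ⟩
        y * nat (2 ℕ.^ k) + y * nat (2 ℕ.^ k)                  ≈⟨ ≈-sym (double k) ⟩
        y * nat (2 ℕ.^ suc k)                                  ∎
        where open ≤-Reasoning

      private
        free-lower-power : ∀ k → y * nat (2 ℕ.^ k) ≤ nat (free ψ (2 ℕ.^ k)) + nat (suc k)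
        free-lower-power zero    = ≤-trans (≤-respʳ-≈ (*-identityˡ 1#) (*-monoʳ-≤ (<⇒≤ 0<1) y≤1)) (≤-respʳ-≈ (+-comm 1# (nat (free ψ 1))) (≤-by (0≤nat (free ψ 1)) (solve 2 (λ a b → (a :+ b) :- a := b) ≈-refl 1# (nat (free ψ 1)))))
        free-lower-power (suc k) = begin
          y * nat (2 ℕ.^ suc k)                                ≈⟨ double k ⟩
          y * nat (2 ℕ.^ k) + y * nat (2 ℕ.^ k)                ≤⟨ +-mono-≤ (free-lower-power k) (y*≤ (2 ℕ.^ k) k ℕₚ.≤-refl) ⟩
          (F + nat (suc k)) + (M + 1#)                         ≈⟨ solve 4 (λ f k m o → (f :+ k) :+ (m :+ o) := (f :+ m) :+ (o :+ k)) ≈-refl F (nat (suc k)) M 1# ⟩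
          (F + M) + (1# + nat (suc k))                         ≈⟨ +-cong (≈-trans (≈-sym (nat-+ (free ψ (2 ℕ.^ k)) (2 ℕ.^ k ℕ.⊓ ψ k))) (≡⇒≈ (cong nat (sym (free-double k))))) (≈-sym (nat-suc (suc k))) ⟩
          nat (free ψ (2 ℕ.^ suc k)) + nat (suc (suc k))       ∎
          where
          open ≤-Reasoning
          F M : ℝ
          F = nat (free ψ (2 ℕ.^ k))
          M = nat (2 ℕ.^ k ℕ.⊓ ψ k)

      -- Rounding y 2^j to ψ j loses at most 1 in each of the blocks 0, ..., `block n`, and position
      -- 0 accounts for one more. The loss is logarithmic in n.
      free-lower : ∀ n → 1 ℕ.≤ n → y * nat n ≤ nat (free ψ n) + nat (2 ℕ.+ block n)
      free-lower n 1≤n = subst (λ n′ → y * nat n′ ≤ nat (free ψ n′) + nat (2 ℕ.+ k)) eq (begin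
        y * nat (2 ℕ.^ k ℕ.+ i)              ≈⟨ ≈-trans (*-cong ≈-refl (nat-+ (2 ℕ.^ k) i)) (*-distribˡ-+ y (nat (2 ℕ.^ k)) (nat i)) ⟩
        y * nat (2 ℕ.^ k) + y * nat i        ≤⟨ +-mono-≤ (free-lower-power k) (y*≤ i k i≤) ⟩
        (F + nat (suc k)) + (M + 1#)         ≈⟨ solve 4 (λ f k m o → (f :+ k) :+ (m :+ o) := (f :+ m) :+ (o :+ k)) ≈-refl F (nat (suc k)) M 1# ⟩
        (F + M) + (1# + nat (suc k))         ≈⟨ +-cong (≈-trans (≈-sym (nat-+ (free ψ (2 ℕ.^ k)) (i ℕ.⊓ ψ k))) (≡⇒≈ (cong nat (sym (free-block k i i≤))))) (≈-sym (nat-suc (suc k))) ⟩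
        nat (free ψ (2 ℕ.^ k ℕ.+ i)) + nat (2 ℕ.+ k) ∎)
        where
        open ≤-Reasoning
        k i : ℕ
        k = block n
        i = n ∸ 2 ℕ.^ k
        eq : 2 ℕ.^ k ℕ.+ i ≡ n
        eq = ℕₚ.m+[n∸m]≡n (2^block≤ n 1≤n)
        i≤ : i ℕ.≤ 2 ℕ.^ k
        i≤ = ℕₚ.+-cancelˡ-≤ (2 ℕ.^ k) i (2 ℕ.^ k) (subst₂ ℕ._≤_ (sym eq) (cong (2 ℕ.^ k ℕ.+_) (ℕₚ.+-identityʳ (2 ℕ.^ k))) (ℕₚ.<⇒≤ (block-< n)))
        F M : ℝ
        F = nat (free ψ (2 ℕ.^ k))
        M = nat (i ℕ.⊓ ψ k)

  -- The quadratic bound serves `power-dominates`: one factor k + 1 absorbs the constant divided by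
  -- ε, the other bounds k + C.
  k²≤4*2^k : ∀ k → suc k ℕ.* suc k ℕ.≤ 4 ℕ.* 2 ℕ.^ k
  k²≤4*2^k 0 = ℕₚ.m≤m+n 1 3
  k²≤4*2^k 1 = ℕₚ.m≤m+n 4 4
  k²≤4*2^k 2 = ℕₚ.m≤m+n 9 7
  k²≤4*2^k (suc (suc (suc k))) = begin
    -- The added polynomial is 2 (k + 3)² - (k + 4)², nonnegative term by term once k has been
    -- shifted by 3.
    (4 ℕ.+ k) ℕ.* (4 ℕ.+ k)                                          ≤⟨ ℕₚ.m≤m+n _ (k ℕ.* k ℕ.+ 4 ℕ.* k ℕ.+ 2) ⟩
    (4 ℕ.+ k) ℕ.* (4 ℕ.+ k) ℕ.+ (k ℕ.* k ℕ.+ 4 ℕ.* k ℕ.+ 2)          ≡⟨ eq₁ k ⟩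
    2 ℕ.* ((3 ℕ.+ k) ℕ.* (3 ℕ.+ k))                                  ≤⟨ ℕₚ.*-monoʳ-≤ 2 (k²≤4*2^k (suc (suc k))) ⟩
    2 ℕ.* (4 ℕ.* 2 ℕ.^ (2 ℕ.+ k))                                    ≡⟨ eq₂ (2 ℕ.^ (2 ℕ.+ k)) ⟩
    4 ℕ.* 2 ℕ.^ (3 ℕ.+ k)                                            ∎
    where
    open ℕₚ.≤-Reasoning
    eq₁ : ∀ k → (4 ℕ.+ k) ℕ.* (4 ℕ.+ k) ℕ.+ (k ℕ.* k ℕ.+ 4 ℕ.* k ℕ.+ 2) ≡ 2 ℕ.* ((3 ℕ.+ k) ℕ.* (3 ℕ.+ k))
    eq₁ = solve-∀
    eq₂ : ∀ t → 2 ℕ.* (4 ℕ.* t) ≡ 4 ℕ.* (2 ℕ.* t)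
    eq₂ = solve-∀

  power-dominates : ∀ C {ε} → 0# < ε → ∃[ N ] (∀ k → N ℕ.≤ k → nat (k ℕ.+ C) ≤ ε * nat (2 ℕ.^ k))
  power-dominates C {ε} ε>0 =
    let N , h = archimedean-* (nat (4 ℕ.* suc C)) ε>0
    in N , λ k N≤k → *-cancelˡ-≤ (*-pos (nat-mono-< {0} {4} (s≤s z≤n)) (0<nat-suc C)) (begin
      nat 4 * nat (suc C) * nat (k ℕ.+ C)                  ≤⟨ *-mono-≤ (*-nonneg (0≤nat 4) (0≤nat (suc C))) (0≤nat (k ℕ.+ C))
                                                               (≤-respˡ-≈ (nat-* 4 (suc C)) (<⇒≤ (<-≤-trans (h k N≤k) (*-monoʳ-≤ (<⇒≤ ε>0) (nat-mono-≤ (ℕₚ.n≤1+n k))))))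
                                                               (nat-mono-≤ (k+C≤ k)) ⟩
      nat (suc k) * ε * nat (suc k ℕ.* suc C)              ≈⟨ *-cong ≈-refl (nat-* (suc k) (suc C)) ⟩
      nat (suc k) * ε * (nat (suc k) * nat (suc C))        ≈⟨ solve 3 (λ k e c → k :* e :* (k :* c) := (k :* k) :* (c :* e)) ≈-refl (nat (suc k)) ε (nat (suc C)) ⟩
      nat (suc k) * nat (suc k) * (nat (suc C) * ε)        ≤⟨ *-monoʳ-≤ (*-nonneg (0≤nat (suc C)) (<⇒≤ ε>0))
                                                               (≤-respˡ-≈ (nat-* (suc k) (suc k)) (≤-respʳ-≈ (nat-* 4 (2 ℕ.^ k)) (nat-mono-≤ (k²≤4*2^k k)))) ⟩
      nat 4 * nat (2 ℕ.^ k) * (nat (suc C) * ε)            ≈⟨ solve 4 (λ f t c e → f :* t :* (c :* e) := f :* c :* (e :* t)) ≈-refl (nat 4) (nat (2 ℕ.^ k)) (nat (suc C)) ε ⟩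
      nat 4 * nat (suc C) * (ε * nat (2 ℕ.^ k))            ∎)
    where
    open ≤-Reasoning
    k+C≤ : ∀ k → k ℕ.+ C ℕ.≤ suc k ℕ.* suc C
    k+C≤ k = ℕₚ.≤-trans (ℕₚ.m≤m+n (k ℕ.+ C) (suc (k ℕ.* C))) (ℕₚ.≤-reflexive (eq k C))
      where
      eq : ∀ k C → k ℕ.+ C ℕ.+ suc (k ℕ.* C) ≡ suc k ℕ.* suc C
      eq = solve-∀

  block-dominated : ∀ C {ε} → 0# < ε → ∃[ N ] (∀ n → N ℕ.≤ n → 1 ℕ.≤ n → nat (block n ℕ.+ C) ≤ ε * nat n)
  block-dominated C {ε} ε>0 =
    let N , h = power-dominates C ε>0
    in 2 ℕ.^ N , λ n le 1≤n → ≤-trans (h (block n) (large N n le)) (*-monoˡ-≤ (<⇒≤ ε>0) (nat-mono-≤ (2^block≤ n 1≤n)))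
    where
    large : ∀ N n → 2 ℕ.^ N ℕ.≤ n → N ℕ.≤ block n
    large N n le = ℕₚ.≤-pred (ℕₚ.≰⇒> λ h → ℕₚ.<⇒≱ (block-< n) (ℕₚ.≤-trans (ℕₚ.^-monoʳ-≤ 2 h) le))

-- Values of binary expansions, and exponents of local mass

module Exponents (em : ExcludedMiddle 0ℓ) where

  open FreePositions em public

  module _ (x : 2^ω) where

    private
      a : ℕ → ℕ
      a n = number (prefix x n)

      a-suc : ∀ n → a (suc n) ≡ 2 ℕ.* a n ℕ.+ codeBool (x n)
      a-suc n = trans (cong number (prefix-∷ʳ x n)) (number-∷ʳ (prefix x n) (x n))

      lo hi : ℕ → ℝ
      lo n = nat (a n) * ½ⁿ n
      hi n = (nat (a n) + 1#) * ½ⁿ n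

      split : ∀ u n → u * ½ⁿ n ≈ (u + u) * ½ⁿ (suc n)
      split u n = ≈-trans (*-cong ≈-refl (≈-sym (½ⁿ-double n))) (solve 2 (λ u h → u :* (h :+ h) := (u :+ u) :* h) ≈-refl u (½ⁿ (suc n)))

      nat-double : ∀ m → nat (2 ℕ.* m) ≈ nat m + nat m
      nat-double m = ≈-trans (≡⇒≈ (cong (λ k → nat (m ℕ.+ k)) (ℕₚ.+-identityʳ m))) (nat-+ m m)

      bit≤1 : ∀ b → codeBool b ℕ.≤ 1
      bit≤1 false = z≤n
      bit≤1 true  = s≤s z≤n

      lo-step : ∀ n → lo n ≤ lo (suc n)
      lo-step n = ≤-respˡ-≈ (≈-sym (split (nat (a n)) n)) (*-monoʳ-≤ (<⇒≤ (0<½ⁿ (suc n)))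
        (≤-respˡ-≈ (nat-double (a n)) (nat-mono-≤ (ℕₚ.≤-trans (ℕₚ.m≤m+n (2 ℕ.* a n) (codeBool (x n))) (ℕₚ.≤-reflexive (sym (a-suc n)))))))

      hi-step : ∀ n → hi (suc n) ≤ hi n
      hi-step n = ≤-respʳ-≈ (≈-sym (split (nat (a n) + 1#) n)) (*-monoʳ-≤ (<⇒≤ (0<½ⁿ (suc n))) (begin
        nat (a (suc n)) + 1#                      ≤⟨ +-mono-≤ (nat-mono-≤ (ℕₚ.≤-trans (ℕₚ.≤-reflexive (a-suc n)) (ℕₚ.+-monoʳ-≤ (2 ℕ.* a n) (bit≤1 (x n))))) ≤-refl ⟩
        nat (2 ℕ.* a n ℕ.+ 1) + 1#                ≈⟨ +-cong (≈-trans (nat-+ (2 ℕ.* a n) 1) (+-cong (nat-double (a n)) ≈-refl)) ≈-refl ⟩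
        nat (a n) + nat (a n) + 1# + 1#           ≈⟨ solve 2 (λ a o → a :+ a :+ o :+ o := (a :+ o) :+ (a :+ o)) ≈-refl (nat (a n)) 1# ⟩
        (nat (a n) + 1#) + (nat (a n) + 1#)       ∎))
        where open ≤-Reasoning

      lo-mono : Monotone lo
      lo-mono {m} h = go (ℕₚ.≤⇒≤′ h)
        where
        go : ∀ {n} → m ℕ.≤′ n → lo m ≤ lo n
        go (ℕ.≤′-reflexive refl) = ≤-refl
        go (ℕ.≤′-step {n} p) = ≤-trans (go p) (lo-step n)

      hi-anti : ∀ {m n} → m ℕ.≤′ n → hi n ≤ hi m
      hi-anti (ℕ.≤′-reflexive refl) = ≤-refl
      hi-anti (ℕ.≤′-step {n} p) = ≤-trans (hi-step n) (hi-anti p)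

      lo≤hi : ∀ m n → lo m ≤ hi n
      lo≤hi m n = ≤-trans (lo-mono (ℕₚ.m≤m⊔n m n)) (≤-trans (*-monoʳ-≤ (<⇒≤ (0<½ⁿ (m ℕ.⊔ n))) (<⇒≤ (x<x+ε 0<1)))
        (hi-anti (ℕₚ.≤⇒≤′ (ℕₚ.m≤n⊔m m n))))

    opaque
      expansion-sup : Σ[ y ∈ ℝ ] IsSupSeq lo y
      expansion-sup = supSeq (λ n → lo≤hi n 0)

    value-of : ℝ
    value-of = proj₁ expansion-sup

    value-lower : ∀ n → nat (number (prefix x n)) ≤ value-of * nat (2 ℕ.^ n)
    value-lower n = ≤-respˡ-≈ (½ⁿ-cancel (nat (a n)) n) (*-monoʳ-≤ (0≤nat (2 ℕ.^ n)) (proj₁ (proj₂ expansion-sup) n))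

    value-upper : ∀ n → value-of * nat (2 ℕ.^ n) ≤ nat (number (prefix x n)) + 1#
    value-upper n = ≤-respʳ-≈ (½ⁿ-cancel (nat (a n) + 1#) n) (*-monoʳ-≤ (0≤nat (2 ℕ.^ n)) (proj₂ (proj₂ expansion-sup) (hi n) λ m → lo≤hi m n))

    0≤value : 0# ≤ value-of
    0≤value = ≤-respʳ-≈ (*-identityʳ value-of) (value-lower 0)

    value≤1 : value-of ≤ 1#
    value≤1 = ≤-respˡ-≈ (*-identityʳ value-of) (≤-respʳ-≈ (+-identityˡ 1#) (value-upper 0))

  -- ℓ = log 2

  opaque
    log2 : ∃[ s ] (0# ≤ s × exp s ≈ nat 2)
    log2 = log-exists (nat-mono-≤ {1} {2} (s≤s z≤n))

  ℓ : ℝ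
  ℓ = proj₁ log2

  0≤ℓ : 0# ≤ ℓ
  0≤ℓ = proj₁ (proj₂ log2)

  exp-ℓ : exp ℓ ≈ nat 2
  exp-ℓ = proj₂ (proj₂ log2)

  0<ℓ : 0# < ℓ
  0<ℓ = ≰⇒> λ h → <-irrefl (<-respʳ-≈ (≈-trans (≈-sym exp-ℓ) (≈-trans (exp-cong 0≤ℓ (≤-antisym h 0≤ℓ)) exp-zero)) (nat-mono-< {1} {2} (s≤s (s≤s z≤n))))

  0≤nat*ℓ : ∀ j → 0# ≤ nat j * ℓ
  0≤nat*ℓ j = *-nonneg (0≤nat j) 0≤ℓ

  exp-nat*ℓ : ∀ j → exp (nat j * ℓ) ≈ nat (2 ℕ.^ j)
  exp-nat*ℓ zero    = ≈-trans (exp-cong (0≤nat*ℓ 0) (solve 1 (λ l → con (+ 0) :* l := con (+ 0)) ≈-refl ℓ)) exp-zero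
  exp-nat*ℓ (suc j) = begin-equality
    exp (nat (suc j) * ℓ)        ≈⟨ exp-cong (0≤nat*ℓ (suc j)) (≈-trans (*-cong (nat-suc j) ≈-refl) (solve 2 (λ n l → (con (+ 1) :+ n) :* l := l :+ n :* l) ≈-refl (nat j) ℓ)) ⟩
    exp (ℓ + nat j * ℓ)          ≈⟨ exp-+ 0≤ℓ (0≤nat*ℓ j) ⟩
    exp ℓ * exp (nat j * ℓ)      ≈⟨ *-cong exp-ℓ (exp-nat*ℓ j) ⟩
    nat 2 * nat (2 ℕ.^ j)        ≈⟨ ≈-sym (nat-* 2 (2 ℕ.^ j)) ⟩
    nat (2 ℕ.^ suc j)            ∎
    where open ≤-Reasoning

  ½ⁿ*exp≤1 : ∀ j {u} → 0# ≤ u → u ≤ nat j * ℓ → ½ⁿ j * exp u ≤ 1#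
  ½ⁿ*exp≤1 j h k = ≤-respʳ-≈ (≈-trans (*-cong ≈-refl (exp-nat*ℓ j)) (½ⁿ*2^n j)) (*-monoˡ-≤ (<⇒≤ (0<½ⁿ j)) (exp-mono-≤ h k))

  1<½ⁿ*exp : ∀ j {u} → nat j * ℓ < u → 1# < ½ⁿ j * exp u
  1<½ⁿ*exp j k = <-respˡ-≈ (≈-trans (*-cong ≈-refl (exp-nat*ℓ j)) (½ⁿ*2^n j)) (*-monoˡ-< (0<½ⁿ j) (exp-mono-< (0≤nat*ℓ j) k))

  -- Low w t says that - log₂ μ [w↾n] ≥ t n for all large n.

  module Dimension (μ : Measure cantor) {K : ℕ} (positive : ∀ σ → ½ⁿ (K ℕ.+ length σ) ≤ cylinder μ σ) where

    cyl : 2^ω → ℕ → ℝ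
    cyl w n = cylinder μ (prefix w n)

    ½ⁿ≤cyl : ∀ w n → ½ⁿ (K ℕ.+ n) ≤ cyl w n
    ½ⁿ≤cyl w n = subst (λ m → ½ⁿ (K ℕ.+ m) ≤ cyl w n) (length-prefix w n) (positive (prefix w n))

    0<cyl : ∀ w n → 0# < cyl w n
    0<cyl w n = <-≤-trans (0<½ⁿ (K ℕ.+ n)) (½ⁿ≤cyl w n)

    -- This is μ(σ) ≤ 2^(-t |σ|), with the power moved to the left because `exp` is the exponential
    -- only at nonnegative arguments.
    Below : ℝ → String → Set
    Below t σ = cylinder μ σ * exp (t * nat (length σ) * ℓ) ≤ 1#

    Low : 2^ω → ℝ → Set
    Low w t = ∃[ N ] (∀ n → N ℕ.≤ n → Below t (prefix w n))

    Below-prefix : ∀ w t n → 0# ≤ t → (Below t (prefix w n) → cyl w n * exp (t * nat n * ℓ) ≤ 1#) × (cyl w n * exp (t * nat n * ℓ) ≤ 1# → Below t (prefix w n))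
    Below-prefix w t n 0≤t = subst (λ m → cyl w n * exp (t * nat m * ℓ) ≤ 1#) (length-prefix w n) ,
      subst (λ m → cyl w n * exp (t * nat m * ℓ) ≤ 1#) (sym (length-prefix w n))

    0≤tnℓ : ∀ {t} n → 0# ≤ t → 0# ≤ t * nat n * ℓ
    0≤tnℓ n h = *-nonneg (*-nonneg h (0≤nat n)) 0≤ℓ

    Low-mono : ∀ w {s t} → 0# ≤ s → s ≤ t → Low w t → Low w s
    Low-mono w {s} {t} 0≤s s≤t (N , h) = N , λ n N≤n →
      ≤-trans (*-monoˡ-≤ (0≤cylinder μ (prefix w n)) (exp-mono-≤ (0≤tnℓ (length (prefix w n)) 0≤s)
        (*-monoʳ-≤ 0≤ℓ (*-monoʳ-≤ (0≤nat (length (prefix w n))) s≤t)))) (h n N≤n)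

    -- Refuting an exponent needs infinitely many heavy prefixes only, so lower bounds on the mass
    -- along a subsequence of lengths suffice.
    ¬Low : ∀ w {t} → 0# ≤ t → (∀ N → ∃[ n ] (N ℕ.≤ n × ∃[ j ] (½ⁿ j ≤ cyl w n × nat j < t * nat n))) → ¬ Low w t
    ¬Low w {t} 0≤t h (N , low) =
      let n , N≤n , j , le , lt = h N
      in ≤⇒≮ (proj₁ (Below-prefix w t n 0≤t) (low n N≤n)) (<-≤-trans (1<½ⁿ*exp j (*-monoʳ-< 0<ℓ lt))
           (*-monoʳ-≤ (<⇒≤ (0<exp (0≤tnℓ n 0≤t))) le))

    Exponent : 2^ω → ℝ → Set
    Exponent w t = 0# ≤ t × Low w t

    Exponent-0 : ∀ w → Exponent w 0#
    Exponent-0 w = ≤-refl , 0 , λ n _ → ≤-trans (≈⇒≤ (≈-trans (*-cong ≈-refl (≈-trans (≈-sym (exp-cong ≤-refl (solve 2 (λ n l → con (+ 0) := con (+ 0) :* n :* l) ≈-refl (nat (length (prefix w n))) ℓ))) exp-zero)) (*-identityʳ (cyl w n)))) (mass≤1 μ (basic (prefix w n)))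

    -- By `positive` a prefix of length n ≥ 1 has mass at least 2^-(K+n), and K + n ≤ (2 + K) n. So
    -- the exponents have a supremum.
    Exponent≤ : ∀ w t → Exponent w t → t ≤ nat (2 ℕ.+ K)
    Exponent≤ w t (0≤t , low) = ≮⇒≤ λ lt → ¬Low w 0≤t (λ N → suc N , ℕₚ.n≤1+n N , K ℕ.+ suc N , ½ⁿ≤cyl w (suc N) , (begin-strict
      nat (K ℕ.+ suc N)             ≤⟨ nat-mono-≤ (ℕₚ.≤-trans (ℕₚ.+-monoˡ-≤ (suc N) (ℕₚ.m≤m*n K (suc N))) (ℕₚ.≤-trans (ℕₚ.m≤n+m _ (suc N)) (ℕₚ.≤-reflexive (eq K (suc N))))) ⟩
      nat ((2 ℕ.+ K) ℕ.* suc N)     ≈⟨ nat-* (2 ℕ.+ K) (suc N) ⟩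
      nat (2 ℕ.+ K) * nat (suc N)   <⟨ *-monoʳ-< (0<nat-suc N) lt ⟩
      t * nat (suc N)               ∎)) low
      where
      open ≤-Reasoning
      eq : ∀ K n → n ℕ.+ (K ℕ.* n ℕ.+ n) ≡ (2 ℕ.+ K) ℕ.* n
      eq = solve-∀

    opaque
      dim-lub : ∀ w → Σ[ d ∈ ℝ ] IsLub (Exponent w) d
      dim-lub w = lub (Exponent w) (Exponent-0 w) (Exponent≤ w)

    -- The lower limit of - log₂ μ[w↾n] / n, as the supremum of the rates valid from some n on.
    -- `PointwiseDim` identifies it with the lower limit over radii.
    dim : 2^ω → ℝ
    dim w = proj₁ (dim-lub w)

    0≤dim : ∀ w → 0# ≤ dim w
    0≤dim w = proj₁ (proj₂ (dim-lub w)) 0# (Exponent-0 w)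

    Low⇒≤dim : ∀ w {t} → 0# ≤ t → Low w t → t ≤ dim w
    Low⇒≤dim w 0≤t low = proj₁ (proj₂ (dim-lub w)) _ (0≤t , low)

    <dim⇒Low : ∀ w {t} → 0# ≤ t → t < dim w → Low w t
    <dim⇒Low w 0≤t t<d = let s , (_ , low) , t<s = lub-witness {Exponent w} (proj₂ (dim-lub w)) t<d
                         in Low-mono w 0≤t (<⇒≤ t<s) low

    dim-unique : ∀ w {y} → 0# ≤ y → (∀ t → 0# ≤ t → t < y → Low w t) → (∀ t → y < t → ¬ Low w t) → dim w ≈ y
    dim-unique w {y} 0≤y below above = ≤-antisym
      (≮⇒≤ λ y<d → let q , a , b = dense y<d in above ⌊ q ⌋ a (<dim⇒Low w (≤-trans 0≤y (<⇒≤ a)) b))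
      (≮⇒≤ λ d<y → let q , a , b = dense d<y in ≤⇒≮ (Low⇒≤dim w (≤-trans (0≤dim w) (<⇒≤ a)) (below ⌊ q ⌋ (≤-trans (0≤dim w) (<⇒≤ a)) b)) a)

  Extending : String → ℕ → String → Set
  Extending σ n τ = length τ ≡ length σ ℕ.+ n × take (length σ) τ ≡ σ

  private
    shrink : ∀ σ b n τ → Extending (σ ∷ʳ b) n τ → Extending σ (suc n) τ
    shrink σ b n τ (l , e) = trans l (trans (cong (ℕ._+ n) (length-∷ʳ σ b)) (sym (ℕₚ.+-suc (length σ) n))) ,
      trans (sym (take-take (length σ) (suc (length σ)) τ (ℕₚ.n≤1+n (length σ)))) (trans (cong (λ m → take (length σ) (take m τ)) (sym (length-∷ʳ σ b)))
        (trans (cong (take (length σ)) e) (trans (take-∷ʳ (length σ) σ b ℕₚ.≤-refl) (take-length σ))))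

  Ext-mono-extending : ∀ n σ {f g} → (∀ τ → Extending σ n τ → f τ ≤ g τ) → Ext n σ f ≤ Ext n σ g
  Ext-mono-extending zero    σ h = h σ (sym (ℕₚ.+-identityʳ (length σ)) , take-length σ)
  Ext-mono-extending (suc n) σ h = +-mono-≤ (Ext-mono-extending n (σ ∷ʳ false) λ τ e → h τ (shrink σ false n τ e))
                                            (Ext-mono-extending n (σ ∷ʳ true) λ τ e → h τ (shrink σ true n τ e))

  Ext-child : ∀ n σ b {f} → (∀ τ → 0# ≤ f τ) → Ext n (σ ∷ʳ b) f ≤ Ext (suc n) σ f
  Ext-child n σ false {f} h = ≤-by (Ext-nonneg n (σ ∷ʳ true) h) (solve 2 (λ a b → (a :+ b) :- a := b) ≈-refl (Ext n (σ ∷ʳ false) f) (Ext n (σ ∷ʳ true) f))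
  Ext-child n σ true  {f} h = ≤-by (Ext-nonneg n (σ ∷ʳ false) h) (solve 2 (λ a b → (a :+ b) :- b := a) ≈-refl (Ext n (σ ∷ʳ false) f) (Ext n (σ ∷ʳ true) f))

  Ext-prefix : ∀ x j n {f} → (∀ τ → 0# ≤ f τ) → Ext n (prefix x j) f ≤ Ext (j ℕ.+ n) [] f
  Ext-prefix x zero    n h = ≤-refl
  Ext-prefix x (suc j) n {f} h = ≤-trans (≤-respˡ-≈ (≡⇒≈ (cong (λ σ → Ext n σ f) (sym (prefix-∷ʳ x j)))) (Ext-child n (prefix x j) (x j) h))
    (≤-respʳ-≈ (≡⇒≈ (cong (λ m → Ext m [] f) (ℕₚ.+-suc j n))) (Ext-prefix x j (suc n) h))

-- Typical diluted sequences have the intended dimension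

module TypicalSequences (em : ExcludedMiddle 0ℓ) where

  open Exponents em public

  opaque
    unfolding _≈_

    neutral-dominates : ∀ {μ} → Neutral μ → (T : CETest) → ∃[ c ] (0ℚ ℚ.< c × (∀ σ → ⌊ c ⌋ * D.apply T μ σ ≤ cylinder μ σ))
    neutral-dominates {μ} (U , universal , passes) T =
      let c , c>0 , h = universal T
      in c , c>0 , λ σ → ≤-trans {⌊ c ⌋ * D.apply T μ σ} {D.apply U μ σ} {cylinder μ σ} (h μ σ) (passes σ)

  -- Fubini's theorem, in the only form that the averaging over x requires.
  Ext-swap : ∀ n σ m ρ (f : String → String → ℝ) → Ext n σ (λ τ → Ext m ρ (f τ)) ≈ Ext m ρ (λ υ → Ext n σ (λ τ → f τ υ))
  Ext-swap zero    σ m ρ f = ≈-refl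
  Ext-swap (suc n) σ m ρ f = ≈-trans (+-cong (Ext-swap n (σ ∷ʳ false) m ρ f) (Ext-swap n (σ ∷ʳ true) m ρ f))
    (≈-sym (Ext-+ m ρ (λ υ → Ext n (σ ∷ʳ false) (λ τ → f τ υ)) (λ υ → Ext n (σ ∷ʳ true) (λ τ → f τ υ))))

  pattern-along : 2^ω → ℕ → ℕ
  pattern-along x j = number (prefix x j)

  pattern-extending : ∀ x k τ → k ℕ.≤ length τ → take k τ ≡ prefix x k → ∀ j → j ℕ.≤ k → pattern-of τ j ≡ pattern-along x j
  pattern-extending x k τ k≤ e j j≤k = cong number (trans (sym (take-take j k τ j≤k)) (trans (cong (take j) e) (take-prefix x j≤k)))

  module _ (μ : Measure cantor) {c : ℝ} (0<c : 0# < c) (dominates : ∀ σ → c * dilutionValue μ σ ≤ cylinder μ σ) where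

    private
      -- The factor ½ is the weight of either measure in the mixture.
      c₀ : ℝ
      c₀ = ½ℝ * c

      0<c₀ : 0# < c₀
      0<c₀ = half 0<c

      diluted-mix : String → String → ℝ
      diluted-mix σ τ = cylinder μ τ * dilutedMeasure (pattern-of τ) σ

      halve : ∀ n x → c₀ * (x * ½ⁿ n) ≈ c * (x * ½ⁿ (suc n))
      halve n x = ≈-trans (solve 4 (λ h c x t → h :* c :* (x :* t) := c :* (x :* (h :* t))) ≈-refl ½ℝ c x (½ⁿ n))
        (*-cong ≈-refl (*-cong ≈-refl (≈-sym (½ⁿ-suc n))))

      below-mix : ∀ σ {f : String → ℝ} → (∀ τ → f τ ≤ mix μ σ τ) → c₀ * (Ext (length σ) [] f * ½ⁿ (length σ)) ≤ cylinder μ σ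
      below-mix σ {f} h = ≤-trans (≈⇒≤ (halve (length σ) (Ext (length σ) [] f)))
        (≤-trans (*-monoˡ-≤ (<⇒≤ 0<c) (*-monoʳ-≤ (<⇒≤ (0<½ⁿ (suc (length σ)))) (Ext-mono (length σ) [] λ τ _ → h τ))) (dominates σ))

      dominates-uniform : ∀ σ → c₀ * ½ⁿ (length σ) ≤ cylinder μ σ
      dominates-uniform σ = ≤-respˡ-≈ (*-cong ≈-refl (≈-trans (*-cong (≈-trans (Ext-cylinder μ (length σ) []) (mass-full μ)) ≈-refl) (*-identityˡ (½ⁿ (length σ)))))
        (below-mix σ λ τ → ≤-respˡ-≈ (*-identityʳ (cylinder μ τ)) (*-monoˡ-≤ (0≤cylinder μ τ) (nat-mono-≤ {1} (s≤s z≤n))))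

      dominates-diluted : ∀ σ → c₀ * Ext (length σ) [] (diluted-mix σ) ≤ cylinder μ σ
      dominates-diluted σ = ≤-respˡ-≈ (*-cong ≈-refl (≈-sym (begin-equality
          Ext n [] (diluted-mix σ)                                            ≈⟨ Ext-cong n [] (λ τ _ → solve 3 (λ m d h → m :* (d :* h) := h :* (m :* d)) ≈-refl (cylinder μ τ) (nat (diluted (pattern-of τ) σ)) (½ⁿ n)) ⟩
          Ext n [] (λ τ → ½ⁿ n * (cylinder μ τ * nat (diluted (pattern-of τ) σ))) ≈⟨ Ext-*ˡ n [] (½ⁿ n) _ ⟩
          ½ⁿ n * Ext n [] (λ τ → cylinder μ τ * nat (diluted (pattern-of τ) σ))   ≈⟨ *-comm (½ⁿ n) _ ⟩
          Ext n [] (λ τ → cylinder μ τ * nat (diluted (pattern-of τ) σ)) * ½ⁿ n   ∎)))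
        (below-mix σ λ τ → *-monoˡ-≤ (0≤cylinder μ τ) (nat-mono-≤ (ℕₚ.n≤1+n (diluted (pattern-of τ) σ))))
        where
        open ≤-Reasoning
        n : ℕ
        n = length σ

      bounds-exist : ∃[ K ] (½ⁿ K ≤ c₀)
      bounds-exist = let N , h = ½ⁿ-small 1# 0<c₀ in N , <⇒≤ (<-respˡ-≈ (*-identityʳ (½ⁿ N)) h)

    opaque
      weight-bound : ∃[ K ] (½ⁿ K ≤ c₀)
      weight-bound = bounds-exist

    bits-lost : ℕ
    bits-lost = proj₁ weight-bound

    -- From the uniform half of the mixture. It gives masses a logarithm, bounds the exponents, and
    -- bounds the factor `cyl x k` in `dilution-dominated` from below.
    positive : ∀ σ → ½ⁿ (bits-lost ℕ.+ length σ) ≤ cylinder μ σ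
    positive σ = ≤-trans (≈⇒≤ (½ⁿ-+ bits-lost (length σ))) (≤-trans (*-monoʳ-≤ (<⇒≤ (0<½ⁿ (length σ))) (proj₂ weight-bound)) (dominates-uniform σ))

    open Dimension μ {bits-lost} positive

    module _ (x : 2^ω) where

      private
        ψ : ℕ → ℕ
        ψ = pattern-along x

        y : ℝ
        y = value-of x

        λ-x : String → ℝ
        λ-x = dilutedMeasure ψ

        lower-≤ : ∀ n → 1 ℕ.≤ n → y * nat n ≤ nat (free ψ n) + nat (2 ℕ.+ block n)
        lower-≤ = free-lower ψ (0≤value x) (value≤1 x) refl (value-lower x) (value-upper x)

        upper-≤ : ∀ k → nat (free ψ (2 ℕ.^ k)) ≤ y * nat (2 ℕ.^ k)
        upper-≤ = free-upper ψ (0≤value x) (value≤1 x) refl (value-lower x) (value-upper x)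

      -- Positions below 2^k lie in blocks of index at most k, so all x′ that extend x↾k give σ the
      -- same diluted probability as x. Their share of the average alone is `cyl x k * λ-x σ`.
      dilution-dominated : ∀ k σ → length σ ≡ 2 ℕ.^ k → c₀ * (cyl x k * λ-x σ) ≤ cylinder μ σ
      dilution-dominated k σ l = ≤-trans (*-monoˡ-≤ (<⇒≤ 0<c₀) (begin
        cyl x k * λ-x σ                                                    ≈⟨ *-comm (cyl x k) (λ-x σ) ⟩
        λ-x σ * cyl x k                                                    ≈⟨ *-cong ≈-refl (≈-sym (Ext-cylinder μ (n ∸ k) (prefix x k))) ⟩
        λ-x σ * Ext (n ∸ k) (prefix x k) (cylinder μ)                      ≈⟨ ≈-sym (Ext-*ˡ (n ∸ k) (prefix x k) (λ-x σ) (cylinder μ)) ⟩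
        Ext (n ∸ k) (prefix x k) (λ τ → λ-x σ * cylinder μ τ)              ≤⟨ Ext-mono-extending (n ∸ k) (prefix x k) (λ τ e → ≈⇒≤ (agree τ e)) ⟩
        Ext (n ∸ k) (prefix x k) (diluted-mix σ)                           ≤⟨ Ext-prefix x k (n ∸ k) (λ τ → *-nonneg (0≤cylinder μ τ) (0≤dilutedMeasure (pattern-of τ) σ)) ⟩
        Ext (k ℕ.+ (n ∸ k)) [] (diluted-mix σ)                             ≈⟨ ≡⇒≈ (cong (λ m → Ext m [] (diluted-mix σ)) (trans (ℕₚ.m+[n∸m]≡n k≤n) (sym l))) ⟩
        Ext (length σ) [] (diluted-mix σ)                                  ∎)) (dominates-diluted σ)
        where
        open ≤-Reasoning
        n : ℕ
        n = 2 ℕ.^ k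
        k≤n : k ℕ.≤ n
        k≤n = ℕₚ.<⇒≤ (a<2^a k)
        agree : ∀ τ → Extending (prefix x k) (n ∸ k) τ → λ-x σ * cylinder μ τ ≈ diluted-mix σ τ
        agree τ (lτ , e) = ≈-trans (*-comm (λ-x σ) (cylinder μ τ)) (*-cong ≈-refl (*-cong (≡⇒≈ (cong nat
          (dilution-cong (length σ) (λ i i< → sym (pattern-extending x k τ
             (subst (k ℕ.≤_) (sym lτ) (ℕₚ.≤-trans (ℕₚ.≤-reflexive (sym (length-prefix x k))) (ℕₚ.m≤m+n _ (n ∸ k))))
             (trans (cong (λ m → take m τ) (sym (length-prefix x k))) e) (block i) (small i (subst (i ℕ.<_) l i<)))) (λ _ _ → refl)))) ≈-refl))
          where
          small : ∀ i → i ℕ.< 2 ℕ.^ k → block i ℕ.≤ k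
          small zero    _  = z≤n
          small (suc i) i< = ℕₚ.<⇒≤ (ℕₚ.≰⇒> λ h → ℕₚ.<⇒≱ i< (ℕₚ.≤-trans (ℕₚ.^-monoʳ-≤ 2 h) (2^block≤ (suc i) (s≤s z≤n))))

      module _ (w : 2^ω) {δ : ℝ} (0<δ : 0# < δ) (typical : ∀ n → δ * cyl w n < λ-x (prefix w n)) where

        private
          λ-value : ∀ n → λ-x (prefix w n) ≈ ½ⁿ (free ψ n)
          λ-value n = ≈-trans (dilutedMeasure-value ψ (prefix w n) (≤-<-trans (*-nonneg (<⇒≤ 0<δ) (0≤cylinder μ (prefix w n))) (typical n)))
            (≡⇒≈ (cong (½ⁿ ∘ free ψ) (length-prefix w n)))

          loss : ∃[ M ] (½ⁿ M ≤ δ)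
          loss = let N , h = ½ⁿ-small 1# 0<δ in N , <⇒≤ (<-respˡ-≈ (*-identityʳ (½ⁿ N)) h)

          low : ∀ M → ½ⁿ M ≤ δ → ∀ t → 0# ≤ t → t < y → Low w t
          low M ½ᴹ≤δ t 0≤t t<y =
            -- `M` bits pay for δ; the 2 and the block index pay for the loss in `free-lower`.
            let N , h = block-dominated (M ℕ.+ 2) (<⇒0<- t<y)
            in suc N , λ n N<n → proj₂ (Below-prefix w t n 0≤t) (bound n (h n (ℕₚ.<⇒≤ N<n) (ℕₚ.≤-trans (s≤s z≤n) N<n)) (ℕₚ.≤-trans (s≤s z≤n) N<n))
            where
            open ≤-Reasoning
            bound : ∀ n → nat (block n ℕ.+ (M ℕ.+ 2)) ≤ (y - t) * nat n → 1 ℕ.≤ n → cyl w n * exp (t * nat n * ℓ) ≤ 1#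
            bound n h 1≤n = begin
              cyl w n * exp u                           ≈⟨ solve 2 (λ c e → c :* e := con (+ 1) :* (c :* e)) ≈-refl (cyl w n) (exp u) ⟩
              1# * (cyl w n * exp u)                    ≈⟨ *-cong (≈-sym (≈-trans (*-cong ≈-refl (exp-nat*ℓ M)) (½ⁿ*2^n M))) ≈-refl ⟩
              ½ⁿ M * exp v * (cyl w n * exp u)          ≈⟨ solve 4 (λ h v c u → h :* v :* (c :* u) := h :* c :* (u :* v)) ≈-refl (½ⁿ M) (exp v) (cyl w n) (exp u) ⟩
              ½ⁿ M * cyl w n * (exp u * exp v)          ≤⟨ *-monoʳ-≤ (*-nonneg (<⇒≤ (0<exp 0≤u)) (<⇒≤ (0<exp 0≤v)))
                                                            (≤-trans (*-monoʳ-≤ (0≤cylinder μ (prefix w n)) ½ᴹ≤δ) (≤-trans (<⇒≤ (typical n)) (≈⇒≤ (λ-value n)))) ⟩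
              ½ⁿ (free ψ n) * (exp u * exp v)           ≈⟨ *-cong ≈-refl (≈-sym (exp-+ 0≤u 0≤v)) ⟩
              ½ⁿ (free ψ n) * exp (u + v)               ≤⟨ ½ⁿ*exp≤1 (free ψ n) (+-nonneg 0≤u 0≤v) (≤-respˡ-≈ (*-distribʳ-+ ℓ (t * nat n) (nat M)) (*-monoʳ-≤ 0≤ℓ exponent)) ⟩
              1#                                        ∎
              where
              u v : ℝ
              u = t * nat n * ℓ
              v = nat M * ℓ
              0≤u : 0# ≤ u
              0≤u = 0≤tnℓ n 0≤t
              0≤v : 0# ≤ v
              0≤v = 0≤nat*ℓ M
              exponent : t * nat n + nat M ≤ nat (free ψ n)
              exponent = ≤-by (+-nonneg (≤⇒0≤- (lower-≤ n 1≤n)) (≤⇒0≤- h)) (≈-trans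
                (solve 6 (λ t y n m f b → f :- (t :* n :+ m) := ((f :+ (con (+ 2) :+ b)) :- y :* n) :+ ((y :- t) :* n :- (b :+ (m :+ con (+ 2))))) ≈-refl t y (nat n) (nat M) (nat (free ψ n)) (nat (block n)))
                (+-cong (+-cong (+-cong ≈-refl (≈-sym (nat-+ 2 (block n)))) ≈-refl)
                  (+-cong ≈-refl (-‿cong (≈-trans (+-cong ≈-refl (≈-sym (nat-+ M 2))) (≈-sym (nat-+ (block n) (M ℕ.+ 2))))))))

          not-low : ∀ t → y < t → ¬ Low w t
          not-low t y<t = ¬Low w 0≤t λ N →
            -- `bits-lost` occurs once for c₀ and once for the mass of x↾k, which also costs k bits;
            -- the extra 1 makes the inequality strict.
            let N′ , h = power-dominates (suc (bits-lost ℕ.+ bits-lost)) (<⇒0<- y<t)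
                k = N ℕ.⊔ N′
            in 2 ℕ.^ k , ℕₚ.≤-trans (ℕₚ.m≤m⊔n N N′) (ℕₚ.<⇒≤ (a<2^a k)) , j k , heavy k , light k (h k (ℕₚ.m≤n⊔m N N′))
            where
            open ≤-Reasoning
            0≤t : 0# ≤ t
            0≤t = ≤-trans (0≤value x) (<⇒≤ y<t)
            j : ℕ → ℕ
            j k = bits-lost ℕ.+ ((bits-lost ℕ.+ k) ℕ.+ free ψ (2 ℕ.^ k))
            heavy : ∀ k → ½ⁿ (j k) ≤ cyl w (2 ℕ.^ k)
            heavy k = begin
              ½ⁿ (j k)                                                       ≈⟨ ≈-trans (½ⁿ-+ bits-lost _) (*-cong ≈-refl (½ⁿ-+ (bits-lost ℕ.+ k) (free ψ (2 ℕ.^ k)))) ⟩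
              ½ⁿ bits-lost * (½ⁿ (bits-lost ℕ.+ k) * ½ⁿ (free ψ (2 ℕ.^ k)))  ≤⟨ *-mono-≤ (<⇒≤ (0<½ⁿ bits-lost)) (*-nonneg (<⇒≤ (0<½ⁿ (bits-lost ℕ.+ k))) (<⇒≤ (0<½ⁿ (free ψ (2 ℕ.^ k))))) (proj₂ weight-bound)
                                                                                  (*-mono-≤ (<⇒≤ (0<½ⁿ (bits-lost ℕ.+ k))) (<⇒≤ (0<½ⁿ (free ψ (2 ℕ.^ k)))) (½ⁿ≤cyl x k) (≈⇒≤ (≈-sym (λ-value (2 ℕ.^ k))))) ⟩
              c₀ * (cyl x k * λ-x (prefix w (2 ℕ.^ k)))                      ≤⟨ dilution-dominated k (prefix w (2 ℕ.^ k)) (length-prefix w (2 ℕ.^ k)) ⟩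
              cyl w (2 ℕ.^ k)                                                ∎
            light : ∀ k → nat (k ℕ.+ suc (bits-lost ℕ.+ bits-lost)) ≤ (t - y) * nat (2 ℕ.^ k) → nat (j k) < t * nat (2 ℕ.^ k)
            light k h = begin-strict
              nat (j k)                                                               <⟨ nat-mono-< {j k} (ℕₚ.n<1+n (j k)) ⟩
              nat (suc (j k))                                                         ≈⟨ ≈-trans (≡⇒≈ (cong nat (eq bits-lost k (free ψ (2 ℕ.^ k))))) (nat-+ (k ℕ.+ suc (bits-lost ℕ.+ bits-lost)) (free ψ (2 ℕ.^ k))) ⟩
              nat (k ℕ.+ suc (bits-lost ℕ.+ bits-lost)) + nat (free ψ (2 ℕ.^ k))      ≤⟨ +-mono-≤ h (upper-≤ k) ⟩
              (t - y) * nat (2 ℕ.^ k) + y * nat (2 ℕ.^ k)                             ≈⟨ solve 3 (λ t y n → (t :- y) :* n :+ y :* n := t :* n) ≈-refl t y (nat (2 ℕ.^ k)) ⟩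
              t * nat (2 ℕ.^ k)                                                       ∎
              where
              eq : ∀ K k f → suc (K ℕ.+ ((K ℕ.+ k) ℕ.+ f)) ≡ (k ℕ.+ suc (K ℕ.+ K)) ℕ.+ f
              eq = solve-∀

        dim-typical : dim w ≈ y
        dim-typical = let M , h = loss in dim-unique w (0≤value x) (low M h) not-low

      -- If O contains all sequences of dimension y, then its measure among the
      -- diluted sequences is 1: otherwise some child of every string on which
      -- λ-x exceeds the part of O plus a small multiple of μ has the same
      -- property, and following such children gives a typical sequence outside O.
      module _ (O : String → Set) (upward : Upward O) (covers : ∀ w → dim w ≈ y → ∃[ n ] O (prefix w n)) where

        part : String → ℝ
        part τ = [ O τ ]· λ-x τ

        0≤part : ∀ τ → 0# ≤ part τ
        0≤part τ = 0≤[]· (0≤dilutedMeasure ψ τ)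

        part-mono : ∀ n σ → Ext n σ part ≤ Ext (suc n) σ part
        part-mono zero    σ = ≤-trans (split em) (+-mono-≤ ([]·-mono (upward σ false) (0≤dilutedMeasure ψ (σ ∷ʳ false)) (λ _ → ≤-refl))
                                                            ([]·-mono (upward σ true) (0≤dilutedMeasure ψ (σ ∷ʳ true)) (λ _ → ≤-refl)))
          where
          split : (d : Dec (O σ)) → weigh d (λ-x σ) ≤ weigh d (λ-x (σ ∷ʳ false)) + weigh d (λ-x (σ ∷ʳ true))
          split (yes _) = ≈⇒≤ (dilutedMeasure-additive ψ σ)
          split (no _)  = ≈⇒≤ (≈-sym (+-identityˡ 0#))
        part-mono (suc n) σ = +-mono-≤ (part-mono n (σ ∷ʳ false)) (part-mono n (σ ∷ʳ true))

        part-mono-≤ : ∀ {m n} σ → m ℕ.≤ n → Ext m σ part ≤ Ext n σ part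
        part-mono-≤ {m} σ h = go (ℕₚ.≤⇒≤′ h)
          where
          go : ∀ {n} → m ℕ.≤′ n → Ext m σ part ≤ Ext n σ part
          go (ℕ.≤′-reflexive refl) = ≤-refl
          go (ℕ.≤′-step {n} p) = ≤-trans (go p) (part-mono n σ)

        private
          module Avoiding {δ : ℝ} (0<δ : 0# < δ) where

            Escapes : String → Set
            Escapes σ = ∀ m → Ext m σ part + δ * cylinder μ σ < λ-x σ

            caught : ∀ σ → ¬ Escapes σ → ∃[ m ] (λ-x σ ≤ Ext m σ part + δ * cylinder μ σ)
            caught σ h = by-contradiction λ k → h λ m → ≰⇒> λ le → k (m , le)

            -- If neither child escapes, each is caught at some level. At the larger of the two both
            -- are caught, since `part` grows with the level, and the two inequalities add up to one
            -- for σ.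
            child : ∀ σ → Escapes σ → ∃[ b ] Escapes (σ ∷ʳ b)
            child σ e = by-contradiction λ none →
              let m , h = caught (σ ∷ʳ false) (λ k → none (false , k))
                  n , k = caught (σ ∷ʳ true) (λ k → none (true , k))
              in ≤⇒≮ (both-caught m n h k) (e (suc (m ℕ.⊔ n)))
              where
              open ≤-Reasoning
              both-caught : ∀ m n → λ-x (σ ∷ʳ false) ≤ Ext m (σ ∷ʳ false) part + δ * cylinder μ (σ ∷ʳ false) →
                λ-x (σ ∷ʳ true) ≤ Ext n (σ ∷ʳ true) part + δ * cylinder μ (σ ∷ʳ true) →
                λ-x σ ≤ Ext (suc (m ℕ.⊔ n)) σ part + δ * cylinder μ σ
              both-caught m n h k = begin
                λ-x σ                                             ≈⟨ dilutedMeasure-additive ψ σ ⟩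
                λ-x (σ ∷ʳ false) + λ-x (σ ∷ʳ true)                ≤⟨ +-mono-≤ (≤-trans h (+-mono-≤ (part-mono-≤ (σ ∷ʳ false) (ℕₚ.m≤m⊔n m n)) ≤-refl))
                                                                               (≤-trans k (+-mono-≤ (part-mono-≤ (σ ∷ʳ true) (ℕₚ.m≤n⊔m m n)) ≤-refl)) ⟩
                (p₀ + δ * cylinder μ (σ ∷ʳ false)) + (p₁ + δ * cylinder μ (σ ∷ʳ true))
                  ≈⟨ solve 5 (λ p q d a b → (p :+ d :* a) :+ (q :+ d :* b) := (p :+ q) :+ d :* (a :+ b)) ≈-refl p₀ p₁ δ (cylinder μ (σ ∷ʳ false)) (cylinder μ (σ ∷ʳ true)) ⟩
                (p₀ + p₁) + δ * (cylinder μ (σ ∷ʳ false) + cylinder μ (σ ∷ʳ true)) ≈⟨ +-cong ≈-refl (*-cong ≈-refl (≈-sym (cylinder-additive μ σ))) ⟩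
                Ext (suc (m ℕ.⊔ n)) σ part + δ * cylinder μ σ     ∎
                where
                p₀ p₁ : ℝ
                p₀ = Ext (m ℕ.⊔ n) (σ ∷ʳ false) part
                p₁ = Ext (m ℕ.⊔ n) (σ ∷ʳ true) part

            module _ (root : Escapes []) where

              node : ℕ → Σ[ σ ∈ String ] Escapes σ
              node zero    = [] , root
              node (suc n) = let σ , e = node n in σ ∷ʳ proj₁ (child σ e) , proj₂ (child σ e)

              path : 2^ω
              path n = proj₁ (child (proj₁ (node n)) (proj₂ (node n)))

              prefix-path : ∀ n → prefix path n ≡ proj₁ (node n)
              prefix-path zero    = refl
              prefix-path (suc n) = trans (prefix-∷ʳ path n) (cong (_∷ʳ path n) (prefix-path n))

              escapes : ∀ n → Escapes (prefix path n)
              escapes n = subst Escapes (sym (prefix-path n)) (proj₂ (node n))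

              absurd : ⊥
              absurd =
                -- Escaping at level 0 already makes the path typical, as `part` is nonnegative.
                let n , o = covers path (dim-typical path 0<δ λ n → ≤-<-trans
                      (≤-by (0≤part (prefix path n)) (solve 2 (λ p d → (p :+ d) :- d := p) ≈-refl (part (prefix path n)) (δ * cyl path n))) (escapes n 0))
                -- On a prefix in `O`, `part` is all of `λ-x`, which leaves no room to escape.
                in ≤⇒≮ (≤-by (*-nonneg (<⇒≤ 0<δ) (0≤cylinder μ (prefix path n)))
                     (≈-trans (+-cong (+-cong ([]·-yes o) ≈-refl) ≈-refl) (solve 2 (λ p d → (p :+ d) :- p := d) ≈-refl (λ-x (prefix path n)) (δ * cyl path n))))
                   (escapes n 0)

        part-large : ∃[ n ] (½ℝ < Ext n [] part)
        -- If no level went beyond ½, the root would escape with δ = ¼, since ½ + ¼ < 1.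
        part-large = by-contradiction λ h → Avoiding.absurd (half 0<½) λ m → begin-strict
          Ext m [] part + ½ℝ * ½ℝ * cylinder μ []   ≤⟨ +-mono-≤ (≮⇒≤ λ k → h (m , k)) (≈⇒≤ (≈-trans (*-cong ≈-refl (mass-full μ)) (*-identityʳ (½ℝ * ½ℝ)))) ⟩
          ½ℝ + ½ℝ * ½ℝ                              <⟨ +-mono-≤-< ≤-refl (<-respʳ-≈ (½-+ ½ℝ) (x<x+ε (half 0<½))) ⟩
          ½ℝ + ½ℝ                                   ≈⟨ ½ℝ+½ℝ ⟩
          1#                                        ≈⟨ ≈-sym (dilutedMeasure-[] ψ) ⟩
          λ-x []                                    ∎
          where open ≤-Reasoning

    -- `H` is replaced by an open superset of nearly the same mass, because λ_x is defined on
    -- strings only. For each x in A some level gives that open set a λ_x-share above ½; averaging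
    -- `dominates-diluted` over these x turns the share into a bound on μ. The levels exhaust A.
    mass-of-dimension : ∀ A H → (∀ x → x ∈ A → ∀ w → dim w ≈ value-of x → w ∈ H) → c₀ * ½ℝ * mass μ A ≤ mass μ H
    mass-of-dimension A H hits = ≤-from-ε λ ε ε>0 →
      let O , upward , covers , small = outer-regular μ H {⌊ ε ⌋} (⌊⌋-mono-< ε>0)
      in ≤-trans (bound O upward λ x a w e → covers w (hits x a w e)) (<⇒≤ small)
      where
      module _ (O : String → Set) (upward : Upward O) (covers : ∀ x → x ∈ A → ∀ w → dim w ≈ value-of x → ∃[ n ] O (prefix w n)) where

        open ≤-Reasoning

        share : ℕ → String → ℝ
        share n ρ = Ext n [] (λ τ → [ O τ ]· dilutedMeasure (pattern-of ρ) τ)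

        Q : ℕ → String → Set
        Q n ρ = ½ℝ < share n ρ

        -- The share at level n depends on the first n bits of x only, so the x whose share exceeds
        -- ½ form a clopen set.
        Aₙ : ℕ → Borel cantor
        Aₙ n = A ∩ clopen n (Q n)

        share≈ : ∀ x n → share n (prefix x n) ≈ Ext n [] (λ τ → [ O τ ]· dilutedMeasure (pattern-along x) τ)
        share≈ x n = Ext-cong n [] λ τ l → []·-cong (*-cong (≡⇒≈ (cong nat (dilution-cong (length τ) (λ i i< →
          pattern-extending x n (prefix x n) (ℕₚ.≤-reflexive (sym (length-prefix x n))) (take-prefix x ℕₚ.≤-refl) (block i)
            (ℕₚ.≤-trans (block≤ i) (ℕₚ.<⇒≤ (subst (i ℕ.<_) l i<)))) (λ _ _ → refl)))) ≈-refl)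

        increasing : ∀ n → Aₙ n ⊆ Aₙ (suc n)
        increasing n x h =
          let a , q = ∈-∩ A (clopen n (Q n)) h
          in ∩-∈ A (clopen (suc n) (Q (suc n))) (a , clopen-∈ (suc n) (Q (suc n)) x
               (<-≤-trans (∈-clopen n (Q n) x q) (≤-trans (≈⇒≤ (share≈ x n)) (≤-trans (part-mono x O upward (covers x a) n []) (≈⇒≤ (≈-sym (share≈ x (suc n))))))))

        exhausts : A ⊆ union Aₙ
        exhausts x a = let n , h = part-large x O upward (covers x a) in
          n , ∩-∈ A (clopen n (Q n)) (a , clopen-∈ n (Q n) x (<-respʳ-≈ (≈-sym (share≈ x n)) h))

        at-level : ∀ n → c₀ * ½ℝ * mass μ (Aₙ n) ≤ mass μ (open-set O)
        at-level n = begin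
          c₀ * ½ℝ * mass μ (Aₙ n)
            ≤⟨ *-monoˡ-≤ (*-nonneg (<⇒≤ 0<c₀) (<⇒≤ 0<½)) (mass-mono μ (Aₙ n) (clopen n (Q n)) λ x h → proj₂ (∈-∩ A (clopen n (Q n)) h)) ⟩
          c₀ * ½ℝ * mass μ (clopen n (Q n))
            ≈⟨ ≈-trans (*-assoc c₀ ½ℝ (mass μ (clopen n (Q n)))) (*-cong ≈-refl (≈-trans (*-cong ≈-refl (mass-clopen μ n (Q n))) (≈-sym (Ext-*ˡ n [] ½ℝ (λ ρ → [ Q n ρ ]· cylinder μ ρ))))) ⟩
          c₀ * Ext n [] (λ ρ → ½ℝ * ([ Q n ρ ]· cylinder μ ρ))
            ≤⟨ *-monoˡ-≤ (<⇒≤ 0<c₀) (Ext-mono n [] λ ρ _ → in-Q ρ) ⟩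
          c₀ * Ext n [] (λ ρ → cylinder μ ρ * share n ρ)
            ≈⟨ *-cong ≈-refl (≈-trans (Ext-cong n [] λ ρ _ → ≈-sym (Ext-*ˡ n [] (cylinder μ ρ) (λ τ → [ O τ ]· dilutedMeasure (pattern-of ρ) τ)))
                 (Ext-swap n [] n [] (λ ρ τ → cylinder μ ρ * ([ O τ ]· dilutedMeasure (pattern-of ρ) τ)))) ⟩
          c₀ * Ext n [] (λ τ → Ext n [] (λ ρ → cylinder μ ρ * ([ O τ ]· dilutedMeasure (pattern-of ρ) τ)))
            ≈⟨ ≈-sym (Ext-*ˡ n [] c₀ _) ⟩
          Ext n [] (λ τ → c₀ * Ext n [] (λ ρ → cylinder μ ρ * ([ O τ ]· dilutedMeasure (pattern-of ρ) τ)))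
            ≤⟨ Ext-mono n [] (λ τ l → in-O τ l) ⟩
          Ext n [] (λ τ → [ O τ ]· cylinder μ τ)
            ≈⟨ ≈-sym (mass-clopen μ n O) ⟩
          mass μ (clopen n O)
            ≤⟨ proj₁ (open-sup μ O upward) n ⟩
          mass μ (open-set O) ∎
          where
          in-Q : ∀ ρ → ½ℝ * ([ Q n ρ ]· cylinder μ ρ) ≤ cylinder μ ρ * share n ρ
          in-Q ρ = go em
            where
            0≤share : 0# ≤ share n ρ
            0≤share = Ext-nonneg n [] λ τ → 0≤[]· (0≤dilutedMeasure (pattern-of ρ) τ)
            go : (d : Dec (Q n ρ)) → ½ℝ * weigh d (cylinder μ ρ) ≤ cylinder μ ρ * share n ρ
            go (yes q) = ≤-respˡ-≈ (*-comm (cylinder μ ρ) ½ℝ) (*-monoˡ-≤ (0≤cylinder μ ρ) (<⇒≤ q))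
            go (no _)  = ≤-respˡ-≈ (solve 1 (λ h → con (+ 0) := h :* con (+ 0)) ≈-refl ½ℝ) (*-nonneg (0≤cylinder μ ρ) 0≤share)
          in-O : ∀ τ → length τ ≡ n → c₀ * Ext n [] (λ ρ → cylinder μ ρ * ([ O τ ]· dilutedMeasure (pattern-of ρ) τ)) ≤ [ O τ ]· cylinder μ τ
          in-O τ l = go em
            where
            go : (d : Dec (O τ)) → c₀ * Ext n [] (λ ρ → cylinder μ ρ * weigh d (dilutedMeasure (pattern-of ρ) τ)) ≤ weigh d (cylinder μ τ)
            go (yes _) = ≤-respˡ-≈ (≡⇒≈ (cong (λ m → c₀ * Ext m [] (diluted-mix τ)) l)) (dominates-diluted τ)
            go (no _)  = ≈⇒≤ (≈-trans (*-cong ≈-refl (≈-trans (Ext-cong n [] λ ρ _ → solve 1 (λ c → c :* con (+ 0) := con (+ 0)) ≈-refl (cylinder μ ρ)) (Ext-zero n [])))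
              (solve 1 (λ c → c :* con (+ 0) := con (+ 0)) ≈-refl c₀))

        bound : c₀ * ½ℝ * mass μ A ≤ mass μ (open-set O)
        bound = sup-scale (*-pos 0<c₀ 0<½) (let up , least = mass-sup μ Aₙ increasing in
          (λ n → mass-mono μ (Aₙ n) A λ x h → proj₁ (∈-∩ A (clopen n (Q n)) h)) ,
          λ u h → ≤-trans (mass-mono μ A (union Aₙ) exhausts) (least u h)) at-level

-- Pointwise dimension: from radii to prefixes

module PointwiseDimensions (em : ExcludedMiddle 0ℓ) where

  open TypicalSequences em public

  opaque
    unfolding _≈_

    -- Translations between the sealed relations and those in which the theorem is stated.
    <ᴰ⇒ : ∀ {x y} → x D.< y → x < y
    <ᴰ⇒ h = h
    ⇒<ᴰ : ∀ {x y} → x < y → x D.< y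
    ⇒<ᴰ h = h
    ≤ᴰ⇒ : ∀ {x y} → x D.≤ y → x ≤ y
    ≤ᴰ⇒ h = h
    ⇒≤ᴰ : ∀ {x y} → x ≤ y → x D.≤ y
    ⇒≤ᴰ h = h
    ≈ᴰ⇒ : ∀ {x y} → x D.≈ y → x ≈ y
    ≈ᴰ⇒ h = h
    ⇒≈ᴰ : ∀ {x y} → x ≈ y → x D.≈ y
    ⇒≈ᴰ h = h
    fromℚ≡ : ∀ q → D.fromℚ q ≡ ⌊ q ⌋
    fromℚ≡ q = refl
    *ᴰ≡ : ∀ x y → x D.* y ≡ x * y
    *ᴰ≡ x y = refl
    +ᴰ≡ : ∀ x y → x D.+ y ≡ x + y
    +ᴰ≡ x y = refl

  0≤ᴰ⇒ : ∀ {x} → D.0ℝ D.≤ x → 0# ≤ x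
  0≤ᴰ⇒ {x} h = subst (_≤ x) (fromℚ≡ 0ℚ) (≤ᴰ⇒ h)

  ⇒0≤ᴰ : ∀ {x} → 0# ≤ x → D.0ℝ D.≤ x
  ⇒0≤ᴰ {x} h = ⇒≤ᴰ (subst (_≤ x) (sym (fromℚ≡ 0ℚ)) h)

  0<ᴰ⇒ : ∀ {x} → D.0ℝ D.< x → 0# < x
  0<ᴰ⇒ {x} h = subst (_< x) (fromℚ≡ 0ℚ) (<ᴰ⇒ h)

  ⇒0<ᴰ : ∀ {x} → 0# < x → D.0ℝ D.< x
  ⇒0<ᴰ {x} h = ⇒<ᴰ (subst (_< x) (sym (fromℚ≡ 0ℚ)) h)

  least-failure : ∀ (P : ℕ → Set) → ¬ (∀ n → P n) → ∃[ m ] (¬ P m × (∀ i → i ℕ.< m → P i))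
  least-failure P h = by-contradiction λ none → h λ n → all none n n ℕₚ.≤-refl
    where
    all : ¬ (∃[ m ] (¬ P m × (∀ i → i ℕ.< m → P i))) → ∀ n i → i ℕ.≤ n → P i
    all none zero    zero    _ = by-contradiction λ ¬p → none (0 , ¬p , λ i ())
    all none (suc n) i i≤ = by-contradiction λ ¬p → none (i , ¬p , λ j j<i → all none n j (ℕₚ.≤-pred (ℕₚ.≤-trans j<i i≤)))

  agree⇒prefix : ∀ (x y : 2^ω) n → (∀ i → i ℕ.< n → x i ≡ y i) → prefix x n ≡ prefix y n
  agree⇒prefix x y zero    h = refl
  agree⇒prefix x y (suc n) h = cong₂ _∷_ (h 0 (s≤s z≤n)) (agree⇒prefix (x ∘ suc) (y ∘ suc) n λ i i<n → h (suc i) (s≤s i<n))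

  prefix⇒agree : ∀ (x y : 2^ω) n → prefix x n ≡ prefix y n → ∀ i → i ℕ.< n → x i ≡ y i
  prefix⇒agree x y (suc n) e zero    _       = Listₚ.∷-injectiveˡ e
  prefix⇒agree x y (suc n) e (suc i) (s≤s h) = prefix⇒agree (x ∘ suc) (y ∘ suc) n (Listₚ.∷-injectiveʳ e) i h

  ½ⁿ-reflects-< : ∀ {m n} → ½ⁿ m < ½ⁿ n → n ℕ.< m
  ½ⁿ-reflects-< h = ℕₚ.≰⇒> λ le → ≤⇒≮ (½ⁿ-anti-≤ le) h

  module _ (w : 2^ω) (n : ℕ) {r : ℝ} (below : ½ⁿ (suc n) < r) (above : r ≤ ½ⁿ n) where

    -- Balls are open and distances are powers of one half: for 2^-(n+1) < r ≤ 2^-n, membership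
    -- means agreement up to and including index n, hence the prefix of length n + 1.
    ball⇒ : ∀ x → Ball w r x → x ∈ basic (prefix w (suc n))
    ball⇒ x (_ , same e , _) = subst (Extends x) (agree⇒prefix x w (suc n) λ i _ → sym (e i)) (Extends-prefix x (suc n))
    ball⇒ x (_ , differ m _ e , d<r) = subst (Extends x) (agree⇒prefix x w (suc n) λ i i< → sym (e i (ℕₚ.≤-trans i<
        (½ⁿ-reflects-< (<-≤-trans (subst (_< r) (trans (fromℚ≡ (½^ m)) (sym (½ⁿ-def m))) (<ᴰ⇒ d<r)) above)))))
      (Extends-prefix x (suc n))

    ⇒ball : ∀ x → x ∈ basic (prefix w (suc n)) → Ball w r x
    ⇒ball x h = go em
      where
      agree : ∀ i → i ℕ.< suc n → w i ≡ x i
      agree i i< = sym (prefix⇒agree x w (suc n) (subst (λ m → prefix x m ≡ prefix w (suc n)) (length-prefix w (suc n)) (Extends⇒prefix x (prefix w (suc n)) h)) i i<)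
      go : Dec (∀ i → w i ≡ x i) → Ball w r x
      go (yes e) = 0ℚ , same e , ⇒0<ᴰ (<-trans (0<½ⁿ (suc n)) below)
      go (no ¬e) =
        let m , m≢ , before = least-failure (λ i → w i ≡ x i) ¬e
            n<m = ℕₚ.≮⇒≥ λ m< → m≢ (agree m m<)
        in ½^ m , differ m m≢ before , ⇒<ᴰ (subst (_< r) (sym (trans (fromℚ≡ (½^ m)) (sym (½ⁿ-def m)))) (≤-<-trans (½ⁿ-anti-≤ n<m) below))

  opaque
    scale-of-radius : ∀ {r} → 0# < r → r < 1# → ∃[ n ] (½ⁿ (suc n) < r × r ≤ ½ⁿ n)
    scale-of-radius {r} 0<r r<1 =
      let N , h = ½ⁿ-small 1# 0<r
          m , ¬¬p , before = least-failure (λ n → ¬ ½ⁿ n < r) λ all → all N (<-respˡ-≈ (*-identityʳ (½ⁿ N)) h)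
      in go m (by-contradiction ¬¬p) before
      where
      go : ∀ m → ½ⁿ m < r → (∀ i → i ℕ.< m → ¬ ½ⁿ i < r) → ∃[ n ] (½ⁿ (suc n) < r × r ≤ ½ⁿ n)
      go zero    h _ = ⊥-elim (<-asym r<1 (<-respˡ-≈ ½ⁿ-zero h))
      go (suc n) h k = n , h , ≮⇒≤ (k n ℕₚ.≤-refl)

  fin′ : ∀ x → 0# ≤ x → [0,∞]
  fin′ x h = fin (x , ⇒0≤ᴰ h)

  -- The lower limit takes the supremum over those infima that exist, so `dim≤bounds` has to produce
  -- one before it can compare it with anything.
  inf-exists : (V : [0,∞] → Set) → ∃[ i ] IsInf V i
  inf-exists V = go em
    where
    go : Dec (∃[ x ] V (fin x)) → ∃[ i ] IsInf V i
    go (no none) = ∞ , (λ { ∞ _ → tt ; (fin x) v → none (x , v) }) , λ u _ → tt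
    go (yes ((x₀ , 0≤x₀) , v₀)) = fin′ s 0≤s , lower , greatest
      where
      LowerBound : ℝ → Set
      LowerBound z = ∀ x → V (fin x) → z ≤ proj₁ x
      zero-lower : LowerBound 0#
      zero-lower (x , 0≤x) _ = 0≤ᴰ⇒ 0≤x
      opaque
        glb : Σ[ s ∈ ℝ ] IsLub LowerBound s
        glb = lub LowerBound zero-lower λ z h → h (x₀ , 0≤x₀) v₀
      s : ℝ
      s = proj₁ glb
      0≤s : 0# ≤ s
      0≤s = proj₁ (proj₂ glb) 0# zero-lower
      lower : ∀ v → V v → fin′ s 0≤s ≤∞ v
      lower ∞       v = tt
      lower (fin x) v = ⇒≤ᴰ (proj₂ (proj₂ glb) (proj₁ x) λ z h → h x v)
      greatest : ∀ u → (∀ v → V v → u ≤∞ v) → u ≤∞ fin′ s 0≤s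
      greatest ∞       h = ⊥-elim (h (fin (x₀ , 0≤x₀)) v₀)
      greatest (fin u) h = ⇒≤ᴰ (proj₁ (proj₂ glb) (proj₁ u) λ x v → ≤ᴰ⇒ (h (fin x) v))

  NegLog-unique-≤ : ∀ {a s u} → NegLog a s → 0# < a → a * exp u ≤ 1# → u ≤ s
  NegLog-unique-≤ (0≤s , e) 0<a h = exp-cancel-≤ 0≤s (*-cancelˡ-≤ 0<a (≤-respʳ-≈ (≈-sym e) h))

  NegLog-pos : ∀ {a s} → NegLog a s → 0# < a
  NegLog-pos {a} {s} (0≤s , e) = *-cancelˡ-< (<⇒≤ (0<exp 0≤s)) (<-respˡ-≈ (solve 1 (λ x → con (+ 0) := x :* con (+ 0)) ≈-refl (exp s))
    (<-respʳ-≈ (≈-trans (≈-sym e) (*-comm a (exp s))) 0<1))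

  module PointwiseDim (μ : Measure cantor) {K : ℕ} (positive : ∀ σ → ½ⁿ (K ℕ.+ length σ) ≤ cylinder μ σ) (w : 2^ω) where

    open Dimension μ {K} positive

    private
      h : ℝ → [0,∞] → Set
      h r v = r D.< D.1ℝ × ∃[ a ] (MeasureOf μ (Ball w r) a × LogQuotient a r v)

      Near : ℝ → [0,∞] → Set
      Near δ v = ∃[ r ] (D.0ℝ D.< r × r D.< δ × h r v)

      d : ℝ
      d = dim w

      module _ (n : ℕ) {r : ℝ} (below : ½ⁿ (suc n) < r) (above : r ≤ ½ⁿ n) where

        ball-mass : ∀ {a} → MeasureOf μ (Ball w r) a → a ≈ cyl w (suc n)
        ball-mass (A , den , e) = ≈-trans (≈-sym (≈ᴰ⇒ e)) (mass-cong μ A (basic (prefix w (suc n)))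
          ((λ x p → ball⇒ w n below above x (Equivalence.to (den x) p)) , λ x p → Equivalence.from (den x) (⇒ball w n below above x p)))

        mass-ball : MeasureOf μ (Ball w r) (cyl w (suc n))
        mass-ball = basic (prefix w (suc n)) , (λ x → mk⇔ (⇒ball w n below above x) (ball⇒ w n below above x)) , ⇒≈ᴰ {cyl w (suc n)} {cyl w (suc n)} ≈-refl

        exponent-< : ∀ {t} → NegLog r t → t < nat (suc n) * ℓ
        exponent-< {t} (0≤t , e) = ≰⇒> λ le → ≤⇒≮ (*-cancelˡ-≤ (<-trans (0<½ⁿ (suc n)) below) (begin
          r * nat (2 ℕ.^ suc n)                     ≈⟨ *-cong ≈-refl (≈-sym (exp-nat*ℓ (suc n))) ⟩
          r * exp (nat (suc n) * ℓ)                 ≤⟨ *-monoˡ-≤ (<⇒≤ (<-trans (0<½ⁿ (suc n)) below)) (exp-mono-≤ (0≤nat*ℓ (suc n)) le) ⟩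
          r * exp t                                 ≤⟨ ≤-refl ⟩
          r * exp t                                 ∎)) (*-cancelˡ-< (<⇒≤ (0<½ⁿ (suc n))) (begin-strict
          ½ⁿ (suc n) * exp t                        <⟨ *-monoʳ-< (0<exp 0≤t) below ⟩
          r * exp t                                 ≈⟨ ≈-trans e (≈-sym (½ⁿ*2^n (suc n))) ⟩
          ½ⁿ (suc n) * nat (2 ℕ.^ suc n)            ∎))
          where open ≤-Reasoning

      quotient⇒ : ∀ {a r ρ} → a ≤ 1# → r ≤ 1# → LogQuotient a r (fin ρ) → ∃[ s ] ∃[ t ] (NegLog a s × NegLog r t × proj₁ ρ * t ≈ s)
      quotient⇒ {a} {r} {ρ , _} a≤1 r≤1 (α , β , log-a , log-r , e) = - α , - β , IsLog⇒NegLog a≤1 log-a , IsLog⇒NegLog r≤1 log-r ,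
        ≈-trans (solve 2 (λ p b → p :* :- b := :- (p :* b)) ≈-refl ρ β) (-‿cong (≈-trans (≡⇒≈ (sym (*ᴰ≡ ρ β))) (≈ᴰ⇒ e)))

      ⇒quotient : ∀ {a r s t} (ρ : [0,∞⟩) → NegLog a s → NegLog r t → proj₁ ρ * t ≈ s → LogQuotient a r (fin ρ)
      ⇒quotient {a} {r} {s} {t} (ρ , _) log-a log-r e = - s , - t , NegLog⇒IsLog log-a , NegLog⇒IsLog log-r ,
        ⇒≈ᴰ (≈-trans (≡⇒≈ (*ᴰ≡ ρ (- t))) (≈-trans (solve 2 (λ p b → p :* :- b := :- (p :* b)) ≈-refl ρ t) (-‿cong e)))

      <1ᴰ⇒ : ∀ {r} → r D.< D.1ℝ → r < 1#
      <1ᴰ⇒ {r} k = subst (r <_) (fromℚ≡ 1ℚ) (<ᴰ⇒ k)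

      ⇒<1ᴰ : ∀ {r} → r < 1# → r D.< D.1ℝ
      ⇒<1ᴰ {r} k = ⇒<ᴰ (subst (r <_) (sym (fromℚ≡ 1ℚ)) k)

      -- At radii just above 2^-n the quotient is close to - log₂ μ [w↾n] / n.
      quotient-near : ∀ n {t} → 0# < t → 1# < cyl w (suc n) * exp (t * nat (suc n) * ℓ) →
        ∃[ r ] ∃[ ρ ] (0# < r × r ≤ ½ⁿ n × r < 1# × h r (fin ρ) × proj₁ ρ < t)
      quotient-near n {t} 0<t heavy = r , (ρ , ⇒0≤ᴰ 0≤ρ) , 0<r , above , r<1 ,
        (⇒<1ᴰ r<1 , cyl w (suc n) , mass-ball n below above , ⇒quotient (ρ , ⇒0≤ᴰ 0≤ρ) log-a (<⇒≤ 0<τ , r-exp) ρτ≈s) , ρ<t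
        where
        open ≤-Reasoning
        N : ℝ
        N = nat (suc n) * ℓ
        neg-log = NegLog-exists (0<cyl w (suc n)) (mass≤1 μ (basic (prefix w (suc n))))
        s : ℝ
        s = proj₁ neg-log
        log-a : NegLog (cyl w (suc n)) s
        log-a = proj₂ neg-log
        s<tN : s < t * nat (suc n) * ℓ
        s<tN = ≰⇒> λ le → ≤⇒≮ (≤-respʳ-≈ (proj₂ log-a) (*-monoˡ-≤ (0≤cylinder μ (prefix w (suc n))) (exp-mono-≤ (0≤tnℓ (suc n) (<⇒≤ 0<t)) le))) heavy
        opaque
          step : ∃[ M ] (½ⁿ M * (t * ℓ) < t * nat (suc n) * ℓ - s)
          step = ½ⁿ-small (t * ℓ) (<⇒0<- s<tN)
        η τ : ℝ
        η = ½ⁿ (proj₁ step) * ℓ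
        -- The exponent of the radius stays slightly below (n+1) log 2, because a ball of radius
        -- exactly 2^-(n+1) is already the next smaller cylinder. `η` is small enough to keep s < t
        -- τ.
        τ = N - η
        s<tτ : s < t * τ
        s<tτ = <-by (<⇒0<- (proj₂ step)) (solve 5 (λ t n l s h → t :* (n :* l :- h :* l) :- s := (t :* n :* l :- s) :- h :* (t :* l)) ≈-refl t (nat (suc n)) ℓ s (½ⁿ (proj₁ step)))
        0<τ : 0# < τ
        0<τ = *-cancelˡ-< (<⇒≤ 0<t) (≤-<-trans (≈⇒≤ (solve 1 (λ t → t :* con (+ 0) := con (+ 0)) ≈-refl t)) (≤-<-trans (proj₁ log-a) s<tτ))
        0<η : 0# < η
        0<η = *-pos (0<½ⁿ (proj₁ step)) 0<ℓ
        η≤ℓ : η ≤ ℓ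
        η≤ℓ = ≤-respʳ-≈ (*-identityˡ ℓ) (*-monoʳ-≤ 0≤ℓ (≤-respʳ-≈ ½ⁿ-zero (½ⁿ-anti-≤ {0} {proj₁ step} z≤n)))
        inv-exp = inverse (0<exp (<⇒≤ 0<τ))
        r : ℝ
        r = proj₁ inv-exp
        0<r : 0# < r
        0<r = proj₁ (proj₂ inv-exp)
        r-exp : r * exp τ ≈ 1#
        r-exp = ≈-trans (*-comm r (exp τ)) (proj₂ (proj₂ inv-exp))
        inv-τ = inverse 0<τ
        ρ : ℝ
        ρ = s * proj₁ inv-τ
        0≤ρ : 0# ≤ ρ
        0≤ρ = *-nonneg (proj₁ log-a) (<⇒≤ (proj₁ (proj₂ inv-τ)))
        ρτ≈s : ρ * τ ≈ s
        ρτ≈s = ≈-trans (solve 3 (λ s i t → s :* i :* t := s :* (t :* i)) ≈-refl s (proj₁ inv-τ) τ) (≈-trans (*-cong ≈-refl (proj₂ (proj₂ inv-τ))) (*-identityʳ s))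
        ρ<t : ρ < t
        ρ<t = *-cancelˡ-< (<⇒≤ 0<τ) (<-respˡ-≈ (≈-trans (≈-sym ρτ≈s) (*-comm ρ τ)) (<-respʳ-≈ (*-comm t τ) s<tτ))
        below : ½ⁿ (suc n) < r
        below = *-cancelˡ-< (0≤nat (2 ℕ.^ suc n)) (begin-strict
          nat (2 ℕ.^ suc n) * ½ⁿ (suc n)   ≈⟨ ≈-trans (*-comm (nat (2 ℕ.^ suc n)) (½ⁿ (suc n))) (½ⁿ*2^n (suc n)) ⟩
          1#                               ≈⟨ ≈-sym r-exp ⟩
          r * exp τ                        <⟨ *-monoˡ-< 0<r (exp-mono-< (<⇒≤ 0<τ) (x-ε<x 0<η)) ⟩
          r * exp N                        ≈⟨ ≈-trans (*-cong ≈-refl (exp-nat*ℓ (suc n))) (*-comm r (nat (2 ℕ.^ suc n))) ⟩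
          nat (2 ℕ.^ suc n) * r            ∎)
        above : r ≤ ½ⁿ n
        above = *-cancelˡ-≤ (nat-mono-< {0} (1≤2^ n)) (begin
          nat (2 ℕ.^ n) * r                ≈⟨ ≈-trans (*-comm (nat (2 ℕ.^ n)) r) (*-cong ≈-refl (≈-sym (exp-nat*ℓ n))) ⟩
          r * exp (nat n * ℓ)              ≤⟨ *-monoˡ-≤ (<⇒≤ 0<r) (exp-mono-≤ (0≤nat*ℓ n) (≤-by (≤⇒0≤- η≤ℓ)
                                                (≈-trans (+-cong (+-cong (*-cong (nat-suc n) ≈-refl) ≈-refl) ≈-refl) (solve 3 (λ n l e → (con (+ 1) :+ n) :* l :- e :- n :* l := l :- e) ≈-refl (nat n) ℓ η)))) ⟩
          r * exp τ                        ≈⟨ ≈-trans r-exp (≈-sym (≈-trans (*-comm (nat (2 ℕ.^ n)) (½ⁿ n)) (½ⁿ*2^n n))) ⟩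
          nat (2 ℕ.^ n) * ½ⁿ n             ∎)
        r<1 : r < 1#
        r<1 = *-cancelˡ-< (<⇒≤ (0<exp (<⇒≤ 0<τ))) (<-respˡ-≈ (≈-trans (≈-sym r-exp) (*-comm r (exp τ))) (<-respʳ-≈ (≈-sym (*-identityʳ (exp τ)))
          (<-≤-trans (x<x+ε 0<τ) (1+x≤exp (<⇒≤ 0<τ)))))

      ¬Low⇒heavy : ∀ {t} → 0# ≤ t → ¬ Low w t → ∀ N → ∃[ n ] (N ℕ.≤ n × 1# < cyl w n * exp (t * nat n * ℓ))
      ¬Low⇒heavy {t} 0≤t ¬low N = by-contradiction λ none → ¬low (N , λ n N≤n → proj₂ (Below-prefix w t n 0≤t) (≮⇒≤ λ lt → none (n , N≤n , lt)))

      -- As t is not an exponent of w, there are arbitrarily long prefixes heavier than 2^(-t n),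
      -- and `quotient-near` supplies radii for them.
      small-quotient : ∀ {t δ} → d < t → 0# < δ → ∃[ ρ ] (Near δ (fin ρ) × proj₁ ρ < t)
      small-quotient {t} {δ} d<t 0<δ =
        let N , k = ½ⁿ-small 1# 0<δ
            0<t = ≤-<-trans (0≤dim w) d<t
            n , N<n , heavy = ¬Low⇒heavy (<⇒≤ 0<t) (λ low → ≤⇒≮ (Low⇒≤dim w (<⇒≤ 0<t) low) d<t) (suc N)
        in finish N n (<-respˡ-≈ (*-identityʳ (½ⁿ N)) k) 0<t N<n heavy
        where
        finish : ∀ N n → ½ⁿ N < δ → 0# < t → suc N ℕ.≤ n → 1# < cyl w n * exp (t * nat n * ℓ) → ∃[ ρ ] (Near δ (fin ρ) × proj₁ ρ < t)
        finish N (suc n) k 0<t (s≤s N≤n) heavy =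
          let r , ρ , 0<r , above , _ , hr , ρ<t = quotient-near n 0<t heavy
          in ρ , (r , ⇒0<ᴰ 0<r , ⇒<ᴰ (≤-<-trans (≤-trans above (½ⁿ-anti-≤ N≤n)) k) , hr) , ρ<t

      -- For every radius in the range of length n + 1, - log r is below (n+1) log 2, so the
      -- quotient is no smaller than the one formed with the length of the prefix.
      large-quotients : ∀ {t} → 0# ≤ t → t < d → ∃[ δ ] (0# < δ × (∀ v → Near δ v → ∀ 0≤t → fin′ t 0≤t ≤∞ v))
      large-quotients {t} 0≤t t<d = ½ⁿ N , 0<½ⁿ N , near
        where
        low : Low w t
        low = <dim⇒Low w 0≤t t<d
        N : ℕ
        N = proj₁ low
        near : ∀ v → Near (½ⁿ N) v → ∀ 0≤t → fin′ t 0≤t ≤∞ v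
        near ∞ _ _ = tt
        near (fin ρ) (r , 0<r , r<δ , r<1 , a , ball , quot) _ =
          let n , below , above = scale-of-radius (0<ᴰ⇒ {r} 0<r) (<1ᴰ⇒ {r} r<1)
              a≈ = ball-mass n below above {a} ball
              s , u , log-a , log-r , e = quotient⇒ {a} {r} {ρ} (≤-respˡ-≈ (≈-sym a≈) (mass≤1 μ (basic (prefix w (suc n))))) (<⇒≤ (<1ᴰ⇒ {r} r<1)) quot
              N<sn = ½ⁿ-reflects-< (<-trans below (<ᴰ⇒ {r} {½ⁿ N} r<δ))
              tn≤s = NegLog-unique-≤ log-a (NegLog-pos log-a) (≤-respˡ-≈ (*-cong (≈-sym a≈) ≈-refl) (proj₁ (Below-prefix w t (suc n) 0≤t) (proj₂ low (suc n) (ℕₚ.<⇒≤ N<sn))))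
              0<u = ≰⇒> λ u≤0 → <-irrefl (<-respˡ-≈ (≈-trans (≈-sym (*-identityʳ r)) (≈-trans (*-cong ≈-refl (≈-sym (≈-trans (exp-cong (proj₁ log-r) (≤-antisym u≤0 (proj₁ log-r))) exp-zero))) (proj₂ log-r))) (<1ᴰ⇒ {r} r<1))
          in ⇒≤ᴰ {t} {proj₁ ρ} (*-cancelˡ-≤ 0<u (begin
               u * t                       ≈⟨ *-comm u t ⟩
               t * u                       ≤⟨ *-monoˡ-≤ 0≤t (<⇒≤ (exponent-< n below above log-r)) ⟩
               t * (nat (suc n) * ℓ)       ≈⟨ ≈-sym (*-assoc t (nat (suc n)) ℓ) ⟩
               t * nat (suc n) * ℓ         ≤⟨ tn≤s ⟩
               s                           ≈⟨ ≈-trans (≈-sym e) (*-comm (proj₁ ρ) u) ⟩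
               u * proj₁ ρ                 ∎))
          where open ≤-Reasoning

      Infima : [0,∞] → Set
      Infima i = ∃[ δ ] (D.0ℝ D.< δ × IsInf (Near δ) i)

      infima≤dim : ∀ i → Infima i → i ≤∞ fin′ d (0≤dim w)
      -- An infimum of ∞ cannot occur, as there are finite quotients below every δ.
      infima≤dim ∞ (δ , 0<δ , lower , _) =
        let ρ , near , _ = small-quotient {d + 1#} {δ} (x<x+ε 0<1) (0<ᴰ⇒ {δ} 0<δ) in lower (fin ρ) near
      infima≤dim (fin (x , 0≤x)) (δ , 0<δ , lower , _) = ⇒≤ᴰ {x} {d} (≮⇒≤ λ d<x →
        let ρ , near , ρ<x = small-quotient {x} {δ} d<x (0<ᴰ⇒ {δ} 0<δ) in ≤⇒≮ (≤ᴰ⇒ {x} {proj₁ ρ} (lower (fin ρ) near)) ρ<x)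

      dim≤bounds : ∀ u → (∀ i → Infima i → i ≤∞ u) → fin′ d (0≤dim w) ≤∞ u
      dim≤bounds ∞       _ = tt
      dim≤bounds (fin (u , 0≤u)) k = ⇒≤ᴰ {d} {u} (≮⇒≤ λ u<d → too-small (dense u<d))
        where
        between : ∀ i {q} {0≤q : 0# ≤ q} → fin′ q 0≤q ≤∞ i → i ≤∞ fin (u , 0≤u) → q ≤ u
        between ∞             _ ()
        between (fin (x , _)) {q} a b = ≤-trans (≤ᴰ⇒ {q} {x} a) (≤ᴰ⇒ {x} {u} b)
        too-small : ∃[ q ] (u < ⌊ q ⌋ × ⌊ q ⌋ < d) → ⊥
        too-small (q , u<q , q<d) =
          let 0≤q = ≤-trans (0≤ᴰ⇒ {u} 0≤u) (<⇒≤ u<q)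
              δ , 0<δ , near = large-quotients {⌊ q ⌋} 0≤q q<d
              i , inf = inf-exists (Near δ)
          in ≤⇒≮ (between i {⌊ q ⌋} {0≤q} (proj₂ inf (fin′ ⌊ q ⌋ 0≤q) λ v p → near v p 0≤q) (k i (δ , ⇒0<ᴰ {δ} 0<δ , inf))) u<q

    dimension⇒ : ∀ s → PointwiseDimension μ w (fin s) → proj₁ s ≈ dim w
    dimension⇒ (s , 0≤s) (upper , least) = ≤-antisym (≤ᴰ⇒ {s} {d} (least (fin′ d (0≤dim w)) infima≤dim)) (≤ᴰ⇒ {d} {s} (dim≤bounds (fin (s , 0≤s)) upper))

    ⇒dimension : ∀ s → proj₁ s ≈ dim w → PointwiseDimension μ w (fin s)
    ⇒dimension (s , 0≤s) e = (λ i p → raise i (infima≤dim i p)) , λ u k → lower u (dim≤bounds u k)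
      where
      raise : ∀ i → i ≤∞ fin′ d (0≤dim w) → i ≤∞ fin (s , 0≤s)
      raise (fin (x , _)) p = ⇒≤ᴰ {x} {s} (≤-respʳ-≈ (≈-sym e) (≤ᴰ⇒ {x} {d} p))
      lower : ∀ u → fin′ d (0≤dim w) ≤∞ u → fin (s , 0≤s) ≤∞ u
      lower ∞             _ = tt
      lower (fin (x , _)) p = ⇒≤ᴰ {s} {x} (≤-respˡ-≈ (≈-sym e) (≤ᴰ⇒ {d} {x} p))

-- Image measures under binary expansion and under the dimension

module ImageMeasures (em : ExcludedMiddle 0ℓ) where

  open PointwiseDimensions em public

  module Image (S : Space) (f : 2^ω → Space.Point S) (pre : Space.Base S → Borel cantor)
               (pre⇒ : ∀ b x → x ∈ pre b → Space._∈ᵇ_ S (f x) b) (⇒pre : ∀ b x → Space._∈ᵇ_ S (f x) b → x ∈ pre b) where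

    preimage : Borel S → Borel cantor
    preimage (basic b) = pre b
    preimage (compl A) = compl (preimage A)
    preimage (union F) = union λ n → preimage (F n)

    preimage⇒ : ∀ A x → x ∈ preimage A → member S (f x) A
    ⇒preimage : ∀ A x → member S (f x) A → x ∈ preimage A
    preimage⇒ (basic b) x h       = pre⇒ b x h
    preimage⇒ (compl A) x h k     = h (⇒preimage A x k)
    preimage⇒ (union F) x (n , h) = n , preimage⇒ (F n) x h
    ⇒preimage (basic b) x h       = ⇒pre b x h
    ⇒preimage (compl A) x h k     = h (preimage⇒ A x k)
    ⇒preimage (union F) x (n , h) = n , ⇒preimage (F n) x h

    image : Measure cantor → Measure S
    image μ = record
      { mass        = λ A → mass μ (preimage A)
      ; extensional = λ A B e → extensional μ (preimage A) (preimage B) λ x →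
          mk⇔ (λ h → ⇒preimage B x (Equivalence.to (e (f x)) (preimage⇒ A x h))) (λ h → ⇒preimage A x (Equivalence.from (e (f x)) (preimage⇒ B x h)))
      ; nonNegative = λ A → nonNegative μ (preimage A)
      ; total       = λ A h → total μ (preimage A) λ x → ⇒preimage A x (h (f x))
      ; σ-additive  = λ F disjoint → σ-additive μ (λ n → preimage (F n)) λ m n m≢n x (h , k) →
          disjoint m n m≢n (f x) (preimage⇒ (F m) x h , preimage⇒ (F n) x k) }

  opaque
    -- An enumeration of the nonnegative rationals by pairs of numbers, since unions of codes are
    -- indexed by ℕ.
    frac : ℕ → ℕ → ℚ
    frac i j = + i ℚ./ suc j

    0≤frac : ∀ i j → 0# ≤ ⌊ frac i j ⌋
    0≤frac i j = ⌊⌋-mono-≤ (ℚₚ.nonNegative⁻¹ (+ i ℚ./ suc j) {{ℚₚ.normalize-nonNeg i (suc j)}})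

    frac-surjective : ∀ q → 0# ≤ ⌊ q ⌋ → ∃[ i ] ∃[ j ] (frac i j ≡ q)
    frac-surjective q@(mkℚ (+ i) j c)    h = i , j , ℚₚ.↥p/↧p≡p q
    frac-surjective (mkℚ -[1+ i ] j c) h = ⊥-elim (≤⇒≮ h (⌊⌋-negative (mkℚ -[1+ i ] j c) refl))

  module Codes {S : Space} (b : Space.Base S) (empty : ∀ x → ¬ Space._∈ᵇ_ S x b) where

    guard : {P : Set} → Dec P → Borel S → Borel S
    guard (yes _) A = A
    guard (no  _) A = basic b

    guard⇒ : ∀ {P A} x (d : Dec P) → member S x (guard d A) → P × member S x A
    guard⇒ x (yes p) h = p , h
    guard⇒ x (no _)  h = ⊥-elim (empty x h)

    ⇒guard : ∀ {P A} x (d : Dec P) → P → member S x A → member S x (guard d A)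
    ⇒guard x (yes _) p h = h
    ⇒guard x (no ¬p) p h = ⊥-elim (¬p p)

    meet : Borel S → Borel S → Borel S
    meet A B = compl (union λ { zero → compl A ; (suc _) → compl B })

    meet⇒ : ∀ x A B → member S x (meet A B) → member S x A × member S x B
    meet⇒ x A B h = by-contradiction (λ k → h (0 , k)) , by-contradiction (λ k → h (1 , k))

    ⇒meet : ∀ x A B → member S x A × member S x B → member S x (meet A B)
    ⇒meet x A B (a , b) (zero , k)  = k a
    ⇒meet x A B (a , b) (suc _ , k) = k b

  -- The interval [m / 2^L, (m+1) / 2^L] lies inside the interval with code J.
  WellInside : ℕ → ℕ → ℕ → Set
  WellInside m L J = ¬ AtMost m (2 ℕ.^ L) (left J) × AtMost (2 ℕ.+ m) (2 ℕ.^ L) (right J)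

  WellInsideP : Pred 3
  WellInsideP = predicate (neg (atom AtMostP (v0 ∷ pow v1 ∷ call₁ leftF v2 ∷ [])) ∧ atom AtMostP (lit 2 ⊕ v0 ∷ pow v1 ∷ call₁ rightF v2 ∷ []))
    (λ { (m ∷ L ∷ J ∷ []) → WellInside m L J }) (λ { (m ∷ L ∷ J ∷ []) h → h }) (λ { (m ∷ L ∷ J ∷ []) h → h })

  -- The bound (m + 2) / 2^L at the right end leaves one unit of slack: values of extensions may
  -- reach (m + 1) / 2^L, and `AtMost` is not strict.
  Inner : Interval → String → Set
  Inner J τ = WellInside (number τ) (length τ) (codeInterval J)

  inner⇒ : ∀ u v τ → Inner (u , v) τ → ⌊ u ⌋ * nat (2 ℕ.^ length τ) < nat (number τ) × nat (2 ℕ.+ number τ) ≤ ⌊ v ⌋ * nat (2 ℕ.^ length τ)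
  inner⇒ u v τ (h , k) =
    ≰⇒> (λ le → h (subst (AtMost (number τ) (2 ℕ.^ length τ)) (sym (left-codePair (codeℚ u) (codeℚ v))) (⇒AtMost u (1≤2^ (length τ)) le))) ,
    AtMost⇒ v (subst (AtMost (2 ℕ.+ number τ) (2 ℕ.^ length τ)) (right-codePair (codeℚ u) (codeℚ v)) k)

  ⇒inner : ∀ u v τ → ⌊ u ⌋ * nat (2 ℕ.^ length τ) < nat (number τ) → nat (2 ℕ.+ number τ) ≤ ⌊ v ⌋ * nat (2 ℕ.^ length τ) → Inner (u , v) τ
  ⇒inner u v τ h k =
    (λ a → ≤⇒≮ (AtMost⇒ u (subst (AtMost (number τ) (2 ℕ.^ length τ)) (left-codePair (codeℚ u) (codeℚ v)) a)) h) ,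
    subst (AtMost (2 ℕ.+ number τ) (2 ℕ.^ length τ)) (sym (right-codePair (codeℚ u) (codeℚ v))) (⇒AtMost v (1≤2^ (length τ)) k)

  inner-upward : ∀ J → Upward (Inner J)
  inner-upward (u , v) σ b h =
    let p , q = inner⇒ u v σ h
    in ⇒inner u v (σ ∷ʳ b) (begin-strict
        ⌊ u ⌋ * nat (2 ℕ.^ length (σ ∷ʳ b))      ≈⟨ scale u ⟩
        nat 2 * (⌊ u ⌋ * nat (2 ℕ.^ length σ))   <⟨ *-monoˡ-< (nat-mono-< {0} {2} (s≤s z≤n)) p ⟩
        nat 2 * nat (number σ)                   ≈⟨ ≈-sym (nat-* 2 (number σ)) ⟩
        nat (2 ℕ.* number σ)                     ≤⟨ nat-mono-≤ (ℕₚ.≤-trans (ℕₚ.m≤m+n (2 ℕ.* number σ) (codeBool b)) (ℕₚ.≤-reflexive (sym (number-∷ʳ σ b)))) ⟩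
        nat (number (σ ∷ʳ b))                    ∎) (begin
        nat (2 ℕ.+ number (σ ∷ʳ b))              ≤⟨ nat-mono-≤ (ℕₚ.≤-trans (ℕₚ.≤-reflexive (cong (2 ℕ.+_) (number-∷ʳ σ b))) (double (number σ) (codeBool b) (bit≤2 b))) ⟩
        nat (2 ℕ.* (2 ℕ.+ number σ))             ≈⟨ nat-* 2 (2 ℕ.+ number σ) ⟩
        nat 2 * nat (2 ℕ.+ number σ)             ≤⟨ *-monoˡ-≤ (0≤nat 2) q ⟩
        nat 2 * (⌊ v ⌋ * nat (2 ℕ.^ length σ))   ≈⟨ ≈-sym (scale v) ⟩
        ⌊ v ⌋ * nat (2 ℕ.^ length (σ ∷ʳ b))      ∎)
    where
    open ≤-Reasoning
    scale : ∀ u → ⌊ u ⌋ * nat (2 ℕ.^ length (σ ∷ʳ b)) ≈ nat 2 * (⌊ u ⌋ * nat (2 ℕ.^ length σ))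
    scale u = ≈-trans (*-cong ≈-refl (≈-trans (≡⇒≈ (cong (λ n → nat (2 ℕ.^ n)) (length-∷ʳ σ b))) (nat-* 2 (2 ℕ.^ length σ))))
      (solve 3 (λ u a t → u :* (a :* t) := a :* (u :* t)) ≈-refl ⌊ u ⌋ (nat 2) (nat (2 ℕ.^ length σ)))
    bit≤2 : ∀ b → codeBool b ℕ.≤ 2
    bit≤2 false = z≤n
    bit≤2 true  = s≤s z≤n
    double : ∀ m b → b ℕ.≤ 2 → 2 ℕ.+ (2 ℕ.* m ℕ.+ b) ℕ.≤ 2 ℕ.* (2 ℕ.+ m)
    double m b h = ℕₚ.≤-trans (ℕₚ.+-monoʳ-≤ 2 (ℕₚ.+-monoʳ-≤ (2 ℕ.* m) h)) (ℕₚ.≤-reflexive (eq m))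
      where
      eq : ∀ m → 2 ℕ.+ (2 ℕ.* m ℕ.+ 2) ≡ 2 ℕ.* (2 ℕ.+ m)
      eq = solve-∀

  inner⇒inside : ∀ u v x n → Inner (u , v) (prefix x n) → ⌊ u ⌋ < value-of x × value-of x < ⌊ v ⌋
  inner⇒inside u v x n h =
    let p , q = subst (λ m → ⌊ u ⌋ * nat (2 ℕ.^ m) < nat (number (prefix x n)) × nat (2 ℕ.+ number (prefix x n)) ≤ ⌊ v ⌋ * nat (2 ℕ.^ m)) (length-prefix x n) (inner⇒ u v (prefix x n) h)
        swap = λ z → *-comm z (nat (2 ℕ.^ n))
    in *-cancelˡ-< (0≤nat (2 ℕ.^ n)) (<-respˡ-≈ (swap ⌊ u ⌋) (<-respʳ-≈ (swap (value-of x)) (<-≤-trans p (value-lower x n)))) ,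
       *-cancelˡ-< (0≤nat (2 ℕ.^ n)) (<-respˡ-≈ (swap (value-of x)) (<-respʳ-≈ (swap ⌊ v ⌋) (≤-<-trans (value-upper x n)
         (<-≤-trans (<-respˡ-≈ (≈-trans (nat-suc (number (prefix x n))) (+-comm 1# (nat (number (prefix x n))))) (nat-mono-< (ℕₚ.n<1+n (suc (number (prefix x n)))))) q))))

  inside⇒inner : ∀ u v x → ⌊ u ⌋ < value-of x → value-of x < ⌊ v ⌋ → ∃[ n ] Inner (u , v) (prefix x n)
  inside⇒inner u v x u<y y<v =
    let N₁ , h₁ = archimedean-* 1# (<⇒0<- u<y)
        N₂ , h₂ = archimedean-* (nat 2) (<⇒0<- y<v)
        n = N₁ ℕ.⊔ N₂
    in n , inner n (h₁ (2 ℕ.^ n) (ℕₚ.≤-trans (ℕₚ.m≤m⊔n N₁ N₂) (ℕₚ.<⇒≤ (a<2^a n)))) (h₂ (2 ℕ.^ n) (ℕₚ.≤-trans (ℕₚ.m≤n⊔m N₁ N₂) (ℕₚ.<⇒≤ (a<2^a n))))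
    where
    y : ℝ
    y = value-of x
    inner : ∀ n → 1# < nat (2 ℕ.^ n) * (y - ⌊ u ⌋) → nat 2 < nat (2 ℕ.^ n) * (⌊ v ⌋ - y) → Inner (u , v) (prefix x n)
    inner n h k = ⇒inner u v (prefix x n)
      (subst (λ m → ⌊ u ⌋ * nat (2 ℕ.^ m) < nat (number (prefix x n))) (sym (length-prefix x n))
        (<-by (+-nonneg-pos (≤⇒0≤- (value-upper x n)) (<⇒0<- h))
          (solve 5 (λ u y t m o → m :- u :* t := ((m :+ o) :- y :* t) :+ (t :* (y :- u) :- o)) ≈-refl ⌊ u ⌋ y (nat (2 ℕ.^ n)) (nat (number (prefix x n))) 1#)))
      (subst (λ m → nat (2 ℕ.+ number (prefix x n)) ≤ ⌊ v ⌋ * nat (2 ℕ.^ m)) (sym (length-prefix x n))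
        (≤-respˡ-≈ (≈-sym (nat-+ 2 (number (prefix x n)))) (≤-by (+-nonneg (≤⇒0≤- (value-lower x n)) (<⇒≤ (<⇒0<- k)))
          (solve 5 (λ v y t m o → v :* t :- (o :+ m) := (y :* t :- m) :+ (t :* (v :- y) :- o)) ≈-refl ⌊ v ⌋ y (nat (2 ℕ.^ n)) (nat (number (prefix x n))) (nat 2)))))

  expand : 2^ω → Space.Point unitInterval
  expand x = value-of x , ⇒0≤ᴰ (0≤value x) , ⇒≤ᴰ {value-of x} {D.1ℝ} (subst (value-of x ≤_) (sym (fromℚ≡ 1ℚ)) (value≤1 x))

  inside⇒ : ∀ {x} u v → Inside x (u , v) → ⌊ u ⌋ < x × x < ⌊ v ⌋
  inside⇒ {x} u v (h , k) = subst (_< x) (fromℚ≡ u) (<ᴰ⇒ {D.fromℚ u} {x} h) , subst (x <_) (fromℚ≡ v) (<ᴰ⇒ {x} {D.fromℚ v} k)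

  ⇒inside : ∀ {x} u v → ⌊ u ⌋ < x → x < ⌊ v ⌋ → Inside x (u , v)
  ⇒inside {x} u v h k = ⇒<ᴰ {D.fromℚ u} {x} (subst (_< x) (sym (fromℚ≡ u)) h) , ⇒<ᴰ {x} {D.fromℚ v} (subst (x <_) (sym (fromℚ≡ v)) k)

  expand⇒ : ∀ J x → x ∈ open-set (Inner J) → Inside (value-of x) J
  expand⇒ (u , v) x (n , h) = let p , q = inner⇒inside u v x n (∈-clopen n (Inner (u , v)) x h) in ⇒inside {value-of x} u v p q

  ⇒expand : ∀ J x → Inside (value-of x) J → x ∈ open-set (Inner J)
  ⇒expand (u , v) x h = let p , q = inside⇒ {value-of x} u v h ; n , k = inside⇒inner u v x p q in open-∈ (Inner (u , v)) x n k

  module Expansion = Image unitInterval expand (λ J → open-set (Inner J)) expand⇒ ⇒expand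

  inside-cong : ∀ {x y} J → x ≈ y → Inside x J → Inside y J
  inside-cong {x} {y} (u , v) e h = let p , q = inside⇒ {x} u v h in ⇒inside {y} u v (<-respʳ-≈ e p) (<-respˡ-≈ e q)

  -- Borel sets respect equality of reals and ignore the proofs that place a point in [0,1]. This is
  -- inherited from intervals by induction on codes.
  member-cong : ∀ E (x y : Space.Point unitInterval) → proj₁ x ≈ proj₁ y → member unitInterval x E → member unitInterval y E
  member-cong (basic J) x y e h       = inside-cong {proj₁ x} {proj₁ y} J e h
  member-cong (compl A) x y e h k     = h (member-cong A y x (≈-sym e) k)
  member-cong (union F) x y e (n , h) = n , member-cong (F n) x y e h

  empty-interval : ∀ x → ¬ Inside x (0ℚ , 0ℚ)
  empty-interval x h = let p , q = inside⇒ {x} 0ℚ 0ℚ h in <-asym p q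

  open Codes {halfLine} (0ℚ , 0ℚ) (λ x → empty-interval (proj₁ x))

  -- Basic sets are bounded, so the ray above t is a union of intervals (q, n) with rational q > t.
  atMost : ∀ t → Borel halfLine
  atMost t = compl (union λ i → union λ j → union λ n → guard (em {t < ⌊ frac i j ⌋}) (basic (frac i j , fromℤ (+ n))))

  atMost⇒ : ∀ t x → 0# ≤ t → member halfLine x (atMost t) → proj₁ x ≤ t
  atMost⇒ t x 0≤t h = ≮⇒≤ λ t<x →
    let q , t<q , q<x = dense t<x
        i , j , e = frac-surjective q (≤-trans 0≤t (<⇒≤ t<q))
        n , x<n = archimedean (proj₁ x)
    in h (i , j , n , ⇒guard x em (subst (λ q → t < ⌊ q ⌋) (sym e) t<q) (⇒inside {proj₁ x} (frac i j) (fromℤ (+ n)) (subst (λ q → ⌊ q ⌋ < proj₁ x) (sym e) q<x) x<n))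

  ⇒atMost : ∀ t x → proj₁ x ≤ t → member halfLine x (atMost t)
  ⇒atMost t x x≤t (i , j , n , h) =
    let t<q , k = guard⇒ {A = basic (frac i j , fromℤ (+ n))} x em h
    in ≤⇒≮ x≤t (<-trans t<q (proj₁ (inside⇒ {proj₁ x} (frac i j) (fromℤ (+ n)) k)))

  -- Complements have to be taken inside [0,1], so each of them is met with `atMost 1#`.
  extend : Borel unitInterval → Borel halfLine
  extend (basic J) = meet (atMost 1#) (basic J)
  extend (compl A) = meet (atMost 1#) (compl (extend A))
  extend (union F) = union λ n → extend (F n)

  ≤1ᴰ⇒ : ∀ {x} → x D.≤ D.1ℝ → x ≤ 1#
  ≤1ᴰ⇒ {x} h = subst (x ≤_) (fromℚ≡ 1ℚ) (≤ᴰ⇒ {x} {D.1ℝ} h)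

  ⇒≤1ᴰ : ∀ {x} → x ≤ 1# → x D.≤ D.1ℝ
  ⇒≤1ᴰ {x} h = ⇒≤ᴰ {x} {D.1ℝ} (subst (x ≤_) (sym (fromℚ≡ 1ℚ)) h)

  extend⇒ : ∀ E x → member halfLine x (extend E) → inHalfLine E x
  ⇒extend : ∀ E x → inHalfLine E x → member halfLine x (extend E)
  extend⇒ (basic J) x h = let a , b = meet⇒ x (atMost 1#) (basic J) h in
    ⇒≤1ᴰ {proj₁ x} (atMost⇒ 1# x (<⇒≤ 0<1) a) , b
  extend⇒ (compl A) x h = let a , b = meet⇒ x (atMost 1#) (compl (extend A)) h in
    ⇒≤1ᴰ {proj₁ x} (atMost⇒ 1# x (<⇒≤ 0<1) a) , λ k → b (⇒extend A x (_ , k))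
  extend⇒ (union F) x (n , h) = let a , b = extend⇒ (F n) x h in a , n , b
  ⇒extend (basic J) x (x≤1 , h) = ⇒meet x (atMost 1#) (basic J) (⇒atMost 1# x (≤1ᴰ⇒ {proj₁ x} x≤1) , h)
  ⇒extend (compl A) (x , 0≤x) (x≤1 , h) = ⇒meet (x , 0≤x) (atMost 1#) (compl (extend A)) (⇒atMost 1# (x , 0≤x) (≤1ᴰ⇒ {x} x≤1) ,
    λ k → let y≤1 , m = extend⇒ A (x , 0≤x) k in h (member-cong A (x , 0≤x , y≤1) (x , 0≤x , x≤1) ≈-refl m))
  ⇒extend (union F) x (x≤1 , n , h) = n , ⇒extend (F n) x (x≤1 , h)

  module DimensionProbability (μ : Measure cantor) {K : ℕ} (positive : ∀ σ → ½ⁿ (K ℕ.+ length σ) ≤ cylinder μ σ) where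

    open Dimension μ {K} positive
    open PointwiseDim μ {K} positive

    dimension : 2^ω → [0,∞⟩
    dimension x = dim x , ⇒0≤ᴰ {dim x} (0≤dim x)

    lowSet : ℝ → Borel cantor
    lowSet t = union λ N → compl (union λ n → clopen (N ℕ.+ n) (λ σ → ¬ Below t σ))

    lowSet⇒ : ∀ t x → x ∈ lowSet t → Low x t
    lowSet⇒ t x (N , h) = N , λ n N≤n → by-contradiction λ ¬b →
      h (n ∸ N , clopen-∈ (N ℕ.+ (n ∸ N)) (λ σ → ¬ Below t σ) x (subst (λ m → ¬ Below t (prefix x m)) (sym (ℕₚ.m+[n∸m]≡n N≤n)) ¬b))

    ⇒lowSet : ∀ t x → Low x t → x ∈ lowSet t
    ⇒lowSet t x (N , h) = N , λ (n , k) → ∈-clopen (N ℕ.+ n) (λ σ → ¬ Below t σ) x k (h (N ℕ.+ n) (ℕₚ.m≤m+n N n))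

    -- Measurability of the dimension: it exceeds p if and only if some rational above p is an
    -- exponent, and is below q if and only if some nonnegative rational below q is not.
    above below : ℝ → Borel cantor
    above p = union λ i → union λ j → choose (em {p < ⌊ frac i j ⌋}) (lowSet ⌊ frac i j ⌋)
    below q = union λ i → union λ j → choose (em {⌊ frac i j ⌋ < q}) (compl (lowSet ⌊ frac i j ⌋))

    above⇒ : ∀ p x → x ∈ above p → p < dim x
    above⇒ p x (i , j , h) = let k , p<t = ∈-choose {A = lowSet ⌊ frac i j ⌋} em h in
      <-≤-trans p<t (Low⇒≤dim x (0≤frac i j) (lowSet⇒ ⌊ frac i j ⌋ x k))

    ⇒above : ∀ p x → p < dim x → x ∈ above p
    ⇒above p x h = go em
      where
      put : ∀ q → 0# ≤ ⌊ q ⌋ → p < ⌊ q ⌋ → Low x ⌊ q ⌋ → x ∈ above p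
      put q 0≤q p<q low = let i , j , e = frac-surjective q 0≤q in
        i , j , choose-∈ {A = lowSet ⌊ frac i j ⌋} em (⇒lowSet ⌊ frac i j ⌋ x (subst (λ q → Low x ⌊ q ⌋) (sym e) low)) (subst (λ q → p < ⌊ q ⌋) (sym e) p<q)
      go : Dec (p < 0#) → x ∈ above p
      -- `frac` has no negative values; below 0 the exponent 0, which every sequence has, is the
      -- witness.
      go (yes p<0) = put 0ℚ ≤-refl p<0 (proj₂ (Exponent-0 x))
      go (no ¬p<0) = let q , p<q , q<d = dense h ; 0≤q = ≤-trans (≮⇒≤ ¬p<0) (<⇒≤ p<q) in put q 0≤q p<q (<dim⇒Low x 0≤q q<d)

    below⇒ : ∀ q x → x ∈ below q → dim x < q
    below⇒ q x (i , j , h) = let k , t<q = ∈-choose {A = compl (lowSet ⌊ frac i j ⌋)} em h in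
      ≤-<-trans (≮⇒≤ λ t<d → k (⇒lowSet ⌊ frac i j ⌋ x (<dim⇒Low x (0≤frac i j) t<d))) t<q

    ⇒below : ∀ q x → dim x < q → x ∈ below q
    ⇒below q x h =
      let t , d<t , t<q = dense h
          0≤t = ≤-trans (0≤dim x) (<⇒≤ d<t)
          i , j , e = frac-surjective t 0≤t
      in i , j , choose-∈ {A = compl (lowSet ⌊ frac i j ⌋)} em
           (λ k → ≤⇒≮ (Low⇒≤dim x 0≤t (subst (λ q → Low x ⌊ q ⌋) e (lowSet⇒ ⌊ frac i j ⌋ x k))) d<t)
           (subst (λ t → ⌊ t ⌋ < q) (sym e) t<q)

    between : Interval → Borel cantor
    between (u , v) = above ⌊ u ⌋ ∩ below ⌊ v ⌋

    between⇒ : ∀ J x → x ∈ between J → Inside (dim x) J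
    between⇒ (u , v) x h = let a , b = ∈-∩ (above ⌊ u ⌋) (below ⌊ v ⌋) h in ⇒inside {dim x} u v (above⇒ ⌊ u ⌋ x a) (below⇒ ⌊ v ⌋ x b)

    ⇒between : ∀ J x → Inside (dim x) J → x ∈ between J
    ⇒between (u , v) x h = let p , q = inside⇒ {dim x} u v h in ∩-∈ (above ⌊ u ⌋) (below ⌊ v ⌋) (⇒above ⌊ u ⌋ x p , ⇒below ⌊ v ⌋ x q)

    module DimensionImage = Image halfLine dimension between between⇒ ⇒between

    -- Every sequence has a finite dimension here, so the dimension probability is the image of μ
    -- under a total map.
    D-μ : Measure halfLine
    D-μ = DimensionImage.image μ

    isDimensionProbability : IsDimensionProbability μ D-μ
    isDimensionProbability (t , 0≤t) = mass D-μ (atMost t) ,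
      (DimensionImage.preimage (atMost t) , (λ x → mk⇔
          (λ h → dimension x , ⇒≤ᴰ {dim x} {t} (atMost⇒ t (dimension x) (0≤ᴰ⇒ {t} 0≤t) (DimensionImage.preimage⇒ (atMost t) x h)) , ⇒dimension x (dimension x) ≈-refl)
          (λ (s , s≤t , pd) → DimensionImage.⇒preimage (atMost t) x (⇒atMost t (dimension x) (≤-respˡ-≈ (dimension⇒ x s pd) (≤ᴰ⇒ {proj₁ s} {t} s≤t))))) ,
        ⇒≈ᴰ {mass D-μ (atMost t)} {mass D-μ (atMost t)} ≈-refl) ,
      (atMost t , (λ x → mk⇔ (λ h → ⇒≤ᴰ {proj₁ x} {t} (atMost⇒ t x (0≤ᴰ⇒ {t} 0≤t) h)) (λ h → ⇒atMost t x (≤ᴰ⇒ {proj₁ x} {t} h))) ,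
        ⇒≈ᴰ {mass D-μ (atMost t)} {mass D-μ (atMost t)} ≈-refl)

    extend-mass : ∀ E → MeasureOf D-μ (inHalfLine E) (mass D-μ (extend E))
    extend-mass E = extend E , (λ x → mk⇔ (extend⇒ E x) (⇒extend E x)) , ⇒≈ᴰ {mass D-μ (extend E)} {mass D-μ (extend E)} ≈-refl

    dimension-hits : ∀ E x → x ∈ Expansion.preimage E → ∀ w → dim w ≈ value-of x → w ∈ DimensionImage.preimage (extend E)
    dimension-hits E x h w e = DimensionImage.⇒preimage (extend E) w (⇒extend E (dimension w)
      (d≤1 , member-cong E (expand x) (dim w , ⇒0≤ᴰ {dim w} (0≤dim w) , d≤1) (≈-sym e) (Expansion.preimage⇒ E x h)))
      where
      d≤1 : dim w D.≤ D.1ℝ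
      d≤1 = ⇒≤1ᴰ {dim w} (≤-respˡ-≈ (≈-sym e) (value≤1 x))

-- Lower sums for the integral of a uniform test

module LabelledStrings (em : ExcludedMiddle 0ℓ) where

  open ImageMeasures em public

  opaque
    greatest : ∀ N (P : ℕ → Set) → ∃[ r ] (r ℕ.≤ N × (r ≡ 0 ⊎ P r) × (∀ s → s ℕ.≤ N → P s → s ℕ.≤ r))
    greatest zero    P = 0 , z≤n , inj₁ refl , λ s s≤ _ → s≤
    greatest (suc N) P = go em
      where
      go : Dec (P (suc N)) → ∃[ r ] (r ℕ.≤ suc N × (r ≡ 0 ⊎ P r) × (∀ s → s ℕ.≤ suc N → P s → s ℕ.≤ r))
      go (yes p) = suc N , ℕₚ.≤-refl , inj₂ p , λ s h _ → h
      go (no ¬p) = let r , r≤ , h , max = greatest N P in r , ℕₚ.m≤n⇒m≤1+n r≤ , h , λ s s≤ p → below r max s p (ℕₚ.m≤n⇒m<n∨m≡n s≤)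
        where
        below : ∀ r → (∀ s → s ℕ.≤ N → P s → s ℕ.≤ r) → ∀ s → P s → s ℕ.< suc N ⊎ s ≡ suc N → s ℕ.≤ r
        below r max s p (inj₁ s<)   = max s (ℕₚ.≤-pred s<) p
        below r max s p (inj₂ refl) = ⊥-elim (¬p p)

  interval-of : UniformElement → Interval
  interval-of (_ , J , _) = J

  rate-of : UniformElement → ℚ
  rate-of (_ , _ , q , _) = q

  -- 2^k times the values, truncated at k and rounded down, which the elements in S
  -- force a test to have on the interval of a string

  module Labels (S : UniformElement → Set) where

    Label : ℕ → String → ℕ → Set
    Label k τ r = ∃[ e ] (S e × Inner (interval-of e) τ × nat r ≤ ⌊ rate-of e ⌋ * nat (2 ℕ.^ k))

    label : ℕ → String → ℕ
    label k τ = proj₁ (greatest (k ℕ.* 2 ℕ.^ k) (Label k τ))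

    label≤ : ∀ k τ → label k τ ℕ.≤ k ℕ.* 2 ℕ.^ k
    label≤ k τ = proj₁ (proj₂ (greatest (k ℕ.* 2 ℕ.^ k) (Label k τ)))

    label-holds : ∀ k τ → label k τ ≡ 0 ⊎ Label k τ (label k τ)
    label-holds k τ = proj₁ (proj₂ (proj₂ (greatest (k ℕ.* 2 ℕ.^ k) (Label k τ))))

    label-max : ∀ k τ r → r ℕ.≤ k ℕ.* 2 ℕ.^ k → Label k τ r → r ℕ.≤ label k τ
    label-max k τ = proj₂ (proj₂ (proj₂ (greatest (k ℕ.* 2 ℕ.^ k) (Label k τ))))

    label-double : ∀ k τ → 2 ℕ.* label k τ ℕ.≤ label (suc k) τ
    label-double k τ = go (label-holds k τ)
      where
      go : label k τ ≡ 0 ⊎ Label k τ (label k τ) → 2 ℕ.* label k τ ℕ.≤ label (suc k) τ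
      go (inj₁ e) = subst (λ r → 2 ℕ.* r ℕ.≤ label (suc k) τ) (sym e) z≤n
      go (inj₂ (e , s , i , h)) = label-max (suc k) τ (2 ℕ.* label k τ)
        (ℕₚ.≤-trans (ℕₚ.*-monoʳ-≤ 2 (label≤ k τ)) (ℕₚ.≤-trans (ℕₚ.≤-reflexive (eq k (2 ℕ.^ k))) (ℕₚ.*-monoˡ-≤ (2 ℕ.* 2 ℕ.^ k) (ℕₚ.n≤1+n k))))
        (e , s , i , (begin
          nat (2 ℕ.* label k τ)                       ≈⟨ nat-* 2 (label k τ) ⟩
          nat 2 * nat (label k τ)                     ≤⟨ *-monoˡ-≤ (0≤nat 2) h ⟩
          nat 2 * (⌊ rate-of e ⌋ * nat (2 ℕ.^ k))     ≈⟨ solve 3 (λ a q n → a :* (q :* n) := q :* (a :* n)) ≈-refl (nat 2) ⌊ rate-of e ⌋ (nat (2 ℕ.^ k)) ⟩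
          ⌊ rate-of e ⌋ * (nat 2 * nat (2 ℕ.^ k))     ≈⟨ *-cong ≈-refl (≈-sym (nat-* 2 (2 ℕ.^ k))) ⟩
          ⌊ rate-of e ⌋ * nat (2 ℕ.^ suc k)           ∎))
        where
        open ≤-Reasoning
        eq : ∀ k n → 2 ℕ.* (k ℕ.* n) ≡ k ℕ.* (2 ℕ.* n)
        eq = solve-∀

    label-child : ∀ k τ b → label k τ ℕ.≤ label k (τ ∷ʳ b)
    label-child k τ b = go (label-holds k τ)
      where
      go : label k τ ≡ 0 ⊎ Label k τ (label k τ) → label k τ ℕ.≤ label k (τ ∷ʳ b)
      go (inj₁ e) = subst (ℕ._≤ label k (τ ∷ʳ b)) (sym e) z≤n
      go (inj₂ (e , s , i , h)) = label-max k (τ ∷ʳ b) (label k τ) (label≤ k τ) (e , s , inner-upward (interval-of e) τ b i , h)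

    module _ (μ : Measure cantor) where

      weighted : ℕ → String → ℝ
      weighted k τ = cylinder μ τ * nat (label k τ)

      weighted-sum : ℕ → String → ℝ
      weighted-sum k σ = Ext k σ (weighted k)

      0≤weighted : ∀ k τ → 0# ≤ weighted k τ
      0≤weighted k τ = *-nonneg (0≤cylinder μ τ) (0≤nat (label k τ))

      private
        double : ∀ k τ {c r} → 0# ≤ c → 2 ℕ.* label k τ ℕ.≤ r → nat 2 * (c * nat (label k τ)) ≤ c * nat r
        double k τ {c} {r} 0≤c h = ≤-respˡ-≈ (≈-trans (*-cong ≈-refl (nat-* 2 (label k τ))) (solve 3 (λ c a l → c :* (a :* l) := a :* (c :* l)) ≈-refl c (nat 2) (nat (label k τ))))
          (*-monoˡ-≤ 0≤c (nat-mono-≤ h))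

      -- Precision k + 1 refines the strings by one bit, under which labels do not drop because
      -- `Inner` persists, and doubles the scale in which labels are measured.
      weighted-sum-double : ∀ k σ → nat 2 * weighted-sum k σ ≤ weighted-sum (suc k) σ
      weighted-sum-double k σ = begin
        nat 2 * weighted-sum k σ                      ≈⟨ ≈-sym (Ext-*ˡ k σ (nat 2) (weighted k)) ⟩
        Ext k σ (λ τ → nat 2 * weighted k τ)   ≤⟨ Ext-mono k σ (λ τ _ → step τ) ⟩
        Ext k σ (λ τ → weighted (suc k) (τ ∷ʳ false) + weighted (suc k) (τ ∷ʳ true)) ≈⟨ ≈-sym (Ext-suc k σ (weighted (suc k))) ⟩
        weighted-sum (suc k) σ                        ∎
        where
        open ≤-Reasoning
        child : ∀ τ b → 2 ℕ.* label k τ ℕ.≤ label (suc k) (τ ∷ʳ b)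
        child τ b = ℕₚ.≤-trans (ℕₚ.*-monoʳ-≤ 2 (label-child k τ b)) (label-double k (τ ∷ʳ b))
        step : ∀ τ → nat 2 * weighted k τ ≤ weighted (suc k) (τ ∷ʳ false) + weighted (suc k) (τ ∷ʳ true)
        step τ = begin
          nat 2 * (cylinder μ τ * nat (label k τ))
            ≈⟨ *-cong ≈-refl (*-cong (cylinder-additive μ τ) ≈-refl) ⟩
          nat 2 * ((cylinder μ (τ ∷ʳ false) + cylinder μ (τ ∷ʳ true)) * nat (label k τ))
            ≈⟨ solve 4 (λ a x y l → a :* ((x :+ y) :* l) := a :* (x :* l) :+ a :* (y :* l)) ≈-refl (nat 2) (cylinder μ (τ ∷ʳ false)) (cylinder μ (τ ∷ʳ true)) (nat (label k τ)) ⟩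
          nat 2 * (cylinder μ (τ ∷ʳ false) * nat (label k τ)) + nat 2 * (cylinder μ (τ ∷ʳ true) * nat (label k τ))
            ≤⟨ +-mono-≤ (double k τ (0≤cylinder μ (τ ∷ʳ false)) (child τ false)) (double k τ (0≤cylinder μ (τ ∷ʳ true)) (child τ true)) ⟩
          weighted (suc k) (τ ∷ʳ false) + weighted (suc k) (τ ∷ʳ true) ∎

      weighted-sum-split : ∀ k σ → nat 2 * (weighted-sum k (σ ∷ʳ false) + weighted-sum k (σ ∷ʳ true)) ≤ weighted-sum (suc k) σ
      weighted-sum-split k σ = ≤-respˡ-≈ (Ext-*ˡ (suc k) σ (nat 2) (weighted k)) (Ext-mono (suc k) σ λ τ _ → double k τ (0≤cylinder μ τ) (label-double k τ))

      -- The lower sum of precision k for the integral of t(ν, g x) over the cylinder of σ: strings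
      -- of length |σ| + k, with values truncated at k and rounded down to multiples of 2^-k.
      average : ℕ → String → ℝ
      average k σ = weighted-sum k σ * ½ⁿ k

      private
        rescale : ∀ k x → nat 2 * x * ½ⁿ (suc k) ≈ x * ½ⁿ k
        rescale k x = begin-equality
          nat 2 * x * ½ⁿ (suc k)               ≈⟨ *-cong (*-cong (nat-+ 1 1) ≈-refl) ≈-refl ⟩
          (1# + 1#) * x * ½ⁿ (suc k)           ≈⟨ solve 2 (λ x h → (con (+ 1) :+ con (+ 1)) :* x :* h := x :* (h :+ h)) ≈-refl x (½ⁿ (suc k)) ⟩
          x * (½ⁿ (suc k) + ½ⁿ (suc k))        ≈⟨ *-cong ≈-refl (½ⁿ-double k) ⟩
          x * ½ⁿ k                             ∎
          where open ≤-Reasoning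

      average-mono : ∀ k σ → average k σ ≤ average (suc k) σ
      average-mono k σ = ≤-respˡ-≈ (rescale k (weighted-sum k σ)) (*-monoʳ-≤ (<⇒≤ (0<½ⁿ (suc k))) (weighted-sum-double k σ))

      -- At precision k the children use the strings that the parent uses at precision k + 1. So
      -- superadditivity holds after a shift of precision, and properly in the supremum.
      average-split : ∀ k σ → average k (σ ∷ʳ false) + average k (σ ∷ʳ true) ≤ average (suc k) σ
      average-split k σ = ≤-respˡ-≈ (≈-trans (rescale k (weighted-sum k (σ ∷ʳ false) + weighted-sum k (σ ∷ʳ true))) (*-distribʳ-+ (½ⁿ k) (weighted-sum k (σ ∷ʳ false)) (weighted-sum k (σ ∷ʳ true))))
        (*-monoʳ-≤ (<⇒≤ (0<½ⁿ (suc k))) (weighted-sum-split k σ))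

      average-mono-≤ : ∀ {j k} σ → j ℕ.≤ k → average j σ ≤ average k σ
      average-mono-≤ {j} σ j≤k = go (ℕₚ.≤⇒≤′ j≤k)
        where
        go : ∀ {k} → j ℕ.≤′ k → average j σ ≤ average k σ
        go (ℕ.≤′-reflexive refl) = ≤-refl
        go (ℕ.≤′-step {k} h) = ≤-trans (go h) (average-mono k σ)

-- Lower sums are bounded by the integral of the test

module IntegralBound (em : ExcludedMiddle 0ℓ) where

  open LabelledStrings em public

  ≤∞-trans : ∀ u v w → u ≤∞ v → v ≤∞ w → u ≤∞ w
  ≤∞-trans u       v       ∞       h k = tt
  ≤∞-trans (fin x) (fin y) (fin z) h k = ⇒≤ᴰ {proj₁ x} {proj₁ z} (≤-trans (≤ᴰ⇒ {proj₁ x} {proj₁ y} h) (≤ᴰ⇒ {proj₁ y} {proj₁ z} k))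

  module UnitCodes = Codes {unitInterval} (0ℚ , 0ℚ) (λ x → empty-interval (proj₁ x))

  -- Summation by parts, comparing the layer-cake form of an integral with its simple-function form:
  -- a r is the mass where the value is at least r, and c r the mass where it is r.
  Σ<-layers : ∀ (a c : ℕ → ℝ) → (∀ r → a r ≤ c r + a (suc r)) → ∀ N → Σ< N (λ r → a (suc r)) ≤ Σ< N (λ r → nat (suc r) * c (suc r)) + nat N * a (suc N)
  Σ<-layers a c h zero    = ≈⇒≤ (solve 1 (λ x → con (+ 0) := con (+ 0) :+ con (+ 0) :* x) ≈-refl (a 1))
  Σ<-layers a c h (suc N) = begin
    Σ< N (λ r → a (suc r)) + a (suc N)
      ≤⟨ +-mono-≤ (Σ<-layers a c h N) ≤-refl ⟩
    S + nat N * a (suc N) + a (suc N)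
      ≈⟨ ≈-trans (solve 3 (λ s n a → s :+ n :* a :+ a := s :+ (con (+ 1) :+ n) :* a) ≈-refl S (nat N) (a (suc N))) (+-cong ≈-refl (*-cong (≈-sym (nat-suc N)) ≈-refl)) ⟩
    S + nat (suc N) * a (suc N)
      ≤⟨ +-mono-≤ ≤-refl (*-monoˡ-≤ (0≤nat (suc N)) (h (suc N))) ⟩
    S + nat (suc N) * (c (suc N) + a (suc (suc N)))
      ≈⟨ solve 4 (λ s n c a → s :+ n :* (c :+ a) := s :+ n :* c :+ n :* a) ≈-refl S (nat (suc N)) (c (suc N)) (a (suc (suc N))) ⟩
    S + nat (suc N) * c (suc N) + nat (suc N) * a (suc (suc N)) ∎
    where
    open ≤-Reasoning
    S : ℝ
    S = Σ< N (λ r → nat (suc r) * c (suc r))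

  module Integral (t : UniformTest) (μ : Measure cantor) where

    ν : Measure unitInterval
    ν = Expansion.image μ

    Satisfied : UniformElement → Set
    Satisfied (conds , J , q) = UniformTest.elements t ∋ (conds , J , q) × All (λ (I , p) → D.fromℚ p D.< mass ν (basic I)) conds

    open Labels Satisfied public

    simple-bound : ∀ (s : Simple) → s ≤ˢ UniformTest.value t ν → 0# ≤ simpleIntegral ν s → simpleIntegral ν s ≤ 1#
    simple-bound s s≤ 0≤s =
      let i , (upper , _) , i≤1 = UniformTest.integral t ν
          v = fin (simpleIntegral ν s , ⇒0≤ᴰ {simpleIntegral ν s} 0≤s)
      in ≤1ᴰ⇒ {simpleIntegral ν s} (≤∞-trans v i (fin (D.1ℝ , 0≤1)) (upper v (s , s≤ , ⇒≈ᴰ {simpleIntegral ν s} {simpleIntegral ν s} ≈-refl)) i≤1)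

    element-bound : ∀ e → Satisfied e → ∀ y → Inside (proj₁ y) (interval-of e) → ∀ x → proj₁ x ≤ ⌊ rate-of e ⌋ → fin x ≤∞ UniformTest.value t ν y
    element-bound (conds , J , q , 0≤q) (e∈ , hold) y inside (x , 0≤x) x≤ =
      ≤∞-trans (fin (x , 0≤x)) v (UniformTest.value t ν y) (⇒≤ᴰ {x} {D.fromℚ q} (subst (x ≤_) (sym (fromℚ≡ q)) x≤))
        (proj₁ (UniformTest.isSup t ν y) v (conds , J , (q , 0≤q) , e∈ , hold , inside , ⇒≈ᴰ {D.fromℚ q} {D.fromℚ q} ≈-refl))
      where
      v : [0,∞]
      v = fin (D.fromℚ q , ⇒0≤ᴰ {D.fromℚ q} (subst (0# ≤_) (sym (fromℚ≡ q)) (⌊⌋-mono-≤ 0≤q)))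

    module _ (k : ℕ) where

      private
        choose-interval : ∀ τ → label k τ ≡ 0 ⊎ Label k τ (label k τ) → Interval
        -- An empty interval: a string without a witness contributes no points.
        choose-interval τ (inj₁ _)       = 0ℚ , 0ℚ
        choose-interval τ (inj₂ (e , _)) = interval-of e

        witness : ∀ τ (h : label k τ ≡ 0 ⊎ Label k τ (label k τ)) → 1 ℕ.≤ label k τ →
          ∃[ e ] (choose-interval τ h ≡ interval-of e × Satisfied e × Inner (interval-of e) τ × nat (label k τ) ≤ ⌊ rate-of e ⌋ * nat (2 ℕ.^ k))
        witness τ (inj₁ e) h = ⊥-elim (ℕₚ.<⇒≱ h (ℕₚ.≤-reflexive e))
        witness τ (inj₂ (e , p)) h = e , refl , p

        interval-at : String → Interval
        interval-at τ = choose-interval τ (label-holds k τ)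

        -- The simple function has to live on [0,1]. Its sets are unions of the open intervals of
        -- the witnessing elements, since the test is large on the whole of such an interval; dyadic
        -- intervals enter through `level⊆superlevel` only.
        superlevel : ℕ → String → ℕ → Borel unitInterval
        superlevel zero    τ r = UnitCodes.guard (r ℕₚ.≤? label k τ) (basic (interval-at τ))
        superlevel (suc n) τ r = union λ { zero → superlevel n (τ ∷ʳ false) r ; (suc _) → superlevel n (τ ∷ʳ true) r }

        superlevel⇒ : ∀ n σ r y → member unitInterval y (superlevel n σ r) → ∃[ τ ] (r ℕ.≤ label k τ × Inside (proj₁ y) (interval-at τ))
        superlevel⇒ zero    σ r y h = let p , i = UnitCodes.guard⇒ {A = basic (interval-at σ)} y (r ℕₚ.≤? label k σ) h in σ , p , i
        superlevel⇒ (suc n) σ r y (zero , h)  = superlevel⇒ n (σ ∷ʳ false) r y h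
        superlevel⇒ (suc n) σ r y (suc _ , h) = superlevel⇒ n (σ ∷ʳ true) r y h

        superlevel-anti : ∀ n σ {r s} y → r ℕ.≤ s → member unitInterval y (superlevel n σ s) → member unitInterval y (superlevel n σ r)
        superlevel-anti zero σ {r} {s} y r≤s h = let p , i = UnitCodes.guard⇒ {A = basic (interval-at σ)} y (s ℕₚ.≤? label k σ) h in
          UnitCodes.⇒guard {A = basic (interval-at σ)} y (r ℕₚ.≤? label k σ) (ℕₚ.≤-trans r≤s p) i
        superlevel-anti (suc n) σ y r≤s (zero , h)  = zero , superlevel-anti n (σ ∷ʳ false) y r≤s h
        superlevel-anti (suc n) σ y r≤s (suc i , h) = suc i , superlevel-anti n (σ ∷ʳ true) y r≤s h

        level⊆superlevel : ∀ n σ r x → x ∈ level n σ (λ τ → suc r ℕ.≤ label k τ) → member unitInterval (expand x) (superlevel n σ (suc r))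
        level⊆superlevel zero σ r x h =
          let x∈σ , r< = ∈-choose {A = basic σ} em h
              e , eq , _ , inner , _ = witness σ (label-holds k σ) (ℕₚ.≤-trans (s≤s z≤n) r<)
          in UnitCodes.⇒guard {A = basic (interval-at σ)} (expand x) (suc r ℕₚ.≤? label k σ) r<
               (Expansion.preimage⇒ (basic (interval-at σ)) x (open-∈ (Inner (interval-at σ)) x (length σ)
                 (subst₂ (λ J τ → Inner J τ) (sym eq) (sym (Extends⇒prefix x σ x∈σ)) inner)))
        level⊆superlevel (suc n) σ r x h = go (∈-∪ (level n (σ ∷ʳ false) (λ τ → suc r ℕ.≤ label k τ)) (level n (σ ∷ʳ true) (λ τ → suc r ℕ.≤ label k τ)) h)
          where
          go : x ∈ level n (σ ∷ʳ false) (λ τ → suc r ℕ.≤ label k τ) ⊎ x ∈ level n (σ ∷ʳ true) (λ τ → suc r ℕ.≤ label k τ) →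
            member unitInterval (expand x) (superlevel (suc n) σ (suc r))
          go (inj₁ h) = 0 , level⊆superlevel n (σ ∷ʳ false) r x h
          go (inj₂ h) = 1 , level⊆superlevel n (σ ∷ʳ true) r x h

      module _ (σ : String) where

        private
          A C : ℕ → Borel unitInterval
          A r = superlevel k σ r
          C r = UnitCodes.meet (A r) (compl (A (suc r)))

          a c : ℕ → ℝ
          a r = mass ν (A r)
          c r = mass ν (C r)

          a≤c+a : ∀ r → a r ≤ c r + a (suc r)
          a≤c+a r = ≤-trans (mass-mono μ (pre (A r)) (pre (C r) ∪ pre (A (suc r))) λ x h → go x h em) (mass-∪-≤ μ (pre (C r)) (pre (A (suc r))))
            where
            pre : Borel unitInterval → Borel cantor
            pre = Expansion.preimage
            go : ∀ x → x ∈ pre (A r) → Dec (x ∈ pre (A (suc r))) → x ∈ pre (C r) ∪ pre (A (suc r))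
            go x h (yes p) = ∪-∈ (pre (C r)) (pre (A (suc r))) (inj₂ p)
            go x h (no ¬p) = ∪-∈ (pre (C r)) (pre (A (suc r))) (inj₁ (Expansion.⇒preimage (C r) x
              (UnitCodes.⇒meet (expand x) (A r) (compl (A (suc r))) (Expansion.preimage⇒ (A r) x h , λ q → ¬p (Expansion.⇒preimage (A (suc r)) x q)))))

          coefficient : ℕ → [0,∞⟩
          coefficient r = nat r * ½ⁿ k , ⇒0≤ᴰ {nat r * ½ⁿ k} (*-nonneg (0≤nat r) (<⇒≤ (0<½ⁿ k)))

          layers : ℕ → List ([0,∞⟩ × Borel unitInterval)
          layers zero    = []
          layers (suc r) = (coefficient (suc r) , C (suc r)) ∷ layers r

          layers-disjoint : ∀ N → AllPairs (λ s t → Disjoint unitInterval (proj₂ s) (proj₂ t)) (layers N)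
          layers-disjoint zero    = []
          layers-disjoint (suc N) = go N ℕₚ.≤-refl ∷ layers-disjoint N
            where
            go : ∀ s → s ℕ.≤ N → All (λ t → Disjoint unitInterval (C (suc N)) (proj₂ t)) (layers s)
            go zero    _ = []
            go (suc s) h = (λ y (p , q) → proj₂ (UnitCodes.meet⇒ y (A (suc s)) (compl (A (suc (suc s)))) q)
                (superlevel-anti k σ y (s≤s h) (proj₁ (UnitCodes.meet⇒ y (A (suc N)) (compl (A (suc (suc N)))) p)))) ∷ go s (ℕₚ.<⇒≤ h)

          simple : ℕ → Simple
          simple N = record { terms = layers N ; disjoint = layers-disjoint N }

          value-on-layer : ∀ r y → member unitInterval y (A (suc r)) → fin (coefficient (suc r)) ≤∞ UniformTest.value t ν y
          value-on-layer r y h =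
            let τ , r< , i = superlevel⇒ k σ (suc r) y h
                e , eq , s , _ , bound = witness τ (label-holds k τ) (ℕₚ.≤-trans (s≤s z≤n) r<)
            in element-bound e s y (subst (Inside (proj₁ y)) eq i) (coefficient (suc r)) (small e (≤-trans (nat-mono-≤ r<) bound))
            where
            small : ∀ e → nat (suc r) ≤ ⌊ rate-of e ⌋ * nat (2 ℕ.^ k) → nat (suc r) * ½ⁿ k ≤ ⌊ rate-of e ⌋
            small e h = ≤-respʳ-≈ (2^-cancel ⌊ rate-of e ⌋ k) (*-monoʳ-≤ (<⇒≤ (0<½ⁿ k)) h)

          simple≤ : ∀ N → simple N ≤ˢ UniformTest.value t ν
          simple≤ zero    = []
          simple≤ (suc N) = (λ y h → value-on-layer N y (proj₁ (UnitCodes.meet⇒ y (A (suc N)) (compl (A (suc (suc N)))) h))) ∷ simple≤ N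

          layered : ℕ → ℝ
          layered N = Σ< N (λ r → nat (suc r) * c (suc r))

          0≤c : ∀ r → 0# ≤ c r
          0≤c r = 0≤mass μ (Expansion.preimage (C r))

          simple≈ : ∀ N → simpleIntegral ν (simple N) ≈ ½ⁿ k * layered N
          simple≈ zero    = ≈-trans (≡⇒≈ (fromℚ≡ 0ℚ)) (solve 1 (λ h → con (+ 0) := h :* con (+ 0)) ≈-refl (½ⁿ k))
          simple≈ (suc N) = ≈-trans (≡⇒≈ (trans (+ᴰ≡ (nat (suc N) * ½ⁿ k D.* c (suc N)) (simpleIntegral ν (simple N))) (cong (_+ simpleIntegral ν (simple N)) (*ᴰ≡ (nat (suc N) * ½ⁿ k) (c (suc N))))))
            (≈-trans (+-cong ≈-refl (simple≈ N))
              (solve 4 (λ n h c s → n :* h :* c :+ h :* s := h :* (s :+ n :* c)) ≈-refl (nat (suc N)) (½ⁿ k) (c (suc N)) (layered N)))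

          0≤layered : ∀ N → 0# ≤ layered N
          0≤layered zero    = ≤-refl
          0≤layered (suc N) = +-nonneg (0≤layered N) (*-nonneg (0≤nat (suc N)) (0≤c (suc N)))

          layered≤1 : ∀ N → ½ⁿ k * layered N ≤ 1#
          layered≤1 N = ≤-respˡ-≈ (simple≈ N) (simple-bound (simple N) (simple≤ N) (≤-respʳ-≈ (≈-sym (simple≈ N)) (*-nonneg (<⇒≤ (0<½ⁿ k)) (0≤layered N))))

          truncated : ℕ → ℝ
          truncated N = Ext k σ (λ τ → cylinder μ τ * nat (label k τ ℕ.⊓ N))

          -- min(l, N + 1) exceeds min(l, N) by the indicator of l > N, and the strings with l > N
          -- lie over `A (suc N)`.
          truncated≤ : ∀ N → truncated N ≤ Σ< N (λ r → a (suc r))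
          truncated≤ zero    = ≤-respˡ-≈ (≈-sym (≈-trans (Ext-cong k σ λ τ _ → ≈-trans (*-cong ≈-refl (≡⇒≈ (cong nat (ℕₚ.⊓-zeroʳ (label k τ))))) (solve 1 (λ x → x :* con (+ 0) := con (+ 0)) ≈-refl (cylinder μ τ))) (Ext-zero k σ))) ≤-refl
          truncated≤ (suc N) = begin
            truncated (suc N)
              ≤⟨ Ext-mono k σ (λ τ _ → step τ em) ⟩
            Ext k σ (λ τ → cylinder μ τ * nat (label k τ ℕ.⊓ N) + [ suc N ℕ.≤ label k τ ]· cylinder μ τ)
              ≈⟨ Ext-+ k σ (λ τ → cylinder μ τ * nat (label k τ ℕ.⊓ N)) (λ τ → [ suc N ℕ.≤ label k τ ]· cylinder μ τ) ⟩
            truncated N + Ext k σ (λ τ → [ suc N ℕ.≤ label k τ ]· cylinder μ τ)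
              ≈⟨ +-cong ≈-refl (≈-sym (mass-level μ k σ (λ τ → suc N ℕ.≤ label k τ))) ⟩
            truncated N + mass μ (level k σ (λ τ → suc N ℕ.≤ label k τ))
              ≤⟨ +-mono-≤ (truncated≤ N) (mass-mono μ (level k σ (λ τ → suc N ℕ.≤ label k τ)) (Expansion.preimage (A (suc N))) λ x h →
                   Expansion.⇒preimage (A (suc N)) x (level⊆superlevel k σ N x h)) ⟩
            Σ< N (λ r → a (suc r)) + a (suc N) ∎
            where
            open ≤-Reasoning
            step : ∀ τ → Dec (suc N ℕ.≤ label k τ) → cylinder μ τ * nat (label k τ ℕ.⊓ suc N) ≤ cylinder μ τ * nat (label k τ ℕ.⊓ N) + [ suc N ℕ.≤ label k τ ]· cylinder μ τ
            step τ (yes h) = ≈⇒≤ (≈-trans (*-cong ≈-refl (≈-trans (≡⇒≈ (cong nat (ℕₚ.m≥n⇒m⊓n≡n h))) (nat-suc N)))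
              (≈-trans (solve 2 (λ c n → c :* (con (+ 1) :+ n) := c :* n :+ c) ≈-refl (cylinder μ τ) (nat N))
                (+-cong (*-cong ≈-refl (≡⇒≈ (cong nat (sym (ℕₚ.m≥n⇒m⊓n≡n (ℕₚ.<⇒≤ h)))))) (≈-sym ([]·-yes h)))))
            step τ (no ¬h) = let l = ℕₚ.≤-pred (ℕₚ.≰⇒> ¬h) in ≈⇒≤ (≈-trans (*-cong ≈-refl (≡⇒≈ (cong nat (trans (ℕₚ.m≤n⇒m⊓n≡m (ℕₚ.m≤n⇒m≤1+n l)) (sym (ℕₚ.m≤n⇒m⊓n≡m l))))))
              (≈-trans (solve 1 (λ x → x := x :+ con (+ 0)) ≈-refl (cylinder μ τ * nat (label k τ ℕ.⊓ N))) (+-cong ≈-refl (≈-sym ([]·-no ¬h)))))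

          N : ℕ
          -- The cap on labels: truncating at it changes nothing, and the boundary term of
          -- `Σ<-layers` vanishes.
          N = k ℕ.* 2 ℕ.^ k

          a-vanishes : a (suc N) ≈ 0#
          a-vanishes = ≈-trans (mass-cong μ (Expansion.preimage (A (suc N))) ∅ ((λ x h → ⊥-elim (none x h)) , λ x h → ⊥-elim (h tt))) (mass-∅ μ)
            where
            none : ∀ x → ¬ x ∈ Expansion.preimage (A (suc N))
            none x h = let τ , l , _ = superlevel⇒ k σ (suc N) (expand x) (Expansion.preimage⇒ (A (suc N)) x h) in ℕₚ.<⇒≱ l (label≤ k τ)

        average≤1 : average μ k σ ≤ 1#
        average≤1 = begin
          weighted-sum μ k σ * ½ⁿ k
            ≈⟨ *-cong (Ext-cong k σ λ τ _ → *-cong ≈-refl (≡⇒≈ (cong nat (sym (ℕₚ.m≤n⇒m⊓n≡m (label≤ k τ)))))) ≈-refl ⟩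
          truncated N * ½ⁿ k
            ≤⟨ *-monoʳ-≤ (<⇒≤ (0<½ⁿ k)) (≤-trans (truncated≤ N) (Σ<-layers a c a≤c+a N)) ⟩
          (layered N + nat N * a (suc N)) * ½ⁿ k
            ≈⟨ *-cong (+-cong ≈-refl (*-cong ≈-refl a-vanishes)) ≈-refl ⟩
          (layered N + nat N * 0#) * ½ⁿ k
            ≈⟨ solve 3 (λ l n h → (l :+ n :* con (+ 0)) :* h := h :* l) ≈-refl (layered N) (nat N) (½ⁿ k) ⟩
          ½ⁿ k * layered N
            ≤⟨ layered≤1 N ⟩
          1# ∎
          where open ≤-Reasoning

-- The program that verifies certificates for a uniform test

module UniformPrograms (em : ExcludedMiddle 0ℓ) where

  open IntegralBound em public

  conditions-of : UniformElement → List (Interval × ℚ)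
  conditions-of (l , _) = l

  module _ (e : UniformElement) where

    private
      c r : ℕ
      c = codeConditions (conditions-of e)
      r = codePair (codeInterval (interval-of e)) (codeℚ (rate-of e))

    code-conditions : left (codeUniformElement e) ≡ codeConditions (conditions-of e)
    code-conditions = left-codePair c r

    code-interval : left (right (codeUniformElement e)) ≡ codeInterval (interval-of e)
    code-interval = trans (cong left (right-codePair c r)) (left-codePair (codeInterval (interval-of e)) (codeℚ (rate-of e)))

    code-rate : right (right (codeUniformElement e)) ≡ codeℚ (rate-of e)
    code-rate = trans (cong right (right-codePair c r)) (right-codePair (codeInterval (interval-of e)) (codeℚ (rate-of e)))

  -- A certificate for a uniform test also contains labels for the strings of its
  -- level and codes of the elements of the test which justify the labels.

  depth-of count-of : ℕ → ℕ
  depth-of k = entry k 0 ∸ entry k 2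
  count-of k = entry k 5

  label-of element-of : ℕ → ℕ → ℕ
  label-of k m = entry (entry k 4) m
  element-of k j = entry (entry k 6) j

  depthᵗ : ∀ {n} → Tm n → Tm n
  depthᵗ k = entryᵗ k 0 ⊖ entryᵗ k 2

  labelᵗ elementᵗ : ∀ {n} → Tm n → Tm n → Tm n
  labelᵗ k m = call₂ entryF (entryᵗ k 4) m
  elementᵗ k j = call₂ entryF (entryᵗ k 6) j

  inside : ℕ → ℕ → ℕ → ℕ
  inside m L J = 1 ∸ apply (char WellInsideP) (m ∷ L ∷ J ∷ [])

  inside-yes : ∀ {m L J} → WellInside m L J → inside m L J ≡ 1
  inside-yes {m} {L} {J} h = cong (1 ∸_) (from WellInsideP (m ∷ L ∷ J ∷ []) h)

  inside-no : ∀ {m L J} → ¬ WellInside m L J → inside m L J ≡ 0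
  inside-no {m} {L} {J} h = go (apply (char WellInsideP) (m ∷ L ∷ J ∷ [])) refl
    where
    go : ∀ n → apply (char WellInsideP) (m ∷ L ∷ J ∷ []) ≡ n → 1 ∸ n ≡ 0
    go zero    e = ⊥-elim (h (to WellInsideP (m ∷ L ∷ J ∷ []) e))
    go (suc n) e = ℕₚ.0∸n≡0 n

  innerMass : ℕ → ℕ → ℕ
  innerMass k I = ∑ (2 ℕ.^ level-of k) (λ m → bound-of k m ℕ.* inside m (level-of k) I)

  innerMassF : Fun 2
  innerMassF = function (sum (pow (entryᵗ v0 0)) (lowerᵗ v1 v0 ⊛ (lit 1 ⊖ call (char WellInsideP) (v0 ∷ entryᵗ v1 0 ∷ v2 ∷ []))))
    (λ { (k ∷ I ∷ []) → innerMass k I }) (λ { (k ∷ I ∷ []) → refl })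

  -- Certifies ν(I) > p: the certified lower bounds of the strings well inside I already add up to
  -- more than p.
  ConditionHolds : ℕ → ℕ → Set
  ConditionHolds k c = ¬ AtMost (innerMass k (left c)) (scale-of k) (right c)

  ConditionHoldsP : Pred 2
  ConditionHoldsP = predicate (neg (atom AtMostP (call₂ innerMassF v0 (call₁ leftF v1) ∷ lit 1 ⊕ entryᵗ v0 1 ∷ call₁ rightF v1 ∷ [])))
    (λ { (k ∷ c ∷ []) → ConditionHolds k c }) (λ { (k ∷ c ∷ []) h → h }) (λ { (k ∷ c ∷ []) h → h })

  ElementHolds : ℕ → ℕ → Set
  ElementHolds k e = IsElement e × (∀ i → i ℕ.< left e → tails (left e) i ℕ.≤ 0 ⊎ ConditionHolds k (entry (left e) i))

  ElementHoldsP : Pred 2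
  ElementHoldsP = predicate (atom IsElementP (v1 ∷ []) ∧
      all< (call₁ leftF v1) ((call₂ tailsF (call₁ leftF v2) v0 ⊴ lit 0) ∨ atom ConditionHoldsP (v1 ∷ call₂ entryF (call₁ leftF v2) v0 ∷ [])))
    (λ { (k ∷ e ∷ []) → ElementHolds k e }) (λ { (k ∷ e ∷ []) h → h }) (λ { (k ∷ e ∷ []) h → h })

  Justifies : ℕ → ℕ → ℕ → Set
  Justifies k m e = WellInside m (level-of k) (left (right e)) × AtMost (label-of k m) (2 ℕ.^ depth-of k) (right (right e))

  JustifiesP : Pred 3
  JustifiesP = predicate (atom WellInsideP (v1 ∷ entryᵗ v0 0 ∷ call₁ leftF (call₁ rightF v2) ∷ []) ∧
      atom AtMostP (labelᵗ v0 v1 ∷ pow (depthᵗ v0) ∷ call₁ rightF (call₁ rightF v2) ∷ []))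
    (λ { (k ∷ m ∷ e ∷ []) → Justifies k m e }) (λ { (k ∷ m ∷ e ∷ []) h → h }) (λ { (k ∷ m ∷ e ∷ []) h → h })

  -- A certificate may understate labels, since being the greatest is not decidable; it must justify
  -- the positive ones. The supremum over certificates recovers the true labels.
  Labelled : ℕ → ℕ → Set
  Labelled k m = label-of k m ℕ.≤ 0 ⊎
    (label-of k m ℕ.≤ depth-of k ℕ.* 2 ℕ.^ depth-of k × ∃[ j ] (j ℕ.< count-of k × Justifies k m (element-of k j)))

  LabelledP : Pred 2
  LabelledP = predicate ((labelᵗ v0 v1 ⊴ lit 0) ∨
      ((labelᵗ v0 v1 ⊴ depthᵗ v0 ⊛ pow (depthᵗ v0)) ∧ ex< (entryᵗ v0 5) (atom JustifiesP (v1 ∷ v2 ∷ elementᵗ v1 v0 ∷ []))))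
    (λ { (k ∷ m ∷ []) → Labelled k m }) (λ { (k ∷ m ∷ []) h → h }) (λ { (k ∷ m ∷ []) h → h })

  -- The decidable content of a certificate. Whether the listed elements belong to the test is only
  -- semidecidable and is left to the oracle.
  Consistent : ℕ → Set
  Consistent k = entry k 2 ℕ.≤ entry k 0 × (∀ j → j ℕ.< count-of k → ElementHolds k (element-of k j)) ×
    (∀ m → m ℕ.< 2 ℕ.^ level-of k → Labelled k m)

  ConsistentP : Pred 2
  ConsistentP = predicate ((entryᵗ v0 2 ⊴ entryᵗ v0 0) ∧ all< (entryᵗ v0 5) (atom ElementHoldsP (v1 ∷ elementᵗ v1 v0 ∷ [])) ∧
      all< (pow (entryᵗ v0 0)) (atom LabelledP (v1 ∷ v0 ∷ [])))
    (λ { (k ∷ s ∷ []) → Consistent k }) (λ { (k ∷ s ∷ []) h → h }) (λ { (k ∷ s ∷ []) h → h })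

  same? : ℕ → ℕ → ℕ
  same? m n = 1 ∸ ((m ∸ n) ℕ.+ (n ∸ m))

  same?-refl : ∀ n → same? n n ≡ 1
  same?-refl n = cong (λ d → 1 ∸ (d ℕ.+ d)) (ℕₚ.n∸n≡0 n)

  same?-no : ∀ {m n} → m ≢ n → same? m n ≡ 0
  same?-no {m} {n} m≢n = go ((m ∸ n) ℕ.+ (n ∸ m)) refl
    where
    go : ∀ d → (m ∸ n) ℕ.+ (n ∸ m) ≡ d → 1 ∸ d ≡ 0
    go zero    e = ⊥-elim (m≢n (ℕₚ.≤-antisym (ℕₚ.m∸n≡0⇒m≤n (ℕₚ.m+n≡0⇒m≡0 (m ∸ n) e)) (ℕₚ.m∸n≡0⇒m≤n (ℕₚ.m+n≡0⇒n≡0 (m ∸ n) e))))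
    go (suc d) e = ℕₚ.0∸n≡0 d

  -- The second factor restricts the sum over all strings to the extensions of σ: halving m
  -- `depth-of k` times leaves the number of its first |σ| bits, which is compared with that of σ.
  labelF : Fun 3
  labelF = function (labelᵗ v0 v1 ⊛ (lit 1 ⊖ ((a ⊖ b) ⊕ (b ⊖ a))))
    (λ { (k ∷ m ∷ s ∷ []) → label-of k m ℕ.* same? (halves m (depth-of k)) (horner s (entry k 2)) }) (λ { (k ∷ m ∷ s ∷ []) → refl })
    where
    a b : Tm 3
    a = call₂ halvesF v1 (depthᵗ v0)
    b = call₂ hornerF v2 (entryᵗ v0 2)

  uniformData : UniformTest → TestData
  uniformData t = record
    { weight  = labelF
    ; divisor = function (pow (depthᵗ v0)) (λ { (k ∷ s ∷ []) → 2 ℕ.^ depth-of k }) (λ { (k ∷ s ∷ []) → refl })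
    ; checks  = ConsistentP
    ; queries = function (entryᵗ v0 5) (λ { (k ∷ []) → count-of k }) (λ { (k ∷ []) → refl })
    ; query   = function (elementᵗ v1 v0) (λ { (j ∷ k ∷ []) → element-of k j }) (λ { (j ∷ k ∷ []) → refl })
    ; oracle  = CESet.program (UniformTest.elements t) }

  aligned : String → String → ℕ
  aligned σ τ = same? (number (take (length σ) τ)) (number σ)

  aligned-yes : ∀ σ τ → take (length σ) τ ≡ σ → aligned σ τ ≡ 1
  aligned-yes σ τ e = trans (cong (λ ρ → same? (number ρ) (number σ)) e) (same?-refl (number σ))

  aligned-no : ∀ σ τ → length σ ℕ.≤ length τ → take (length σ) τ ≢ σ → aligned σ τ ≡ 0
  aligned-no σ τ h e = same?-no λ p → e (number-injective (length σ) (take (length σ) τ) σ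
    (trans (Listₚ.length-take (length σ) τ) (ℕₚ.m≤n⇒m⊓n≡m h)) refl p)

  label-weight : ∀ k σ τ → length τ ≡ length σ ℕ.+ depth-of k → entry k 2 ≡ length σ →
    same? (halves (number τ) (depth-of k)) (horner (codeString σ) (entry k 2)) ≡ aligned σ τ
  label-weight k σ τ lτ lσ = cong₂ same?
    (trans (cong (halves (number τ)) (sym (ℕₚ.m+n∸m≡n (length σ) (depth-of k))))
      (halves-number (length σ ℕ.+ depth-of k) (length σ) τ lτ (ℕₚ.m≤m+n (length σ) (depth-of k))))
    (trans (cong (horner (codeString σ)) lσ) (horner-length σ))

  -- Presents σ as a prefix of a sequence, the form in which `Ext-prefix` and `Ext-restrict` apply.
  pad : String → 2^ω
  pad []      n       = false
  pad (b ∷ σ) zero    = b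
  pad (b ∷ σ) (suc n) = pad σ n

  prefix-pad : ∀ σ → prefix (pad σ) (length σ) ≡ σ
  prefix-pad []      = refl
  prefix-pad (b ∷ σ) = cong (b ∷_) (prefix-pad σ)

  Ext-restrict : ∀ x j n {f} → (∀ τ → length τ ≡ j ℕ.+ n → take j τ ≢ prefix x j → f τ ≤ 0#) → Ext (j ℕ.+ n) [] f ≤ Ext n (prefix x j) f
  Ext-restrict x zero    n     h = ≤-refl
  Ext-restrict x (suc j) n {f} h = begin
    Ext (suc j ℕ.+ n) [] f       ≈⟨ ≡⇒≈ (cong (λ m → Ext m [] f) (sym (ℕₚ.+-suc j n))) ⟩
    Ext (j ℕ.+ suc n) [] f       ≤⟨ Ext-restrict x j (suc n) (λ τ l e → h τ (trans l (ℕₚ.+-suc j n)) λ p → e (trans (sym (take-take j (suc j) τ (ℕₚ.n≤1+n j))) (trans (cong (take j) p) (take-prefix x (ℕₚ.n≤1+n j))))) ⟩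
    Ext (suc n) (prefix x j) f   ≤⟨ child (x j) refl ⟩
    Ext n (prefix x j ∷ʳ x j) f  ≈⟨ ≡⇒≈ (cong (λ σ → Ext n σ f) (sym (prefix-∷ʳ x j))) ⟩
    Ext n (prefix x (suc j)) f   ∎
    where
    open ≤-Reasoning
    len : ∀ c → length (prefix x j ∷ʳ c) ≡ suc j
    len c = trans (length-∷ʳ (prefix x j) c) (cong suc (length-prefix x j))
    sibling : ∀ b c → x j ≡ b → b ≢ c → Ext n (prefix x j ∷ʳ c) f ≤ 0#
    sibling b c e b≢c = ≤-respʳ-≈ (Ext-zero n (prefix x j ∷ʳ c)) (Ext-mono-extending n (prefix x j ∷ʳ c) λ τ (l , p) →
      h τ (trans l (cong (ℕ._+ n) (len c))) λ q → b≢c (sym (trans (Listₚ.∷ʳ-injectiveʳ (prefix x j) (prefix x j)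
        (trans (sym p) (trans (cong (λ m → take m τ) (len c)) (trans q (prefix-∷ʳ x j))))) e)))
    child : ∀ b → x j ≡ b → Ext (suc n) (prefix x j) f ≤ Ext n (prefix x j ∷ʳ b) f
    child false e = ≤-respʳ-≈ (+-identityʳ (Ext n (prefix x j ∷ʳ false) f)) (+-mono-≤ ≤-refl (sibling false true e λ ()))
    child true  e = ≤-respʳ-≈ (+-identityˡ (Ext n (prefix x j ∷ʳ true) f)) (+-mono-≤ (sibling true false e λ ()) ≤-refl)

-- Certificates never overstate the test

module CertificateSoundness (em : ExcludedMiddle 0ℓ) where

  open UniformPrograms em public
  open Any using (here; there)

  eventually-all : ∀ {A : Set} (R : A → ℕ → Set) (l : List A) → (∀ a → a ∈ˡ l → ∃[ N ] (∀ n → N ℕ.≤ n → R a n)) →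
    ∃[ N ] (∀ n → N ℕ.≤ n → ∀ a → a ∈ˡ l → R a n)
  eventually-all R []      h = 0 , λ n _ a ()
  eventually-all R (b ∷ l) h =
    let N₁ , h₁ = h b (here refl)
        N₂ , h₂ = eventually-all R l (λ a a∈ → h a (there a∈))
    in N₁ ℕ.⊔ N₂ , λ n N≤n a → λ where
      (here refl) → h₁ n (ℕₚ.≤-trans (ℕₚ.m≤m⊔n N₁ N₂) N≤n)
      (there a∈)  → h₂ n (ℕₚ.≤-trans (ℕₚ.m≤n⊔m N₁ N₂) N≤n) a a∈

  eventually-both : ∀ {P Q : ℕ → Set} → ∃[ N ] (∀ n → N ℕ.≤ n → P n) → ∃[ N ] (∀ n → N ℕ.≤ n → Q n) → ∃[ N ] (∀ n → N ℕ.≤ n → P n × Q n)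
  eventually-both (M , h) (N , k) = M ℕ.⊔ N , λ n le → h n (ℕₚ.≤-trans (ℕₚ.m≤m⊔n M N) le) , k n (ℕₚ.≤-trans (ℕₚ.m≤n⊔m M N) le)

  inside-weight : ∀ μ I τ {L} → length τ ≡ L → cylinder μ τ * nat (inside (number τ) L (codeInterval I)) ≈ [ Inner I τ ]· cylinder μ τ
  inside-weight μ I τ refl = go em
    where
    go : Dec (Inner I τ) → cylinder μ τ * nat (inside (number τ) (length τ) (codeInterval I)) ≈ [ Inner I τ ]· cylinder μ τ
    go (yes h) = ≈-trans (*-cong ≈-refl (≡⇒≈ (cong nat (inside-yes {number τ} {length τ} {codeInterval I} h)))) (≈-trans (*-identityʳ (cylinder μ τ)) (≈-sym ([]·-yes h)))
    go (no ¬h) = ≈-trans (*-cong ≈-refl (≡⇒≈ (cong nat (inside-no {number τ} {length τ} {codeInterval I} ¬h)))) (≈-trans (solve 1 (λ x → x :* con (+ 0) := con (+ 0)) ≈-refl (cylinder μ τ)) (≈-sym ([]·-no ¬h)))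

  mass-inner : ∀ μ I L → mass μ (clopen L (Inner I)) ≈ Ext L [] (λ τ → cylinder μ τ * nat (inside (number τ) L (codeInterval I)))
  mass-inner μ I L = ≈-trans (mass-clopen μ L (Inner I)) (Ext-cong L [] λ τ l → ≈-sym (inside-weight μ I τ l))

  innerMass≈ : ∀ k J → nat (innerMass k J) ≈ Ext (level-of k) [] (λ τ → nat (bound-of k (number τ) ℕ.* inside (number τ) (level-of k) J))
  innerMass≈ k J = ≈-trans (nat-∑ (2 ℕ.^ level-of k) (λ m → bound-of k m ℕ.* inside m (level-of k) J))
    (≈-sym (Ext-number (level-of k) (λ m → nat (bound-of k m ℕ.* inside m (level-of k) J))))

  module UniformSoundness (t : UniformTest) (μ : Measure cantor) where

    open Integral t μ
    module Program = Test (uniformData t)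
    open Program.Certified

    module _ {k : ℕ} {σ : String} {q : ℚ} (c : Program.Certified μ k σ q) where

      private
        L d : ℕ
        L = level-of k
        d = depth-of k
        lσ : entry k 2 ≡ length σ
        lσ = proj₁ (holdsAt c)
        consistent : Consistent k
        consistent = proj₁ (proj₂ (holdsAt c))
        L≡ : L ≡ length σ ℕ.+ d
        L≡ = trans (sym (ℕₚ.m+[n∸m]≡n (proj₁ consistent))) (cong (ℕ._+ d) lσ)

      innerMass≤ : ∀ I → nat (innerMass k (codeInterval I)) ≤ mass μ (clopen L (Inner I)) * nat (scale-of k)
      innerMass≤ I = begin
        nat (innerMass k (codeInterval I))  ≈⟨ innerMass≈ k (codeInterval I) ⟩
        Ext L [] (λ τ → nat (bound-of k (number τ) ℕ.* w τ)) ≤⟨ Ext-mono L [] (λ τ l → step τ (bounds c τ l)) ⟩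
        Ext L [] (λ τ → nat (scale-of k) * (cylinder μ τ * nat (w τ))) ≈⟨ Ext-*ˡ L [] (nat (scale-of k)) (λ τ → cylinder μ τ * nat (w τ)) ⟩
        nat (scale-of k) * Ext L [] (λ τ → cylinder μ τ * nat (w τ)) ≈⟨ *-comm (nat (scale-of k)) _ ⟩
        Ext L [] (λ τ → cylinder μ τ * nat (w τ)) * nat (scale-of k) ≈⟨ *-cong (≈-sym (mass-inner μ I L)) ≈-refl ⟩
        mass μ (clopen L (Inner I)) * nat (scale-of k) ∎
        where
        open ≤-Reasoning
        w : String → ℕ
        w τ = inside (number τ) L (codeInterval I)
        step : ∀ τ → bound-of k (number τ) ≡ 0 ⊎ nat (bound-of k (number τ)) < cylinder μ τ * nat (scale-of k) →
          nat (bound-of k (number τ) ℕ.* w τ) ≤ nat (scale-of k) * (cylinder μ τ * nat (w τ))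
        step τ (inj₁ e) = subst (λ b → nat (b ℕ.* w τ) ≤ nat (scale-of k) * (cylinder μ τ * nat (w τ))) (sym e)
          (*-nonneg (0≤nat (scale-of k)) (*-nonneg (0≤cylinder μ τ) (0≤nat (w τ))))
        step τ (inj₂ h) = ≤-respʳ-≈ (solve 3 (λ c s w → c :* s :* w := s :* (c :* w)) ≈-refl (cylinder μ τ) (nat (scale-of k)) (nat (w τ)))
          (≤-respˡ-≈ (≈-sym (nat-* (bound-of k (number τ)) (w τ))) (*-monoʳ-≤ (0≤nat (w τ)) (<⇒≤ h)))

      -- The certified sum is at most the mass of a clopen set contained in the preimage of I.
      condition-sound : ∀ I p → ConditionHolds k (codeCondition (I , p)) → D.fromℚ p D.< mass ν (basic I)
      condition-sound I p h = ⇒fromℚ< {p} (<-≤-trans (*-cancelˡ-< (0≤nat (scale-of k)) (<-respˡ-≈ (*-comm ⌊ p ⌋ (nat (scale-of k)))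
          (<-respʳ-≈ (*-comm (mass μ (clopen L (Inner I))) (nat (scale-of k))) (<-≤-trans exceed (innerMass≤ I)))))
        (proj₁ (open-sup μ (Inner I) (inner-upward I)) L))
        where
        exceed : ⌊ p ⌋ * nat (scale-of k) < nat (innerMass k (codeInterval I))
        exceed = ≰⇒> λ le → h (subst₂ (λ J r → AtMost (innerMass k J) (scale-of k) r) (sym (left-codePair (codeInterval I) (codeℚ p))) (sym (right-codePair (codeInterval I) (codeℚ p)))
          (⇒AtMost p (s≤s z≤n) le))

      element-sound : ∀ j → j ℕ.< count-of k → ∃[ e ] (codeUniformElement e ≡ element-of k j × Satisfied e)
      element-sound j j< =
        let isE , conds = proj₁ (proj₂ consistent) j j<
            e , code = decodeElement (element-of k j) isE
        in e , code , subst (λ n → ∃[ b ] (_ [ n ∷ [] ]⇓ b)) (sym code) (proj₂ (proj₂ (holdsAt c)) j j<) ,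
           All.tabulate (λ {(I , p)} → condition e (subst (λ n → ∀ i → i ℕ.< left n → tails (left n) i ℕ.≤ 0 ⊎ ConditionHolds k (entry (left n) i)) (sym code) conds) I p)
        where
        condition : ∀ e → (∀ i → i ℕ.< left (codeUniformElement e) → tails (left (codeUniformElement e)) i ℕ.≤ 0 ⊎ ConditionHolds k (entry (left (codeUniformElement e)) i)) →
          ∀ I p → (I , p) ∈ˡ conditions-of e → D.fromℚ p D.< mass ν (basic I)
        condition e h I p m = condition-sound I p (go (subst (λ n → ∀ i → i ℕ.< n → tails n i ℕ.≤ 0 ⊎ ConditionHolds k (entry n i)) (code-conditions e) h) (∈⇒drop m))
          where
          l : List (Interval × ℚ)
          l = conditions-of e
          go : (∀ i → i ℕ.< codeConditions l → tails (codeConditions l) i ℕ.≤ 0 ⊎ ConditionHolds k (entry (codeConditions l) i)) →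
            ∃[ i ] ∃[ r ] (i ℕ.< length l × drop i l ≡ (I , p) ∷ r) → ConditionHolds k (codeCondition (I , p))
          go h (i , r , i< , eq) = nonempty (h i (ℕₚ.≤-trans i< (length≤codeList codeCondition l)))
            where
            nonempty : tails (codeConditions l) i ℕ.≤ 0 ⊎ ConditionHolds k (entry (codeConditions l) i) → ConditionHolds k (codeCondition (I , p))
            nonempty (inj₁ z) = ⊥-elim (ℕₚ.<⇒≱ (⇒1≤tails codeCondition l i i<) z)
            nonempty (inj₂ h) = subst (ConditionHolds k) (entry-codeList codeCondition l i eq) h

      label-sound : ∀ τ → length τ ≡ L → label-of k (number τ) ℕ.≤ label d τ
      label-sound τ l = go (proj₂ (proj₂ consistent) (number τ) (number<2^ L τ l))
        where
        go : Labelled k (number τ) → label-of k (number τ) ℕ.≤ label d τ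
        go (inj₁ z) = ℕₚ.≤-trans z z≤n
        go (inj₂ (small , j , j< , wi , am)) =
          let e , code , sat = element-sound j j<
          in label-max d τ (label-of k (number τ)) small (e , sat ,
            subst₂ (λ n J → WellInside (number τ) n J) (sym l) (trans (cong (left ∘ right) (sym code)) (code-interval e)) wi ,
            AtMost⇒ (rate-of e) (subst (AtMost (label-of k (number τ)) (2 ℕ.^ d)) (trans (cong (right ∘ right) (sym code)) (code-rate e)) am))

      -- The weights vanish off the extensions of σ, and on them the labels of the certificate are
      -- at most the true labels of precision `d`.
      certified⇒average : ⌊ q ⌋ < average μ d σ
      certified⇒average = proj₁ (2^-scale d) (<-≤-trans (certified-sound (uniformData t) μ c) (begin
        Ext L [] f                                   ≈⟨ ≡⇒≈ (cong (λ n → Ext n [] f) L≡) ⟩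
        Ext (length σ ℕ.+ d) [] f                    ≤⟨ Ext-restrict (pad σ) (length σ) d (λ τ l h → ≈⇒≤ (vanish τ l λ e → h (trans e (sym (prefix-pad σ))))) ⟩
        Ext d (prefix (pad σ) (length σ)) f          ≈⟨ ≡⇒≈ (cong (λ ρ → Ext d ρ f) (prefix-pad σ)) ⟩
        Ext d σ f                                    ≤⟨ Ext-mono-extending d σ agree ⟩
        weighted-sum μ d σ                           ∎))
        where
        open ≤-Reasoning
        f : String → ℝ
        f τ = cylinder μ τ * nat (Program.weightOf k (number τ) σ)
        vanish : ∀ τ → length τ ≡ length σ ℕ.+ d → take (length σ) τ ≢ σ → f τ ≈ 0#
        vanish τ l h = ≈-trans (*-cong ≈-refl (≡⇒≈ (cong nat (trans (cong (label-of k (number τ) ℕ.*_) (trans (label-weight k σ τ l lσ)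
            (aligned-no σ τ (ℕₚ.≤-trans (ℕₚ.m≤m+n (length σ) d) (ℕₚ.≤-reflexive (sym l))) h))) (ℕₚ.*-zeroʳ (label-of k (number τ)))))))
          (solve 1 (λ x → x :* con (+ 0) := con (+ 0)) ≈-refl (cylinder μ τ))
        agree : ∀ τ → Extending σ d τ → f τ ≤ weighted μ d τ
        agree τ (l , e) = *-monoˡ-≤ (0≤cylinder μ τ) (nat-mono-≤ (ℕₚ.≤-trans
          (ℕₚ.≤-reflexive (trans (cong (label-of k (number τ) ℕ.*_) (trans (label-weight k σ τ l lσ) (aligned-yes σ τ e))) (ℕₚ.*-identityʳ (label-of k (number τ)))))
          (label-sound τ (trans l (sym L≡)))))

-- Every rational below the value has a certificate

module CertificateCompleteness (em : ExcludedMiddle 0ℓ) where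

  open CertificateSoundness em public
  open Any using (here; there)

  <length⇒drop : ∀ {A : Set} (l : List A) i → i ℕ.< length l → ∃[ a ] ∃[ r ] (drop i l ≡ a ∷ r)
  <length⇒drop (a ∷ l) zero    _       = a , l , refl
  <length⇒drop (a ∷ l) (suc i) (s≤s h) = <length⇒drop l i h

  module UniformCertificate (t : UniformTest) (μ : Measure cantor) (σ : String) (es : List UniformElement) (k d : ℕ) where

    module Program = Test (uniformData t)
    -- Labels are recomputed from the list `es`, since a certificate can justify a label only by an
    -- element that it contains.
    module Finite = Labels (_∈ˡ es)

    L : ℕ
    L = length σ ℕ.+ k

    labels : ℕ → ℕ
    labels m = Finite.label k (string L m)

    extra : List ℕ
    extra = codeNumbers (table labels (2 ℕ.^ L)) ∷ length es ∷ codeList codeUniformElement es ∷ []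

    K : ℕ
    K = certificate-for μ L d (length σ) extra

    level≡ : level-of K ≡ L
    level≡ = certificate-level μ L d (length σ) extra

    length≡ : entry K 2 ≡ length σ
    length≡ = certificate-length μ L d (length σ) extra

    scale≡ : scale-of K ≡ suc d
    scale≡ = certificate-scale μ L d (length σ) extra

    depth≡ : depth-of K ≡ k
    depth≡ = trans (cong₂ _∸_ level≡ length≡) (ℕₚ.m+n∸m≡n (length σ) k)

    count≡ : count-of K ≡ length es
    count≡ = certificate-extra μ L d (length σ) extra 1 refl

    label≡ : ∀ τ → length τ ≡ L → label-of K (number τ) ≡ Finite.label k τ
    label≡ τ l = trans (cong (λ c → entry c (number τ)) (certificate-extra μ L d (length σ) extra 0 refl))
      (trans (entry-table labels (2 ℕ.^ L) (number τ) (number<2^ L τ l)) (cong (Finite.label k) (string-number L τ l)))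

    element≡ : ∀ j {e r} → drop j es ≡ e ∷ r → element-of K j ≡ codeUniformElement e
    element≡ j h = trans (cong (λ c → entry c j) (certificate-extra μ L d (length σ) extra 2 refl)) (entry-codeList codeUniformElement es j h)

    inner≈ : ∀ J → nat (innerMass K J) ≈ Ext L [] (λ τ → nat (lower-bound μ (suc d) τ ℕ.* inside (number τ) L J))
    inner≈ J = ≈-trans (innerMass≈ K J) (≈-trans (≡⇒≈ (cong (λ n → Ext n [] (λ τ → nat (bound-of K (number τ) ℕ.* inside (number τ) n J))) level≡))
      (Ext-cong L [] λ τ l → ≡⇒≈ (cong (λ a → nat (a ℕ.* inside (number τ) L J)) (certificate-lower μ L d (length σ) extra τ l))))

    total≈ : nat (Program.totalOf K σ) ≈ Ext L [] (λ τ → nat (lower-bound μ (suc d) τ ℕ.* (Finite.label k τ ℕ.* aligned σ τ)))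
    total≈ = ≈-trans (certificate-total μ L d (length σ) extra (uniformData t) σ) (Ext-cong L [] λ τ l → ≡⇒≈ (cong (λ w → nat (lower-bound μ (suc d) τ ℕ.* w))
      (cong₂ ℕ._*_ (label≡ τ l) (label-weight K σ τ (trans l (cong (length σ ℕ.+_) (sym depth≡))) length≡))))

    module _
      (satisfied : ∀ e → e ∈ˡ es → UniformTest.elements t ∋ e)
      (conditions : ∀ e → e ∈ˡ es → ∀ c → c ∈ˡ conditions-of e →
        ⌊ proj₂ c ⌋ * nat (suc d) < Ext L [] (λ τ → nat (lower-bound μ (suc d) τ ℕ.* inside (number τ) L (codeInterval (proj₁ c)))))
      where

      condition-holds : ∀ e → e ∈ˡ es → ∀ c → c ∈ˡ conditions-of e → ConditionHolds K (codeCondition c)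
      condition-holds e e∈ (I , p) c∈ h = ≤⇒≮ (AtMost⇒ p (subst₂ (λ J r → AtMost (innerMass K J) (scale-of K) r) (left-codePair (codeInterval I) (codeℚ p)) (right-codePair (codeInterval I) (codeℚ p)) h))
        (<-respˡ-≈ (≡⇒≈ (cong (λ s → ⌊ p ⌋ * nat s) (sym scale≡))) (<-respʳ-≈ (≈-sym (inner≈ (codeInterval I))) (conditions e e∈ (I , p) c∈)))

      element-holds : ∀ e → e ∈ˡ es → ElementHolds K (codeUniformElement e)
      element-holds e e∈ = isElement e , λ i _ → subst (λ n → tails n i ℕ.≤ 0 ⊎ ConditionHolds K (entry n i)) (sym (code-conditions e)) (go i (drop i l) refl)
        where
        l : List (Interval × ℚ)
        l = conditions-of e
        go : ∀ i r → drop i l ≡ r → tails (codeConditions l) i ℕ.≤ 0 ⊎ ConditionHolds K (entry (codeConditions l) i)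
        go i []      eq = inj₁ (ℕₚ.≤-reflexive (trans (tails-codeList codeCondition l i) (cong codeConditions eq)))
        go i (c ∷ r) eq = inj₂ (subst (ConditionHolds K) (sym (entry-codeList codeCondition l i eq)) (condition-holds e e∈ c (drop⇒∈ i l eq)))

      labelled : ∀ τ → length τ ≡ L → Labelled K (number τ)
      labelled τ l = go (Finite.label-holds k τ)
        where
        go : Finite.label k τ ≡ 0 ⊎ Finite.Label k τ (Finite.label k τ) → Labelled K (number τ)
        go (inj₁ z) = inj₁ (ℕₚ.≤-reflexive (trans (label≡ τ l) z))
        go (inj₂ (e , e∈ , inner , bound)) =
          let j , r , j< , eq = ∈⇒drop e∈ in
          inj₂ (subst₂ (λ a n → a ℕ.≤ n ℕ.* 2 ℕ.^ n) (sym (label≡ τ l)) (sym depth≡) (Finite.label≤ k τ) , j , subst (j ℕ.<_) (sym count≡) j< ,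
            subst (Justifies K (number τ)) (sym (element≡ j eq))
              ( subst₂ (λ n J → WellInside (number τ) n J) (trans l (sym level≡)) (sym (code-interval e)) inner
              , subst (AtMost (label-of K (number τ)) (2 ℕ.^ depth-of K)) (sym (code-rate e))
                  (subst₂ (λ a n → AtMost a (2 ℕ.^ n) (codeℚ (rate-of e))) (sym (label≡ τ l)) (sym depth≡) (⇒AtMost (rate-of e) (1≤2^ k) bound)) ))

      consistent : Consistent K
      consistent =
        subst₂ ℕ._≤_ (sym length≡) (sym level≡) (ℕₚ.m≤m+n (length σ) k) ,
        (λ j j< → let e , r , eq = <length⇒drop es j (subst (j ℕ.<_) count≡ j<) in
          subst (ElementHolds K) (sym (element≡ j eq)) (element-holds e (drop⇒∈ j es eq))) ,
        λ m m< → let τ , l , num = string-of L m (subst (λ n → m ℕ.< 2 ℕ.^ n) level≡ m<) in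
          subst (Labelled K) num (labelled τ l)

      halts : ∀ j → j ℕ.< count-of K → ∃[ b ] (CESet.program (UniformTest.elements t) [ element-of K j ∷ [] ]⇓ b)
      halts j j< = let e , r , eq = <length⇒drop es j (subst (j ℕ.<_) count≡ j<) in
        subst (λ n → ∃[ b ] (CESet.program (UniformTest.elements t) [ n ∷ [] ]⇓ b)) (sym (element≡ j eq)) (satisfied e (drop⇒∈ j es eq))

      certify : ∀ q → ⌊ q ⌋ * nat (2 ℕ.^ k) * nat (suc d) < Ext L [] (λ τ → nat (lower-bound μ (suc d) τ ℕ.* (Finite.label k τ ℕ.* aligned σ τ))) →
        Program.Certified μ K σ q
      certify q h = record
        { bounds  = certificate-bounds μ L d (length σ) extra
        ; holdsAt = length≡ , consistent , halts
        ; exceeds = <-respˡ-≈ (≈-trans (solve 3 (λ q a b → q :* a :* b := q :* (b :* a)) ≈-refl ⌊ q ⌋ (nat (2 ℕ.^ k)) (nat (suc d)))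
            (*-cong ≈-refl (≈-trans (≈-sym (nat-* (suc d) (2 ℕ.^ k))) (≡⇒≈ (cong₂ (λ s n → nat (s ℕ.* 2 ℕ.^ n)) (sym scale≡) (sym depth≡))))))
            (<-respʳ-≈ (≈-sym total≈) h) }

  module UniformCompleteness (t : UniformTest) (μ : Measure cantor) (σ : String) where

    open Integral t μ
    module Program = Test (uniformData t)

    Covered : ℕ → List UniformElement → String → Set
    Covered k es τ = label k τ ≡ 0 ⊎ ∃[ e ] (e ∈ˡ es × Inner (interval-of e) τ × nat (label k τ) ≤ ⌊ rate-of e ⌋ * nat (2 ℕ.^ k))

    -- One witnessing element for each string with a positive label; so finitely many elements
    -- account for a lower sum of given precision.
    collect : ∀ k (l : List String) → ∃[ es ] ((∀ e → e ∈ˡ es → Satisfied e) × (∀ τ → τ ∈ˡ l → Covered k es τ))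
    collect k []      = [] , (λ e ()) , λ τ ()
    collect k (τ ∷ l) = let es , sat , cover = collect k l in go es sat cover (label-holds k τ)
      where
      go : ∀ es → (∀ e → e ∈ˡ es → Satisfied e) → (∀ τ → τ ∈ˡ l → Covered k es τ) → label k τ ≡ 0 ⊎ Label k τ (label k τ) →
        ∃[ es ] ((∀ e → e ∈ˡ es → Satisfied e) × (∀ ρ → ρ ∈ˡ (τ ∷ l) → Covered k es ρ))
      go es sat cover (inj₁ z) = es , sat , λ where
        ρ (here refl) → inj₁ z
        ρ (there h)   → cover ρ h
      go es sat cover (inj₂ (e , s , p)) = e ∷ es , satisfied , covered
        where
        satisfied : ∀ e′ → e′ ∈ˡ (e ∷ es) → Satisfied e′
        satisfied _ (here refl) = s
        satisfied _ (there h)   = sat _ h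
        weaken : ∀ ρ → Covered k es ρ → Covered k (e ∷ es) ρ
        weaken ρ (inj₁ z)             = inj₁ z
        weaken ρ (inj₂ (e′ , e∈ , p)) = inj₂ (e′ , there e∈ , p)
        covered : ∀ ρ → ρ ∈ˡ (τ ∷ l) → Covered k (e ∷ es) ρ
        covered _ (here refl) = inj₂ (e , here refl , p)
        covered ρ (there h)   = weaken ρ (cover ρ h)

    module _ (es : List UniformElement) (sat : ∀ e → e ∈ˡ es → Satisfied e) where

      open Labels (_∈ˡ es) using () renaming (label to label′; average to average′; average-mono-≤ to average′-mono-≤; weighted-sum to weighted-sum′; weighted to weighted′; 0≤weighted to 0≤weighted′)

      -- The preimage of I is an increasing union of clopen sets, so a strict lower bound on its
      -- mass shows at some level; finitely many conditions share one.
      conditions-eventually : ∃[ N ] (∀ n → N ℕ.≤ n → ∀ e → e ∈ˡ es → ∀ c → c ∈ˡ conditions-of e → ⌊ proj₂ c ⌋ < mass μ (clopen n (Inner (proj₁ c))))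
      conditions-eventually = eventually-all (λ e n → ∀ c → c ∈ˡ conditions-of e → ⌊ proj₂ c ⌋ < mass μ (clopen n (Inner (proj₁ c)))) es λ e e∈ →
        eventually-all (λ c n → ⌊ proj₂ c ⌋ < mass μ (clopen n (Inner (proj₁ c)))) (conditions-of e) λ (I , p) c∈ →
          let n , h = IsSupSeq-witness (open-sup μ (Inner I) (inner-upward I)) (fromℚ<⇒ {p} (All.lookup (proj₂ (sat e e∈)) c∈))
          in n , λ m n≤m → <-≤-trans h (mass-mono μ (clopen n (Inner I)) (clopen m (Inner I)) λ x x∈ →
               clopen-∈ m (Inner I) x (Upward-≤ (inner-upward I) x n≤m (∈-clopen n (Inner I) x x∈)))

      module _ (k : ℕ) (q : ℚ) (q< : ⌊ q ⌋ < average′ μ k σ)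
               (conditions : ∀ e → e ∈ˡ es → ∀ c → c ∈ˡ conditions-of e → ⌊ proj₂ c ⌋ < mass μ (clopen (length σ ℕ.+ k) (Inner (proj₁ c)))) where

        private
          L : ℕ
          L = length σ ℕ.+ k

          scaled : ⌊ q ⌋ * nat (2 ℕ.^ k) < Ext L [] (λ τ → cylinder μ τ * nat (label′ k τ ℕ.* aligned σ τ))
          scaled = <-≤-trans (proj₂ (2^-scale k) q<) (begin
            weighted-sum′ μ k σ                  ≤⟨ Ext-mono-extending k σ (λ τ (l , e) → *-monoˡ-≤ (0≤cylinder μ τ) (nat-mono-≤ (ℕₚ.≤-reflexive
                                                      (sym (trans (cong (label′ k τ ℕ.*_) (aligned-yes σ τ e)) (ℕₚ.*-identityʳ (label′ k τ))))))) ⟩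
            Ext k σ f                            ≈⟨ ≡⇒≈ (cong (λ ρ → Ext k ρ f) (sym (prefix-pad σ))) ⟩
            Ext k (prefix (pad σ) (length σ)) f  ≤⟨ Ext-prefix (pad σ) (length σ) k (λ τ → *-nonneg (0≤cylinder μ τ) (0≤nat (label′ k τ ℕ.* aligned σ τ))) ⟩
            Ext L [] f                           ∎)
            where
            open ≤-Reasoning
            f : String → ℝ
            f τ = cylinder μ τ * nat (label′ k τ ℕ.* aligned σ τ)

          MainAt : ℕ → Set
          MainAt d = ⌊ q ⌋ * nat (2 ℕ.^ k) * nat d < Ext L [] (λ τ → nat (lower-bound μ d τ ℕ.* (label′ k τ ℕ.* aligned σ τ)))

          ConditionAt : Interval × ℚ → ℕ → Set
          ConditionAt (I , p) d = ⌊ p ⌋ * nat d < Ext L [] (λ τ → nat (lower-bound μ d τ ℕ.* inside (number τ) L (codeInterval I)))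

          scale-eventually : ∃[ N ] (∀ d → N ℕ.≤ d → MainAt d × (∀ e → e ∈ˡ es → ∀ c → c ∈ˡ conditions-of e → ConditionAt c d))
          scale-eventually = eventually-both {MainAt} {λ d → ∀ e → e ∈ˡ es → ∀ c → c ∈ˡ conditions-of e → ConditionAt c d}
            (Ext-floor {L} (0≤cylinder μ) (λ τ → label′ k τ ℕ.* aligned σ τ) scaled)
            (eventually-all (λ e d → ∀ c → c ∈ˡ conditions-of e → ConditionAt c d) es λ e e∈ →
              eventually-all ConditionAt (conditions-of e) λ c c∈ →
                Ext-floor {L} (0≤cylinder μ) (λ τ → inside (number τ) L (codeInterval (proj₁ c))) (<-respʳ-≈ (mass-inner μ (proj₁ c) L) (conditions e e∈ c c∈)))

        average⇒certified-at : ∃[ K ] Program.Certified μ K σ q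
        average⇒certified-at =
          let N , h = scale-eventually
              main , conds = h (suc N) (ℕₚ.n≤1+n N)
          in UniformCertificate.K t μ σ es k N , UniformCertificate.certify t μ σ es k N (λ e e∈ → proj₁ (sat e e∈)) conds q main

    -- The order of the choices matters: the elements are fixed at precision k, then the precision
    -- is raised until their conditions hold at that level of strings, which does not lower the sum
    -- over these elements, and only then is a denominator chosen for the finitely many strict
    -- inequalities.
    average⇒certified : ∀ k q → ⌊ q ⌋ < average μ k σ → ∃[ K ] Program.Certified μ K σ q
    average⇒certified k q q< =
      let es , sat , cover = collect k (strings (length σ ℕ.+ k))
      in with-elements es sat cover (conditions-eventually es sat)
      where
      with-elements : ∀ es (sat : ∀ e → e ∈ˡ es → Satisfied e) →
        (∀ τ → τ ∈ˡ strings (length σ ℕ.+ k) → Covered k es τ) →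
        ∃[ N ] (∀ n → N ℕ.≤ n → ∀ e → e ∈ˡ es → ∀ c → c ∈ˡ conditions-of e → ⌊ proj₂ c ⌋ < mass μ (clopen n (Inner (proj₁ c)))) →
        ∃[ K ] Program.Certified μ K σ q
      with-elements es sat cover (N , h) = average⇒certified-at es sat (k ℕ.⊔ N) q
        (<-≤-trans (<-≤-trans q< (*-monoʳ-≤ (<⇒≤ (0<½ⁿ k)) (Ext-mono k σ λ τ l → *-monoˡ-≤ (0≤cylinder μ τ) (nat-mono-≤ (enough τ (cover τ (∈-strings (length σ ℕ.+ k) τ l)))))))
          (Finite.average-mono-≤ μ σ (ℕₚ.m≤m⊔n k N)))
        (h (length σ ℕ.+ (k ℕ.⊔ N)) (ℕₚ.≤-trans (ℕₚ.m≤n⊔m k N) (ℕₚ.m≤n+m (k ℕ.⊔ N) (length σ))))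
        where
        module Finite = Labels (_∈ˡ es)
        enough : ∀ τ → Covered k es τ → label k τ ℕ.≤ Finite.label k τ
        enough τ (inj₁ z) = ℕₚ.≤-trans (ℕₚ.≤-reflexive z) z≤n
        enough τ (inj₂ p) = Finite.label-max k τ (label k τ) (label≤ k τ) p

-- Neutrality of the image measure, and domination

module Neutrality (em : ExcludedMiddle 0ℓ) where

  open CertificateCompleteness em public

  module UniformValue (t : UniformTest) (μ : Measure cantor) where

    open Integral t μ public
    module Program = Test (uniformData t)

    opaque
      value-exists : ∀ σ → Σ[ v ∈ ℝ ] IsSupSeq (λ k → average μ k σ) v
      value-exists σ = supSeq (λ k → average≤1 k σ)

    value : String → ℝ
    value σ = proj₁ (value-exists σ)

    average≤value : ∀ k σ → average μ k σ ≤ value σ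
    average≤value k σ = proj₁ (proj₂ (value-exists σ)) k

    value-least : ∀ σ u → (∀ k → average μ k σ ≤ u) → value σ ≤ u
    value-least σ = proj₂ (proj₂ (value-exists σ))

    0≤uniform : ∀ σ → 0# ≤ value σ
    0≤uniform σ = ≤-trans (*-nonneg (Ext-nonneg 0 σ (0≤weighted μ 0)) (<⇒≤ (0<½ⁿ 0))) (average≤value 0 σ)

    uniform≤1 : ∀ σ → value σ ≤ 1#
    uniform≤1 σ = value-least σ 1# λ k → average≤1 k σ

    -- The children may attain their values at different precisions; both lower sums are raised to
    -- the larger precision before `average-split` applies.
    uniform-superadditive : ∀ σ → value (σ ∷ʳ false) + value (σ ∷ʳ true) ≤ value σ
    uniform-superadditive σ = move (value (σ ∷ʳ false)) (value (σ ∷ʳ true)) (value-least (σ ∷ʳ false) (value σ - value (σ ∷ʳ true)) λ j →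
        unmove (average μ j (σ ∷ʳ false)) (value (σ ∷ʳ true)) (value-least (σ ∷ʳ true) (value σ - average μ j (σ ∷ʳ false)) λ k →
          unmove′ (average μ j (σ ∷ʳ false)) (average μ k (σ ∷ʳ true)) (begin
            average μ j (σ ∷ʳ false) + average μ k (σ ∷ʳ true)
              ≤⟨ +-mono-≤ (average-mono-≤ μ (σ ∷ʳ false) (ℕₚ.m≤m⊔n j k)) (average-mono-≤ μ (σ ∷ʳ true) (ℕₚ.m≤n⊔m j k)) ⟩
            average μ (j ℕ.⊔ k) (σ ∷ʳ false) + average μ (j ℕ.⊔ k) (σ ∷ʳ true)
              ≤⟨ average-split μ (j ℕ.⊔ k) σ ⟩
            average μ (suc (j ℕ.⊔ k)) σ
              ≤⟨ average≤value (suc (j ℕ.⊔ k)) σ ⟩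
            value σ ∎)))
      where
      open ≤-Reasoning
      move : ∀ a b → a ≤ value σ - b → a + b ≤ value σ
      move a b h = ≤-by (≤⇒0≤- h) (solve 3 (λ a b v → v :- (a :+ b) := (v :- b) :- a) ≈-refl a b (value σ))
      unmove : ∀ a b → b ≤ value σ - a → a ≤ value σ - b
      unmove a b h = ≤-by (≤⇒0≤- h) (solve 3 (λ a b v → (v :- b) :- a := (v :- a) :- b) ≈-refl a b (value σ))
      unmove′ : ∀ a b → a + b ≤ value σ → b ≤ value σ - a
      unmove′ a b h = ≤-by (≤⇒0≤- h) (solve 3 (λ a b v → (v :- a) :- b := v :- (a :+ b)) ≈-refl a b (value σ))

    produces⇒ : ∀ σ q → Produces Program.elements μ (σ , q) → ⌊ q ⌋ < value σ
    produces⇒ σ q p =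
      let k , c = Program.produces⇒certified μ (λ k _ → 1≤2^ (depth-of k)) σ q p
      in <-≤-trans (UniformSoundness.certified⇒average t μ c) (average≤value (depth-of k) σ)

    ⇒produces : ∀ σ q → ⌊ q ⌋ < value σ → Produces Program.elements μ (σ , q)
    ⇒produces σ q h =
      let k , q< = IsSupSeq-witness (proj₂ (value-exists σ)) h
          K , c = UniformCompleteness.average⇒certified t μ σ k q q<
      in Program.certified⇒produces μ K σ q c

  uniformTest : UniformTest → CETest
  uniformTest t = record
    { elements    = Test.elements (uniformData t)
    ; apply       = value
    ; semimeasure = λ μ → is-semimeasure (0≤uniform μ) (uniform≤1 μ) (uniform-superadditive μ)
    ; undergraph  = λ μ σ q → mk⇔ (λ p → ⇒fromℚ< (produces⇒ μ σ q p)) (λ h → ⇒produces μ σ q (fromℚ<⇒ h)) }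
    where open UniformValue t

  module BinaryExpansion (y : ℝ) (0≤y : 0# ≤ y) (y≤1 : y ≤ 1#) where

    bit : ∀ z → Dec (½ℝ ≤ z) → Bool
    bit z (yes _) = true
    bit z (no  _) = false

    double-minus : ∀ z → Dec (½ℝ ≤ z) → ℝ
    double-minus z (yes _) = (z + z) - 1#
    double-minus z (no  _) = z + z

    remainder : ℕ → ℝ
    remainder zero    = y
    remainder (suc n) = double-minus (remainder n) em

    bits-of : 2^ω
    bits-of n = bit (remainder n) (em {½ℝ ≤ remainder n})

    remainder-range : ∀ n → 0# ≤ remainder n × remainder n ≤ 1#
    remainder-range zero    = 0≤y , y≤1
    remainder-range (suc n) = go (remainder n) (remainder-range n) em
      where
      go : ∀ z → 0# ≤ z × z ≤ 1# → (d : Dec (½ℝ ≤ z)) → 0# ≤ double-minus z d × double-minus z d ≤ 1#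
      go z (0≤z , z≤1) (yes h) = ≤⇒0≤- (≤-respˡ-≈ ½ℝ+½ℝ (+-mono-≤ h h)) ,
        ≤-by (+-nonneg (≤⇒0≤- z≤1) (≤⇒0≤- z≤1)) (solve 1 (λ z → con (+ 1) :- ((z :+ z) :- con (+ 1)) := (con (+ 1) :- z) :+ (con (+ 1) :- z)) ≈-refl z)
      go z (0≤z , z≤1) (no ¬h) = +-nonneg 0≤z 0≤z , ≤-respʳ-≈ ½ℝ+½ℝ (+-mono-≤ (<⇒≤ (≰⇒> ¬h)) (<⇒≤ (≰⇒> ¬h)))

    expansion : ∀ n → y * nat (2 ℕ.^ n) ≈ nat (number (prefix bits-of n)) + remainder n
    expansion zero    = ≈-trans (*-identityʳ y) (≈-sym (+-identityˡ y))
    expansion (suc n) = begin-equality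
      y * nat (2 ℕ.* 2 ℕ.^ n)                                ≈⟨ *-cong ≈-refl (≈-trans (nat-* 2 (2 ℕ.^ n)) (*-cong (nat-+ 1 1) ≈-refl)) ⟩
      y * ((1# + 1#) * nat (2 ℕ.^ n))                        ≈⟨ solve 2 (λ y n → y :* ((con (+ 1) :+ con (+ 1)) :* n) := (con (+ 1) :+ con (+ 1)) :* (y :* n)) ≈-refl y (nat (2 ℕ.^ n)) ⟩
      (1# + 1#) * (y * nat (2 ℕ.^ n))                        ≈⟨ *-cong ≈-refl (expansion n) ⟩
      (1# + 1#) * (nat m + remainder n)                      ≈⟨ step (remainder n) em ⟩
      (1# + 1#) * nat m + nat (codeBool (bits-of n)) + remainder (suc n)
        ≈⟨ +-cong (≈-sym (≈-trans (nat-+ (2 ℕ.* m) (codeBool (bits-of n))) (+-cong (≈-trans (nat-* 2 m) (*-cong (nat-+ 1 1) ≈-refl)) ≈-refl))) ≈-refl ⟩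
      nat (2 ℕ.* m ℕ.+ codeBool (bits-of n)) + remainder (suc n)
        ≈⟨ +-cong (≡⇒≈ (cong nat (trans (sym (number-∷ʳ (prefix bits-of n) (bits-of n))) (cong number (sym (prefix-∷ʳ bits-of n)))))) ≈-refl ⟩
      nat (number (prefix bits-of (suc n))) + remainder (suc n) ∎
      where
      open ≤-Reasoning
      m : ℕ
      m = number (prefix bits-of n)
      step : ∀ z (d : Dec (½ℝ ≤ z)) → (1# + 1#) * (nat m + z) ≈ (1# + 1#) * nat m + nat (codeBool (bit z d)) + double-minus z d
      step z (yes _) = solve 2 (λ m z → (con (+ 1) :+ con (+ 1)) :* (m :+ z) := (con (+ 1) :+ con (+ 1)) :* m :+ con (+ 1) :+ ((z :+ z) :- con (+ 1))) ≈-refl (nat m) z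
      step z (no _)  = solve 2 (λ m z → (con (+ 1) :+ con (+ 1)) :* (m :+ z) := (con (+ 1) :+ con (+ 1)) :* m :+ con (+ 0) :+ (z :+ z)) ≈-refl (nat m) z

    -- Neutrality asks for a bound at every point of [0,1], whereas rates are bounded only at values
    -- of sequences; hence every point must be such a value.
    value-of-bits : value-of bits-of ≈ y
    value-of-bits = ≤-antisym (close (value-of bits-of) y λ n → ≤-trans (value-upper bits-of n) (+-mono-≤ (lower n) ≤-refl))
                              (close y (value-of bits-of) λ n → ≤-trans (upper n) (+-mono-≤ (value-lower bits-of n) ≤-refl))
      where
      lower : ∀ n → nat (number (prefix bits-of n)) ≤ y * nat (2 ℕ.^ n)
      lower n = ≤-by (proj₁ (remainder-range n)) (≈-trans (+-cong (expansion n) ≈-refl) (solve 2 (λ a b → (a :+ b) :- a := b) ≈-refl (nat (number (prefix bits-of n))) (remainder n)))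
      upper : ∀ n → y * nat (2 ℕ.^ n) ≤ nat (number (prefix bits-of n)) + 1#
      upper n = ≤-respˡ-≈ (≈-sym (expansion n)) (+-mono-≤ ≤-refl (proj₂ (remainder-range n)))
      close : ∀ a b → (∀ n → a * nat (2 ℕ.^ n) ≤ b * nat (2 ℕ.^ n) + 1#) → a ≤ b
      close a b h = ≮⇒≤ λ b<a →
        let N , big = archimedean-* 1# (<⇒0<- b<a)
        in ≤⇒≮ (h N) (<-by (<⇒0<- (big (2 ℕ.^ N) (ℕₚ.<⇒≤ (a<2^a N))))
             (solve 4 (λ a b n o → a :* n :- (b :* n :+ o) := n :* (a :- b) :- o) ≈-refl a b (nat (2 ℕ.^ N)) 1#))

  module _ (μ : Measure cantor) (0<cylinder : ∀ σ → 0# < cylinder μ σ) where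

    module _ (t : UniformTest) {c : ℝ} (0<c : 0# < c) (dominates : ∀ σ → c * UniformValue.value t μ σ ≤ cylinder μ σ) where

      open UniformValue t μ

      private
        opaque
          cap : ∃[ M ] (1# < nat M * c)
          cap = let M , h = archimedean-* 1# 0<c in M , h M ℕₚ.≤-refl

        M : ℕ
        -- `M` serves both as the bound on the rates and as the precision: lower sums of precision M
        -- are truncated at M, just enough to refute a larger rate.
        M = proj₁ cap

        supported : ∀ e → Satisfied e → nat M ≤ ⌊ rate-of e ⌋ → ∀ n τ → Inner (interval-of e) τ → cylinder μ τ * nat (M ℕ.* 2 ℕ.^ M) ≤ Ext n τ (weighted μ M)
        supported e s h zero    τ i = *-monoˡ-≤ (0≤cylinder μ τ) (nat-mono-≤ (label-max M τ (M ℕ.* 2 ℕ.^ M) ℕₚ.≤-refl (e , s , i ,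
          ≤-respˡ-≈ (≈-sym (nat-* M (2 ℕ.^ M))) (*-monoʳ-≤ (0≤nat (2 ℕ.^ M)) h))))
        supported e s h (suc n) τ i = ≤-respˡ-≈ (≈-trans (≈-sym (*-distribʳ-+ (nat (M ℕ.* 2 ℕ.^ M)) (cylinder μ (τ ∷ʳ false)) (cylinder μ (τ ∷ʳ true)))) (*-cong (≈-sym (cylinder-additive μ τ)) ≈-refl))
          (+-mono-≤ (supported e s h n (τ ∷ʳ false) (inner-upward (interval-of e) τ false i)) (supported e s h n (τ ∷ʳ true) (inner-upward (interval-of e) τ true i)))

        -- An element of rate above `M` has a whole cylinder τ well inside its interval, on which
        -- the lower sum of precision M is at least M μ(τ). Domination then gives M c μ(τ) ≤ μ(τ),
        -- against M c > 1 and μ(τ) > 0.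
        rate-bounded : ∀ e → Satisfied e → ∀ x → Inside (value-of x) (interval-of e) → ⌊ rate-of e ⌋ ≤ nat M
        rate-bounded e s x inside = ≮⇒≤ λ M<q →
          let n , i = ∈-open (Inner (interval-of e)) x (Expansion.⇒preimage (basic (interval-of e)) x inside)
          in absurd (prefix x n) (supported e s (<⇒≤ M<q) M (prefix x n) i)
          where
          absurd : ∀ τ → cylinder μ τ * nat (M ℕ.* 2 ℕ.^ M) ≤ weighted-sum μ M τ → ⊥
          absurd τ h = ≤⇒≮ (begin
            cylinder μ τ * (nat M * c)                            ≈⟨ solve 3 (λ y m c → y :* (m :* c) := c :* (y :* m)) ≈-refl (cylinder μ τ) (nat M) c ⟩
            c * (cylinder μ τ * nat M)                            ≈⟨ *-cong ≈-refl (≈-trans (≈-sym (2^-cancel (cylinder μ τ * nat M) M))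
                                                                       (*-cong (≈-trans (*-assoc (cylinder μ τ) (nat M) (nat (2 ℕ.^ M))) (*-cong ≈-refl (≈-sym (nat-* M (2 ℕ.^ M))))) ≈-refl)) ⟩
            c * (cylinder μ τ * nat (M ℕ.* 2 ℕ.^ M) * ½ⁿ M)       ≤⟨ *-monoˡ-≤ (<⇒≤ 0<c) (*-monoʳ-≤ (<⇒≤ (0<½ⁿ M)) h) ⟩
            c * average μ M τ                                     ≤⟨ *-monoˡ-≤ (<⇒≤ 0<c) (average≤value M τ) ⟩
            c * value τ                                           ≤⟨ dominates τ ⟩
            cylinder μ τ                                          ≈⟨ ≈-sym (*-identityʳ (cylinder μ τ)) ⟩
            cylinder μ τ * 1#                                     ∎) (*-monoˡ-< (0<cylinder τ) (proj₂ cap))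
            where open ≤-Reasoning

      bounded-test : Σ[ M ∈ [0,∞⟩ ] (∀ y → UniformTest.value t ν y ≤∞ fin M)
      bounded-test = bound , λ y → proj₂ (UniformTest.isSup t ν y) (fin bound) (at y)
        where
        bound : [0,∞⟩
        bound = nat M , ⇒0≤ᴰ {nat M} (0≤nat M)
        at : ∀ y v → Value (UniformTest.elements t) ν y v → v ≤∞ fin bound
        at (y , 0≤y , y≤1) (fin (a , _)) (conds , J , q , e∈ , hold , inside , a≈q) = ⇒≤ᴰ {a} {nat M}
          (≤-respˡ-≈ (≈-sym (≈-trans (≈ᴰ⇒ {a} {D.fromℚ (proj₁ q)} a≈q) (≡⇒≈ (fromℚ≡ (proj₁ q)))))
            (rate-bounded (conds , J , q) (e∈ , hold) bits-of (inside-cong {y} {value-of bits-of} J (≈-sym value-of-bits) inside)))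
          where open BinaryExpansion y (0≤ᴰ⇒ {y} 0≤y) (≤1ᴰ⇒ {y} y≤1)
        at y ∞ (_ , _ , _ , _ , _ , _ , ())

    image-neutral : Neutral μ → NeutralOnUnitInterval (Expansion.image μ)
    image-neutral neutral t = let c , c>0 , h = neutral-dominates neutral (uniformTest t) in bounded-test t {⌊ c ⌋} (⌊⌋-mono-< c>0) h

  dominates-neutral : (μ : Measure cantor) → Neutral μ →
      Σ[ D ∈ Measure halfLine ] (IsDimensionProbability μ D ×
      (Σ[ ν ∈ Measure unitInterval ] (NeutralOnUnitInterval ν ×
      (Σ[ c ∈ ℝ ] (D.0ℝ D.< c ×
      (∀ (E : Borel unitInterval) →
      Σ[ v ∈ ℝ ] (MeasureOf D (inHalfLine E) v × c D.* mass ν E D.≤ v)))))))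
  dominates-neutral μ neutral = let c , c>0 , h = neutral-dominates neutral dilutionTest in with-constant c (⌊⌋-mono-< c>0) h
    where
    with-constant : ∀ c → 0# < ⌊ c ⌋ → (∀ σ → ⌊ c ⌋ * dilutionValue μ σ ≤ cylinder μ σ) → _
    with-constant c 0<c h = D-μ , isDimensionProbability , Expansion.image μ , image-neutral μ 0<cylinder neutral ,
      C , ⇒0<ᴰ {C} (*-pos (*-pos 0<½ 0<c) 0<½) , λ E → mass D-μ (extend E) , extend-mass E ,
        ⇒≤ᴰ {C D.* mass (Expansion.image μ) E} {mass D-μ (extend E)} (subst (_≤ mass D-μ (extend E)) (sym (*ᴰ≡ C (mass (Expansion.image μ) E)))
          (mass-of-dimension μ 0<c h (Expansion.preimage E) (DimensionImage.preimage (extend E)) (dimension-hits E)))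
      where
      open DimensionProbability μ {bits-lost μ 0<c h} (positive μ 0<c h)
      C : ℝ
      -- The first ½ is the weight of the diluted sequences in the mixture, the second the share of
      -- the open set guaranteed by `part-large`.
      C = ½ℝ * ⌊ c ⌋ * ½ℝ
      0<cylinder : ∀ σ → 0# < cylinder μ σ
      0<cylinder σ = <-≤-trans (0<½ⁿ (bits-lost μ 0<c h ℕ.+ length σ)) (positive μ 0<c h σ)

open D using (0ℝ; _<_; _≤_; _*_)

theorem5p15 : ExcludedMiddle 0ℓ →
    (μ : Measure cantor) → Neutral μ →
    Σ[ D ∈ Measure halfLine ] (IsDimensionProbability μ D ×
    (Σ[ ν ∈ Measure unitInterval ] (NeutralOnUnitInterval ν ×
    (Σ[ c ∈ ℝ ] (0ℝ < c ×
    (∀ (E : Borel unitInterval) →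
    Σ[ v ∈ ℝ ] (MeasureOf D (inHalfLine E) v × c * mass ν E ≤ v)))))))
theorem5p15 em μ neutral = dominates-neutral μ neutral
  where open Neutrality em
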